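{- Let $p_1 \equiv 3 \pmod 8$ and $p_2 \equiv 5 \pmod 8$ be primes, let $e_1,e_2$ be positive integers and $N=p_1^{e_1}p_2^{e_2}$. Assume that the Legendre symbol $\left(\frac{p_1}{p_2}\right)=-1$ and that the multiplicative order of $2$ in $(\mathbb{Z}/N\mathbb{Z})^*$ equals $\varphi(N)/2$. Let $m$ be the smallest positive integer such that $p_1A^2+p_2B^2=2^{m+2}$ has a solution $(A,B)\in\mathbb{Z}^2$. Then there is no generalized bent function of type $[m,2N]$.
   Context: For integers $n\ge 1$, $q\ge 2$, write $\mathbb{Z}_q=\mathbb{Z}/q\mathbb{Z}$ and $\zeta_q=e^{2\pi i/q}$. A function $f:\mathbb{Z}_q^n\to\mathbb{Z}_q$ is a generalized bent function (GBF) of type $[n,q]$ if $\alpha_f(\lambda)\overline{\alpha_f(\lambda)}=q^n$ for all $\lambda\in\mathbb{Z}_q^n$, where $\alpha_f(\lambda)=\sum_{x\in\mathbb{Z}_q^n}\zeta_q^{f(x)-\lambda\cdot x}$ and $\lambda\cdot x$ is the standard dot product. $\varphi$ is Euler's totient function. -}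

module Defs where

open import Data.Nat as ℕ using (ℕ; zero; suc; _+_; _*_; _∸_; _^_; _<_; NonZero)
open import Data.Nat.DivMod using (_mod_)
open import Data.Nat.GCD using (gcd)
open import Data.Nat.Divisibility using (_∣_; _∣?_)
open import Data.Integer as ℤ using (ℤ; +_)
import Data.Integer.Divisibility as ℤD
open import Data.Fin as F using (Fin; toℕ)
open import Data.Vec using (Vec; []; _∷_)
open import Data.List using (List; []; _∷_; map; concatMap; filter; length; foldr; upTo)
open import Data.List.Base using (allFin)
open import Data.Product using (Σ; ∃; _×_)
open import Data.Empty using (⊥)
open import Relation.Nullary using (¬_)
open import Relation.Binary.PropositionalEquality using (_≡_)
open import Relation.Nullary.Decidable using (_×-dec_)

totient : ℕ → ℕ
totient n = length (filter (λ k → gcd k n ℕ.≟ 1) (upTo n))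

-- k is the multiplicative order of a modulo N:
-- k ≥ 1, a^k ≡ 1 (mod N), and no smaller positive j has a^j ≡ 1 (mod N).
-- (Congruence a^j ≡ 1 (mod N) written N ∣ a^j ∸ 1, valid since a^j ≥ 1 for a ≥ 1.)
IsMultOrder : ℕ → ℕ → ℕ → Set
IsMultOrder a N k =
  (0 < k) × (N ∣ (a ^ k ∸ 1)) × (∀ j → 0 < j → j < k → ¬ (N ∣ (a ^ j ∸ 1)))

LegendreMinusOne : ℕ → ℕ → Set
LegendreMinusOne a p =
  ¬ (p ∣ a) × ¬ (Σ ℤ λ x → (+ p) ℤD.∣ (x ℤ.* x ℤ.- + a))

-- Generalized bent functions.
-- Z_q is modelled by Fin q with arithmetic mod q.  Elements of the ring
-- Z[ζ_q] are represented by elements of the group ring Z[Z_q]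
-- (functions Fin q → ℤ, c ↦ Σ_k c(k) ζ_q^k).  Two group-ring elements have
-- the same value at ζ_q = e^{2πi/q} iff their difference c satisfies
-- c ⋆ M_q = 0, where M_q = ∏_{d ∣ q, 0<d<q} (g^d − 1)
-- (equivalently (x^q − 1) ∣ c(x) M_q(x) in ℤ[x], i.e. Φ_q ∣ c(x)).

module _ (q : ℕ) .{{_ : NonZero q}} where

  Zq : Set
  Zq = Fin q

  _+q_ : Zq → Zq → Zq
  i +q j = (toℕ i + toℕ j) mod q

  -q_ : Zq → Zq
  -q i = (q ∸ toℕ i) mod q

  _-q_ : Zq → Zq → Zq
  i -q j = i +q (-q j)

  GR : Set
  GR = Zq → ℤ

  sumℤ : List ℤ → ℤ
  sumℤ = foldr ℤ._+_ (+ 0)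

  δ : Zq → GR
  δ k j with k F.≟ j
  ... | Relation.Nullary.yes _ = + 1
  ... | Relation.Nullary.no  _ = + 0

  _⋆_ : GR → GR → GR
  (a ⋆ b) k = sumℤ (map (λ i → a i ℤ.* b (k -q i)) (allFin q))

  _⊖_ : GR → GR → GR
  (a ⊖ b) k = a k ℤ.- b k

  scale : ℤ → GR → GR
  scale c a k = c ℤ.* a k

  conj : GR → GR
  conj a k = a (-q k)

  zeroq : Zq
  zeroq = 0 mod q

  Mq : GR
  Mq = foldr (λ d acc → acc ⋆ (δ (d mod q) ⊖ δ zeroq)) (δ zeroq)
             (filter (λ d → (0 ℕ.<? d) ×-dec (d ∣? q)) (upTo q))

  VanishesAtζ : GR → Set
  VanishesAtζ c = ∀ k → (c ⋆ Mq) k ≡ + 0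

  _≈ζ_ : GR → GR → Set
  a ≈ζ b = VanishesAtζ (a ⊖ b)

  allVecs : (n : ℕ) → List (Vec Zq n)
  allVecs zero    = [] ∷ []
  allVecs (suc n) = concatMap (λ i → map (i ∷_) (allVecs n)) (allFin q)

  dot : ∀ {n} → Vec Zq n → Vec Zq n → Zq
  dot [] [] = zeroq
  dot (x ∷ xs) (y ∷ ys) = ((toℕ x * toℕ y) mod q) +q dot xs ys

  -- α_f(λ) = Σ_x ζ_q^{f(x) − λ·x}
  walsh : (n : ℕ) → (Vec Zq n → Zq) → Vec Zq n → GR
  walsh n f λv k =
    + length (filter (λ x → (f x -q dot λv x) F.≟ k) (allVecs n))

  IsGBF : (n : ℕ) → (Vec Zq n → Zq) → Set
  IsGBF n f = ∀ (λv : Vec Zq n) →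
    (walsh n f λv ⋆ conj (walsh n f λv)) ≈ζ scale (+ (q ^ n)) (δ zeroq)

ExistsGBF : ℕ → ℕ → Set
ExistsGBF n zero    = ⊥
ExistsGBF n (suc q) = Σ (Vec (Fin (suc q)) n → Fin (suc q)) (IsGBF (suc q) n)

Solvable : ℕ → ℕ → ℕ → Set
Solvable p1 p2 m =
  Σ ℤ λ A → Σ ℤ λ B → (+ p1) ℤ.* (A ℤ.* A) ℤ.+ (+ p2) ℤ.* (B ℤ.* B) ≡ + (2 ^ (m + 2))

{-# OPTIONS --safe #-}
module Submission where

-- Let N = p₁^e₁ p₂^e₂ and let α be the Walsh transform of a generalized bent function of type
-- [m, 2N], with values in ℤ[ζ_N].  The hypotheses imply that ±2^i exhausts the units modulo N,
-- that p₁ and p₂ are self-conjugate modulo each other, and that m is odd.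
--
-- Suppose X conj X = 2^k N^m with k odd and 2 ∤ X, and let σ be ζ ↦ ζ².  The primes over 2 form
-- two orbits of σ exchanged by conj, so X and σ X have the same divisor, and by Kronecker's
-- theorem σ X = ± ζ^a X.  As σ - 1 is invertible on the roots of unity of odd order, we may assume
-- σ X = ± X.  Then the traces of the ζ^j X are determined by two integers, and the trace of
-- X conj X gives A² + p₁ p₂ B² = 2^(k+2), impossible modulo p₂, or p₁ A² + p₂ B² = 2^(k+2).
-- So, m being minimal, no α(l) is divisible by 2.
--
-- The values α(l + N μ) are congruent to α(l) modulo 2, and the same argument shows that they are
-- ± α(l).  Their sum over μ is 2^m β(l), where β is the transform of the restriction to the x with
-- all entries even, so β(l) is 0 or ± α(l).  By Parseval the number of l in (ℤ/2N)^m with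
-- β(l) ≠ 0 is N^m, which is odd; but β is periodic under translation by N, so this number is even.

open import Algebra.Bundles using (CommutativeRing)
import Algebra.Properties.Group
import Algebra.Solver.Ring
open import Algebra.Solver.Ring.AlmostCommutativeRing using (_-Raw-AlmostCommutative⟶_; fromCommutativeRing)
open import Data.Empty using (⊥-elim)
open import Data.Fin as Fin using (Fin; toℕ; fromℕ; inject₁)
import Data.Fin.Permutation as Perm
import Data.Fin.Properties as Finₚ
open import Data.Integer as ℤ using (ℤ; +_; -[1+_])
open import Data.Integer.DivMod using (n%ℕd<d; a≡a%ℕn+[a/ℕn]*n)
import Data.Integer.Properties as ℤₚ
open import Data.Integer.Tactic.RingSolver using (solve-∀)
open import Data.List.Base as List using (List; []; _∷_; _++_; map; concatMap; upTo; allFin; tabulate)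
open import Data.List.Membership.Propositional using (_∈_)
open import Data.List.Membership.Propositional.Properties using (∈-filter⁺; ∈-filter⁻; ∈-upTo⁺; ∈-upTo⁻)
import Data.List.Properties as Lₚ
import Data.List.Relation.Unary.Any as Any
open import Data.List.Relation.Unary.Any.Properties using (lookup-index)
open import Data.Maybe using (Maybe; just; nothing)
open import Data.Nat as ℕ using (ℕ; zero; suc; s≤s; z≤n; _!)
open import Data.Nat.Combinatorics
  using (_C_; nCn≡1; k>n⇒nCk≡0; nCk≡n!/k![n-k]!; k![n∸k]!∣n!; nCk+nC[k+1]≡[n+1]C[k+1])
import Data.Nat.Coprimality as Coprimality
import Data.Nat.Divisibility as ℕ∣
open import Data.Nat.DivMod using (_mod_; m%n<n; m≡m%n+[m/n]*n; m/n*n≡m)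
open import Data.Nat.GCD using (gcd; module Bézout)
open import Data.Nat.Primality
  using (Prime; prime[2]; euclidsLemma; prime⇒nonZero; prime⇒nonTrivial; prime⇒irreducible)
import Data.Nat.Properties as ℕₚ
open import Data.Nat.Tactic.RingSolver using () renaming (solve-∀ to ℕsolve-∀)
open import Data.Product using (Σ; _×_; _,_; proj₁; proj₂)
open import Data.Sum using (_⊎_; inj₁; inj₂; [_,_]′)
open import Data.Vec as Vec using (Vec; []; _∷_)
open import Function.Base using (_∘_; _$_; id)
open import Level using (0ℓ)
open import Relation.Binary.PropositionalEquality
  using (_≡_; _≢_; refl; sym; trans; cong; cong₂; subst; module ≡-Reasoning)
open import Relation.Nullary using (¬_; Dec; yes; no)
open import Relation.Nullary.Decidable using (_×-dec_)

import Defs as D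
open import Defs using (Solvable; totient; LegendreMinusOne; IsMultOrder; ExistsGBF)

-- ℤ[ζ_N] is built without fields, embeddings or ideals. An element is a formal sum of terms c ζ₁^a
-- ζ₂^b, and two sums are equal when all their normalised traces `hat X k l` agree; these form a
-- periodic table of integers, from which vanishing and divisibility by an integer prime to N can be
-- read off. Archimedean size is replaced by sums of integer squares: `parseval` and `energy` write
-- the trace of X conj X in two ways as such a sum, and Kronecker's theorem becomes a count of how
-- few nonzero mixed differences an integer array can have. The factorisation of 2 is replaced by
-- idempotents: X^(2^f - 1) is idempotent modulo 2 and records which primes over 2 divide X. If X
-- and Y have the same norm 2^k N^m and the same idempotent, then 2^k divides X conj Y; that N^m
-- divides it too is the purpose of self-conjugacy, and only then is X/Y a unit of absolute value 1.
-- As N is odd, -ζ₁ζ₂ has order 2N, so the Walsh transform lives in ℤ[ζ_N], and translation by N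
-- changes it by signs, which are invisible modulo 2.

-- Divisibility, congruences and finite sums in a commutative ring with a map from ℤ.

record ℤAlgebra : Set₁ where
  field
    commRing : CommutativeRing 0ℓ 0ℓ
  open CommutativeRing commRing using (Carrier; _≈_; _+_; _*_; 1#)
  field
    ι   : ℤ → Carrier
    ι-+ : ∀ a b → ι (a ℤ.+ b) ≈ ι a + ι b
    ι-* : ∀ a b → ι (a ℤ.* b) ≈ ι a * ι b
    ι-1 : ι (+ 1) ≈ 1#

module RingTools (𝓑 : ℤAlgebra) where
  open ℤAlgebra 𝓑 using (ι; ι-+; ι-*; ι-1) renaming (commRing to cring) public
  open CommutativeRing cring
    using (Carrier; _≈_; _+_; _*_; -_; 0#; 1#; +-cong; *-cong; -‿cong; setoid; +-comm; *-comm; +-assoc;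
        *-assoc; *-identityˡ; *-identityʳ; +-identityˡ; +-identityʳ; distribˡ; distribʳ; zeroˡ; zeroʳ;
        commutativeSemiring)
    renaming (_-_ to infixl 6 _-_; refl to ≈-refl; sym to ≈-sym; trans to ≈-trans; reflexive to
        ≈-reflexive; -‿inverseʳ to x-x; -‿inverseˡ to -x+x) public
  open import Algebra.Properties.CommutativeSemiring.Exp commutativeSemiring
    using (_^_; ^-congˡ; ^-cong; ^-homo-*; ^-assocʳ; ^-distrib-*) public
  open import Relation.Binary.Reasoning.Setoid setoid

  +-cancelʳ : ∀ {x y z} → x + z ≈ y + z → x ≈ y
  +-cancelʳ {x} {y} {z} = Algebra.Properties.Group.∙-cancelʳ (CommutativeRing.+-group cring) z x y

  ι-0 : ι (+ 0) ≈ 0#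
  ι-0 = +-cancelʳ (≈-trans (≈-sym (ι-+ (+ 0) (+ 0))) (≈-sym (+-identityˡ _)))

  ι-neg : ∀ a → ι (ℤ.- a) ≈ - ι a
  ι-neg a = +-cancelʳ (begin
    ι (ℤ.- a) + ι a  ≈⟨ ι-+ _ _ ⟨
    ι (ℤ.- a ℤ.+ a)  ≡⟨ cong ι (ℤₚ.+-inverseˡ a) ⟩
    ι (+ 0)          ≈⟨ ι-0 ⟩
    0#               ≈⟨ -x+x (ι a) ⟨
    - ι a + ι a      ∎)

  -- The coefficient map of the ring solver: ι, except that it sends 0 and 1
  -- to 0# and 1# definitionally.
  coeff : ℤ → Carrier
  coeff (+ 0) = 0#
  coeff (+ 1) = 1#
  coeff n     = ι n

  coeff≈ι : ∀ n → coeff n ≈ ι n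
  coeff≈ι (+ 0) = ≈-sym ι-0
  coeff≈ι (+ 1) = ≈-sym ι-1
  coeff≈ι (+ suc (suc n)) = ≈-refl
  coeff≈ι -[1+ n ] = ≈-refl

  coeff-hom : CommutativeRing.rawRing ℤₚ.+-*-commutativeRing -Raw-AlmostCommutative⟶ fromCommutativeRing cring
  coeff-hom = record
    { ⟦_⟧    = coeff
    ; +-homo = λ a b → ≈-trans (coeff≈ι (a ℤ.+ b))
        (≈-trans (ι-+ a b) (≈-sym (+-cong (coeff≈ι a) (coeff≈ι b))))
    ; *-homo = λ a b → ≈-trans (coeff≈ι (a ℤ.* b))
        (≈-trans (ι-* a b) (≈-sym (*-cong (coeff≈ι a) (coeff≈ι b))))
    ; -‿homo = λ a → ≈-trans (coeff≈ι (ℤ.- a)) (≈-trans (ι-neg a) (≈-sym (-‿cong (coeff≈ι a))))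
    ; 0-homo = ≈-refl
    ; 1-homo = ≈-refl
    }

  coeff≟ : ∀ a b → Maybe (coeff a ≈ coeff b)
  coeff≟ a b with a ℤ.≟ b
  ... | yes e = just (≈-reflexive (cong coeff e))
  ... | no _  = nothing

  open Algebra.Solver.Ring (CommutativeRing.rawRing ℤₚ.+-*-commutativeRing)
      (fromCommutativeRing cring) coeff-hom coeff≟
    using (solve; _:=_; _:+_; _:*_; _:-_; :-_; con) public

  cancel- : ∀ x y → x - y + y ≈ x
  cancel- = solve 2 (λ x y → x :- y :+ y := x) ≈-refl

  sub-0⇒≈ : ∀ {x y} → x - y ≈ 0# → x ≈ y
  sub-0⇒≈ {x} {y} h = begin
    x         ≈⟨ cancel- x y ⟨
    x - y + y ≈⟨ +-cong h ≈-refl ⟩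
    0# + y    ≈⟨ +-identityˡ y ⟩
    y         ∎

  ≈⇒sub-0 : ∀ {x y} → x ≈ y → x - y ≈ 0#
  ≈⇒sub-0 {x} {y} h = ≈-trans (+-cong h ≈-refl) (x-x y)

  -‿cong₂ : ∀ {a b c d} → a ≈ b → c ≈ d → a - c ≈ b - d
  -‿cong₂ h k = +-cong h (-‿cong k)

  1^ : ∀ n → 1# ^ n ≈ 1#
  1^ zero = ≈-refl
  1^ (suc n) = ≈-trans (*-identityˡ _) (1^ n)

  infix 4 _∣_
  record _∣_ (d x : Carrier) : Set where
    constructor divides
    field
      quotient : Carrier
      equality : x ≈ d * quotient

  ∣-resp : ∀ {d x y} → x ≈ y → d ∣ x → d ∣ y
  ∣-resp h (divides q e) = divides q (≈-trans (≈-sym h) e)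

  ∣-respˡ : ∀ {d d′ x} → d ≈ d′ → d ∣ x → d′ ∣ x
  ∣-respˡ h (divides q e) = divides q (≈-trans e (*-cong h ≈-refl))

  ∣-refl : ∀ {d} → d ∣ d
  ∣-refl = divides 1# (≈-sym (*-identityʳ _))

  ∣0 : ∀ {d} → d ∣ 0#
  ∣0 {d} = divides 0# (≈-sym (zeroʳ d))

  ∣-+ : ∀ {d x y} → d ∣ x → d ∣ y → d ∣ x + y
  ∣-+ {d} (divides a e) (divides b f) = divides (a + b) (≈-trans (+-cong e f) (≈-sym (distribˡ d a b)))

  ∣-neg : ∀ {d x} → d ∣ x → d ∣ - x
  ∣-neg {d} (divides a e) = divides (- a) (≈-trans (-‿cong e) (h d a))
    where h : ∀ d a → - (d * a) ≈ d * - a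
          h = solve 2 (λ d a → :- (d :* a) := d :* :- a) ≈-refl

  ∣-sub : ∀ {d x y} → d ∣ x → d ∣ y → d ∣ x - y
  ∣-sub h k = ∣-+ h (∣-neg k)

  ∣-*ʳ : ∀ {d x} y → d ∣ x → d ∣ x * y
  ∣-*ʳ {d} y (divides a e) = divides (a * y) (≈-trans (*-cong e ≈-refl) (*-assoc d a y))

  ∣-*ˡ : ∀ {d x} y → d ∣ x → d ∣ y * x
  ∣-*ˡ y h = ∣-resp (*-comm _ y) (∣-*ʳ y h)

  ∣-trans : ∀ {a b c} → a ∣ b → b ∣ c → a ∣ c
  ∣-trans h (divides q e) = ∣-resp (≈-sym e) (∣-*ʳ q h)

  ∣-*-mono : ∀ {a b c d} → a ∣ b → c ∣ d → a * c ∣ b * d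
  ∣-*-mono {a} {b} {c} {d} (divides x e) (divides y f) =
    divides (x * y) (≈-trans (*-cong e f) (h a x c y))
    where h : ∀ a x c y → (a * x) * (c * y) ≈ (a * c) * (x * y)
          h = solve 4 (λ a x c y → (a :* x) :* (c :* y) := (a :* c) :* (x :* y)) ≈-refl

  ∣-^-mono : ∀ {a b} n → a ∣ b → a ^ n ∣ b ^ n
  ∣-^-mono zero h = ∣-refl
  ∣-^-mono (suc n) h = ∣-*-mono h (∣-^-mono n h)

  ∣-^ : ∀ a {m n} → m ℕ.≤ n → a ^ m ∣ a ^ n
  ∣-^ a {n = n} z≤n = divides (a ^ n) (≈-sym (*-identityˡ _))
  ∣-^ a (s≤s h) = ∣-*-mono ∣-refl (∣-^ a h)

  infix 4 _≋_[_]
  record _≋_[_] (a b d : Carrier) : Set where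
    constructor congr
    field
      ∣-diff : d ∣ a - b
  open _≋_[_] public

  ≈⇒≋ : ∀ {a b d} → a ≈ b → a ≋ b [ d ]
  ≈⇒≋ h = congr (∣-resp (≈-sym (≈⇒sub-0 h)) ∣0)

  ≋-refl : ∀ {a d} → a ≋ a [ d ]
  ≋-refl = ≈⇒≋ ≈-refl

  ≋-sym : ∀ {a b d} → a ≋ b [ d ] → b ≋ a [ d ]
  ≋-sym {a} {b} (congr h) = congr (∣-resp (k a b) (∣-neg h))
    where k : ∀ a b → - (a - b) ≈ b - a
          k = solve 2 (λ a b → :- (a :- b) := b :- a) ≈-refl

  ≋-trans : ∀ {a b c d} → a ≋ b [ d ] → b ≋ c [ d ] → a ≋ c [ d ]
  ≋-trans {a} {b} {c} (congr h) (congr k) = congr (∣-resp (l a b c) (∣-+ h k))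
    where l : ∀ a b c → (a - b) + (b - c) ≈ a - c
          l = solve 3 (λ a b c → (a :- b) :+ (b :- c) := a :- c) ≈-refl

  ≋-+ : ∀ {a b x y d} → a ≋ b [ d ] → x ≋ y [ d ] → a + x ≋ b + y [ d ]
  ≋-+ {a} {b} {x} {y} (congr h) (congr k) = congr (∣-resp (l a b x y) (∣-+ h k))
    where l : ∀ a b x y → (a - b) + (x - y) ≈ (a + x) - (b + y)
          l = solve 4 (λ a b x y → (a :- b) :+ (x :- y) := (a :+ x) :- (b :+ y)) ≈-refl

  ≋-neg : ∀ {a b d} → a ≋ b [ d ] → - a ≋ - b [ d ]
  ≋-neg {a} {b} (congr h) = congr (∣-resp (l a b) (∣-neg h))
    where l : ∀ a b → - (a - b) ≈ - a - - b
          l = solve 2 (λ a b → :- (a :- b) := :- a :- :- b) ≈-refl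

  ≋-sub : ∀ {a b x y d} → a ≋ b [ d ] → x ≋ y [ d ] → a - x ≋ b - y [ d ]
  ≋-sub h k = ≋-+ h (≋-neg k)

  ≋-* : ∀ {a b x y d} → a ≋ b [ d ] → x ≋ y [ d ] → a * x ≋ b * y [ d ]
  ≋-* {a} {b} {x} {y} (congr h) (congr k) = congr (∣-resp (l a b x y) (∣-+ (∣-*ʳ x h) (∣-*ˡ b k)))
    where l : ∀ a b x y → (a - b) * x + b * (x - y) ≈ a * x - b * y
          l = solve 4 (λ a b x y → (a :- b) :* x :+ b :* (x :- y) := a :* x :- b :* y) ≈-refl

  ≋-^ : ∀ {a b d} n → a ≋ b [ d ] → a ^ n ≋ b ^ n [ d ]
  ≋-^ zero h = ≋-refl
  ≋-^ (suc n) h = ≋-* h (≋-^ n h)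

  ∣⇒≋0 : ∀ {d x} → d ∣ x → x ≋ 0# [ d ]
  ∣⇒≋0 {d} {x} h = congr (∣-resp (l x) h)
    where l : ∀ x → x ≈ x - 0#
          l = solve 1 (λ x → x := x :- con (+ 0)) ≈-refl

  ≋0⇒∣ : ∀ {d x} → x ≋ 0# [ d ] → d ∣ x
  ≋0⇒∣ {d} {x} (congr h) = ∣-resp (l x) h
    where l : ∀ x → x - 0# ≈ x
          l = solve 1 (λ x → x :- con (+ 0) := x) ≈-refl

  ≋-∣ : ∀ {a b d} → a ≋ b [ d ] → d ∣ a → d ∣ b
  ≋-∣ h k = ≋0⇒∣ (≋-trans (≋-sym h) (∣⇒≋0 k))

  ≋-weaken : ∀ {a b d d′} → d′ ∣ d → a ≋ b [ d ] → a ≋ b [ d′ ]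
  ≋-weaken h (congr k) = congr (∣-trans h k)

  ∑ : {A : Set} → List A → (A → Carrier) → Carrier
  ∑ []       f = 0#
  ∑ (x ∷ xs) f = f x + ∑ xs f

  ∑-cong : {A : Set} (xs : List A) {f g : A → Carrier} → (∀ x → f x ≈ g x) → ∑ xs f ≈ ∑ xs g
  ∑-cong [] h = ≈-refl
  ∑-cong (x ∷ xs) h = +-cong (h x) (∑-cong xs h)

  ∑-0 : {A : Set} (xs : List A) {f : A → Carrier} → (∀ x → f x ≈ 0#) → ∑ xs f ≈ 0#
  ∑-0 [] h = ≈-refl
  ∑-0 (x ∷ xs) h = ≈-trans (+-cong (h x) (∑-0 xs h)) (+-identityˡ 0#)

  ∑-+ : {A : Set} (xs : List A) (f g : A → Carrier) → ∑ xs (λ x → f x + g x) ≈ ∑ xs f + ∑ xs g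
  ∑-+ [] f g = ≈-sym (+-identityˡ 0#)
  ∑-+ (x ∷ xs) f g = ≈-trans (+-cong ≈-refl (∑-+ xs f g)) (h (f x) (g x) (∑ xs f) (∑ xs g))
    where h : ∀ a b c d → (a + b) + (c + d) ≈ (a + c) + (b + d)
          h = solve 4 (λ a b c d → (a :+ b) :+ (c :+ d) := (a :+ c) :+ (b :+ d)) ≈-refl

  ∑-*ˡ : {A : Set} (c : Carrier) (xs : List A) (f : A → Carrier) → c * ∑ xs f ≈ ∑ xs (λ x → c * f x)
  ∑-*ˡ c [] f = zeroʳ c
  ∑-*ˡ c (x ∷ xs) f = ≈-trans (distribˡ c _ _) (+-cong ≈-refl (∑-*ˡ c xs f))

  ∑-*ʳ : {A : Set} (c : Carrier) (xs : List A) (f : A → Carrier) → ∑ xs f * c ≈ ∑ xs (λ x → f x * c)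
  ∑-*ʳ c [] f = zeroˡ c
  ∑-*ʳ c (x ∷ xs) f = ≈-trans (distribʳ c _ _) (+-cong ≈-refl (∑-*ʳ c xs f))

  ∑-neg : {A : Set} (xs : List A) (f : A → Carrier) → - ∑ xs f ≈ ∑ xs (λ x → - f x)
  ∑-neg [] f = h
    where h : - 0# ≈ 0#
          h = solve 0 (:- con (+ 0) := con (+ 0)) ≈-refl
  ∑-neg (x ∷ xs) f = ≈-trans (h (f x) (∑ xs f)) (+-cong ≈-refl (∑-neg xs f))
    where h : ∀ a b → - (a + b) ≈ - a + - b
          h = solve 2 (λ a b → :- (a :+ b) := :- a :+ :- b) ≈-refl

  ∑-sub : {A : Set} (xs : List A) (f g : A → Carrier) → ∑ xs (λ x → f x - g x) ≈ ∑ xs f - ∑ xs g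
  ∑-sub xs f g = ≈-trans (∑-+ xs f (λ x → - g x)) (+-cong ≈-refl (≈-sym (∑-neg xs g)))

  ∑-++ : {A : Set} (xs ys : List A) (f : A → Carrier) → ∑ (xs ++ ys) f ≈ ∑ xs f + ∑ ys f
  ∑-++ [] ys f = ≈-sym (+-identityˡ _)
  ∑-++ (x ∷ xs) ys f = ≈-trans (+-cong ≈-refl (∑-++ xs ys f)) (≈-sym (+-assoc _ _ _))

  ∑-swap : {A C : Set} (xs : List A) (ys : List C) (f : A → C → Carrier) →
           ∑ xs (λ x → ∑ ys (f x)) ≈ ∑ ys (λ y → ∑ xs (λ x → f x y))
  ∑-swap [] ys f = ≈-sym (∑-0 ys (λ _ → ≈-refl))
  ∑-swap (x ∷ xs) ys f = ≈-trans (+-cong ≈-refl (∑-swap xs ys f)) (h ys)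
    where
    k : ∀ a b c d → (a + b) + (c + d) ≈ (a + c) + (b + d)
    k = solve 4 (λ a b c d → (a :+ b) :+ (c :+ d) := (a :+ c) :+ (b :+ d)) ≈-refl
    h : ∀ ys → ∑ ys (f x) + ∑ ys (λ y → ∑ xs (λ x → f x y)) ≈ ∑ ys (λ y → f x y + ∑ xs (λ x → f x y))
    h [] = +-identityˡ 0#
    h (y ∷ ys) = ≈-trans (k _ _ _ _) (+-cong ≈-refl (h ys))

  ∑-∣ : {A : Set} → ∀ {d} (xs : List A) {f : A → Carrier} → (∀ x → d ∣ f x) → d ∣ ∑ xs f
  ∑-∣ [] h = ∣0
  ∑-∣ (x ∷ xs) h = ∣-+ (h x) (∑-∣ xs h)

  ∑-≋ : {A : Set} → ∀ {d} (xs : List A) {f g : A → Carrier} → (∀ x → f x ≋ g x [ d ]) → ∑ xs f ≋ ∑ xs g [ d ]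
  ∑-≋ xs h = congr (∣-resp (∑-sub xs _ _) (∑-∣ xs (∣-diff ∘ h)))

  ∑-map : {A C : Set} (g : C → A) (xs : List C) (f : A → Carrier) → ∑ (map g xs) f ≈ ∑ xs (f ∘ g)
  ∑-map g [] f = ≈-refl
  ∑-map g (x ∷ xs) f = +-cong ≈-refl (∑-map g xs f)

  ∑-concatMap : {A C : Set} (g : C → List A) (xs : List C) (f : A → Carrier) →
                ∑ (concatMap g xs) f ≈ ∑ xs (λ x → ∑ (g x) f)
  ∑-concatMap g [] f = ≈-refl
  ∑-concatMap g (x ∷ xs) f = ≈-trans (∑-++ (g x) _ f) (+-cong ≈-refl (∑-concatMap g xs f))

  ∑< : ℕ → (ℕ → Carrier) → Carrier
  ∑< zero    f = 0#
  ∑< (suc n) f = ∑< n f + f n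

  ∑<-upTo : ∀ n f → ∑ (upTo n) f ≈ ∑< n f
  ∑<-upTo zero f = ≈-refl
  ∑<-upTo (suc n) f = begin
    ∑ (upTo (suc n)) f        ≡⟨ cong (λ xs → ∑ xs f) (sym (Lₚ.upTo-∷ʳ n)) ⟩
    ∑ (upTo n ++ n ∷ []) f    ≈⟨ ∑-++ (upTo n) _ f ⟩
    ∑ (upTo n) f + (f n + 0#) ≈⟨ +-cong (∑<-upTo n f) (+-identityʳ _) ⟩
    ∑< n f + f n              ∎

  ∑<-cong : ∀ n {f g} → (∀ k → k ℕ.< n → f k ≈ g k) → ∑< n f ≈ ∑< n g
  ∑<-cong zero h = ≈-refl
  ∑<-cong (suc n) h = +-cong (∑<-cong n (λ k l → h k (ℕₚ.m<n⇒m<1+n l))) (h n (ℕₚ.n<1+n n))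

  ∑<-congᵃ : ∀ n {f g} → (∀ k → f k ≈ g k) → ∑< n f ≈ ∑< n g
  ∑<-congᵃ n h = ∑<-cong n (λ k _ → h k)

  ∑<-0 : ∀ n {f} → (∀ k → k ℕ.< n → f k ≈ 0#) → ∑< n f ≈ 0#
  ∑<-0 zero h = ≈-refl
  ∑<-0 (suc n) h = ≈-trans (+-cong (∑<-0 n (λ k l → h k (ℕₚ.m<n⇒m<1+n l))) (h n (ℕₚ.n<1+n n)))
      (+-identityˡ 0#)

  ∑<-+ : ∀ n f g → ∑< n (λ k → f k + g k) ≈ ∑< n f + ∑< n g
  ∑<-+ zero f g = ≈-sym (+-identityˡ 0#)
  ∑<-+ (suc n) f g = ≈-trans (+-cong (∑<-+ n f g) ≈-refl) (h (∑< n f) (∑< n g) (f n) (g n))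
    where h : ∀ a b c d → (a + b) + (c + d) ≈ (a + c) + (b + d)
          h = solve 4 (λ a b c d → (a :+ b) :+ (c :+ d) := (a :+ c) :+ (b :+ d)) ≈-refl

  ∑<-*ˡ : ∀ c n f → c * ∑< n f ≈ ∑< n (λ k → c * f k)
  ∑<-*ˡ c zero f = zeroʳ c
  ∑<-*ˡ c (suc n) f = ≈-trans (distribˡ c _ _) (+-cong (∑<-*ˡ c n f) ≈-refl)

  ∑<-*ʳ : ∀ c n f → ∑< n f * c ≈ ∑< n (λ k → f k * c)
  ∑<-*ʳ c zero f = zeroˡ c
  ∑<-*ʳ c (suc n) f = ≈-trans (distribʳ c _ _) (+-cong (∑<-*ʳ c n f) ≈-refl)

  ∑<-neg : ∀ n f → - ∑< n f ≈ ∑< n (λ k → - f k)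
  ∑<-neg zero f = h
    where h : - 0# ≈ 0#
          h = solve 0 (:- con (+ 0) := con (+ 0)) ≈-refl
  ∑<-neg (suc n) f = ≈-trans (h (∑< n f) (f n)) (+-cong (∑<-neg n f) ≈-refl)
    where h : ∀ a b → - (a + b) ≈ - a + - b
          h = solve 2 (λ a b → :- (a :+ b) := :- a :+ :- b) ≈-refl

  ∑<-sub : ∀ n f g → ∑< n (λ k → f k - g k) ≈ ∑< n f - ∑< n g
  ∑<-sub n f g = ≈-trans (∑<-+ n f (λ x → - g x)) (+-cong ≈-refl (≈-sym (∑<-neg n g)))

  ∑<-const : ∀ n c → ∑< n (λ _ → c) ≈ ι (+ n) * c
  ∑<-const zero c = ≈-sym (≈-trans (*-cong ι-0 ≈-refl) (zeroˡ c))
  ∑<-const (suc n) c = begin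
    ∑< n (λ _ → c) + c     ≈⟨ +-cong (∑<-const n c) ≈-refl ⟩
    ι (+ n) * c + c        ≈⟨ h (ι (+ n)) c ⟩
    (1# + ι (+ n)) * c     ≈⟨ *-cong (+-cong ι-1 ≈-refl) ≈-refl ⟨
    (ι (+ 1) + ι (+ n)) * c ≈⟨ *-cong (ι-+ (+ 1) (+ n)) ≈-refl ⟨
    ι (+ suc n) * c        ∎
    where h : ∀ a c → a * c + c ≈ (1# + a) * c
          h = solve 2 (λ a c → a :* c :+ c := (con (+ 1) :+ a) :* c) ≈-refl

  ∑<-swap : ∀ m n (f : ℕ → ℕ → Carrier) → ∑< m (λ i → ∑< n (f i)) ≈ ∑< n (λ j → ∑< m (λ i → f i j))
  ∑<-swap zero n f = ≈-sym (∑<-0 n (λ _ _ → ≈-refl))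
  ∑<-swap (suc m) n f = ≈-trans (+-cong (∑<-swap m n f) ≈-refl) (≈-sym (∑<-+ n _ _))

  ∑-∑<-swap : {A : Set} (xs : List A) (n : ℕ) (f : A → ℕ → Carrier) →
              ∑ xs (λ x → ∑< n (f x)) ≈ ∑< n (λ k → ∑ xs (λ x → f x k))
  ∑-∑<-swap xs zero f = ∑-0 xs (λ _ → ≈-refl)
  ∑-∑<-swap xs (suc n) f = ≈-trans (∑-+ xs _ _) (+-cong (∑-∑<-swap xs n f) ≈-refl)

  ∑<-head : ∀ n f → ∑< (suc n) f ≈ f 0 + ∑< n (f ∘ suc)
  ∑<-head zero f = +-comm _ _
  ∑<-head (suc n) f = ≈-trans (+-cong (∑<-head n f) ≈-refl) (+-assoc _ _ _)

  ∑<-split : ∀ m n f → ∑< (m ℕ.+ n) f ≈ ∑< m f + ∑< n (λ k → f (m ℕ.+ k))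
  ∑<-split m zero f = ≈-trans (≈-reflexive (cong (λ l → ∑< l f) (ℕₚ.+-identityʳ m))) (≈-sym (+-identityʳ _))
  ∑<-split m (suc n) f = ≈-trans (≈-reflexive (cong (λ l → ∑< l f) (ℕₚ.+-suc m n)))
    (≈-trans (+-cong (∑<-split m n f) ≈-refl) (+-assoc _ _ _))

  ∑<-blocks : ∀ m n f → ∑< (n ℕ.* m) f ≈ ∑< m (λ r → ∑< n (λ x → f (r ℕ.+ x ℕ.* m)))
  ∑<-blocks m zero f = ≈-sym (∑<-0 m (λ _ _ → ≈-refl))
  ∑<-blocks m (suc n) f = begin
    ∑< (m ℕ.+ n ℕ.* m) f ≡⟨ cong (λ l → ∑< l f) (ℕₚ.+-comm m (n ℕ.* m)) ⟩
    ∑< (n ℕ.* m ℕ.+ m) f ≈⟨ ∑<-split (n ℕ.* m) m f ⟩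
    ∑< (n ℕ.* m) f + ∑< m (λ k → f (n ℕ.* m ℕ.+ k))
      ≈⟨ +-cong (∑<-blocks m n f) (∑<-congᵃ m (λ k → ≈-reflexive (cong f (ℕₚ.+-comm (n ℕ.* m) k)))) ⟩
    ∑< m (λ r → ∑< n (λ x → f (r ℕ.+ x ℕ.* m))) + ∑< m (λ r → f (r ℕ.+ n ℕ.* m)) ≈⟨ ∑<-+ m _ _ ⟨
    ∑< m (λ r → ∑< (suc n) (λ x → f (r ℕ.+ x ℕ.* m))) ∎

  ∑<-single : ∀ n f r → r ℕ.< n → (∀ k → k ℕ.< n → k ≢ r → f k ≈ 0#) → ∑< n f ≈ f r
  ∑<-single (suc n) f r r<n h with r ℕ.≟ n
  ... | yes refl = ≈-trans (+-cong (∑<-0 n (λ k k<n → h k (ℕₚ.m<n⇒m<1+n k<n) (ℕₚ.<⇒≢ k<n))) ≈-refl)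
      (+-identityˡ _)
  ... | no r≢n = ≈-trans (+-cong (∑<-single n f r (ℕₚ.≤∧≢⇒< (ℕₚ.≤-pred r<n) r≢n)
          (λ k k<n → h k (ℕₚ.m<n⇒m<1+n k<n)))
                                 (h n (ℕₚ.n<1+n n) (λ e → r≢n (sym e)))) (+-identityʳ _)

  ∑<-∣ : ∀ {d} n {f} → (∀ k → k ℕ.< n → d ∣ f k) → d ∣ ∑< n f
  ∑<-∣ zero h = ∣0
  ∑<-∣ (suc n) h = ∣-+ (∑<-∣ n (λ k l → h k (ℕₚ.m<n⇒m<1+n l))) (h n (ℕₚ.n<1+n n))

  ∑<-≋ : ∀ {d} n {f g} → (∀ k → k ℕ.< n → f k ≋ g k [ d ]) → ∑< n f ≋ ∑< n g [ d ]
  ∑<-≋ n h = congr (∣-resp (∑<-sub n _ _) (∑<-∣ n (λ k l → ∣-diff (h k l))))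

  geometric : ∀ n y → (1# - y) * ∑< n (y ^_) ≈ 1# - y ^ n
  geometric zero y = h y
    where h : ∀ y → (1# - y) * 0# ≈ 1# - 1#
          h = solve 1 (λ y → (con (+ 1) :- y) :* con (+ 0) := con (+ 1) :- con (+ 1)) ≈-refl
  geometric (suc n) y = begin
    (1# - y) * (∑< n (y ^_) + y ^ n)           ≈⟨ distribˡ _ _ _ ⟩
    (1# - y) * ∑< n (y ^_) + (1# - y) * y ^ n  ≈⟨ +-cong (geometric n y) ≈-refl ⟩
    (1# - y ^ n) + (1# - y) * y ^ n            ≈⟨ h y (y ^ n) ⟩
    1# - y * y ^ n                             ∎
    where h : ∀ y z → (1# - z) + (1# - y) * z ≈ 1# - y * z
          h = solve 2 (λ y z → (con (+ 1) :- z) :+ (con (+ 1) :- y) :* z := con (+ 1) :- y :* z) ≈-refl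

  1-y∣1-y^ : ∀ y n → 1# - y ∣ 1# - y ^ n
  1-y∣1-y^ y n = divides _ (≈-sym (geometric n y))

  2# : Carrier
  2# = 1# + 1#

  -- a² - b² = (a - b)(2b + (a - b)), and the second factor is even, so squaring gains one power of
  -- 2.
  square-lift : ∀ {a b} j → a ≋ b [ 2# ^ suc j ] → a * a ≋ b * b [ 2# ^ suc (suc j) ]
  square-lift {a} {b} j (congr (divides q e)) = congr (divides (b * q + (2# ^ j) * q * q) (begin
    a * a - b * b                               ≈⟨ h a b ⟩
    (a - b) * (2# * b + (a - b))                ≈⟨ *-cong e (+-cong ≈-refl e) ⟩
    (2# * 2# ^ j * q) * (2# * b + 2# * 2# ^ j * q) ≈⟨ k (2# ^ j) q b ⟩
    (2# * (2# * 2# ^ j)) * (b * q + (2# ^ j) * q * q) ∎))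
    where h : ∀ a b → a * a - b * b ≈ (a - b) * ((1# + 1#) * b + (a - b))
          h = solve 2 (λ a b → a :* a :- b :* b := (a :- b) :* ((con (+ 1) :+ con (+ 1)) :* b :+ (a :- b)))
              ≈-refl
          k : ∀ t q b → ((1# + 1#) * t * q) * ((1# + 1#) * b + (1# + 1#) * t * q) ≈
              ((1# + 1#) * ((1# + 1#) * t)) * (b * q + t * q * q)
          k = solve 3 (λ t q b → ((con (+ 1) :+ con (+ 1)) :* t :* q) :*
                ((con (+ 1) :+ con (+ 1)) :* b :+ (con (+ 1) :+ con (+ 1)) :* t :* q) :=
                ((con (+ 1) :+ con (+ 1)) :* ((con (+ 1) :+ con (+ 1)) :* t)) :* (b :* q :+ t :* q :* q))
              ≈-refl

  -- Turns congruences modulo 2 between idempotents into congruences modulo 2^(j+1), so that a full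
  -- power of 2 can later be divided out of a product.
  power-lift : ∀ {a b} j → a ≋ b [ 2# ] → a ^ (2 ℕ.^ j) ≋ b ^ (2 ℕ.^ j) [ 2# ^ suc j ]
  power-lift {a} {b} zero h = congr (∣-respˡ (≈-sym (*-identityʳ 2#)) (∣-diff (≋-^ 1 h)))
  power-lift {a} {b} (suc j) h =
    ≋-trans (≈⇒≋ (sq a)) (≋-trans (square-lift j (power-lift j h)) (≈⇒≋ (≈-sym (sq b))))
    where
    sq : ∀ x → x ^ (2 ℕ.^ suc j) ≈ x ^ (2 ℕ.^ j) * x ^ (2 ℕ.^ j)
    sq x = ≈-trans (≈-reflexive (cong (λ n → x ^ (2 ℕ.^ j ℕ.+ n)) (ℕₚ.+-identityʳ _)))
        (^-homo-* x (2 ℕ.^ j) (2 ℕ.^ j))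

-- Binomial coefficients modulo a prime.

prime>1 : ∀ {p} → Prime p → 1 ℕ.< p
prime>1 pr = ℕ.nonTrivial⇒n>1 _ {{prime⇒nonTrivial pr}}

prime∤! : ∀ {p} → Prime p → ∀ k → k ℕ.< p → ¬ p ℕ∣.∣ k !
prime∤! pr zero k<p d = ℕₚ.<⇒≢ (prime>1 pr) (sym (ℕ∣.∣1⇒≡1 d))
prime∤! pr (suc k) k<p d with euclidsLemma (suc k) (k !) pr d
... | inj₁ h = ℕ∣.>⇒∤ k<p h
... | inj₂ h = prime∤! pr k (ℕₚ.<⇒≤ k<p) h

prime∣C : ∀ {p} → Prime p → ∀ {k} → 0 ℕ.< k → k ℕ.< p → p ℕ∣.∣ p C k
prime∣C {suc p-1} pr {k} 0<k k<p =
  [ id , ⊥-elim ∘ ([ prime∤! pr k k<p , prime∤! pr (p ℕ.∸ k) (ℕₚ.∸-monoʳ-< 0<k k≤p) ]′ ∘ euclidsLemma _ _ pr)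
    ]′
    (euclidsLemma (p C k) (k ! ℕ.* (p ℕ.∸ k) !) pr (subst (p ℕ∣.∣_) (sym C*k!≡p!) (ℕ∣.m∣m*n (p-1 !))))
  where
  p = suc p-1
  k≤p = ℕₚ.<⇒≤ k<p
  instance _ = k ℕₚ.!* (p ℕ.∸ k) !≢0
  C*k!≡p! : (p C k) ℕ.* (k ! ℕ.* (p ℕ.∸ k) !) ≡ p !
  C*k!≡p! = trans (cong (ℕ._* (k ! ℕ.* (p ℕ.∸ k) !)) (nCk≡n!/k![n-k]! k≤p)) (m/n*n≡m (k![n∸k]!∣n! k≤p))

ℤ-algebra : ℤAlgebra
ℤ-algebra = record
  { commRing = ℤₚ.+-*-commutativeRing
  ; ι        = id
  ; ι-+      = λ _ _ → refl
  ; ι-*      = λ _ _ → refl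
  ; ι-1      = refl
  }

module Z = RingTools ℤ-algebra

-- The signed binomial coefficient (-1)^j C(n,j), by the recursion that multiplication by 1 - y
-- induces on the coefficients of (1 - y)^n.
sbinom : ℕ → ℕ → ℤ
sbinom n       zero    = + 1
sbinom zero    (suc j) = + 0
sbinom (suc n) (suc j) = sbinom n (suc j) ℤ.- sbinom n j

sbinom≡C : ∀ n j → sbinom n j ≡ (ℤ.- + 1) Z.^ j ℤ.* + (n C j)
sbinom≡C n zero = refl
sbinom≡C zero (suc j) = sym (ℤₚ.*-zeroʳ ((ℤ.- + 1) Z.^ suc j))
sbinom≡C (suc n) (suc j) = begin
  sbinom n (suc j) ℤ.- sbinom n j ≡⟨ cong₂ ℤ._-_ (sbinom≡C n (suc j)) (sbinom≡C n j) ⟩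
  (ℤ.- + 1) ℤ.* s ℤ.* + (n C suc j) ℤ.- s ℤ.* + (n C j) ≡⟨ h s (+ (n C suc j)) (+ (n C j)) ⟩
  (ℤ.- + 1) ℤ.* s ℤ.* (+ (n C j) ℤ.+ + (n C suc j)) ≡⟨ cong (λ t → (ℤ.- + 1) ℤ.* s ℤ.* + t)
    (nCk+nC[k+1]≡[n+1]C[k+1] n j) ⟩
  (ℤ.- + 1) ℤ.* s ℤ.* + (suc n C suc j) ∎
  where
  open ≡-Reasoning
  s = (ℤ.- + 1) Z.^ j
  h : ∀ s x y → (ℤ.- + 1) ℤ.* s ℤ.* x ℤ.- s ℤ.* y ≡ (ℤ.- + 1) ℤ.* s ℤ.* (y ℤ.+ x)
  h = solve-∀

sbinom-n<j : ∀ n j → n ℕ.< j → sbinom n j ≡ + 0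
sbinom-n<j n j n<j = trans (sbinom≡C n j) (trans (cong (λ t → (ℤ.- + 1) Z.^ j ℤ.* + t) (k>n⇒nCk≡0 n<j))
      (ℤₚ.*-zeroʳ ((ℤ.- + 1) Z.^ j)))

pos∣ : ∀ {a b} → a ℕ∣.∣ b → + a Z.∣ + b
pos∣ {a} (ℕ∣.divides q e) = Z.divides (+ q) (trans (cong +_ e) (trans (ℤₚ.pos-* q a) (ℤₚ.*-comm (+ q) (+ a))))

-- Consecutive coefficients of (1 - y)^p differ by a coefficient of (1 - y)^(p+1), which the prime p
-- + 1 divides; so all are congruent to the first one.
sbinom-prime : ∀ {p} → Prime (suc p) → ∀ j → j ℕ.≤ p → sbinom p j Z.≋ + 1 [ + suc p ]
sbinom-prime pr zero j≤p = Z.≋-refl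
sbinom-prime {p} pr (suc j) j<p =
  Z.≋-trans (Z.congr (subst (+ suc p Z.∣_) (sym (sbinom≡C (suc p) (suc j)))
        (Z.∣-*ˡ ((ℤ.- + 1) Z.^ suc j) (pos∣ (prime∣C pr (s≤s z≤n) (s≤s j<p))))))
            (sbinom-prime pr j (ℕₚ.<⇒≤ j<p))

module RingPowers (𝓑 : ℤAlgebra) where
  open RingTools 𝓑
  open import Relation.Binary.Reasoning.Setoid setoid
  open import Algebra.Properties.Semiring.Mult (CommutativeRing.semiring cring) using () renaming (_×_ to _×ℕ_)
  open import Algebra.Properties.Semiring.Sum (CommutativeRing.semiring cring) using (sum; sum-init-last)
  import Algebra.Properties.CommutativeSemiring.Binomial commutativeSemiring as Binomial

  ×≈ι : ∀ n x → n ×ℕ x ≈ ι (+ n) * x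
  ×≈ι zero x = ≈-sym (≈-trans (*-cong ι-0 ≈-refl) (zeroˡ x))
  ×≈ι (suc n) x = begin
    x + n ×ℕ x               ≈⟨ +-cong ≈-refl (×≈ι n x) ⟩
    x + ι (+ n) * x          ≈⟨ h (ι (+ n)) x ⟩
    (1# + ι (+ n)) * x       ≈⟨ *-cong (+-cong ι-1 ≈-refl) ≈-refl ⟨
    (ι (+ 1) + ι (+ n)) * x  ≈⟨ *-cong (ι-+ (+ 1) (+ n)) ≈-refl ⟨
    ι (+ suc n) * x          ∎
    where h : ∀ a x → x + a * x ≈ (1# + a) * x
          h = solve 2 (λ a x → x :+ a :* x := (con (+ 1) :+ a) :* x) ≈-refl

  ι-∣ : ∀ {a b} → a Z.∣ b → ι a ∣ ι b
  ι-∣ {a} (Z.divides q e) = divides (ι q) (≈-trans (≈-reflexive (cong ι e)) (ι-* a q))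

  ι-≋ : ∀ {a b d} → a Z.≋ b [ d ] → ι a ≋ ι b [ ι d ]
  ι-≋ {a} {b} (Z.congr h) = congr (∣-resp (≈-trans (ι-+ a (ℤ.- b)) (+-cong ≈-refl (ι-neg b))) (ι-∣ h))

  sum-∣ : ∀ {d n} (t : Fin n → Carrier) → (∀ i → d ∣ t i) → d ∣ sum t
  sum-∣ {n = zero} t h = ∣0
  sum-∣ {n = suc n} t h = ∣-+ (h Fin.zero) (sum-∣ (t ∘ Fin.suc) (h ∘ Fin.suc))

  freshman : ∀ {p} → Prime p → ∀ x y → (x + y) ^ p ≋ x ^ p + y ^ p [ ι (+ p) ]
  freshman {zero} pr x y = ⊥-elim (ℕₚ.n≮0 (prime>1 pr))
  freshman {suc p-1} pr x y = congr (∣-resp (≈-sym eq) (sum-∣ (t ∘ Fin.suc ∘ inject₁) middle))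
    where
    p = suc p-1
    t : Fin (suc p) → Carrier
    t = Binomial.binomialTerm x y p
    first : t Fin.zero ≈ y ^ p
    first = ≈-trans (+-identityʳ _) (*-identityˡ _)
    last : t (fromℕ p) ≈ x ^ p
    last rewrite Finₚ.toℕ-fromℕ p-1 | nCn≡1 p | ℕₚ.n∸n≡0 p-1 = ≈-trans (+-identityʳ _) (*-identityʳ _)
    middle : ∀ i → ι (+ p) ∣ t (Fin.suc (inject₁ i))
    middle i rewrite Finₚ.toℕ-inject₁ i =
      ∣-resp (≈-sym (×≈ι (p C suc (toℕ i)) _)) (∣-*ʳ _
          (ι-∣ (pos∣ (prime∣C pr (s≤s z≤n) (s≤s (Finₚ.toℕ<n i))))))
    h : ∀ a b c → a + (b + c) - (c + a) ≈ b
    h = solve 3 (λ a b c → a :+ (b :+ c) :- (c :+ a) := b) ≈-refl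
    eq : (x + y) ^ p - (x ^ p + y ^ p) ≈ sum (t ∘ Fin.suc ∘ inject₁)
    eq = begin
      (x + y) ^ p - (x ^ p + y ^ p)
        ≈⟨ -‿cong₂ (≈-trans (Binomial.theorem p x y) (+-cong ≈-refl (sum-init-last (t ∘ Fin.suc)))) ≈-refl ⟩
      t Fin.zero + (sum (t ∘ Fin.suc ∘ inject₁) + t (fromℕ p)) - (x ^ p + y ^ p)
        ≈⟨ -‿cong₂ (+-cong first (+-cong ≈-refl last)) ≈-refl ⟩
      y ^ p + (sum (t ∘ Fin.suc ∘ inject₁) + x ^ p) - (x ^ p + y ^ p)
        ≈⟨ h (y ^ p) _ (x ^ p) ⟩
      sum (t ∘ Fin.suc ∘ inject₁) ∎

  1-y^ : ∀ n y → (1# - y) ^ n ≈ ∑< (suc n) (λ j → ι (sbinom n j) * y ^ j)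
  1-y^ zero y = ≈-sym (≈-trans (+-identityˡ _) (≈-trans (*-identityʳ _) ι-1))
  1-y^ (suc n) y = begin
    (1# - y) * (1# - y) ^ n   ≈⟨ *-cong ≈-refl (1-y^ n y) ⟩
    (1# - y) * S              ≈⟨ h y S ⟩
    S + 0# - y * S            ≈⟨ -‿cong₂ (+-cong ≈-refl (≈-sym top)) (∑<-*ˡ y (suc n) f) ⟩
    ∑< (suc (suc n)) f - ∑< (suc n) (λ j → y * f j)
                              ≈⟨ -‿cong₂ (∑<-head (suc n) f) ≈-refl ⟩
    f 0 + ∑< (suc n) (f ∘ suc) - ∑< (suc n) (λ j → y * f j)
                              ≈⟨ +-assoc _ _ _ ⟩
    f 0 + (∑< (suc n) (f ∘ suc) - ∑< (suc n) (λ j → y * f j))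
                              ≈⟨ +-cong ≈-refl (≈-trans (≈-sym (∑<-sub (suc n) _ _)) (∑<-congᵃ (suc n) step))
                                ⟩
    g 0 + ∑< (suc n) (g ∘ suc) ≈⟨ ∑<-head (suc n) g ⟨
    ∑< (suc (suc n)) g        ∎
    where
    f g : ℕ → Carrier
    f j = ι (sbinom n j) * y ^ j
    g j = ι (sbinom (suc n) j) * y ^ j
    S = ∑< (suc n) f
    h : ∀ y s → (1# - y) * s ≈ s + 0# - y * s
    h = solve 2 (λ y s → (con (+ 1) :- y) :* s := s :+ con (+ 0) :- y :* s) ≈-refl
    top : f (suc n) ≈ 0#
    top = ≈-trans (*-cong (≈-trans (≈-reflexive (cong ι (sbinom-n<j n (suc n) (ℕₚ.n<1+n n)))) ι-0) ≈-refl)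
        (zeroˡ _)
    k : ∀ a b y z → a * (y * z) - y * (b * z) ≈ (a - b) * (y * z)
    k = solve 4 (λ a b y z → a :* (y :* z) :- y :* (b :* z) := (a :- b) :* (y :* z)) ≈-refl
    step : ∀ j → f (suc j) - y * f j ≈ g (suc j)
    step j = ≈-trans (k (ι (sbinom n (suc j))) (ι (sbinom n j)) y (y ^ j))
      (*-cong (≈-sym (≈-trans (ι-+ _ _) (+-cong ≈-refl (ι-neg _)))) ≈-refl)

module ZP = RingPowers ℤ-algebra

-- n · cycloCoeff pr j + 1 is the coefficient of y^j in (1 - y)^(n-1), where n = suc p.
cycloCoeff : ∀ {p} → Prime (suc p) → ℕ → ℤ
cycloCoeff {p} pr j with j ℕ.≤? p
... | yes j≤p = Z._∣_.quotient (Z.∣-diff (sbinom-prime pr j j≤p))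
... | no  _   = + 0

cycloCoeff-spec : ∀ {p} (pr : Prime (suc p)) j → j ℕ.≤ p → sbinom p j ≡ + 1 ℤ.+ + suc p ℤ.* cycloCoeff pr j
cycloCoeff-spec {p} pr j j≤p with j ℕ.≤? p
... | no ¬j≤p = ⊥-elim (¬j≤p j≤p)
... | yes j≤p′ = trans (h (sbinom p j)) (cong (ℤ._+_ (+ 1))
      (Z._∣_.equality (Z.∣-diff (sbinom-prime pr j j≤p′))))
  where h : ∀ x → x ≡ + 1 ℤ.+ (x ℤ.- + 1)
        h = solve-∀

fermat : ∀ {p} → Prime p → ∀ n → (+ n) Z.^ p Z.≋ + n [ + p ]
fermat {zero} pr n = ⊥-elim (ℕₚ.n≮0 (prime>1 pr))
fermat {suc p} pr zero = Z.≋-refl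
fermat {suc p} pr (suc n) = Z.≋-trans (ZP.freshman pr (+ 1) (+ n))
    (Z.≋-+ (Z.≈⇒≋ (Z.1^ (suc p))) (fermat pr n))

-- Comaximality and divisibility in ℤ

-- Coprimality carries its Bézout coefficients: `v` serves as an inverse of b modulo a, and the
-- identity can be pushed into any ring by `ι`.
record Comax (a b : ℤ) : Set where
  constructor comax
  field
    u v    : ℤ
    bézout : a ℤ.* u ℤ.+ b ℤ.* v ≡ + 1

comax-sym : ∀ {a b} → Comax a b → Comax b a
comax-sym {a} {b} (comax u v e) = comax v u (trans (ℤₚ.+-comm (b ℤ.* v) (a ℤ.* u)) e)

comax-*ʳ : ∀ {a b c} → Comax a b → Comax a c → Comax a (b ℤ.* c)
comax-*ʳ {a} {b} {c} (comax u v e) (comax x y f) =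
  comax (u ℤ.* (a ℤ.* x ℤ.+ c ℤ.* y) ℤ.+ b ℤ.* v ℤ.* x) (v ℤ.* y) (trans (h a b c u v x y) (cong₂ ℤ._*_ e f))
  where h : ∀ a b c u v x y → a ℤ.* (u ℤ.* (a ℤ.* x ℤ.+ c ℤ.* y) ℤ.+ b ℤ.* v ℤ.* x) ℤ.+ b ℤ.* c ℤ.* (v ℤ.* y)
                              ≡ (a ℤ.* u ℤ.+ b ℤ.* v) ℤ.* (a ℤ.* x ℤ.+ c ℤ.* y)
        h = solve-∀

comax-1ʳ : ∀ {a} → Comax a (+ 1)
comax-1ʳ {a} = comax (+ 0) (+ 1) (cong (λ t → t ℤ.+ + 1) (ℤₚ.*-zeroʳ a))

comax-^ʳ : ∀ {a b} n → Comax a b → Comax a (b Z.^ n)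
comax-^ʳ zero h = comax-1ʳ
comax-^ʳ (suc n) h = comax-*ʳ h (comax-^ʳ n h)

comax-^ : ∀ {a b} m n → Comax a b → Comax (a Z.^ m) (b Z.^ n)
comax-^ m n h = comax-^ʳ n (comax-sym (comax-^ʳ m (comax-sym h)))

comax-cancel : ∀ {d} a {x} → Comax d a → d Z.∣ a ℤ.* x → d Z.∣ x
comax-cancel {d} a {x} (comax u v e) (Z.divides q f) = Z.divides (u ℤ.* x ℤ.+ q ℤ.* v) (begin
  x                                     ≡⟨ ℤₚ.*-identityˡ x ⟨
  + 1 ℤ.* x                             ≡⟨ cong (ℤ._* x) e ⟨
  (d ℤ.* u ℤ.+ a ℤ.* v) ℤ.* x           ≡⟨ h d a u v x ⟩
  d ℤ.* (u ℤ.* x) ℤ.+ a ℤ.* x ℤ.* v     ≡⟨ cong (λ t → d ℤ.* (u ℤ.* x) ℤ.+ t ℤ.* v) f ⟩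
  d ℤ.* (u ℤ.* x) ℤ.+ d ℤ.* q ℤ.* v     ≡⟨ k d u x q v ⟩
  d ℤ.* (u ℤ.* x ℤ.+ q ℤ.* v)           ∎)
  where
  open ≡-Reasoning
  h : ∀ d a u v x → (d ℤ.* u ℤ.+ a ℤ.* v) ℤ.* x ≡ d ℤ.* (u ℤ.* x) ℤ.+ a ℤ.* x ℤ.* v
  h = solve-∀
  k : ∀ d u x q v → d ℤ.* (u ℤ.* x) ℤ.+ d ℤ.* q ℤ.* v ≡ d ℤ.* (u ℤ.* x ℤ.+ q ℤ.* v)
  k = solve-∀

comax-∣-* : ∀ {a b x} → Comax a b → a Z.∣ x → b Z.∣ x → a ℤ.* b Z.∣ x
comax-∣-* {a} {b} {x} (comax u v e) (Z.divides q f) (Z.divides r g) = Z.divides (r ℤ.* u ℤ.+ q ℤ.* v) (begin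
  x                                           ≡⟨ ℤₚ.*-identityʳ x ⟨
  x ℤ.* + 1                                   ≡⟨ cong (x ℤ.*_) e ⟨
  x ℤ.* (a ℤ.* u ℤ.+ b ℤ.* v)                 ≡⟨ ℤₚ.*-distribˡ-+ x _ _ ⟩
  x ℤ.* (a ℤ.* u) ℤ.+ x ℤ.* (b ℤ.* v)         ≡⟨ cong₂ (λ s t → s ℤ.* (a ℤ.* u) ℤ.+ t ℤ.* (b ℤ.* v)) g f ⟩
  b ℤ.* r ℤ.* (a ℤ.* u) ℤ.+ a ℤ.* q ℤ.* (b ℤ.* v) ≡⟨ h a b u v q r ⟩
  a ℤ.* b ℤ.* (r ℤ.* u ℤ.+ q ℤ.* v)           ∎)
  where
  open ≡-Reasoning
  h : ∀ a b u v q r → b ℤ.* r ℤ.* (a ℤ.* u) ℤ.+ a ℤ.* q ℤ.* (b ℤ.* v) ≡ a ℤ.* b ℤ.* (r ℤ.* u ℤ.+ q ℤ.* v)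
  h = solve-∀

∣⇒abs∣ : ∀ {d x} → + d Z.∣ x → d ℕ∣.∣ ℤ.∣ x ∣
∣⇒abs∣ {d} {x} (Z.divides q e) = ℕ∣.divides ℤ.∣ q ∣
    (trans (cong ℤ.∣_∣ e) (trans (ℤₚ.abs-* (+ d) q) (ℕₚ.*-comm d ℤ.∣ q ∣)))

abs∣⇒∣ : ∀ {d} x → d ℕ∣.∣ ℤ.∣ x ∣ → + d Z.∣ x
abs∣⇒∣ (+ n) h = pos∣ h
abs∣⇒∣ -[1+ n ] h = Z.∣-neg (pos∣ h)

∣?ℤ : ∀ d x → Dec (+ d Z.∣ x)
∣?ℤ d x with d ℕ∣.∣? ℤ.∣ x ∣
... | yes h = yes (abs∣⇒∣ x h)
... | no ¬h = no (¬h ∘ ∣⇒abs∣)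

euclidℤ : ∀ {p} → Prime p → ∀ x y → + p Z.∣ x ℤ.* y → (+ p Z.∣ x) ⊎ (+ p Z.∣ y)
euclidℤ {p} pr x y h with euclidsLemma ℤ.∣ x ∣ ℤ.∣ y ∣ pr (subst (p ℕ∣.∣_) (ℤₚ.abs-* x y) (∣⇒abs∣ h))
... | inj₁ k = inj₁ (abs∣⇒∣ x k)
... | inj₂ k = inj₂ (abs∣⇒∣ y k)

bézoutℤ : ∀ {m n} → Coprimality.Coprime m n → Comax (+ m) (+ n)
bézoutℤ {m} {n} c with Coprimality.coprime-Bézout c
... | Bézout.+- x y eq = comax (+ x) (ℤ.- + y) $ trans
    (cong (λ t → t ℤ.+ + n ℤ.* (ℤ.- + y)) (trans (ℤₚ.*-comm (+ m) (+ x))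
        (trans (sym (ℤₚ.pos-* x m)) (trans (cong +_ (sym eq)) (cong (ℤ._+_ (+ 1)) (ℤₚ.pos-* y n))))))
    (h (+ y) (+ n))
  where h : ∀ y n → + 1 ℤ.+ y ℤ.* n ℤ.+ n ℤ.* (ℤ.- y) ≡ + 1
        h = solve-∀
... | Bézout.-+ x y eq = comax (ℤ.- + x) (+ y) $ trans
    (cong (ℤ._+_ (+ m ℤ.* (ℤ.- + x))) (trans (ℤₚ.*-comm (+ n) (+ y))
        (trans (sym (ℤₚ.pos-* y n)) (trans (cong +_ (sym eq)) (cong (ℤ._+_ (+ 1)) (ℤₚ.pos-* x m))))))
    (h (+ x) (+ m))
  where h : ∀ x m → m ℤ.* (ℤ.- x) ℤ.+ (+ 1 ℤ.+ x ℤ.* m) ≡ + 1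
        h = solve-∀

prime-comaxℕ : ∀ {p} → Prime p → ∀ n → ¬ p ℕ∣.∣ n → Comax (+ p) (+ n)
prime-comaxℕ {p} pr n ¬d = bézoutℤ (λ (d∣p , d∣n) → [ id , (λ { refl → ⊥-elim (¬d d∣n) }) ]′
      (prime⇒irreducible pr d∣p))

comax-negʳ : ∀ {a b} → Comax a b → Comax a (ℤ.- b)
comax-negʳ {a} {b} (comax u v e) = comax u (ℤ.- v) (trans (cong (ℤ._+_ (a ℤ.* u)) (h b v)) e)
  where h : ∀ b v → (ℤ.- b) ℤ.* (ℤ.- v) ≡ b ℤ.* v
        h = solve-∀

prime-comax : ∀ {p} → Prime p → ∀ x → ¬ + p Z.∣ x → Comax (+ p) x
prime-comax pr (+ n) ¬d = prime-comaxℕ pr n (¬d ∘ pos∣)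
prime-comax pr -[1+ n ] ¬d = comax-negʳ (prime-comaxℕ pr (suc n) (¬d ∘ Z.∣-neg ∘ pos∣))

comax⇒∤ : ∀ {p} → Prime p → ∀ {x} → Comax (+ p) x → ¬ + p Z.∣ x
comax⇒∤ {p} pr {x} (comax u v e) h =
  ℕₚ.<⇒≢ (prime>1 pr) (sym (ℕ∣.∣1⇒≡1 (∣⇒abs∣ (Z.∣-resp e (Z.∣-+ (Z.∣-*ʳ u Z.∣-refl) (Z.∣-*ʳ v h))))))

pos-^ : ∀ a n → + (a ℕ.^ n) ≡ (+ a) Z.^ n
pos-^ a zero = refl
pos-^ a (suc n) = trans (ℤₚ.pos-* a (a ℕ.^ n)) (cong (ℤ._*_ (+ a)) (pos-^ a n))

≋-cancelˡ : ∀ {d} a {x y} → Comax d a → a ℤ.* x Z.≋ a ℤ.* y [ d ] → x Z.≋ y [ d ]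
≋-cancelˡ {d} a {x} {y} c (Z.congr h) = Z.congr (comax-cancel a c (Z.∣-resp (k a x y) h))
  where k : ∀ a x y → a ℤ.* x ℤ.- a ℤ.* y ≡ a ℤ.* (x ℤ.- y)
        k = solve-∀

fermat-1 : ∀ {p} → Prime (suc p) → ∀ x → ¬ + suc p Z.∣ + x → (+ x) Z.^ p Z.≋ + 1 [ + suc p ]
fermat-1 {p} pr x ¬d = ≋-cancelˡ (+ x) (prime-comax pr (+ x) ¬d)
    (Z.≋-trans (fermat pr x) (Z.≈⇒≋ (sym (ℤₚ.*-identityʳ (+ x)))))

eps : ℕ → ℤ
eps n = (ℤ.- + 1) Z.^ n

eps-+ : ∀ m n → eps (m ℕ.+ n) ≡ eps m ℤ.* eps n
eps-+ = Z.^-homo-* (ℤ.- + 1)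

eps² : ∀ n → eps n ℤ.* eps n ≡ + 1
eps² zero = refl
eps² (suc n) = trans (h (eps n)) (eps² n)
  where h : ∀ e → ((ℤ.- + 1) ℤ.* e) ℤ.* ((ℤ.- + 1) ℤ.* e) ≡ e ℤ.* e
        h = solve-∀

eps-± : ∀ n → (eps n ≡ + 1) ⊎ (eps n ≡ ℤ.- + 1)
eps-± zero = inj₁ refl
eps-± (suc n) with eps-± n
... | inj₁ e = inj₂ (cong (ℤ._*_ (ℤ.- + 1)) e)
... | inj₂ e = inj₁ (cong (ℤ._*_ (ℤ.- + 1)) e)

eps-≋1 : ∀ {p} → 2 ℕ.< p → ∀ n → eps n Z.≋ + 1 [ + p ] → eps n ≡ + 1
eps-≋1 {p} 2<p n (Z.congr h) with eps-± n
... | inj₁ e = e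
... | inj₂ e = ⊥-elim (ℕ∣.>⇒∤ 2<p (∣⇒abs∣ (subst (λ t → + p Z.∣ t ℤ.- + 1) e h)))

eps-odd : ∀ k → eps (suc (2 ℕ.* k)) ≡ ℤ.- + 1
eps-odd k = trans (cong (λ t → ℤ.- + 1 ℤ.* eps (k ℕ.+ t)) (ℕₚ.+-identityʳ k))
    (trans (cong (ℤ._*_ (ℤ.- + 1)) (eps-+ k k)) (cong (ℤ._*_ (ℤ.- + 1)) (eps² k)))

eps-even : ∀ k → eps (2 ℕ.* k) ≡ + 1
eps-even k = trans (cong (λ t → eps (k ℕ.+ t)) (ℕₚ.+-identityʳ k)) (trans (eps-+ k k) (eps² k))

-- The second supplement to quadratic reciprocity

-- The product 2·4···2h equals 2^h h!. Modulo 2h + 1 its b largest factors 2h, 2h - 2, ... are -1,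
-- -3, ...; when a and b count the even and the odd numbers up to h, the absolute values multiply to
-- h! again. Cancelling h! leaves 2^h ≡ (-1)^b.
module Supplement (h a b : ℕ) (a+b≡h : a ℕ.+ b ≡ h) where
  2h+1 = suc (2 ℕ.* h)

  evens odds : ℕ → ℤ
  evens zero    = + 1
  evens (suc n) = evens n ℤ.* (+ 2 ℤ.* + suc n)
  odds zero    = + 1
  odds (suc n) = odds n ℤ.* (+ 1 ℤ.+ + 2 ℤ.* + n)

  top : ℕ → ℤ
  top zero    = + 1
  top (suc n) = top n ℤ.* (+ 2 ℤ.* (+ h ℤ.- + n))

  evens-fact : ∀ n → evens n ≡ (+ 2) Z.^ n ℤ.* + (n !)
  evens-fact zero = refl
  evens-fact (suc n) = trans (cong (λ t → t ℤ.* (+ 2 ℤ.* + suc n)) (evens-fact n))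
    (trans (k ((+ 2) Z.^ n) (+ (n !)) (+ 2) (+ suc n))
        (cong (ℤ._*_ (+ 2 ℤ.* (+ 2) Z.^ n)) (sym (ℤₚ.pos-* (suc n) (n !)))))
    where k : ∀ x y z w → x ℤ.* y ℤ.* (z ℤ.* w) ≡ z ℤ.* x ℤ.* (w ℤ.* y)
          k = solve-∀

  evens-split : ∀ c n → n ℕ.+ c ≡ h → evens h ≡ evens n ℤ.* top c
  evens-split zero n refl = trans (cong evens (ℕₚ.+-identityʳ n)) (sym (ℤₚ.*-identityʳ (evens n)))
  evens-split (suc c) n e = trans (evens-split c (suc n) (trans (sym (ℕₚ.+-suc n c)) e))
    (trans (ℤₚ.*-assoc (evens n) _ _) (cong (evens n ℤ.*_)
          (trans (ℤₚ.*-comm _ (top c)) (cong (λ t → top c ℤ.* (+ 2 ℤ.* t)) (sym h-c)))))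
    where
    k : ∀ x y → x ℤ.+ y ℤ.- y ≡ x
    k = solve-∀
    h-c : + h ℤ.- + c ≡ + suc n
    h-c = trans (cong (λ t → + t ℤ.- + c) (sym (trans (sym (ℕₚ.+-suc n c)) e))) (k (+ suc n) (+ c))

  top≋odds : ∀ n → top n Z.≋ eps n ℤ.* odds n [ + 2h+1 ]
  top≋odds zero = Z.≋-refl
  top≋odds (suc n) = Z.≋-trans (Z.≋-* (top≋odds n) (Z.congr (Z.divides (+ 1) eq)))
      (Z.≈⇒≋ (l (eps n) (odds n) (+ n)))
    where
    k : ∀ h n → + 2 ℤ.* (h ℤ.- n) ℤ.- (ℤ.- + 1) ℤ.* (+ 1 ℤ.+ + 2 ℤ.* n) ≡ (+ 1 ℤ.+ + 2 ℤ.* h) ℤ.* + 1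
    k = solve-∀
    eq : + 2 ℤ.* (+ h ℤ.- + n) ℤ.- (ℤ.- + 1) ℤ.* (+ 1 ℤ.+ + 2 ℤ.* + n) ≡ + 2h+1 ℤ.* + 1
    eq = trans (k (+ h) (+ n)) (cong (λ t → (+ 1 ℤ.+ t) ℤ.* + 1) (sym (ℤₚ.pos-* 2 h)))
    l : ∀ e o n → e ℤ.* o ℤ.* ((ℤ.- + 1) ℤ.* (+ 1 ℤ.+ + 2 ℤ.* n)) ≡ (ℤ.- + 1) ℤ.* e ℤ.*
        (o ℤ.* (+ 1 ℤ.+ + 2 ℤ.* n))
    l = solve-∀

  two-power : Prime 2h+1 → + (h !) ≡ evens a ℤ.* odds b → (+ 2) Z.^ h Z.≋ eps b [ + 2h+1 ]
  two-power prm fact = ≋-cancelˡ (+ (h !)) (prime-comaxℕ prm (h !) (prime∤! prm h (s≤s (ℕₚ.m≤m+n h _))))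
    (Z.≋-trans (Z.≈⇒≋ (trans (ℤₚ.*-comm (+ (h !)) ((+ 2) Z.^ h))
            (trans (sym (evens-fact h)) (evens-split b a a+b≡h))))
    (Z.≋-trans (Z.≋-* (Z.≋-refl {evens a}) (top≋odds b))
    (Z.≈⇒≋ (trans (k (evens a) (eps b) (odds b)) (cong (ℤ._* eps b) (sym fact))))))
    where
    k : ∀ x e o → x ℤ.* (e ℤ.* o) ≡ x ℤ.* o ℤ.* e
    k = solve-∀

  fact-even : ∀ n → + ((n ℕ.+ n) !) ≡ evens n ℤ.* odds n
  fact-odd : ∀ n → + (suc (n ℕ.+ n) !) ≡ evens n ℤ.* odds (suc n)
  fact-even zero = refl
  fact-even (suc n) = begin
    + ((suc n ℕ.+ suc n) !) ≡⟨ cong (λ t → + (suc t !)) (ℕₚ.+-suc n n) ⟩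
    + (suc (suc (n ℕ.+ n)) !) ≡⟨ ℤₚ.pos-* (suc (suc (n ℕ.+ n))) (suc (n ℕ.+ n) !) ⟩
    + suc (suc (n ℕ.+ n)) ℤ.* + (suc (n ℕ.+ n) !) ≡⟨ cong (ℤ._*_ (+ suc (suc (n ℕ.+ n)))) (fact-odd n) ⟩
    (+ 2 ℤ.+ (+ n ℤ.+ + n)) ℤ.* (evens n ℤ.* odds (suc n)) ≡⟨ k (+ n) (evens n) (odds (suc n)) ⟩
    evens n ℤ.* (+ 2 ℤ.* (+ 1 ℤ.+ + n)) ℤ.* odds (suc n) ∎
    where
    open ≡-Reasoning
    k : ∀ n e o → (+ 2 ℤ.+ (n ℤ.+ n)) ℤ.* (e ℤ.* o) ≡ e ℤ.* (+ 2 ℤ.* (+ 1 ℤ.+ n)) ℤ.* o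
    k = solve-∀
  fact-odd n = trans (ℤₚ.pos-* (suc (n ℕ.+ n)) ((n ℕ.+ n) !))
      (trans (cong (ℤ._*_ (+ suc (n ℕ.+ n))) (fact-even n)) (k (+ n) (evens n) (odds n)))
    where
    k : ∀ n e o → (+ 1 ℤ.+ (n ℤ.+ n)) ℤ.* (e ℤ.* o) ≡ e ℤ.* (o ℤ.* (+ 1 ℤ.+ + 2 ℤ.* n))
    k = solve-∀

-- Up to h = 4k + 1, as up to h = 4k + 2 in the next lemma, there are 2k + 1 odd numbers, so the
-- sign is -1.
two-nonresidue-3 : ∀ k → Prime (suc (2 ℕ.* suc (4 ℕ.* k))) → (+ 2) Z.^ suc (4 ℕ.* k) Z.≋ ℤ.- + 1 [ + suc
    (2 ℕ.* suc (4 ℕ.* k)) ]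
two-nonresidue-3 k pr = subst (λ t → (+ 2) Z.^ suc (4 ℕ.* k) Z.≋ t [ + suc (2 ℕ.* suc (4 ℕ.* k)) ])
    (eps-odd k) (two-power pr (subst (λ t → + (suc t !) ≡ evens (2 ℕ.* k) ℤ.* odds (suc (2 ℕ.* k))) e
        (fact-odd (2 ℕ.* k))))
  where
  e : 2 ℕ.* k ℕ.+ 2 ℕ.* k ≡ 4 ℕ.* k
  e = sym (ℕₚ.*-distribʳ-+ k 2 2)
  open Supplement (suc (4 ℕ.* k)) (2 ℕ.* k) (suc (2 ℕ.* k)) (trans (ℕₚ.+-suc (2 ℕ.* k) (2 ℕ.* k)) (cong suc e))

two-nonresidue-5 : ∀ k → Prime (suc (2 ℕ.* (2 ℕ.* suc (2 ℕ.* k)))) → (+ 2) Z.^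
    (2 ℕ.* suc (2 ℕ.* k)) Z.≋ ℤ.- + 1 [ + suc (2 ℕ.* (2 ℕ.* suc (2 ℕ.* k))) ]
two-nonresidue-5 k pr = subst (λ t → (+ 2) Z.^ (2 ℕ.* suc (2 ℕ.* k)) Z.≋ t [ + suc
      (2 ℕ.* (2 ℕ.* suc (2 ℕ.* k))) ]) (eps-odd k)
    (two-power pr (subst (λ t → + (t !) ≡ evens b ℤ.* odds b) e (fact-even b)))
  where
  b = suc (2 ℕ.* k)
  e : b ℕ.+ b ≡ 2 ℕ.* b
  e = cong (b ℕ.+_) (sym (ℕₚ.+-identityʳ b))
  open Supplement (2 ℕ.* b) b b e

-- y^p + 1 is y + 1 times the sum of the (-y)^j with j < p, and this sum is divisible by p when y ≡
-- -1 modulo p; each p-th power therefore gains one factor p.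
neg-one-lift : ∀ {p} → Prime p → ∀ {k} → p ≡ suc (2 ℕ.* k) → ∀ e x → x Z.≋ ℤ.- + 1 [ + p ] → Σ ℕ λ s →
    x Z.^ s Z.≋ ℤ.- + 1 [ (+ p) Z.^ suc e ]
neg-one-lift {p} pr pk zero x h = 1 , Z.congr (Z.∣-resp (cong (ℤ._- (ℤ.- + 1)) (sym (ℤₚ.*-identityʳ x)))
      (Z.∣-respˡ (sym (ℤₚ.*-identityʳ (+ p))) (Z.∣-diff h)))
neg-one-lift {p} pr {k} pk (suc e) x h with neg-one-lift pr {k} pk e x h
... | s , h′ = s ℕ.* p , Z.≋-trans (Z.≈⇒≋ (sym (Z.^-assocʳ x s p)))
    (Z.congr (Z.∣-resp final (Z.∣-respˡ (ℤₚ.*-comm ((+ p) Z.^ suc e) (+ p)) (Z.∣-*-mono (Z.∣-diff h′) S≋p))))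
  where
  y = x Z.^ s
  z = ℤ.- y
  z≋1 : z Z.≋ + 1 [ + p ]
  z≋1 = Z.≋-neg (Z.≋-weaken (Z.∣-*ʳ ((+ p) Z.^ e) Z.∣-refl) h′)
  S = Z.∑< p (z Z.^_)
  S≋p : + p Z.∣ S
  S≋p = Z.≋0⇒∣ (Z.≋-trans (Z.∑<-≋ p (λ j _ → Z.≋-trans (Z.≋-^ j z≋1) (Z.≈⇒≋ (Z.1^ j))))
        (Z.≋-trans (Z.≈⇒≋ (Z.∑<-const p (+ 1))) (Z.∣⇒≋0 (Z.∣-*ʳ (+ 1) Z.∣-refl))))
  zp : z Z.^ p ≡ ℤ.- (y Z.^ p)
  zp = begin
    z Z.^ p ≡⟨ Z.^-congˡ p (ℤₚ.-1*i≡-i y) ⟨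
    (ℤ.- + 1 ℤ.* y) Z.^ p ≡⟨ Z.^-distrib-* (ℤ.- + 1) y p ⟩
    eps p ℤ.* y Z.^ p ≡⟨ cong (λ t → eps t ℤ.* y Z.^ p) pk ⟩
    eps (suc (2 ℕ.* k)) ℤ.* y Z.^ p ≡⟨ cong (λ t → t ℤ.* y Z.^ p) (eps-odd k) ⟩
    ℤ.- + 1 ℤ.* y Z.^ p ≡⟨ ℤₚ.-1*i≡-i (y Z.^ p) ⟩
    ℤ.- (y Z.^ p) ∎
    where open ≡-Reasoning
  final : (y ℤ.- (ℤ.- + 1)) ℤ.* S ≡ y Z.^ p ℤ.- (ℤ.- + 1)
  final = begin
    (y ℤ.- (ℤ.- + 1)) ℤ.* S ≡⟨ cong (ℤ._* S) (l y) ⟩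
    (+ 1 ℤ.- z) ℤ.* S ≡⟨ Z.geometric p z ⟩
    + 1 ℤ.- z Z.^ p ≡⟨ cong (ℤ._-_ (+ 1)) zp ⟩
    + 1 ℤ.- (ℤ.- (y Z.^ p)) ≡⟨ l′ (y Z.^ p) ⟩
    y Z.^ p ℤ.- (ℤ.- + 1) ∎
    where
    open ≡-Reasoning
    l : ∀ y → y ℤ.- (ℤ.- + 1) ≡ + 1 ℤ.- (ℤ.- y)
    l = solve-∀
    l′ : ∀ y → + 1 ℤ.- (ℤ.- y) ≡ y ℤ.- (ℤ.- + 1)
    l′ = solve-∀

-- Residues and the units ± 2^i.

≋-%ℕ : ∀ x n .{{_ : ℕ.NonZero n}} → x Z.≋ + (x ℤ.%ℕ n) [ + n ]
≋-%ℕ x n = Z.congr (Z.divides (x ℤ./ℕ n) (trans (cong (ℤ._- + (x ℤ.%ℕ n)) (a≡a%ℕn+[a/ℕn]*n x n))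
        (h (+ (x ℤ.%ℕ n)) (x ℤ./ℕ n) (+ n))))
  where h : ∀ r q n → r ℤ.+ q ℤ.* n ℤ.- r ≡ n ℤ.* q
        h = solve-∀

%ℕ-≡⇒≋ : ∀ x y n .{{_ : ℕ.NonZero n}} → x ℤ.%ℕ n ≡ y ℤ.%ℕ n → x Z.≋ y [ + n ]
%ℕ-≡⇒≋ x y n e = Z.≋-trans (≋-%ℕ x n) (Z.≋-trans (Z.≈⇒≋ (cong +_ e)) (Z.≋-sym (≋-%ℕ y n)))

comax-≋ : ∀ {a b c} → b Z.≋ c [ a ] → Comax a b → Comax a c
comax-≋ {a} {b} {c} (Z.congr (Z.divides q f)) (comax u v e) = comax (u ℤ.+ q ℤ.* v) v
    (trans (h a c u v q) (trans (cong (λ t → a ℤ.* u ℤ.+ (t ℤ.+ c) ℤ.* v) (sym f)) (trans (k a b c u v) e)))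
  where h : ∀ a c u v q → a ℤ.* (u ℤ.+ q ℤ.* v) ℤ.+ c ℤ.* v ≡ a ℤ.* u ℤ.+ (a ℤ.* q ℤ.+ c) ℤ.* v
        h = solve-∀
        k : ∀ a b c u v → a ℤ.* u ℤ.+ (b ℤ.- c ℤ.+ c) ℤ.* v ≡ a ℤ.* u ℤ.+ b ℤ.* v
        k = solve-∀

comax⇒coprime : ∀ {m n} → Comax (+ m) (+ n) → gcd n m ≡ 1
comax⇒coprime {m} {n} (comax u v e) = Coprimality.coprime⇒gcd≡1 {n} {m} (λ (d∣n , d∣m) →
  ℕ∣.∣1⇒≡1 (∣⇒abs∣ (Z.∣-resp e (Z.∣-+ (Z.∣-*ʳ u (pos∣ d∣m)) (Z.∣-*ʳ v (pos∣ d∣n))))))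

pm2 : ℕ → ℕ → ℤ
pm2 t i = eps t ℤ.* (+ 2) Z.^ i

pm2-* : ∀ t i t′ i′ → pm2 t i ℤ.* pm2 t′ i′ ≡ pm2 (t ℕ.+ t′) (i ℕ.+ i′)
pm2-* t i t′ i′ = trans (h (eps t) ((+ 2) Z.^ i) (eps t′) ((+ 2) Z.^ i′))
    (sym (cong₂ ℤ._*_ (eps-+ t t′) (Z.^-homo-* (+ 2) i i′)))
  where h : ∀ a b c d → a ℤ.* b ℤ.* (c ℤ.* d) ≡ a ℤ.* c ℤ.* (b ℤ.* d)
        h = solve-∀

pm2-^ : ∀ t i h → pm2 t i Z.^ h ≡ eps (t ℕ.* h) ℤ.* ((+ 2) Z.^ h) Z.^ i
pm2-^ t i h = trans (Z.^-distrib-* (eps t) ((+ 2) Z.^ i) h)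
    (cong₂ ℤ._*_ (Z.^-assocʳ (ℤ.- + 1) t h) (trans (Z.^-assocʳ (+ 2) i h)
        (trans (cong ((+ 2) Z.^_) (ℕₚ.*-comm i h)) (sym (Z.^-assocʳ (+ 2) h i)))))

eps-*odd : ∀ t k → eps (t ℕ.* suc (2 ℕ.* k)) ≡ eps t
eps-*odd t k = trans (sym (Z.^-assocʳ (ℤ.- + 1) t (suc (2 ℕ.* k))))
    ([ (λ e → trans (cong (Z._^ suc (2 ℕ.* k)) e) (trans (Z.1^ (suc (2 ℕ.* k))) (sym e))) ,
      (λ e → trans (cong (Z._^ suc (2 ℕ.* k)) e) (trans (eps-odd k) (sym e))) ]′ (eps-± t))

eps-*even : ∀ t k → eps (t ℕ.* (2 ℕ.* k)) ≡ + 1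
eps-*even t k = trans (cong eps (trans (sym (ℕₚ.*-assoc t 2 k))
        (trans (cong (ℕ._* k) (ℕₚ.*-comm t 2)) (ℕₚ.*-assoc 2 t k)))) (eps-even (t ℕ.* k))

-1≋⇒^ : ∀ {x p} → x Z.≋ ℤ.- + 1 [ p ] → ∀ i → x Z.^ i Z.≋ eps i [ p ]
-1≋⇒^ h i = Z.≋-^ i h

-- Arithmetic consequences of the hypotheses.

-- n₁ and n₂ are the prime powers of the theorem: e₁ and e₂ are its exponents minus one.
record Setting : Set where
  field
    p₁ p₂ e₁ e₂ : ℕ
    pr₁ : Prime p₁
    pr₂ : Prime p₂
    half₁ half₂ : ℕ
    odd₁ : p₁ ≡ suc (2 ℕ.* half₁)
    odd₂ : p₂ ≡ suc (2 ℕ.* half₂)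
    p₁≢p₂ : p₁ ≢ p₂
  n₁ : ℕ
  n₁ = p₁ ℕ.^ suc e₁
  n₂ : ℕ
  n₂ = p₂ ℕ.^ suc e₂
  field
    units : ∀ x y → ¬ + p₁ Z.∣ x → ¬ + p₂ Z.∣ y →
            Σ ℕ λ t → Σ ℕ λ i → (pm2 t i Z.≋ x [ + n₁ ]) × (pm2 t i Z.≋ y [ + n₂ ])
    -- Modulo p₁ both -1 and 2 are nonresidues, modulo p₂ only 2 is: the quadratic characters read
    -- off the parities of t + i and of i.
    parity₁ : ∀ t i → pm2 t i Z.≋ + 1 [ + p₁ ] → eps (t ℕ.+ i) ≡ + 1
    parity₂ : ∀ t i → pm2 t i Z.≋ + 1 [ + p₂ ] → eps i ≡ + 1
    -- A nonresidue modulo one of the primes that is 1 modulo the other one. Such units show that an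
    -- odd function vanishes where one coordinate is 0.
    flip₁ : Σ ℕ λ t → Σ ℕ λ i → (eps t ≡ ℤ.- + 1) × (eps i ≡ + 1) × (pm2 t i Z.≋ + 1 [ + p₂ ])
    flip₂ : Σ ℕ λ t → Σ ℕ λ i → (eps t ≡ ℤ.- + 1) × (eps i ≡ ℤ.- + 1) × (pm2 t i Z.≋ + 1 [ + p₁ ])
    f : ℕ
    f>0 : 0 ℕ.< f
    2^f₁ : (+ 2) Z.^ f Z.≋ + 1 [ + n₁ ]
    2^f₂ : (+ 2) Z.^ f Z.≋ + 1 [ + n₂ ]
    selfconj₁ : Σ ℕ λ s → (+ p₁) Z.^ s Z.≋ ℤ.- + 1 [ + n₂ ]
    selfconj₂ : Σ ℕ λ s → (+ p₂) Z.^ s Z.≋ ℤ.- + 1 [ + n₁ ]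
    no-principal : ∀ k A B → eps k ≡ ℤ.- + 1 → A ℤ.* A ℤ.+ + p₁ ℤ.* + p₂ ℤ.* (B ℤ.* B) ≢ + (2 ℕ.^ (k ℕ.+ 2))

record Hypotheses : Set where
  field
    p₁ p₂ e₁ e₂ k₁ k₂ : ℕ
    pr₁ : Prime p₁
    pr₂ : Prime p₂
    p₁≡ : p₁ ≡ suc (2 ℕ.* suc (4 ℕ.* k₁))
    p₂≡ : p₂ ≡ suc (2 ℕ.* (2 ℕ.* suc (2 ℕ.* k₂)))
    A B : ℤ
    m : ℕ
    sol : + p₁ ℤ.* (A ℤ.* A) ℤ.+ + p₂ ℤ.* (B ℤ.* B) ≡ + (2 ℕ.^ (m ℕ.+ 2))
    leg : LegendreMinusOne p₁ p₂
    ord : IsMultOrder 2 (p₁ ℕ.^ suc e₁ ℕ.* p₂ ℕ.^ suc e₂) (totient (p₁ ℕ.^ suc e₁ ℕ.* p₂ ℕ.^ suc e₂) ℕ./ 2)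

module Arith (H : Hypotheses) where
  open Hypotheses H
  h₁ h₂ n₁ n₂ N f : ℕ
  h₁ = suc (4 ℕ.* k₁)
  h₂ = 2 ℕ.* suc (2 ℕ.* k₂)
  n₁ = p₁ ℕ.^ suc e₁
  n₂ = p₂ ℕ.^ suc e₂
  N = n₁ ℕ.* n₂
  f = totient N ℕ./ 2

  2^h₁ : (+ 2) Z.^ h₁ Z.≋ ℤ.- + 1 [ + p₁ ]
  2^h₁ = subst (λ t → (+ 2) Z.^ h₁ Z.≋ ℤ.- + 1 [ + t ]) (sym p₁≡) (two-nonresidue-3 k₁ (subst Prime p₁≡ pr₁))

  2^h₂ : (+ 2) Z.^ h₂ Z.≋ ℤ.- + 1 [ + p₂ ]
  2^h₂ = subst (λ t → (+ 2) Z.^ h₂ Z.≋ ℤ.- + 1 [ + t ]) (sym p₂≡) (two-nonresidue-5 k₂ (subst Prime p₂≡ pr₂))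

  2<p₁ : 2 ℕ.< p₁
  2<p₁ = subst (2 ℕ.<_) (sym p₁≡) (s≤s (ℕₚ.*-monoʳ-≤ 2 (s≤s z≤n)))

  2<p₂ : 2 ℕ.< p₂
  2<p₂ = subst (2 ℕ.<_) (sym p₂≡) (s≤s (ℕₚ.*-monoʳ-≤ 2 (ℕₚ.≤-trans (s≤s z≤n) (ℕₚ.m≤n*m (suc (2 ℕ.* k₂)) 2))))

  ∤2 : ∀ {p} → 2 ℕ.< p → ¬ + p Z.∣ + 2
  ∤2 h d = ℕ∣.>⇒∤ h (∣⇒abs∣ d)

  eps-h₁ : ∀ t → eps (t ℕ.* h₁) ≡ eps t
  eps-h₁ t = trans (cong (λ z → eps (t ℕ.* suc z)) (ℕₚ.*-assoc 2 2 k₁)) (eps-*odd t (2 ℕ.* k₁))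

  -- Euler's criterion: the exponent `h₁` = (p₁ - 1)/2 is odd and sends both -1 and 2 to -1.
  parity₁ : ∀ t i → pm2 t i Z.≋ + 1 [ + p₁ ] → eps (t ℕ.+ i) ≡ + 1
  parity₁ t i h = eps-≋1 2<p₁ (t ℕ.+ i) (Z.≋-trans
        (Z.≈⇒≋ (trans (eps-+ t i) (cong (ℤ._* eps i) (sym (eps-h₁ t)))))
    (Z.≋-trans (Z.≋-* (Z.≋-refl {eps (t ℕ.* h₁)}) (Z.≋-sym (-1≋⇒^ 2^h₁ i)))
    (Z.≋-trans (Z.≈⇒≋ (sym (pm2-^ t i h₁))) (Z.≋-trans (Z.≋-^ h₁ h) (Z.≈⇒≋ (Z.1^ h₁))))))

  -- The exponent `h₂` = (p₂ - 1)/2 is even, so it removes the sign and sends only 2 to -1.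
  parity₂ : ∀ t i → pm2 t i Z.≋ + 1 [ + p₂ ] → eps i ≡ + 1
  parity₂ t i h = eps-≋1 2<p₂ i (Z.≋-trans (Z.≈⇒≋ (trans (sym (ℤₚ.*-identityˡ (eps i)))
            (cong (ℤ._* eps i) (sym (eps-*even t (suc (2 ℕ.* k₂)))))))
    (Z.≋-trans (Z.≋-* (Z.≋-refl {eps (t ℕ.* h₂)}) (Z.≋-sym (-1≋⇒^ 2^h₂ i)))
    (Z.≋-trans (Z.≈⇒≋ (sym (pm2-^ t i h₂))) (Z.≋-trans (Z.≋-^ h₂ h) (Z.≈⇒≋ (Z.1^ h₂))))))

  flip : ∀ {p} h → (+ 2) Z.^ h Z.≋ ℤ.- + 1 [ + p ] → pm2 1 h Z.≋ + 1 [ + p ]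
  flip h e = Z.≋-* (Z.≋-refl {eps 1}) e

  p₁∣n₁ : + p₁ Z.∣ + n₁
  p₁∣n₁ = pos∣ (ℕ∣.m∣m*n _)

  p₂∣n₂ : + p₂ Z.∣ + n₂
  p₂∣n₂ = pos∣ (ℕ∣.m∣m*n _)

  n₁∣N : + n₁ Z.∣ + N
  n₁∣N = pos∣ (ℕ∣.m∣m*n n₂)

  n₂∣N : + n₂ Z.∣ + N
  n₂∣N = pos∣ (ℕ∣.n∣m*n n₁)

  comax-2ᵖ : ∀ {p} e i → Prime p → 2 ℕ.< p → Comax (+ (p ℕ.^ e)) ((+ 2) Z.^ i)
  comax-2ᵖ {p} e i pr 2<p = subst (λ z → Comax z ((+ 2) Z.^ i)) (sym (pos-^ p e))
      (comax-^ e i (prime-comax pr (+ 2) (∤2 2<p)))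

  comax-N : ∀ {x} → Comax (+ n₁) x → Comax (+ n₂) x → Comax (+ N) x
  comax-N {x} c d = subst (λ z → Comax z x) (sym (ℤₚ.pos-* n₁ n₂))
      (comax-sym (comax-*ʳ (comax-sym c) (comax-sym d)))

  comax-N-2 : ∀ i → Comax (+ N) ((+ 2) Z.^ i)
  comax-N-2 i = comax-N (comax-2ᵖ (suc e₁) i pr₁ 2<p₁) (comax-2ᵖ (suc e₂) i pr₂ 2<p₂)

  comax-prime : ∀ {p x} e → Prime p → ¬ + p Z.∣ x → Comax (+ (p ℕ.^ e)) x
  comax-prime {p} {x} e pr ¬d = subst (λ z → Comax z x) (sym (pos-^ p e))
      (comax-sym (comax-^ʳ e (comax-sym (prime-comax pr x ¬d))))

  instance
    N≢0 : ℕ.NonZero N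
    N≢0 = ℕₚ.m*n≢0 n₁ n₂ {{ℕₚ.m^n≢0 p₁ (suc e₁) {{prime⇒nonZero pr₁}}}}
        {{ℕₚ.m^n≢0 p₂ (suc e₂) {{prime⇒nonZero pr₂}}}}

  pow∸1 : ∀ j → + (2 ℕ.^ j ℕ.∸ 1) ≡ (+ 2) Z.^ j ℤ.- + 1
  pow∸1 j = trans (sym (trans (ℤₚ.m-n≡m⊖n (2 ℕ.^ j) 1) (ℤₚ.⊖-≥ (ℕₚ.m^n>0 2 j)))) (cong (ℤ._- + 1) (pos-^ 2 j))

  f>0 : 0 ℕ.< f
  f>0 = proj₁ ord

  2^f : (+ 2) Z.^ f Z.≋ + 1 [ + N ]
  2^f = Z.congr (Z.∣-resp (pow∸1 f) (pos∣ (proj₁ (proj₂ ord))))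

  order-minimal : ∀ j → j ℕ.< f → (+ 2) Z.^ j Z.≋ + 1 [ + N ] → j ≡ 0
  order-minimal zero j<f h = refl
  order-minimal (suc j) j<f (Z.congr h) = ⊥-elim (proj₂ (proj₂ ord) (suc j) (s≤s z≤n) j<f
        (∣⇒abs∣ (Z.∣-resp (sym (pow∸1 (suc j))) h)))

  pm2-inverse : ∀ t i → i ℕ.≤ f → pm2 t i ℤ.* pm2 t (f ℕ.∸ i) Z.≋ + 1 [ + N ]
  pm2-inverse t i i≤f = Z.≋-trans (Z.≈⇒≋ (trans (pm2-* t i t (f ℕ.∸ i))
          (cong₂ (λ a b → a ℤ.* (+ 2) Z.^ b) (trans (eps-+ t t) (eps² t)) (ℕₚ.m+[n∸m]≡n i≤f))))
      (Z.≋-trans (Z.≈⇒≋ (ℤₚ.*-identityˡ _)) 2^f)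

  -- The quotient ± 2^d of the two is 1 modulo N. The parity lemmas make d even and then the sign
  -- +1, so 2^d ≡ 1 with d below the order f, and d = 0. In particular -1 is not a power of 2 modulo
  -- N.
  pm2-injective-≤ : ∀ t i t′ i′ → i ℕ.≤ i′ → i′ ℕ.< f → pm2 t i Z.≋ pm2 t′ i′ [ + N ] → (eps t ≡ eps t′) ×
      (i ≡ i′)
  pm2-injective-≤ t i t′ i′ i≤i′ i′<f h = epst , ℕₚ.≤-antisym i≤i′
      (ℕₚ.m∸n≡0⇒m≤n (order-minimal d (ℕₚ.≤-<-trans (ℕₚ.m∸n≤m i′ i) i′<f)
          (Z.≋-trans (Z.≈⇒≋ (trans (sym (ℤₚ.*-identityˡ ((+ 2) Z.^ d))) (cong (ℤ._* (+ 2) Z.^ d) (sym tt))))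
            g)))
    where
    d = i′ ℕ.∸ i
    c : ∀ a b z y → a ℤ.* z ℤ.* (b ℤ.* y) ≡ z ℤ.* (a ℤ.* b ℤ.* y)
    c = solve-∀
    c′ : ∀ a z → a ℤ.* (a ℤ.* z) ≡ z ℤ.* (a ℤ.* a)
    c′ = solve-∀
    eq : eps t ℤ.* pm2 t′ i′ ≡ (+ 2) Z.^ i ℤ.* pm2 (t ℕ.+ t′) d
    eq = trans (cong (λ z → eps t ℤ.* (eps t′ ℤ.* z))
          (trans (cong ((+ 2) Z.^_) (sym (ℕₚ.m+[n∸m]≡n i≤i′))) (Z.^-homo-* (+ 2) i d)))
        (trans (k (eps t) (eps t′) ((+ 2) Z.^ i) ((+ 2) Z.^ d))
          (cong (λ z → (+ 2) Z.^ i ℤ.* (z ℤ.* (+ 2) Z.^ d)) (sym (eps-+ t t′))))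
      where k : ∀ a b z y → a ℤ.* (b ℤ.* (z ℤ.* y)) ≡ z ℤ.* (a ℤ.* b ℤ.* y)
            k = solve-∀
    g : pm2 (t ℕ.+ t′) d Z.≋ + 1 [ + N ]
    g = Z.≋-sym (≋-cancelˡ ((+ 2) Z.^ i) (comax-N-2 i)
          (Z.≋-trans (Z.≈⇒≋ (trans (cong ((+ 2) Z.^ i ℤ.*_) (sym (eps² t))) (sym (c′ (eps t) ((+ 2) Z.^ i)))))
            (Z.≋-trans (Z.≋-* (Z.≋-refl {eps t}) h) (Z.≈⇒≋ eq))))
    par-d : eps d ≡ + 1
    par-d = parity₂ (t ℕ.+ t′) d (Z.≋-weaken (Z.∣-trans p₂∣n₂ n₂∣N) g)
    tt : eps (t ℕ.+ t′) ≡ + 1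
    tt = trans (sym (ℤₚ.*-identityʳ _)) (trans (cong (eps (t ℕ.+ t′) ℤ.*_) (sym par-d))
          (trans (sym (eps-+ (t ℕ.+ t′) d)) (parity₁ (t ℕ.+ t′) d (Z.≋-weaken (Z.∣-trans p₁∣n₁ n₁∣N) g))))
    epst : eps t ≡ eps t′
    epst = begin
      eps t ≡⟨ ℤₚ.*-identityʳ (eps t) ⟨
      eps t ℤ.* + 1 ≡⟨ cong (eps t ℤ.*_) (trans (sym tt) (eps-+ t t′)) ⟩
      eps t ℤ.* (eps t ℤ.* eps t′) ≡⟨ ℤₚ.*-assoc (eps t) (eps t) (eps t′) ⟨
      eps t ℤ.* eps t ℤ.* eps t′ ≡⟨ cong (ℤ._* eps t′) (eps² t) ⟩
      + 1 ℤ.* eps t′ ≡⟨ ℤₚ.*-identityˡ (eps t′) ⟩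
      eps t′ ∎
      where open ≡-Reasoning

  pm2-injective : ∀ t i t′ i′ → i ℕ.< f → i′ ℕ.< f → pm2 t i Z.≋ pm2 t′ i′ [ + N ] → (eps t ≡ eps t′) ×
      (i ≡ i′)
  pm2-injective t i t′ i′ i<f i′<f h with ℕₚ.≤-total i i′
  ... | inj₁ l = pm2-injective-≤ t i t′ i′ l i′<f h
  ... | inj₂ l = let (a , b) = pm2-injective-≤ t′ i′ t i l i<f (Z.≋-sym h) in sym a , sym b

  eps-Fin2 : (t t′ : Fin 2) → eps (toℕ t) ≡ eps (toℕ t′) → t ≡ t′
  eps-Fin2 Fin.zero Fin.zero e = refl
  eps-Fin2 Fin.zero (Fin.suc Fin.zero) ()
  eps-Fin2 (Fin.suc Fin.zero) Fin.zero ()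
  eps-Fin2 (Fin.suc Fin.zero) (Fin.suc Fin.zero) e = refl

  -- The 4f residues ±2^i and ±2^i a cannot be distinct, as there are only φ(N) < 4f units.
  module Generated (a : ℤ) (ca : Comax (+ N) a) where

    Idx : Set
    Idx = Fin 2 × Fin 2 × Fin f

    decode : Fin (2 ℕ.* (2 ℕ.* f)) → Idx
    decode k = let (τ , r) = Fin.remQuot {2} (2 ℕ.* f) k in τ , Fin.remQuot {2} f r

    encode : Idx → Fin (2 ℕ.* (2 ℕ.* f))
    encode (τ , t , i) = Fin.combine τ (Fin.combine t i)

    encode-decode : ∀ k → encode (decode k) ≡ k
    encode-decode k = trans (cong (Fin.combine (proj₁ (Fin.remQuot {2} (2 ℕ.* f) k)))
          (Finₚ.combine-remQuot {2} f (proj₂ (Fin.remQuot {2} (2 ℕ.* f) k))))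
        (Finₚ.combine-remQuot {2} (2 ℕ.* f) k)

    elt : Idx → ℤ
    elt (τ , t , i) = a Z.^ toℕ τ ℤ.* pm2 (toℕ t) (toℕ i)

    comax-elt : ∀ k → Comax (+ N) (elt k)
    comax-elt (τ , t , i) = comax-*ʳ (comax-^ʳ (toℕ τ) ca)
        (comax-*ʳ (comax-^ʳ (toℕ t) (comax-negʳ comax-1ʳ)) (comax-N-2 (toℕ i)))

    residues : List ℕ
    residues = List.filter (λ k → gcd k N ℕ.≟ 1) (upTo N)

    res∈ : ∀ k → (elt k ℤ.%ℕ N) ∈ residues
    res∈ k = ∈-filter⁺ (λ j → gcd j N ℕ.≟ 1) (∈-upTo⁺ (n%ℕd<d (elt k) N))
        (comax⇒coprime (comax-≋ (≋-%ℕ (elt k) N) (comax-elt k)))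

    slot : Fin (2 ℕ.* (2 ℕ.* f)) → Fin (totient N)
    slot k = Any.index (res∈ (decode k))

    -- With f = ⌊φ(N)/2⌋ ≥ 1 one has φ(N) < 2f + 2 ≤ 4f.
    totient< : totient N ℕ.< 2 ℕ.* (2 ℕ.* f)
    totient< = begin-strict
      totient N                          ≡⟨ m≡m%n+[m/n]*n (totient N) 2 ⟩
      totient N ℕ.% 2 ℕ.+ f ℕ.* 2        <⟨ ℕₚ.+-monoˡ-< (f ℕ.* 2) (m%n<n (totient N) 2) ⟩
      2 ℕ.+ f ℕ.* 2                      ≡⟨ cong (2 ℕ.+_) (ℕₚ.*-comm f 2) ⟩
      2 ℕ.+ 2 ℕ.* f                      ≤⟨ ℕₚ.+-monoˡ-≤ (2 ℕ.* f) (ℕₚ.*-monoʳ-≤ 2 f>0) ⟩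
      2 ℕ.* f ℕ.+ 2 ℕ.* f                ≡⟨ cong (2 ℕ.* f ℕ.+_) (ℕₚ.+-identityʳ (2 ℕ.* f)) ⟨
      2 ℕ.* (2 ℕ.* f)                    ∎
      where open ℕₚ.≤-Reasoning

    Result : Set
    Result = Σ ℕ λ t → Σ ℕ λ i → pm2 t i Z.≋ a [ + N ]

    collide : ∀ t i t′ i′ → i ℕ.< f → a ℤ.* pm2 t i Z.≋ pm2 t′ i′ [ + N ] → Result
    collide t i t′ i′ i<f h = t′ ℕ.+ t , i′ ℕ.+ (f ℕ.∸ i) , Z.≋-sym
      (Z.≋-trans (Z.≈⇒≋ (sym (ℤₚ.*-identityʳ a)))
      (Z.≋-trans (Z.≋-* (Z.≋-refl {a}) (Z.≋-sym (pm2-inverse t i (ℕₚ.<⇒≤ i<f))))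
      (Z.≋-trans (Z.≈⇒≋ (sym (ℤₚ.*-assoc a (pm2 t i) (pm2 t (f ℕ.∸ i)))))
      (Z.≋-trans (Z.≋-* h (Z.≋-refl {pm2 t (f ℕ.∸ i)})) (Z.≈⇒≋ (pm2-* t′ i′ t (f ℕ.∸ i)))))))

    -- A collision inside one of the two families contradicts `pm2-injective`; a collision across
    -- them expresses a as a quotient of two elements ± 2^i.
    analyse : ∀ k k′ → k ≢ k′ → elt k Z.≋ elt k′ [ + N ] → Result
    analyse (Fin.zero , t , i) (Fin.zero , t′ , i′) ne h =
      ⊥-elim (ne (cong₂ (λ x y → Fin.zero , x , y) (eps-Fin2 t t′ (proj₁ r)) (Finₚ.toℕ-injective (proj₂ r))))
      where r = pm2-injective (toℕ t) (toℕ i) (toℕ t′) (toℕ i′) (Finₚ.toℕ<n i) (Finₚ.toℕ<n i′)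
                  (Z.≋-trans (Z.≈⇒≋ (sym (ℤₚ.*-identityˡ _))) (Z.≋-trans h (Z.≈⇒≋ (ℤₚ.*-identityˡ _))))
    analyse (Fin.suc Fin.zero , t , i) (Fin.suc Fin.zero , t′ , i′) ne h =
      ⊥-elim (ne (cong₂ (λ x y → Fin.suc Fin.zero , x , y) (eps-Fin2 t t′ (proj₁ r))
            (Finₚ.toℕ-injective (proj₂ r))))
      where r = pm2-injective (toℕ t) (toℕ i) (toℕ t′) (toℕ i′) (Finₚ.toℕ<n i) (Finₚ.toℕ<n i′)
                  (≋-cancelˡ (a Z.^ 1) (comax-^ʳ 1 ca) h)
    analyse (Fin.suc Fin.zero , t , i) (Fin.zero , t′ , i′) ne h =
      collide (toℕ t) (toℕ i) (toℕ t′) (toℕ i′) (Finₚ.toℕ<n i)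
        (Z.≋-trans (Z.≈⇒≋ (cong (ℤ._* pm2 (toℕ t) (toℕ i)) (sym (ℤₚ.*-identityʳ a))))
            (Z.≋-trans h (Z.≈⇒≋ (ℤₚ.*-identityˡ _))))
    analyse (Fin.zero , t , i) (Fin.suc Fin.zero , t′ , i′) ne h =
      collide (toℕ t′) (toℕ i′) (toℕ t) (toℕ i) (Finₚ.toℕ<n i′)
        (Z.≋-trans (Z.≈⇒≋ (cong (ℤ._* pm2 (toℕ t′) (toℕ i′)) (sym (ℤₚ.*-identityʳ a))))
            (Z.≋-trans (Z.≋-sym h) (Z.≈⇒≋ (ℤₚ.*-identityˡ _))))

    same : ∀ k k′ → slot k ≡ slot k′ → elt (decode k) ℤ.%ℕ N ≡ elt (decode k′) ℤ.%ℕ N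
    same k k′ eq = trans (lookup-index (res∈ (decode k)))
        (trans (cong (List.lookup residues) eq) (sym (lookup-index (res∈ (decode k′)))))

    from-collision : ∀ k k′ → k Fin.< k′ → slot k ≡ slot k′ → Result
    from-collision k k′ k<k′ eq = analyse (decode k) (decode k′)
      (λ e → Finₚ.<⇒≢ k<k′ (trans (sym (encode-decode k)) (trans (cong encode e) (encode-decode k′))))
      (%ℕ-≡⇒≋ (elt (decode k)) (elt (decode k′)) N (same k k′ eq))

    generated : Result
    generated = let (k , k′ , k<k′ , eq) = Finₚ.pigeonhole totient< slot in from-collision k k′ k<k′ eq

  comax-n₁n₂ : Comax (+ n₁) (+ n₂)
  comax-n₁n₂ = subst (λ z → Comax (+ n₁) z) (sym (pos-^ p₂ (suc e₂)))
      (subst (λ z → Comax z ((+ p₂) Z.^ suc e₂)) (sym (pos-^ p₁ (suc e₁)))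
    (comax-^ (suc e₁) (suc e₂) (prime-comaxℕ pr₁ p₂ p₁∤p₂)))
    where
    p₁∤p₂ : ¬ p₁ ℕ∣.∣ p₂
    p₁∤p₂ d with prime⇒irreducible pr₂ d
    ... | inj₁ e = ℕₚ.<⇒≢ (prime>1 pr₁) (sym e)
    ... | inj₂ e = proj₁ leg (ℕ∣.∣-reflexive (sym e))

  -- By the Chinese remainder theorem a single residue a modulo N has the prescribed residues x and
  -- y; it is prime to N and hence some ± 2^i.
  units : ∀ x y → ¬ + p₁ Z.∣ x → ¬ + p₂ Z.∣ y →
          Σ ℕ λ t → Σ ℕ λ i → (pm2 t i Z.≋ x [ + n₁ ]) × (pm2 t i Z.≋ y [ + n₂ ])
  units x y ¬x ¬y = t , i , Z.≋-trans (Z.≋-weaken n₁∣N a≋) a≋x , Z.≋-trans (Z.≋-weaken n₂∣N a≋) a≋y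
    where
    open Comax comax-n₁n₂ renaming (bézout to e)
    a : ℤ
    a = x ℤ.* (+ n₂ ℤ.* v) ℤ.+ y ℤ.* (+ n₁ ℤ.* u)
    k₃ : ∀ x y nu nv → x ℤ.* nv ℤ.+ y ℤ.* nu ℤ.- x ℤ.* (nu ℤ.+ nv) ≡ nu ℤ.* (y ℤ.- x)
    k₃ = solve-∀
    k₄ : ∀ x y nu nv → x ℤ.* nv ℤ.+ y ℤ.* nu ℤ.- y ℤ.* (nu ℤ.+ nv) ≡ nv ℤ.* (x ℤ.- y)
    k₄ = solve-∀
    a≋x : a Z.≋ x [ + n₁ ]
    a≋x = Z.congr (Z.∣-resp (trans (sym (k₃ x y (+ n₁ ℤ.* u) (+ n₂ ℤ.* v)))
            (cong (λ z → a ℤ.- z) (trans (cong (x ℤ.*_) e) (ℤₚ.*-identityʳ x))))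
          (Z.∣-*ʳ (y ℤ.- x) (Z.∣-*ʳ u Z.∣-refl)))
    a≋y : a Z.≋ y [ + n₂ ]
    a≋y = Z.congr (Z.∣-resp (trans (sym (k₄ x y (+ n₁ ℤ.* u) (+ n₂ ℤ.* v)))
            (cong (λ z → a ℤ.- z) (trans (cong (y ℤ.*_) e) (ℤₚ.*-identityʳ y))))
          (Z.∣-*ʳ (x ℤ.- y) (Z.∣-*ʳ v Z.∣-refl)))
    cn : Comax (+ N) a
    cn = comax-N (comax-≋ (Z.≋-sym a≋x) (comax-prime (suc e₁) pr₁ ¬x))
        (comax-≋ (Z.≋-sym a≋y) (comax-prime (suc e₂) pr₂ ¬y))
    g : Generated.Result a cn
    g = Generated.generated a cn
    t i : ℕ
    t = proj₁ g
    i = proj₁ (proj₂ g)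
    a≋ : pm2 t i Z.≋ a [ + N ]
    a≋ = proj₂ (proj₂ g)

  solution-mod-p₂ : + p₁ ℤ.* (A ℤ.* A) Z.≋ (+ 2) Z.^ (m ℕ.+ 2) [ + p₂ ]
  solution-mod-p₂ = Z.congr (Z.∣-resp (trans (h (+ p₁ ℤ.* (A ℤ.* A)) (+ p₂ ℤ.* (B ℤ.* B)))
          (cong (λ z → + p₁ ℤ.* (A ℤ.* A) ℤ.- z) (trans sol (pos-^ 2 (m ℕ.+ 2)))))
        (Z.∣-neg (Z.∣-*ʳ (B ℤ.* B) Z.∣-refl)))
    where h : ∀ x y → ℤ.- y ≡ x ℤ.- (x ℤ.+ y)
          h = solve-∀

  solution-mod-p₁ : + p₂ ℤ.* (B ℤ.* B) Z.≋ (+ 2) Z.^ (m ℕ.+ 2) [ + p₁ ]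
  solution-mod-p₁ = Z.congr (Z.∣-resp (trans (h (+ p₁ ℤ.* (A ℤ.* A)) (+ p₂ ℤ.* (B ℤ.* B)))
          (cong (λ z → + p₂ ℤ.* (B ℤ.* B) ℤ.- z) (trans sol (pos-^ 2 (m ℕ.+ 2)))))
        (Z.∣-neg (Z.∣-*ʳ (A ℤ.* A) Z.∣-refl)))
    where h : ∀ x y → ℤ.- x ≡ y ℤ.- (x ℤ.+ y)
          h = solve-∀

  ∤pow2 : ∀ {p} → Prime p → 2 ℕ.< p → ∀ i → ¬ + p Z.∣ (+ 2) Z.^ i
  ∤pow2 pr 2<p i = comax⇒∤ pr (comax-^ʳ i (prime-comax pr (+ 2) (∤2 2<p)))

  p₂∤A : ¬ + p₂ Z.∣ A
  p₂∤A d = ∤pow2 pr₂ 2<p₂ (m ℕ.+ 2) (Z.≋-∣ solution-mod-p₂ (Z.∣-*ˡ (+ p₁) (Z.∣-*ʳ A d)))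

  p₁∤B : ¬ + p₁ Z.∣ B
  p₁∤B d = ∤pow2 pr₁ 2<p₁ (m ℕ.+ 2) (Z.≋-∣ solution-mod-p₁ (Z.∣-*ˡ (+ p₂) (Z.∣-*ʳ B d)))

  inverse-mod : ∀ {p} → Prime p → ∀ x → ¬ + p Z.∣ x → Σ ℤ λ y → x ℤ.* y Z.≋ + 1 [ + p ]
  inverse-mod {p} pr x ¬d with prime-comax pr x ¬d
  ... | comax u v e = v , Z.congr (Z.∣-resp (trans (h (+ p ℤ.* u) (x ℤ.* v)) (cong (λ z → x ℤ.* v ℤ.- z) e))
        (Z.∣-neg (Z.∣-*ʳ u Z.∣-refl)))
    where h : ∀ a b → ℤ.- a ≡ b ℤ.- (a ℤ.+ b)
          h = solve-∀

  -- For even m the right side 2^(m+2) is a square r², and p₁ ≡ (r/A)² modulo p₂ contradicts the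
  -- Legendre symbol.
  m-odd : eps m ≡ ℤ.- + 1
  m-odd with eps-± m
  ... | inj₂ e = e
  ... | inj₁ e = ⊥-elim (proj₂ leg (x , ∣⇒abs∣ (Z.∣-diff x²≋p₁)))
    where
    half : ∀ n → eps n ≡ + 1 → Σ ℕ λ k → n ≡ k ℕ.+ k
    half-odd : ∀ n → eps n ≡ ℤ.- + 1 → Σ ℕ λ k → n ≡ suc (k ℕ.+ k)
    half zero e = 0 , refl
    half (suc n) e with half-odd n (trans (sym (k (eps n))) (cong (ℤ._*_ (ℤ.- + 1)) e))
      where k : ∀ x → (ℤ.- + 1) ℤ.* ((ℤ.- + 1) ℤ.* x) ≡ x
            k = solve-∀
    ... | k , refl = suc k , cong suc (sym (ℕₚ.+-suc k k))
    half-odd zero ()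
    half-odd (suc n) e with half n (trans (sym (k (eps n))) (cong (ℤ._*_ (ℤ.- + 1)) e))
      where k : ∀ x → (ℤ.- + 1) ℤ.* ((ℤ.- + 1) ℤ.* x) ≡ x
            k = solve-∀
    ... | k , refl = k , refl
    j = proj₁ (half m e)
    y = proj₁ (inverse-mod pr₂ A p₂∤A)
    Ay≋1 = proj₂ (inverse-mod pr₂ A p₂∤A)
    r = (+ 2) Z.^ suc j
    x = r ℤ.* y
    pow : (+ 2) Z.^ (m ℕ.+ 2) ≡ r ℤ.* r
    pow = trans (cong ((+ 2) Z.^_) (trans (cong (ℕ._+ 2) (proj₂ (half m e)))
            (trans (ℕₚ.+-comm (j ℕ.+ j) 2) (cong suc (sym (ℕₚ.+-suc j j))))))
        (Z.^-homo-* (+ 2) (suc j) (suc j))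
    k₅ : ∀ r y → r ℤ.* y ℤ.* (r ℤ.* y) ≡ r ℤ.* r ℤ.* (y ℤ.* y)
    k₅ = solve-∀
    k₆ : ∀ p a y → p ℤ.* (a ℤ.* a) ℤ.* (y ℤ.* y) ≡ p ℤ.* (a ℤ.* y ℤ.* (a ℤ.* y))
    k₆ = solve-∀
    x²≋p₁ : x ℤ.* x Z.≋ + p₁ [ + p₂ ]
    x²≋p₁ = Z.≋-trans (Z.≈⇒≋ (trans (k₅ r y) (cong (ℤ._* (y ℤ.* y)) (sym pow))))
      (Z.≋-trans (Z.≋-* (Z.≋-sym solution-mod-p₂) (Z.≋-refl {y ℤ.* y}))
      (Z.≋-trans (Z.≈⇒≋ (k₆ (+ p₁) A y))
      (Z.≋-trans (Z.≋-* (Z.≋-refl {+ p₁}) (Z.≋-* Ay≋1 Ay≋1)) (Z.≈⇒≋ (ℤₚ.*-identityʳ (+ p₁))))))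

  square-abs : ∀ x → x ℤ.* x ≡ + ℤ.∣ x ∣ ℤ.* + ℤ.∣ x ∣
  square-abs (+ n) = refl
  square-abs -[1+ n ] = refl

  square-^ : ∀ {p} h → Prime p → p ≡ suc (2 ℕ.* h) → ∀ x → ¬ + p Z.∣ x → (x ℤ.* x) Z.^ h Z.≋ + 1 [ + p ]
  square-^ {p} h pr refl x ¬d = Z.≋-trans (Z.≈⇒≋ eq) (fermat-1 pr ℤ.∣ x ∣ (¬d ∘ abs∣⇒∣ x ∘ ∣⇒abs∣))
    where
    a = + ℤ.∣ x ∣
    eq : (x ℤ.* x) Z.^ h ≡ a Z.^ (2 ℕ.* h)
    eq = trans (cong (Z._^ h) (trans (square-abs x) (cong (a ℤ.*_) (sym (ℤₚ.*-identityʳ a)))))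
        (Z.^-assocʳ a 2 h)

  pow2-^ : ∀ {p} h → (+ 2) Z.^ h Z.≋ ℤ.- + 1 [ + p ] → ∀ i → ((+ 2) Z.^ i) Z.^ h Z.≋ eps i [ + p ]
  pow2-^ h e i = Z.≋-trans (Z.≈⇒≋ (trans (Z.^-assocʳ (+ 2) i h)
          (trans (cong ((+ 2) Z.^_) (ℕₚ.*-comm i h)) (sym (Z.^-assocʳ (+ 2) h i))))) (-1≋⇒^ e i)

  eps-m+2 : ∀ k → eps k ≡ ℤ.- + 1 → eps (k ℕ.+ 2) ≡ ℤ.- + 1
  eps-m+2 k e = trans (eps-+ k 2) (trans (ℤₚ.*-identityʳ (eps k)) e)

  -- Raised to the power h = (p - 1)/2, the square y² becomes 1 and 2^(m+2) becomes (-1)^(m+2) = -1.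
  -- The solution (A, B) thus makes each of p₁, p₂ a nonresidue modulo the other.
  other-prime : ∀ {p} h x y → Prime p → p ≡ suc (2 ℕ.* h) → (+ 2) Z.^ h Z.≋ ℤ.- + 1 [ + p ] → ¬ + p Z.∣ y →
                x ℤ.* (y ℤ.* y) Z.≋ (+ 2) Z.^ (m ℕ.+ 2) [ + p ] → x Z.^ h Z.≋ ℤ.- + 1 [ + p ]
  other-prime h x y pr p≡ 2^h ¬y e =
    Z.≋-trans (Z.≈⇒≋ (sym (ℤₚ.*-identityʳ (x Z.^ h))))
    (Z.≋-trans (Z.≋-* (Z.≋-refl {x Z.^ h}) (Z.≋-sym (square-^ h pr p≡ y ¬y)))
    (Z.≋-trans (Z.≈⇒≋ (sym (Z.^-distrib-* x (y ℤ.* y) h)))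
    (Z.≋-trans (Z.≋-^ h e) (Z.≋-trans (pow2-^ h 2^h (m ℕ.+ 2)) (Z.≈⇒≋ (eps-m+2 m m-odd))))))

  selfconj : ∀ {p} h e x → Prime p → p ≡ suc (2 ℕ.* h) → x Z.^ h Z.≋ ℤ.- + 1 [ + p ] → Σ ℕ λ s →
      x Z.^ s Z.≋ ℤ.- + 1 [ + (p ℕ.^ suc e) ]
  selfconj {p} h e x pr p≡ xh = h ℕ.* s , Z.≋-trans (Z.≈⇒≋ (sym (Z.^-assocʳ x h s)))
      (subst (λ z → (x Z.^ h) Z.^ s Z.≋ ℤ.- + 1 [ z ]) (sym (pos-^ p (suc e))) l)
    where
    g = neg-one-lift pr {h} p≡ e (x Z.^ h) xh
    s = proj₁ g
    l = proj₂ g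

  -- Modulo p₂ the square A² would be 2^(k+2), an odd power of a nonresidue.
  no-principal : ∀ k A B → eps k ≡ ℤ.- + 1 → A ℤ.* A ℤ.+ + p₁ ℤ.* + p₂ ℤ.* (B ℤ.* B) ≢ + (2 ℕ.^ (k ℕ.+ 2))
  no-principal k a b odd e = ℕ∣.>⇒∤ 2<p₂ (∣⇒abs∣ (Z.∣-diff 1≋-1))
    where
    h : ∀ x y p q → ℤ.- (q ℤ.* (p ℤ.* y)) ≡ x ℤ.- (x ℤ.+ p ℤ.* q ℤ.* y)
    h = solve-∀
    a²≋ : a ℤ.* a Z.≋ (+ 2) Z.^ (k ℕ.+ 2) [ + p₂ ]
    a²≋ = Z.congr (Z.∣-resp (trans (h (a ℤ.* a) (b ℤ.* b) (+ p₁) (+ p₂))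
            (cong (λ z → a ℤ.* a ℤ.- z) (trans e (pos-^ 2 (k ℕ.+ 2)))))
          (Z.∣-neg (Z.∣-*ʳ (+ p₁ ℤ.* (b ℤ.* b)) Z.∣-refl)))
    p₂∤a : ¬ + p₂ Z.∣ a
    p₂∤a d = ∤pow2 pr₂ 2<p₂ (k ℕ.+ 2) (Z.≋-∣ a²≋ (Z.∣-*ʳ a d))
    1≋-1 : + 1 Z.≋ ℤ.- + 1 [ + p₂ ]
    1≋-1 = Z.≋-trans (Z.≋-sym (square-^ h₂ pr₂ p₂≡ a p₂∤a))
        (Z.≋-trans (Z.≋-^ h₂ a²≋) (Z.≋-trans (pow2-^ h₂ 2^h₂ (k ℕ.+ 2)) (Z.≈⇒≋ (eps-m+2 k odd))))

  setting : Setting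
  setting = record
    { p₁ = p₁ ; p₂ = p₂ ; e₁ = e₁ ; e₂ = e₂ ; pr₁ = pr₁ ; pr₂ = pr₂
    ; half₁ = h₁ ; half₂ = h₂ ; odd₁ = p₁≡ ; odd₂ = p₂≡
    ; p₁≢p₂ = λ e → proj₁ leg (ℕ∣.∣-reflexive (sym e))
    ; units = units ; parity₁ = parity₁ ; parity₂ = parity₂
    ; flip₁ = 1 , h₂ , refl , eps-even (suc (2 ℕ.* k₂)) , flip h₂ 2^h₂
    ; flip₂ = 1 , h₁ , refl , trans (cong (λ z → eps (suc z)) (ℕₚ.*-assoc 2 2 k₁))
        (eps-odd (2 ℕ.* k₁)) , flip h₁ 2^h₁
    ; f = f ; f>0 = f>0 ; 2^f₁ = Z.≋-weaken n₁∣N 2^f ; 2^f₂ = Z.≋-weaken n₂∣N 2^f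
    ; selfconj₁ = selfconj h₂ e₂ (+ p₁) pr₂ p₂≡ (other-prime h₂ (+ p₁) A pr₂ p₂≡ 2^h₂ p₂∤A solution-mod-p₂)
    ; selfconj₂ = selfconj h₁ e₁ (+ p₂) pr₁ p₁≡ (other-prime h₁ (+ p₂) B pr₁ p₁≡ 2^h₁ p₁∤B solution-mod-p₁)
    ; no-principal = no-principal
    }

-- Indicator functions and sums over ℤ/n.

ind : ℕ → ℤ → ℤ
ind n x with ∣?ℤ n x
... | yes _ = + 1
... | no  _ = + 0

ind-yes : ∀ {n x} → + n Z.∣ x → ind n x ≡ + 1
ind-yes {n} {x} h with ∣?ℤ n x
... | yes _ = refl
... | no ¬h = ⊥-elim (¬h h)

ind-no : ∀ {n x} → ¬ + n Z.∣ x → ind n x ≡ + 0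
ind-no {n} {x} ¬h with ∣?ℤ n x
... | yes h = ⊥-elim (¬h h)
... | no _ = refl

ind-iff : ∀ {n n′ x y} → (+ n Z.∣ x → + n′ Z.∣ y) → (+ n′ Z.∣ y → + n Z.∣ x) → ind n x ≡ ind n′ y
ind-iff {n} {n′} {x} {y} to from with ∣?ℤ n x
... | yes h = sym (ind-yes (to h))
... | no ¬h = sym (ind-no (¬h ∘ from))

Periodic : ℕ → (ℤ → ℤ) → Set
Periodic n F = ∀ {x y} → x Z.≋ y [ + n ] → F x ≡ F y

ind-per : ∀ n → Periodic n (ind n)
ind-per n h = ind-iff (Z.≋-∣ h) (Z.≋-∣ (Z.≋-sym h))

ind-unit : ∀ n a {x} → Comax (+ n) a → ind n (a ℤ.* x) ≡ ind n x
ind-unit n a c = ind-iff (comax-cancel a c) (Z.∣-*ˡ a)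

ind-neg : ∀ n x → ind n (ℤ.- x) ≡ ind n x
ind-neg n x = ind-iff (λ h → Z.∣-resp (ℤₚ.neg-involutive x) (Z.∣-neg h)) Z.∣-neg

residue-unique : ∀ {n k r} → k ℕ.< n → r ℕ.< n → + k Z.≋ + r [ + n ] → k ≡ r
residue-unique {n} {k} {r} k<n r<n (Z.congr h) with ℕₚ.≤-total k r
... | inj₁ k≤r = ℕₚ.≤-antisym k≤r (ℕₚ.m∸n≡0⇒m≤n (small (r ℕ.∸ k) (ℕₚ.≤-<-trans (ℕₚ.m∸n≤m r k) r<n)
        (∣⇒abs∣ (Z.∣-resp (trans (neg-sub (+ k) (+ r)) (trans (ℤₚ.m-n≡m⊖n r k) (ℤₚ.⊖-≥ k≤r))) (Z.∣-neg h)))))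
  where
  neg-sub : ∀ a b → ℤ.- (a ℤ.- b) ≡ b ℤ.- a
  neg-sub = solve-∀
  small : ∀ d → d ℕ.< n → n ℕ∣.∣ d → d ≡ 0
  small zero _ _ = refl
  small (suc d) l h = ⊥-elim (ℕ∣.>⇒∤ l h)
... | inj₂ r≤k = ℕₚ.≤-antisym (ℕₚ.m∸n≡0⇒m≤n (small (k ℕ.∸ r) (ℕₚ.≤-<-trans (ℕₚ.m∸n≤m k r) k<n)
        (∣⇒abs∣ (Z.∣-resp (trans (ℤₚ.m-n≡m⊖n k r) (ℤₚ.⊖-≥ r≤k)) h)))) r≤k
  where
  small : ∀ d → d ℕ.< n → n ℕ∣.∣ d → d ≡ 0
  small zero _ _ = refl
  small (suc d) l h = ⊥-elim (ℕ∣.>⇒∤ l h)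

∑-ind : ∀ n .{{_ : ℕ.NonZero n}} a F → Periodic n F → Z.∑< n (λ k → ind n (a ℤ.+ + k) ℤ.* F (+ k)) ≡ F (ℤ.- a)
∑-ind n a F per = trans (Z.∑<-single n _ r r<n off)
    (trans (cong (ℤ._* F (+ r)) (ind-yes on)) (trans (ℤₚ.*-identityˡ (F (+ r))) (per (Z.≋-sym -a≋r))))
  where
  r = (ℤ.- a) ℤ.%ℕ n
  r<n = n%ℕd<d (ℤ.- a) n
  -a≋r : ℤ.- a Z.≋ + r [ + n ]
  -a≋r = ≋-%ℕ (ℤ.- a) n
  h : ∀ a x → a ℤ.+ x ≡ ℤ.- (ℤ.- a ℤ.- x)
  h = solve-∀
  on : + n Z.∣ a ℤ.+ + r
  on = Z.∣-resp (sym (h a (+ r))) (Z.∣-neg (Z.∣-diff -a≋r))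
  off : ∀ k → k ℕ.< n → k ≢ r → ind n (a ℤ.+ + k) ℤ.* F (+ k) ≡ + 0
  off k k<n k≢r = cong (ℤ._* F (+ k)) (ind-no (λ d → k≢r (residue-unique k<n r<n
    (Z.≋-trans (Z.≋-sym (Z.congr (Z.∣-resp (neg (h a (+ k))) (Z.∣-neg d)))) -a≋r))))
    where
    neg : ∀ {x y} → x ≡ ℤ.- y → ℤ.- x ≡ y
    neg refl = ℤₚ.neg-involutive _

-- Each G(sj + x) is expanded in indicator functions; after exchanging the sums it remains that
-- every residue k is hit by exactly one j, namely v (k - x).
∑-affine : ∀ n .{{_ : ℕ.NonZero n}} s x G → Comax (+ n) s → Periodic n G → Z.∑< n (λ j → G (s ℤ.* + j ℤ.+ x))
    ≡ Z.∑< n (λ j → G (+ j))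
∑-affine n s x G c@(comax u v e) per = begin
  Z.∑< n (λ j → G (s ℤ.* + j ℤ.+ x))
    ≡⟨ Z.∑<-congᵃ n (λ j → sym (trans (∑-ind n (ℤ.- (s ℤ.* + j ℤ.+ x)) G per) (cong G (ℤₚ.neg-involutive _))))
      ⟩
  Z.∑< n (λ j → Z.∑< n (λ k → ind n (ℤ.- (s ℤ.* + j ℤ.+ x) ℤ.+ + k) ℤ.* G (+ k)))
    ≡⟨ Z.∑<-swap n n _ ⟩
  Z.∑< n (λ k → Z.∑< n (λ j → ind n (ℤ.- (s ℤ.* + j ℤ.+ x) ℤ.+ + k) ℤ.* G (+ k)))
    ≡⟨ Z.∑<-congᵃ n (λ k → trans (sym (Z.∑<-*ʳ (G (+ k)) n _))
        (trans (cong (ℤ._* G (+ k)) (one k)) (ℤₚ.*-identityˡ (G (+ k))))) ⟩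
  Z.∑< n (λ k → G (+ k)) ∎
  where
  open ≡-Reasoning
  one : ∀ k → Z.∑< n (λ j → ind n (ℤ.- (s ℤ.* + j ℤ.+ x) ℤ.+ + k)) ≡ + 1
  one k = trans (Z.∑<-congᵃ n (λ j → trans (trans (trans (sym (ind-neg n _))
            (ind-per n (Z.congr (Z.divides (ℤ.- (u ℤ.* (+ k ℤ.- x))) (eq j)))))
                                         (ind-unit n s c)) (sym (ℤₚ.*-identityʳ _))))
                (∑-ind n ((ℤ.- v) ℤ.* (+ k ℤ.- x)) (λ _ → + 1) (λ _ → refl))
    where
    l : ∀ s j x k v nu → ℤ.- (ℤ.- (s ℤ.* j ℤ.+ x) ℤ.+ k) ℤ.- s ℤ.* ((ℤ.- v) ℤ.* (k ℤ.- x) ℤ.+ j) ≡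
        ((nu ℤ.+ s ℤ.* v) ℤ.- + 1) ℤ.* (k ℤ.- x) ℤ.- nu ℤ.* (k ℤ.- x)
    l = solve-∀
    l′ : ∀ n u y → (+ 1 ℤ.- + 1) ℤ.* y ℤ.- n ℤ.* u ℤ.* y ≡ n ℤ.* (ℤ.- (u ℤ.* y))
    l′ = solve-∀
    eq : ∀ j → ℤ.- (ℤ.- (s ℤ.* + j ℤ.+ x) ℤ.+ + k) ℤ.- s ℤ.* ((ℤ.- v) ℤ.* (+ k ℤ.- x) ℤ.+ + j) ≡ + n ℤ.*
        (ℤ.- (u ℤ.* (+ k ℤ.- x)))
    eq j = trans (l s (+ j) x (+ k) v (+ n ℤ.* u))
        (trans (cong (λ z → (z ℤ.- + 1) ℤ.* (+ k ℤ.- x) ℤ.- + n ℤ.* u ℤ.* (+ k ℤ.- x)) e)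
          (l′ (+ n) u (+ k ℤ.- x)))

∑-shift : ∀ n .{{_ : ℕ.NonZero n}} x G → Periodic n G → Z.∑< n (λ j → G (x ℤ.+ + j)) ≡ Z.∑< n (λ j → G (+ j))
∑-shift n x G per = trans (Z.∑<-congᵃ n (λ j → cong G (h x (+ j)))) (∑-affine n (+ 1) x G comax-1ʳ per)
  where h : ∀ x j → x ℤ.+ j ≡ + 1 ℤ.* j ℤ.+ x
        h = solve-∀

≋-shift : ∀ {n x y} c → x Z.≋ y [ n ] → c ℤ.+ x Z.≋ c ℤ.+ y [ n ]
≋-shift c h = Z.≋-+ (Z.≋-refl {c}) h

-- Ramanujan sums to a prime power modulus.

module Weight (p e : ℕ) (pr : Prime p) where
  n n′ : ℕ
  n′ = p ℕ.^ e
  n = p ℕ.^ suc e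

  instance
    p≢0 : ℕ.NonZero p
    p≢0 = prime⇒nonZero pr
    n′≢0 : ℕ.NonZero n′
    n′≢0 = ℕₚ.m^n≢0 p e
    n≢0 : ℕ.NonZero n
    n≢0 = ℕₚ.m^n≢0 p (suc e)

  n≡ : + n ≡ + p ℤ.* + n′
  n≡ = ℤₚ.pos-* p n′

  n′∣n : + n′ Z.∣ + n
  n′∣n = Z.divides (+ p) (trans n≡ (ℤₚ.*-comm (+ p) (+ n′)))

  p∣n : + p Z.∣ + n
  p∣n = Z.divides (+ n′) n≡

  -- Runs through the subgroup of order p in ℤ/n.
  step : ℕ → ℤ
  step j = + j ℤ.* + n′

  ∑-ind-coset : ∀ x → Z.∑< p (λ j → ind n (x ℤ.+ step j)) ≡ ind n′ x
  ∑-ind-coset x = case (∣?ℤ n′ x)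
    where
    case : Dec (+ n′ Z.∣ x) → Z.∑< p (λ j → ind n (x ℤ.+ step j)) ≡ ind n′ x
    case (no ¬d) = trans (Z.∑<-0 p (λ j _ → ind-no
            (λ d → ¬d (Z.∣-resp (l x (step j)) (Z.∣-sub (Z.∣-trans n′∣n d) (Z.∣-*ˡ (+ j) Z.∣-refl))))))
        (sym (ind-no ¬d))
      where l : ∀ x y → x ℤ.+ y ℤ.- y ≡ x
            l = solve-∀
    case (yes (Z.divides t e)) = trans (Z.∑<-congᵃ p
          (λ j → trans (ind-iff (to j) (from j)) (sym (ℤₚ.*-identityʳ _))))
        (trans (∑-ind p t (λ _ → + 1) (λ _ → refl)) (sym (ind-yes (Z.divides t e))))
      where
      eq : ∀ j → x ℤ.+ step j ≡ + n′ ℤ.* (t ℤ.+ + j)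
      eq j = trans (cong (ℤ._+ step j) e) (l (+ n′) t (+ j))
        where l : ∀ n t j → n ℤ.* t ℤ.+ j ℤ.* n ≡ n ℤ.* (t ℤ.+ j)
              l = solve-∀
      to : ∀ j → + n Z.∣ x ℤ.+ step j → + p Z.∣ t ℤ.+ + j
      to j (Z.divides q f) = Z.divides q (ℤₚ.*-cancelˡ-≡ (+ n′) _ _
            (trans (sym (eq j)) (trans f (trans (cong (ℤ._* q) n≡) (l (+ p) (+ n′) q)))))
        where l : ∀ p n q → p ℤ.* n ℤ.* q ≡ n ℤ.* (p ℤ.* q)
              l = solve-∀
      from : ∀ j → + p Z.∣ t ℤ.+ + j → + n Z.∣ x ℤ.+ step j
      from j (Z.divides q f) = Z.divides q (trans (eq j)
            (trans (cong (+ n′ ℤ.*_) f) (trans (l (+ p) (+ n′) q) (cong (ℤ._* q) (sym n≡)))))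
        where l : ∀ p n q → n ℤ.* (p ℤ.* q) ≡ p ℤ.* n ℤ.* q
              l = solve-∀

  -- w x is the trace of the x-th power of a primitive n-th root of unity, divided by n′
  w : ℤ → ℤ
  w x = + p ℤ.* ind n x ℤ.- ind n′ x

  w-per : Periodic n w
  w-per h = cong₂ (λ a b → + p ℤ.* a ℤ.- b) (ind-per n h) (ind-per n′ (Z.≋-weaken n′∣n h))

  w-neg : ∀ x → w (ℤ.- x) ≡ w x
  w-neg x = cong₂ (λ a b → + p ℤ.* a ℤ.- b) (ind-neg n x) (ind-neg n′ x)

  comax-pow : ∀ a k → Comax (+ p) a → Comax (+ (p ℕ.^ k)) a
  comax-pow a k c = subst (λ z → Comax z a) (sym (pos-^ p k)) (comax-sym (comax-^ʳ k (comax-sym c)))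

  w-unit : ∀ a x → Comax (+ p) a → w (a ℤ.* x) ≡ w x
  w-unit a x c = cong₂ (λ a b → + p ℤ.* a ℤ.- b) (ind-unit n a (comax-pow a (suc e) c))
      (ind-unit n′ a (comax-pow a e c))

  ind′-step : ∀ x j → ind n′ (x ℤ.+ step j) ≡ ind n′ x
  ind′-step x j = ind-per n′ (Z.congr (Z.∣-resp (l x (step j)) (Z.∣-*ˡ (+ j) Z.∣-refl)))
    where l : ∀ x y → y ≡ x ℤ.+ y ℤ.- x
          l = solve-∀

  -- The trace form of the vanishing of the sum of all p-th roots of unity.
  w-coset : ∀ x → Z.∑< p (λ j → w (x ℤ.+ step j)) ≡ + 0
  w-coset x = begin
    Z.∑< p (λ j → + p ℤ.* ind n (x ℤ.+ step j) ℤ.- ind n′ (x ℤ.+ step j)) ≡⟨ Z.∑<-sub p _ _ ⟩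
    Z.∑< p (λ j → + p ℤ.* ind n (x ℤ.+ step j)) ℤ.- Z.∑< p (λ j → ind n′ (x ℤ.+ step j))
      ≡⟨ cong₂ ℤ._-_ (trans (sym (Z.∑<-*ˡ (+ p) p _)) (cong (+ p ℤ.*_) (∑-ind-coset x)))
                     (trans (Z.∑<-congᵃ p (ind′-step x)) (Z.∑<-const p _)) ⟩
    + p ℤ.* ind n′ x ℤ.- + p ℤ.* ind n′ x ≡⟨ ℤₚ.+-inverseʳ (+ p ℤ.* ind n′ x) ⟩
    + 0 ∎
    where open ≡-Reasoning

  w-coset⁻ : ∀ x → Z.∑< p (λ j → w (x ℤ.- step j)) ≡ + 0
  w-coset⁻ x = trans (Z.∑<-congᵃ p (λ j → trans (sym (w-neg (x ℤ.- step j))) (cong w (l x (step j)))))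
      (w-coset (ℤ.- x))
    where l : ∀ x y → ℤ.- (x ℤ.- y) ≡ ℤ.- x ℤ.+ y
          l = solve-∀

  ∑-shifted : ∀ F a b → Periodic n F → Z.∑< n (λ k → F (a ℤ.+ + k) ℤ.* ind n (b ℤ.+ + k)) ≡ F (a ℤ.- b)
  ∑-shifted F a b per = trans (Z.∑<-congᵃ n (λ k → ℤₚ.*-comm (F (a ℤ.+ + k)) _))
      (∑-ind n b (λ x → F (a ℤ.+ x)) (per ∘ ≋-shift a))

  -- The second weight is expanded in indicators of the multiples of n; its `ind n′` part becomes a
  -- sum of w over a coset, which vanishes, and only the term with the factor p survives.
  w-conv : ∀ a b → Z.∑< n (λ k → w (a ℤ.+ + k) ℤ.* w (b ℤ.+ + k)) ≡ + p ℤ.* w (a ℤ.- b)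
  w-conv a b = begin
    Z.∑< n (λ k → w (a ℤ.+ + k) ℤ.* w (b ℤ.+ + k))
      ≡⟨ Z.∑<-congᵃ n (λ k → trans (l (w (a ℤ.+ + k)) (+ p) (ind n (b ℤ.+ + k)) (ind n′ (b ℤ.+ + k)))
           (cong (λ z → + p ℤ.* (w (a ℤ.+ + k) ℤ.* ind n (b ℤ.+ + k)) ℤ.- z) (expand k))) ⟩
    Z.∑< n (λ k → + p ℤ.* (w (a ℤ.+ + k) ℤ.* ind n (b ℤ.+ + k)) ℤ.- Z.∑< p
        (λ j → w (a ℤ.+ + k) ℤ.* ind n (b ℤ.+ step j ℤ.+ + k)))
      ≡⟨ Z.∑<-sub n _ _ ⟩
    Z.∑< n (λ k → + p ℤ.* (w (a ℤ.+ + k) ℤ.* ind n (b ℤ.+ + k))) ℤ.- Z.∑< n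
      (λ k → Z.∑< p (λ j → w (a ℤ.+ + k) ℤ.* ind n (b ℤ.+ step j ℤ.+ + k)))
      ≡⟨ cong₂ ℤ._-_ (trans (sym (Z.∑<-*ˡ (+ p) n _)) (cong (+ p ℤ.*_) (∑-shifted w a b w-per)))
           (trans (Z.∑<-swap n p _) (Z.∑<-congᵃ p (λ j → trans (∑-shifted w a (b ℤ.+ step j) w-per)
                   (cong w (l′ a b (step j)))))) ⟩
    + p ℤ.* w (a ℤ.- b) ℤ.- Z.∑< p (λ j → w (a ℤ.- b ℤ.- step j))
      ≡⟨ cong (λ z → + p ℤ.* w (a ℤ.- b) ℤ.- z) (w-coset⁻ (a ℤ.- b)) ⟩
    + p ℤ.* w (a ℤ.- b) ℤ.- + 0 ≡⟨ ℤₚ.+-identityʳ _ ⟩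
    + p ℤ.* w (a ℤ.- b) ∎
    where
    open ≡-Reasoning
    l : ∀ x p i i′ → x ℤ.* (p ℤ.* i ℤ.- i′) ≡ p ℤ.* (x ℤ.* i) ℤ.- x ℤ.* i′
    l = solve-∀
    l′ : ∀ a b s → a ℤ.- (b ℤ.+ s) ≡ a ℤ.- b ℤ.- s
    l′ = solve-∀
    l″ : ∀ b s k → b ℤ.+ k ℤ.+ s ≡ b ℤ.+ s ℤ.+ k
    l″ = solve-∀
    expand : ∀ k → w (a ℤ.+ + k) ℤ.* ind n′ (b ℤ.+ + k) ≡ Z.∑< p
        (λ j → w (a ℤ.+ + k) ℤ.* ind n (b ℤ.+ step j ℤ.+ + k))
    expand k = trans (cong (w (a ℤ.+ + k) ℤ.*_) (trans (sym (∑-ind-coset (b ℤ.+ + k)))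
            (Z.∑<-congᵃ p (λ j → cong (ind n) (l″ b (step j) (+ k))))))
        (Z.∑<-*ˡ (w (a ℤ.+ + k)) p (λ j → ind n (b ℤ.+ step j ℤ.+ + k)))

  -- One of the p differences whose sum over j is w; a mixed difference of coefficients arises from
  -- a product of two of them, one for each prime.
  diff : ℕ → ℤ → ℤ
  diff j x = ind n x ℤ.- ind n (x ℤ.+ step j)

  diff-per : ∀ j → Periodic n (diff j)
  diff-per j h = cong₂ ℤ._-_ (ind-per n h) (ind-per n (Z.≋-+ h (Z.≋-refl {step j})))

  ∑-diff : ∀ x → Z.∑< p (λ j → diff j x) ≡ w x
  ∑-diff x = trans (Z.∑<-sub p _ _) (cong₂ ℤ._-_ (Z.∑<-const p (ind n x)) (∑-ind-coset x))

  -- Expanding the second factor leaves two terms, each of which sums over j to w (a - b); this is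
  -- the origin of the 4 = 2·2 in `energy`.
  diff-conv : ∀ a b → Z.∑< p (λ j → Z.∑< n (λ k → diff j (a ℤ.+ + k) ℤ.* diff j (b ℤ.+ + k))) ≡ + 2 ℤ.* w
      (a ℤ.- b)
  diff-conv a b = begin
    Z.∑< p (λ j → Z.∑< n (λ k → diff j (a ℤ.+ + k) ℤ.* diff j (b ℤ.+ + k))) ≡⟨ Z.∑<-congᵃ p one ⟩
    Z.∑< p (λ j → diff j c ℤ.- diff j (c ℤ.- step j)) ≡⟨ Z.∑<-sub p _ _ ⟩
    Z.∑< p (λ j → diff j c) ℤ.- Z.∑< p (λ j → diff j (c ℤ.- step j)) ≡⟨ cong₂ ℤ._-_ (∑-diff c) second ⟩
    w c ℤ.- (ind n′ c ℤ.- + p ℤ.* ind n c) ≡⟨ l₀ (+ p) (ind n c) (ind n′ c) ⟩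
    + 2 ℤ.* w c ∎
    where
    open ≡-Reasoning
    c = a ℤ.- b
    l₀ : ∀ p x y → p ℤ.* x ℤ.- y ℤ.- (y ℤ.- p ℤ.* x) ≡ + 2 ℤ.* (p ℤ.* x ℤ.- y)
    l₀ = solve-∀
    l₁ : ∀ d x y → d ℤ.* (x ℤ.- y) ≡ d ℤ.* x ℤ.- d ℤ.* y
    l₁ = solve-∀
    l₂ : ∀ b s k → b ℤ.+ k ℤ.+ s ≡ b ℤ.+ s ℤ.+ k
    l₂ = solve-∀
    l₃ : ∀ a b s → a ℤ.- (b ℤ.+ s) ≡ a ℤ.- b ℤ.- s
    l₃ = solve-∀
    one : ∀ j → Z.∑< n (λ k → diff j (a ℤ.+ + k) ℤ.* diff j (b ℤ.+ + k)) ≡ diff j c ℤ.- diff j (c ℤ.- step j)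
    one j = trans (Z.∑<-congᵃ n (λ k → trans (l₁ (diff j (a ℤ.+ + k)) (ind n (b ℤ.+ + k)) _)
            (cong (λ z → diff j (a ℤ.+ + k) ℤ.* ind n (b ℤ.+ + k) ℤ.- diff j (a ℤ.+ + k) ℤ.* ind n z)
              (l₂ b (step j) (+ k)))))
      (trans (Z.∑<-sub n _ _) (cong₂ ℤ._-_ (∑-shifted (diff j) a b (diff-per j))
            (trans (∑-shifted (diff j) a (b ℤ.+ step j) (diff-per j)) (cong (diff j) (l₃ a b (step j))))))
    l₄ : ∀ x y → x ℤ.- y ℤ.+ y ≡ x
    l₄ = solve-∀
    l₅ : ∀ x y → ℤ.- (x ℤ.- y) ≡ ℤ.- x ℤ.+ y
    l₅ = solve-∀
    second : Z.∑< p (λ j → diff j (c ℤ.- step j)) ≡ ind n′ c ℤ.- + p ℤ.* ind n c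
    second = trans (Z.∑<-sub p _ _) (cong₂ ℤ._-_
      (trans (Z.∑<-congᵃ p (λ j → trans (sym (ind-neg n _)) (cong (ind n) (l₅ c (step j)))))
          (trans (∑-ind-coset (ℤ.- c)) (ind-neg n′ c)))
      (trans (Z.∑<-congᵃ p (λ j → cong (ind n) (l₄ c (step j)))) (Z.∑<-const p (ind n c))))

  n∤step : ∀ {x} → ¬ + p Z.∣ x → ¬ + n Z.∣ x ℤ.* + n′
  n∤step {x} ¬d (Z.divides q f) = ¬d (Z.divides q (ℤₚ.*-cancelʳ-≡ x _ (+ n′)
          (trans f (trans (cong (ℤ._* q) n≡) (l (+ p) (+ n′) q)))))
    where l : ∀ p n q → p ℤ.* n ℤ.* q ≡ p ℤ.* q ℤ.* n
          l = solve-∀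

  w-step : ∀ {x} → ¬ + p Z.∣ x → w (x ℤ.* + n′) ≡ ℤ.- + 1
  w-step {x} ¬d = trans (cong₂ (λ a b → + p ℤ.* a ℤ.- b) (ind-no (n∤step ¬d)) (ind-yes (Z.∣-*ˡ x Z.∣-refl)))
      (cong (ℤ._- + 1) (ℤₚ.*-zeroʳ (+ p)))

  w-0 : w (+ 0) ≡ + p ℤ.- + 1
  w-0 = trans (cong₂ (λ a b → + p ℤ.* a ℤ.- b) (ind-yes {n} Z.∣0) (ind-yes {n′} Z.∣0))
      (cong (ℤ._- + 1) (ℤₚ.*-identityʳ (+ p)))

-- Interface of the ring ℤ[ζ_N].

-- The ring ℤ[ζ_N]: hat X k l is the trace of ζ₁^k ζ₂^l X divided by p₁^e₁ p₂^e₂ = N / p₁ p₂, coef X k l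
-- is the coefficient of ζ₁^(-k) ζ₂^(-l) in a representative of X in the group ring of ℤ/n₁ × ℤ/n₂,
-- and ψ s raises the roots of unity to the power s.
record CyclotomicRing (S : Setting) : Set₁ where
  open Setting S
  module W₁ = Weight p₁ e₁ pr₁
  module W₂ = Weight p₂ e₂ pr₂
  field
    algebra : ℤAlgebra
  open RingTools algebra
  field
    hat  : Carrier → ℤ → ℤ → ℤ
    coef : Carrier → ℤ → ℤ → ℤ
    ζ    : ℤ → ℤ → Carrier
    ψ    : ℤ → Carrier → Carrier

    hat-cong : ∀ {X Y} → X ≈ Y → ∀ k l → hat X k l ≡ hat Y k l
    hat-ext  : ∀ {X Y} → (∀ k l → hat X k l ≡ hat Y k l) → X ≈ Y
    hat-+    : ∀ X Y k l → hat (X + Y) k l ≡ hat X k l ℤ.+ hat Y k l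
    hat-ι    : ∀ c X k l → hat (ι c * X) k l ≡ c ℤ.* hat X k l
    hat-ζ    : ∀ a b X k l → hat (ζ a b * X) k l ≡ hat X (k ℤ.+ a) (l ℤ.+ b)
    hat-1    : ∀ k l → hat 1# k l ≡ W₁.w k ℤ.* W₂.w l
    hat-per₁ : ∀ X l → Periodic n₁ (λ k → hat X k l)
    hat-per₂ : ∀ X k → Periodic n₂ (hat X k)
    hat-coset₁ : ∀ X k l → Z.∑< p₁ (λ j → hat X (k ℤ.+ W₁.step j) l) ≡ + 0
    hat-coset₂ : ∀ X k l → Z.∑< p₂ (λ j → hat X k (l ℤ.+ W₂.step j)) ≡ + 0

    -- ψ s acts on representatives and is defined for every s, also for s = p₁ and s = p₂, as
    -- `frobenius` requires; for s prime to p₁ p₂ its compatibility with ≈ is derived from `hat-ψ`.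
    ψ-+    : ∀ s X Y → ψ s (X + Y) ≈ ψ s X + ψ s Y
    ψ-neg  : ∀ s X → ψ s (- X) ≈ - ψ s X
    ψ-one  : ∀ s → ψ s 1# ≈ 1#
    ψ-*    : ∀ s X Y → ψ s (X * Y) ≈ ψ s X * ψ s Y
    ψ-ι    : ∀ s c → ψ s (ι c) ≈ ι c
    ψ-ζ    : ∀ s a b → ψ s (ζ a b) ≈ ζ (s ℤ.* a) (s ℤ.* b)
    ψ-ψ    : ∀ s t X → ψ s (ψ t X) ≈ ψ (s ℤ.* t) X
    ψ-mod  : ∀ {s t} X → s Z.≋ t [ + n₁ ] → s Z.≋ t [ + n₂ ] → ψ s X ≈ ψ t X
    -- If s ≡ t modulo n₂, the two power maps agree on ζ₂, and every power of ζ₁ is 1 modulo 1 - ζ₁.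
    ψ-mod₁ : ∀ {s t} X → s Z.≋ t [ + n₂ ] → ψ s X ≋ ψ t X [ 1# - ζ (+ 1) (+ 0) ]
    ψ-mod₂ : ∀ {s t} X → s Z.≋ t [ + n₁ ] → ψ s X ≋ ψ t X [ 1# - ζ (+ 0) (+ 1) ]
    hat-ψ  : ∀ s X k l → Comax (+ p₁) s → Comax (+ p₂) s → hat (ψ s X) (s ℤ.* k) (s ℤ.* l) ≡ hat X k l
    frobenius : ∀ {p} → Prime p → ∀ X → X ^ p ≋ ψ (+ p) X [ ι (+ p) ]

    parseval : ∀ X Y → Z.∑< n₁ (λ k → Z.∑< n₂ (λ l → hat X (+ k) (+ l) ℤ.* hat Y (+ k) (+ l)))
                       ≡ + p₁ ℤ.* + p₂ ℤ.* hat (X * ψ (ℤ.- + 1) Y) (+ 0) (+ 0)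

  -- The mixed second difference of the coefficients along the subgroups of orders p₁ and p₂. It
  -- depends only on X, whereas the coefficients depend on the representative.
  mixed : Carrier → ℕ → ℕ → ℤ → ℤ → ℤ
  mixed X i j k l = coef X k l ℤ.- coef X (k ℤ.+ W₁.step i) l
                    ℤ.- (coef X k (l ℤ.+ W₂.step j) ℤ.- coef X (k ℤ.+ W₁.step i) (l ℤ.+ W₂.step j))

  field
    coef-per₁ : ∀ X l → Periodic n₁ (λ k → coef X k l)
    coef-per₂ : ∀ X k → Periodic n₂ (coef X k)
    hat-mixed : ∀ X k l → hat X k l ≡ Z.∑< p₁ (λ i → Z.∑< p₂ (λ j → mixed X i j k l))
    -- The trace of X conj X as a sum of squares of integers, which limits how many mixed
    -- differences can be nonzero.
    energy    : ∀ X → Z.∑< p₁ (λ i → Z.∑< n₁ (λ k → Z.∑< p₂ (λ j → Z.∑< n₂ (λ l →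
                  mixed X i j (+ k) (+ l) ℤ.* mixed X i j (+ k) (+ l)))))
                  ≡ + 4 ℤ.* hat (X * ψ (ℤ.- + 1) X) (+ 0) (+ 0)

-- Construction of ℤ[ζ_N] from formal sums.

module FormalSums (S : Setting) where
  open Setting S
  module W₁ = Weight p₁ e₁ pr₁
  module W₂ = Weight p₂ e₂ pr₂

  -- c , a , b stands for c ζ₁^a ζ₂^b, where ζ₁ and ζ₂ are primitive n₁-th and n₂-th roots of unity
  Term R : Set
  Term = ℤ × ℤ × ℤ
  R = List Term

  term : (ℤ → ℤ → ℤ) → Term → ℤ
  term v (c , a , b) = c ℤ.* v a b

  -- The linear functional on formal sums that extends v. Identities valid for all v hold already
  -- before any relation between roots of unity is imposed; passing to ℤ[ζ_N] means restricting v to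
  -- the translates of the weights.
  ev : (ℤ → ℤ → ℤ) → R → ℤ
  ev v X = Z.∑ X (term v)

  ev-cong : ∀ {v v′} X → (∀ a b → v a b ≡ v′ a b) → ev v X ≡ ev v′ X
  ev-cong X h = Z.∑-cong X (λ (c , a , b) → cong (c ℤ.*_) (h a b))

  shift : ℤ → ℤ → (ℤ → ℤ → ℤ) → ℤ → ℤ → ℤ
  shift a b v a′ b′ = v (a ℤ.+ a′) (b ℤ.+ b′)

  mulᵗ : Term → Term → Term
  mulᵗ (c , a , b) (c′ , a′ , b′) = c ℤ.* c′ , a ℤ.+ a′ , b ℤ.+ b′

  negᵗ : Term → Term
  negᵗ (c , a , b) = ℤ.- c , a , b

  ψᵗ : ℤ → Term → Term
  ψᵗ s (c , a , b) = c , s ℤ.* a , s ℤ.* b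

  infixl 7 _⊗_
  _⊗_ : R → R → R
  X ⊗ Y = concatMap (λ m → map (mulᵗ m) Y) X

  ⊖_ : R → R
  ⊖ X = map negᵗ X

  const : ℤ → R
  const c = (c , + 0 , + 0) ∷ []

  ev-⊖ : ∀ v X → ev v (⊖ X) ≡ ℤ.- ev v X
  ev-⊖ v X = trans (Z.∑-map negᵗ X (term v)) (trans
        (Z.∑-cong X (λ (c , a , b) → sym (ℤₚ.neg-distribˡ-* c (v a b)))) (sym (Z.∑-neg X (term v))))

  ev-map-mul : ∀ v c a b Y → ev v (map (mulᵗ (c , a , b)) Y) ≡ c ℤ.* ev (shift a b v) Y
  ev-map-mul v c a b Y = trans (Z.∑-map (mulᵗ (c , a , b)) Y (term v))
      (trans (Z.∑-cong Y (λ (c′ , a′ , b′) → ℤₚ.*-assoc c c′ _)) (sym (Z.∑-*ˡ c Y (term (shift a b v)))))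

  ev-⊗ : ∀ v X Y → ev v (X ⊗ Y) ≡ ev (λ a b → ev (shift a b v) Y) X
  ev-⊗ v X Y = trans (Z.∑-concatMap (λ m → map (mulᵗ m) Y) X (term v))
      (Z.∑-cong X (λ (c , a , b) → ev-map-mul v c a b Y))

  ev-⊗-comm : ∀ v X Y → ev v (X ⊗ Y) ≡ ev v (Y ⊗ X)
  ev-⊗-comm v X Y = begin
    ev v (X ⊗ Y) ≡⟨ ev-⊗ v X Y ⟩
    Z.∑ X (λ (c , a , b) → c ℤ.* Z.∑ Y (λ (c′ , a′ , b′) → c′ ℤ.* v (a ℤ.+ a′) (b ℤ.+ b′)))
      ≡⟨ Z.∑-cong X (λ (c , a , b) → Z.∑-*ˡ c Y _) ⟩
    Z.∑ X (λ (c , a , b) → Z.∑ Y (λ (c′ , a′ , b′) → c ℤ.* (c′ ℤ.* v (a ℤ.+ a′) (b ℤ.+ b′))))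
      ≡⟨ Z.∑-swap X Y _ ⟩
    Z.∑ Y (λ (c′ , a′ , b′) → Z.∑ X (λ (c , a , b) → c ℤ.* (c′ ℤ.* v (a ℤ.+ a′) (b ℤ.+ b′))))
      ≡⟨ Z.∑-cong Y (λ (c′ , a′ , b′) → Z.∑-cong X (λ (c , a , b) →
           trans (l c c′ _) (cong₂ (λ x y → c′ ℤ.* (c ℤ.* v x y)) (ℤₚ.+-comm a a′) (ℤₚ.+-comm b b′)))) ⟩
    Z.∑ Y (λ (c′ , a′ , b′) → Z.∑ X (λ (c , a , b) → c′ ℤ.* (c ℤ.* v (a′ ℤ.+ a) (b′ ℤ.+ b))))
      ≡⟨ Z.∑-cong Y (λ (c , a , b) → Z.∑-*ˡ c X _) ⟨
    Z.∑ Y (λ (c′ , a′ , b′) → c′ ℤ.* Z.∑ X (λ (c , a , b) → c ℤ.* v (a′ ℤ.+ a) (b′ ℤ.+ b)))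
      ≡⟨ ev-⊗ v Y X ⟨
    ev v (Y ⊗ X) ∎
    where
    open ≡-Reasoning
    l : ∀ a b c → a ℤ.* (b ℤ.* c) ≡ b ℤ.* (a ℤ.* c)
    l = solve-∀

  ev-⊗-assoc : ∀ v X Y Y′ → ev v ((X ⊗ Y) ⊗ Y′) ≡ ev v (X ⊗ (Y ⊗ Y′))
  ev-⊗-assoc v X Y Y′ = begin
    ev v ((X ⊗ Y) ⊗ Y′) ≡⟨ ev-⊗ v (X ⊗ Y) Y′ ⟩
    ev (λ a b → ev (shift a b v) Y′) (X ⊗ Y) ≡⟨ ev-⊗ _ X Y ⟩
    ev (λ a b → ev (λ a′ b′ → ev (shift (a ℤ.+ a′) (b ℤ.+ b′) v) Y′) Y) X
      ≡⟨ ev-cong X (λ a b → trans (ev-cong Y (λ a′ b′ → ev-cong Y′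
              (λ a″ b″ → cong₂ v (ℤₚ.+-assoc a a′ a″) (ℤₚ.+-assoc b b′ b″)))) (sym (ev-⊗ (shift a b v) Y Y′)))
        ⟩
    ev (λ a b → ev (shift a b v) (Y ⊗ Y′)) X ≡⟨ ev-⊗ v X (Y ⊗ Y′) ⟨
    ev v (X ⊗ (Y ⊗ Y′)) ∎
    where open ≡-Reasoning

  ev-const-⊗ : ∀ v c X → ev v (const c ⊗ X) ≡ c ℤ.* ev v X
  ev-const-⊗ v c X = trans (ev-⊗ v (const c) X) (trans (ℤₚ.+-identityʳ _)
        (cong (c ℤ.*_) (ev-cong X (λ a b → cong₂ v (ℤₚ.+-identityˡ a) (ℤₚ.+-identityˡ b)))))

  ev-⊗-distribʳ : ∀ v X Y Y′ → ev v ((Y ++ Y′) ⊗ X) ≡ ev v (Y ⊗ X ++ Y′ ⊗ X)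
  ev-⊗-distribʳ v X Y Y′ = trans (ev-⊗ v (Y ++ Y′) X)
      (trans (Z.∑-++ Y Y′ _) (trans (sym (cong₂ ℤ._+_ (ev-⊗ v Y X) (ev-⊗ v Y′ X)))
          (sym (Z.∑-++ (Y ⊗ X) (Y′ ⊗ X) (term v)))))

  ww : ℤ → ℤ → ℤ → ℤ → ℤ
  ww k l a b = W₁.w (a ℤ.+ k) ℤ.* W₂.w (b ℤ.+ l)

  -- The trace form of ℚ(ζ_N) is nondegenerate, so equality in ℤ[ζ_N] is equality of all hat X k l.
  hat : R → ℤ → ℤ → ℤ
  hat X k l = ev (ww k l) X

  infix 4 _≈_
  record _≈_ (X Y : R) : Set where
    constructor eq
    field at : ∀ k l → hat X k l ≡ hat Y k l
  open _≈_

  ext : ∀ {X Y} → (∀ v → ev v X ≡ ev v Y) → X ≈ Y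
  ext h = eq (λ k l → h (ww k l))

  hat-⊗ : ∀ X Y k l → hat (X ⊗ Y) k l ≡ ev (λ a b → hat Y (k ℤ.+ a) (l ℤ.+ b)) X
  hat-⊗ X Y k l = trans (ev-⊗ (ww k l) X Y) (ev-cong X
        (λ a b → ev-cong Y (λ a′ b′ → cong₂ (λ x y → W₁.w x ℤ.* W₂.w y) (h a a′ k) (h b b′ l))))
    where h : ∀ a a′ k → a ℤ.+ a′ ℤ.+ k ≡ a′ ℤ.+ (k ℤ.+ a)
          h = solve-∀

  -- A trace of X ⊗ Y is a combination of traces of Y, so equality in the right factor is preserved;
  -- the left factor follows by commutativity.
  ⊗-congˡ : ∀ X {Y Y′} → Y ≈ Y′ → X ⊗ Y ≈ X ⊗ Y′
  ⊗-congˡ X {Y} {Y′} h = eq (λ k l → trans (hat-⊗ X Y k l)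
        (trans (ev-cong X (λ a b → at h (k ℤ.+ a) (l ℤ.+ b))) (sym (hat-⊗ X Y′ k l))))

  ≈-trans′ : ∀ {X Y Y′} → X ≈ Y → Y ≈ Y′ → X ≈ Y′
  ≈-trans′ h h′ = eq (λ k l → trans (at h k l) (at h′ k l))

  ⊗-comm : ∀ X Y → X ⊗ Y ≈ Y ⊗ X
  ⊗-comm X Y = ext (λ v → ev-⊗-comm v X Y)

  ⊗-cong : ∀ {X X′ Y Y′} → X ≈ X′ → Y ≈ Y′ → X ⊗ Y ≈ X′ ⊗ Y′
  ⊗-cong {X} {X′} {Y} {Y′} h h′ = ≈-trans′ (⊗-congˡ X h′)
      (≈-trans′ (⊗-comm X Y′) (≈-trans′ (⊗-congˡ Y′ h) (⊗-comm Y′ X′)))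

  ⊗-identityˡ : ∀ X → const (+ 1) ⊗ X ≈ X
  ⊗-identityˡ X = ext (λ v → trans (ev-const-⊗ v (+ 1) X) (ℤₚ.*-identityˡ _))

  ⊗-distribʳ : ∀ X Y Y′ → (Y ++ Y′) ⊗ X ≈ Y ⊗ X ++ Y′ ⊗ X
  ⊗-distribʳ X Y Y′ = ext (λ v → ev-⊗-distribʳ v X Y Y′)

  ++-cong : ∀ {X X′ Y Y′} → X ≈ X′ → Y ≈ Y′ → X ++ Y ≈ X′ ++ Y′
  ++-cong {X} {X′} {Y} {Y′} h h′ = eq (λ k l → trans (Z.∑-++ X Y _)
        (trans (cong₂ ℤ._+_ (at h k l) (at h′ k l)) (sym (Z.∑-++ X′ Y′ _))))

  ++-comm : ∀ X Y → X ++ Y ≈ Y ++ X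
  ++-comm X Y = ext (λ v → trans (Z.∑-++ X Y (term v))
        (trans (ℤₚ.+-comm (ev v X) (ev v Y)) (sym (Z.∑-++ Y X (term v)))))

  ⊖-inverseʳ : ∀ X → X ++ ⊖ X ≈ []
  ⊖-inverseʳ X = ext (λ v → trans (Z.∑-++ X (⊖ X) (term v))
        (trans (cong (ℤ._+_ (ev v X)) (ev-⊖ v X)) (ℤₚ.+-inverseʳ (ev v X))))

  ring : CommutativeRing 0ℓ 0ℓ
  ring = record
    { Carrier = R ; _≈_ = _≈_ ; _+_ = _++_ ; _*_ = _⊗_ ; -_ = ⊖_ ; 0# = [] ; 1# = const (+ 1)
    ; isCommutativeRing = record
      { isRing = record
        { +-isAbelianGroup = record
          { isGroup = record
            { isMonoid = record
              { isSemigroup = record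
                { isMagma = record
                  { isEquivalence = record
                    { refl = eq (λ k l → refl)
                    ; sym = λ h → eq (λ k l → sym (at h k l))
                    ; trans = ≈-trans′ }
                  ; ∙-cong = ++-cong }
                ; assoc = λ X Y Y′ → ext (λ v → cong (ev v) (Lₚ.++-assoc X Y Y′)) }
              ; identity = (λ X → eq (λ k l → refl)) , (λ X → ext (λ v → cong (ev v) (Lₚ.++-identityʳ X))) }
            ; inverse = (λ X → ≈-trans′ (++-comm (⊖ X) X) (⊖-inverseʳ X)) , ⊖-inverseʳ
            ; ⁻¹-cong = λ {X} {Y} h → eq (λ k l → trans (ev-⊖ _ X)
                  (trans (cong ℤ.-_ (at h k l)) (sym (ev-⊖ _ Y)))) }
          ; comm = ++-comm }
        ; *-cong = ⊗-cong
        ; *-assoc = λ X Y Y′ → ext (λ v → ev-⊗-assoc v X Y Y′)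
        ; *-identity = ⊗-identityˡ , (λ X → ≈-trans′ (⊗-comm X _) (⊗-identityˡ X))
        ; distrib = (λ X Y Y′ → ≈-trans′ (⊗-comm X (Y ++ Y′))
              (≈-trans′ (⊗-distribʳ X Y Y′) (++-cong (⊗-comm Y X) (⊗-comm Y′ X)))) , ⊗-distribʳ }
      ; *-comm = ⊗-comm } }

  algebra : ℤAlgebra
  algebra = record
    { commRing = ring
    ; ι = const
    ; ι-+ = λ a b → ext (λ v → l a b (v (+ 0) (+ 0)))
    ; ι-* = λ a b → ext (λ v → trans (l′ a b (v (+ 0) (+ 0))) (sym (ev-const-⊗ v a (const b))))
    ; ι-1 = eq (λ k l → refl) }
    where
    l : ∀ a b x → (a ℤ.+ b) ℤ.* x ℤ.+ + 0 ≡ a ℤ.* x ℤ.+ (b ℤ.* x ℤ.+ + 0)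
    l = solve-∀
    l′ : ∀ a b x → a ℤ.* b ℤ.* x ℤ.+ + 0 ≡ a ℤ.* (b ℤ.* x ℤ.+ + 0)
    l′ = solve-∀

≋-mulʳ : ∀ {n s t} a → s Z.≋ t [ n ] → s ℤ.* a Z.≋ t ℤ.* a [ n ]
≋-mulʳ a h = Z.≋-* h (Z.≋-refl {a})

fermatℤ : ∀ {p} → Prime p → ∀ c → c Z.^ p Z.≋ c [ + p ]
fermatℤ {p} pr c = Z.≋-trans (Z.≋-^ p h) (Z.≋-trans (fermat pr (c ℤ.%ℕ p)) (Z.≋-sym h))
  where
  instance _ = prime⇒nonZero pr
  h = ≋-%ℕ c p

∑<-product : ∀ m n x y → Z.∑< m (λ k → Z.∑< n (λ l → x k ℤ.* y l)) ≡ Z.∑< m x ℤ.* Z.∑< n y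
∑<-product m n x y = trans (Z.∑<-congᵃ m (λ k → sym (Z.∑<-*ˡ (x k) n y))) (sym (Z.∑<-*ʳ (Z.∑< n y) m x))

module FormalSumsRing (S : Setting) where
  open Setting S
  open FormalSums S
  open RingTools algebra hiding (_≈_)
  open RingPowers algebra
  open _≈_

  ζ : ℤ → ℤ → R
  ζ a b = (+ 1 , a , b) ∷ []

  ψ : ℤ → R → R
  ψ s X = map (ψᵗ s) X

  coef : R → ℤ → ℤ → ℤ
  coef X k l = ev (λ a b → ind n₁ (a ℤ.+ k) ℤ.* ind n₂ (b ℤ.+ l)) X

  hat-ζ : ∀ a b X k l → hat (ζ a b * X) k l ≡ hat X (k ℤ.+ a) (l ℤ.+ b)
  hat-ζ a b X k l = trans (hat-⊗ (ζ a b) X k l) (trans (ℤₚ.+-identityʳ _) (ℤₚ.*-identityˡ _))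

  hat-1 : ∀ k l → hat 1# k l ≡ W₁.w k ℤ.* W₂.w l
  hat-1 k l = trans (ℤₚ.+-identityʳ _) (trans (ℤₚ.*-identityˡ _)
        (cong₂ (λ x y → W₁.w x ℤ.* W₂.w y) (ℤₚ.+-identityˡ k) (ℤₚ.+-identityˡ l)))

  hat-per₁ : ∀ X l → Periodic n₁ (λ k → hat X k l)
  hat-per₁ X l h = ev-cong X (λ a b → cong (ℤ._* W₂.w (b ℤ.+ l)) (W₁.w-per (≋-shift a h)))

  hat-per₂ : ∀ X k → Periodic n₂ (hat X k)
  hat-per₂ X k h = ev-cong X (λ a b → cong (W₁.w (a ℤ.+ k) ℤ.*_) (W₂.w-per (≋-shift b h)))

  coef-per₁ : ∀ X l → Periodic n₁ (λ k → coef X k l)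
  coef-per₁ X l h = ev-cong X (λ a b → cong (ℤ._* ind n₂ (b ℤ.+ l)) (ind-per n₁ (≋-shift a h)))

  coef-per₂ : ∀ X k → Periodic n₂ (coef X k)
  coef-per₂ X k h = ev-cong X (λ a b → cong (ind n₁ (a ℤ.+ k) ℤ.*_) (ind-per n₂ (≋-shift b h)))

  ev-∑< : ∀ n (f : ℕ → ℤ → ℤ → ℤ) X → Z.∑< n (λ k → ev (f k) X) ≡ ev (λ a b → Z.∑< n (λ k → f k a b)) X
  ev-∑< n f X = trans (sym (Z.∑-∑<-swap X n (λ m k → term (f k) m)))
      (Z.∑-cong X (λ (c , a , b) → sym (Z.∑<-*ˡ c n (λ k → f k a b))))

  ev-*ʳ : ∀ f X y → ev f X ℤ.* y ≡ ev (λ a b → f a b ℤ.* y) X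
  ev-*ʳ f X y = trans (Z.∑-*ʳ y X (term f)) (Z.∑-cong X (λ (c , a , b) → ℤₚ.*-assoc c (f a b) y))

  ev-*ˡ : ∀ f X y → y ℤ.* ev f X ≡ ev (λ a b → y ℤ.* f a b) X
  ev-*ˡ f X y = trans (ℤₚ.*-comm y (ev f X)) (trans (ev-*ʳ f X y) (ev-cong X (λ a b → ℤₚ.*-comm (f a b) y)))

  ev-sub : ∀ f g X → ev f X ℤ.- ev g X ≡ ev (λ a b → f a b ℤ.- g a b) X
  ev-sub f g X = trans (sym (Z.∑-sub X (term f) (term g))) (Z.∑-cong X (λ (c , a , b) → l c (f a b) (g a b)))
    where l : ∀ c x y → c ℤ.* x ℤ.- c ℤ.* y ≡ c ℤ.* (x ℤ.- y)
          l = solve-∀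

  ev-0 : ∀ f X → (∀ a b → f a b ≡ + 0) → ev f X ≡ + 0
  ev-0 f X h = Z.∑-0 X (λ (c , a , b) → trans (cong (c ℤ.*_) (h a b)) (ℤₚ.*-zeroʳ c))

  ev-ev : ∀ f g X Y → ev f X ℤ.* ev g Y ≡ ev (λ a b → ev (λ a′ b′ → f a b ℤ.* g a′ b′) Y) X
  ev-ev f g X Y = trans (ev-*ʳ f X (ev g Y)) (ev-cong X (λ a b → ev-*ˡ g Y (f a b)))

  ev-ev-∑< : ∀ n (f : ℕ → ℤ → ℤ → ℤ → ℤ → ℤ) X Y → Z.∑< n (λ k → ev (λ a b → ev (f k a b) Y) X) ≡ ev
      (λ a b → ev (λ a′ b′ → Z.∑< n (λ k → f k a b a′ b′)) Y) X
  ev-ev-∑< n f X Y = trans (ev-∑< n (λ k a b → ev (f k a b) Y) X)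
      (ev-cong X (λ a b → ev-∑< n (λ k → f k a b) Y))

  hat-coset₁ : ∀ X k l → Z.∑< p₁ (λ j → hat X (k ℤ.+ W₁.step j) l) ≡ + 0
  hat-coset₁ X k l = trans (ev-∑< p₁ _ X) (ev-0 _ X (λ a b →
    trans (sym (Z.∑<-*ʳ (W₂.w (b ℤ.+ l)) p₁ _)) (cong (ℤ._* W₂.w (b ℤ.+ l))
        (trans (Z.∑<-congᵃ p₁ (λ j → cong W₁.w (sym (ℤₚ.+-assoc a k (W₁.step j))))) (W₁.w-coset (a ℤ.+ k))))))

  hat-coset₂ : ∀ X k l → Z.∑< p₂ (λ j → hat X k (l ℤ.+ W₂.step j)) ≡ + 0
  hat-coset₂ X k l = trans (ev-∑< p₂ _ X) (ev-0 _ X (λ a b →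
    trans (sym (Z.∑<-*ˡ (W₁.w (a ℤ.+ k)) p₂ _)) (trans
        (cong (W₁.w (a ℤ.+ k) ℤ.*_) (trans (Z.∑<-congᵃ p₂
            (λ j → cong W₂.w (sym (ℤₚ.+-assoc b l (W₂.step j))))) (W₂.w-coset (b ℤ.+ l))))
        (ℤₚ.*-zeroʳ (W₁.w (a ℤ.+ k))))))

  ev-ψ : ∀ v s X → ev v (ψ s X) ≡ ev (λ a b → v (s ℤ.* a) (s ℤ.* b)) X
  ev-ψ v s X = Z.∑-map (ψᵗ s) X (term v)

  ψ-+ : ∀ s X Y → ψ s (X + Y) ≈ ψ s X + ψ s Y
  ψ-+ s X Y = ext (λ v → cong (ev v) (Lₚ.map-++ (ψᵗ s) X Y))

  ψ-neg : ∀ s X → ψ s (- X) ≈ - ψ s X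
  ψ-neg s X = ext (λ v → trans (ev-ψ v s (- X)) (trans (ev-⊖ _ X)
          (trans (cong ℤ.-_ (sym (ev-ψ v s X))) (sym (ev-⊖ v (ψ s X))))))

  ψ-* : ∀ s X Y → ψ s (X * Y) ≈ ψ s X * ψ s Y
  ψ-* s X Y = ext (λ v → begin
    ev v (ψ s (X * Y)) ≡⟨ ev-ψ v s (X * Y) ⟩
    ev (λ a b → v (s ℤ.* a) (s ℤ.* b)) (X * Y) ≡⟨ ev-⊗ _ X Y ⟩
    ev (λ a b → ev (λ a′ b′ → v (s ℤ.* (a ℤ.+ a′)) (s ℤ.* (b ℤ.+ b′))) Y) X
      ≡⟨ ev-cong X (λ a b → trans (ev-cong Y (λ a′ b′ → cong₂ v (ℤₚ.*-distribˡ-+ s a a′)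
              (ℤₚ.*-distribˡ-+ s b b′))) (sym (ev-ψ (shift (s ℤ.* a) (s ℤ.* b) v) s Y))) ⟩
    ev (λ a b → ev (shift (s ℤ.* a) (s ℤ.* b) v) (ψ s Y)) X ≡⟨ ev-ψ (λ a b → ev (shift a b v) (ψ s Y)) s X ⟨
    ev (λ a b → ev (shift a b v) (ψ s Y)) (ψ s X) ≡⟨ ev-⊗ v (ψ s X) (ψ s Y) ⟨
    ev v (ψ s X * ψ s Y) ∎)
    where open ≡-Reasoning

  ψ-ι : ∀ s c → ψ s (ι c) ≈ ι c
  ψ-ι s c = ext (λ v → cong (λ z → c ℤ.* v z z ℤ.+ + 0) (ℤₚ.*-zeroʳ s))

  ψ-ψ : ∀ s t X → ψ s (ψ t X) ≈ ψ (s ℤ.* t) X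
  ψ-ψ s t X = ext (λ v → trans (ev-ψ v s (ψ t X)) (trans (ev-ψ _ t X)
          (trans (ev-cong X (λ a b → cong₂ v (sym (ℤₚ.*-assoc s t a)) (sym (ℤₚ.*-assoc s t b))))
            (sym (ev-ψ v (s ℤ.* t) X)))))

  ψ-mod : ∀ {s t} X → s Z.≋ t [ + n₁ ] → s Z.≋ t [ + n₂ ] → ψ s X ≈ ψ t X
  ψ-mod {s} {t} X h₁ h₂ = eq (λ k l → trans (ev-ψ _ s X) (trans (ev-cong X (λ a b →
    cong₂ ℤ._*_ (W₁.w-per (Z.≋-+ (≋-mulʳ a h₁) (Z.≋-refl {k})))
      (W₂.w-per (Z.≋-+ (≋-mulʳ b h₂) (Z.≋-refl {l}))))) (sym (ev-ψ _ t X))))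

  hat-ψ : ∀ s X k l → Comax (+ p₁) s → Comax (+ p₂) s → hat (ψ s X) (s ℤ.* k) (s ℤ.* l) ≡ hat X k l
  hat-ψ s X k l c₁ c₂ = trans (ev-ψ _ s X) (ev-cong X (λ a b →
    cong₂ ℤ._*_ (trans (cong W₁.w (sym (ℤₚ.*-distribˡ-+ s a k))) (W₁.w-unit s (a ℤ.+ k) c₁))
                (trans (cong W₂.w (sym (ℤₚ.*-distribˡ-+ s b l))) (W₂.w-unit s (b ℤ.+ l) c₂))))

  ζ-ζ : ∀ a b a′ b′ → ζ a b * ζ a′ b′ ≈ ζ (a ℤ.+ a′) (b ℤ.+ b′)
  ζ-ζ a b a′ b′ = ext (λ v → refl)

  ζ-^ : ∀ n a b → ζ a b ^ n ≈ ζ (+ n ℤ.* a) (+ n ℤ.* b)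
  ζ-^ zero a b = ≈-refl
  ζ-^ (suc n) a b = ≈-trans (*-cong (≈-refl {ζ a b}) (ζ-^ n a b))
      (≈-trans (ζ-ζ a b (+ n ℤ.* a) (+ n ℤ.* b)) (ext
          (λ v → cong₂ (λ x y → + 1 ℤ.* v x y ℤ.+ + 0) (l (+ n) a) (l (+ n) b))))
    where l : ∀ n a → a ℤ.+ n ℤ.* a ≡ (+ 1 ℤ.+ n) ℤ.* a
          l = solve-∀

  cons≈ : ∀ c a b X → (c , a , b) ∷ X ≈ ι c * ζ a b + X
  cons≈ c a b X = ext (λ v → cong (ℤ._+ ev v X) (cong₂ ℤ._*_ (sym (ℤₚ.*-identityʳ c))
          (cong₂ v (sym (ℤₚ.+-identityˡ a)) (sym (ℤₚ.+-identityˡ b)))))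

  -- A negative exponent is reduced to a positive one by 1 - z⁻¹ = -z⁻¹ (1 - z).
  unipotent : ∀ u v x → 1# - ζ u v ∣ 1# - ζ (x ℤ.* u) (x ℤ.* v)
  unipotent u v (+ n) = ∣-resp (-‿cong₂ (≈-refl {1#}) (ζ-^ n u v)) (1-y∣1-y^ (ζ u v) n)
  unipotent u v x@(-[1+ n ]) = ∣-resp eqn (∣-*ʳ (- ζ (x ℤ.* u) (x ℤ.* v)) (unipotent u v (+ suc n)))
    where
    m = + suc n
    l₀ : ∀ m u → m ℤ.* u ℤ.+ (ℤ.- m) ℤ.* u ≡ + 0
    l₀ = solve-∀
    inv : ζ (m ℤ.* u) (m ℤ.* v) * ζ (x ℤ.* u) (x ℤ.* v) ≈ 1#
    inv = ≈-trans (ζ-ζ (m ℤ.* u) (m ℤ.* v) (x ℤ.* u) (x ℤ.* v))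
        (ext (λ f → cong₂ (λ a b → + 1 ℤ.* f a b ℤ.+ + 0) (l₀ m u) (l₀ m v)))
    l : ∀ z y → (1# - z) * - y ≈ z * y - y
    l = solve 2 (λ z y → (con (+ 1) :- z) :* :- y := z :* y :- y) ≈-refl
    eqn : (1# - ζ (m ℤ.* u) (m ℤ.* v)) * - ζ (x ℤ.* u) (x ℤ.* v) ≈ 1# - ζ (x ℤ.* u) (x ℤ.* v)
    eqn = ≈-trans (l (ζ (m ℤ.* u) (m ℤ.* v)) (ζ (x ℤ.* u) (x ℤ.* v))) (-‿cong₂ inv ≈-refl)

  ζ-split : ∀ a b → ζ a b ≈ ζ a (+ 0) * ζ (+ 0) b
  ζ-split a b = ≈-sym (≈-trans (ζ-ζ a (+ 0) (+ 0) b)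
        (ext (λ v → cong₂ (λ x y → + 1 ℤ.* v x y ℤ.+ + 0) (ℤₚ.+-identityʳ a) (ℤₚ.+-identityˡ b))))

  ζ-per₁ : ∀ {a a′} b → a Z.≋ a′ [ + n₁ ] → ζ a b ≈ ζ a′ b
  ζ-per₁ b h = eq (λ k l → cong (λ z → + 1 ℤ.* (z ℤ.* W₂.w (b ℤ.+ l)) ℤ.+ + 0)
        (W₁.w-per (Z.≋-+ h (Z.≋-refl {k}))))

  ζ-per₂ : ∀ a {b b′} → b Z.≋ b′ [ + n₂ ] → ζ a b ≈ ζ a b′
  ζ-per₂ a h = eq (λ k l → cong (λ z → + 1 ℤ.* (W₁.w (a ℤ.+ k) ℤ.* z) ℤ.+ + 0)
        (W₂.w-per (Z.≋-+ h (Z.≋-refl {l}))))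

  ζ₁≋1 : ∀ a → ζ a (+ 0) ≋ 1# [ 1# - ζ (+ 1) (+ 0) ]
  ζ₁≋1 a = ≋-sym (congr (∣-resp (-‿cong₂ (≈-refl {1#})
            (ext (λ v → cong₂ (λ x y → + 1 ℤ.* v x y ℤ.+ + 0) (ℤₚ.*-identityʳ a) (ℤₚ.*-zeroʳ a))))
          (unipotent (+ 1) (+ 0) a)))

  ζ₂≋1 : ∀ b → ζ (+ 0) b ≋ 1# [ 1# - ζ (+ 0) (+ 1) ]
  ζ₂≋1 b = ≋-sym (congr (∣-resp (-‿cong₂ (≈-refl {1#})
            (ext (λ v → cong₂ (λ x y → + 1 ℤ.* v x y ℤ.+ + 0) (ℤₚ.*-zeroʳ b) (ℤₚ.*-identityʳ b))))
          (unipotent (+ 0) (+ 1) b)))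

  ψ-≋ : ∀ {d} s t → (∀ a b → ζ (s ℤ.* a) (s ℤ.* b) ≋ ζ (t ℤ.* a) (t ℤ.* b) [ d ]) → ∀ X → ψ s X ≋ ψ t X [ d ]
  ψ-≋ s t h [] = ≋-refl
  ψ-≋ s t h ((c , a , b) ∷ X) = ≋-trans (≈⇒≋ (cons≈ c (s ℤ.* a) (s ℤ.* b) (ψ s X)))
      (≋-trans (≋-+ (≋-* (≋-refl {ι c}) (h a b)) (ψ-≋ s t h X))
        (≈⇒≋ (≈-sym (cons≈ c (t ℤ.* a) (t ℤ.* b) (ψ t X)))))

  ψ-mod₁ : ∀ {s t} X → s Z.≋ t [ + n₂ ] → ψ s X ≋ ψ t X [ 1# - ζ (+ 1) (+ 0) ]
  ψ-mod₁ {s} {t} X h = ψ-≋ s t (λ a b → ≋-trans (≈⇒≋ (ζ-split (s ℤ.* a) (s ℤ.* b)))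
        (≋-trans (≋-* (≋-trans (ζ₁≋1 (s ℤ.* a)) (≋-sym (ζ₁≋1 (t ℤ.* a)))) (≈⇒≋ (ζ-per₂ (+ 0) (≋-mulʳ b h))))
          (≈⇒≋ (≈-sym (ζ-split (t ℤ.* a) (t ℤ.* b)))))) X

  ψ-mod₂ : ∀ {s t} X → s Z.≋ t [ + n₁ ] → ψ s X ≋ ψ t X [ 1# - ζ (+ 0) (+ 1) ]
  ψ-mod₂ {s} {t} X h = ψ-≋ s t (λ a b → ≋-trans (≈⇒≋ (ζ-split (s ℤ.* a) (s ℤ.* b)))
        (≋-trans (≋-* (≈⇒≋ (ζ-per₁ (+ 0) (≋-mulʳ a h))) (≋-trans (ζ₂≋1 (s ℤ.* b)) (≋-sym (ζ₂≋1 (t ℤ.* b)))))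
          (≈⇒≋ (≈-sym (ζ-split (t ℤ.* a) (t ℤ.* b)))))) X

  -- Induction on the number of terms: modulo p the binomial theorem splits off one term, and its
  -- integer coefficient satisfies c^p ≡ c.
  frobenius : ∀ {p} → Prime p → ∀ X → X ^ p ≋ ψ (+ p) X [ ι (+ p) ]
  frobenius {zero} pr X = ⊥-elim (ℕₚ.n≮0 (prime>1 pr))
  frobenius {suc p-1} pr [] = ≈⇒≋ (zeroˡ ([] ^ p-1))
  frobenius {p@(suc p-1)} pr ((c , a , b) ∷ X) =
    ≋-trans (≈⇒≋ (^-congˡ p (cons≈ c a b X)))
    (≋-trans (freshman pr (ι c * ζ a b) X)
    (≋-trans (≋-+ (≋-trans (≈⇒≋ (^-distrib-* (ι c) (ζ a b) p))
            (≋-* (≋-trans (≈⇒≋ (≈-sym (ι-^′ c p))) (ι-≋ (fermatℤ pr c))) (≈⇒≋ (ζ-^ p a b)))) (frobenius pr X))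
    (≈⇒≋ (≈-sym (cons≈ c (+ p ℤ.* a) (+ p ℤ.* b) (ψ (+ p) X))))))
    where
    ι-^′ : ∀ c n → ι (c Z.^ n) ≈ ι c ^ n
    ι-^′ c zero = ≈-refl
    ι-^′ c (suc n) = ≈-trans (ι-* c (c Z.^ n)) (*-cong (≈-refl {ι c}) (ι-^′ c n))

  -- Both sides are bilinear, so two single terms suffice; for these the sum factors into one
  -- `w-conv` for each prime, which accounts for p₁ p₂.
  parseval : ∀ X Y → Z.∑< n₁ (λ k → Z.∑< n₂ (λ l → hat X (+ k) (+ l) ℤ.* hat Y (+ k) (+ l)))
                     ≡ + p₁ ℤ.* + p₂ ℤ.* hat (X * ψ (ℤ.- + 1) Y) (+ 0) (+ 0)
  parseval X Y = begin
    Z.∑< n₁ (λ k → Z.∑< n₂ (λ l → hat X (+ k) (+ l) ℤ.* hat Y (+ k) (+ l)))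
      ≡⟨ Z.∑<-congᵃ n₁ (λ k → trans (Z.∑<-congᵃ n₂ (λ l → ev-ev (ww (+ k) (+ l)) (ww (+ k) (+ l)) X Y))
          (ev-ev-∑< n₂ _ X Y)) ⟩
    Z.∑< n₁ (λ k → ev (λ a b → ev (λ a′ b′ → Z.∑< n₂ (λ l → ww (+ k) (+ l) a b ℤ.* ww (+ k) (+ l) a′ b′)) Y)
        X)
      ≡⟨ ev-ev-∑< n₁ _ X Y ⟩
    ev (λ a b → ev (λ a′ b′ → Z.∑< n₁ (λ k → Z.∑< n₂ (λ l → ww (+ k) (+ l) a b ℤ.* ww (+ k) (+ l) a′ b′))) Y)
      X
      ≡⟨ ev-cong X (λ a b → ev-cong Y (λ a′ b′ → inner a b a′ b′)) ⟩
    ev (λ a b → ev (λ a′ b′ → + p₁ ℤ.* + p₂ ℤ.* ww (+ 0) (+ 0) (a ℤ.+ (ℤ.- + 1) ℤ.* a′)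
          (b ℤ.+ (ℤ.- + 1) ℤ.* b′)) Y) X
      ≡⟨ ev-cong X (λ a b → trans (sym (ev-*ˡ _ Y (+ p₁ ℤ.* + p₂)))
          (cong (+ p₁ ℤ.* + p₂ ℤ.*_) (sym (ev-ψ (shift a b (ww (+ 0) (+ 0))) (ℤ.- + 1) Y)))) ⟩
    ev (λ a b → + p₁ ℤ.* + p₂ ℤ.* ev (shift a b (ww (+ 0) (+ 0))) (ψ (ℤ.- + 1) Y)) X
      ≡⟨ ev-*ˡ _ X (+ p₁ ℤ.* + p₂) ⟨
    + p₁ ℤ.* + p₂ ℤ.* ev (λ a b → ev (shift a b (ww (+ 0) (+ 0))) (ψ (ℤ.- + 1) Y)) X
      ≡⟨ cong (+ p₁ ℤ.* + p₂ ℤ.*_) (ev-⊗ (ww (+ 0) (+ 0)) X (ψ (ℤ.- + 1) Y)) ⟨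
    + p₁ ℤ.* + p₂ ℤ.* hat (X * ψ (ℤ.- + 1) Y) (+ 0) (+ 0) ∎
    where
    open ≡-Reasoning
    l₁ : ∀ a b c d → a ℤ.* b ℤ.* (c ℤ.* d) ≡ a ℤ.* c ℤ.* (b ℤ.* d)
    l₁ = solve-∀
    l₂ : ∀ a b → a ℤ.- b ≡ a ℤ.+ (ℤ.- + 1) ℤ.* b ℤ.+ + 0
    l₂ = solve-∀
    inner : ∀ a b a′ b′ → Z.∑< n₁ (λ k → Z.∑< n₂ (λ l → ww (+ k) (+ l) a b ℤ.* ww (+ k) (+ l) a′ b′))
                          ≡ + p₁ ℤ.* + p₂ ℤ.* ww (+ 0) (+ 0) (a ℤ.+ (ℤ.- + 1) ℤ.* a′) (b ℤ.+ (ℤ.- + 1) ℤ.* b′)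
    inner a b a′ b′ = begin
      Z.∑< n₁ (λ k → Z.∑< n₂ (λ l → ww (+ k) (+ l) a b ℤ.* ww (+ k) (+ l) a′ b′))
        ≡⟨ Z.∑<-congᵃ n₁ (λ k → Z.∑<-congᵃ n₂ (λ l → l₁ (W₁.w (a ℤ.+ + k)) (W₂.w (b ℤ.+ + l))
              (W₁.w (a′ ℤ.+ + k)) (W₂.w (b′ ℤ.+ + l)))) ⟩
      Z.∑< n₁ (λ k → Z.∑< n₂ (λ l → W₁.w (a ℤ.+ + k) ℤ.* W₁.w (a′ ℤ.+ + k) ℤ.*
            (W₂.w (b ℤ.+ + l) ℤ.* W₂.w (b′ ℤ.+ + l))))
        ≡⟨ ∑<-product n₁ n₂ (λ k → W₁.w (a ℤ.+ + k) ℤ.* W₁.w (a′ ℤ.+ + k))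
          (λ l → W₂.w (b ℤ.+ + l) ℤ.* W₂.w (b′ ℤ.+ + l)) ⟩
      Z.∑< n₁ (λ k → W₁.w (a ℤ.+ + k) ℤ.* W₁.w (a′ ℤ.+ + k)) ℤ.* Z.∑< n₂
        (λ l → W₂.w (b ℤ.+ + l) ℤ.* W₂.w (b′ ℤ.+ + l))
        ≡⟨ cong₂ ℤ._*_ (W₁.w-conv a a′) (W₂.w-conv b b′) ⟩
      + p₁ ℤ.* W₁.w (a ℤ.- a′) ℤ.* (+ p₂ ℤ.* W₂.w (b ℤ.- b′)) ≡⟨ l₁ (+ p₁) (W₁.w (a ℤ.- a′)) (+ p₂)
        (W₂.w (b ℤ.- b′)) ⟩
      + p₁ ℤ.* + p₂ ℤ.* (W₁.w (a ℤ.- a′) ℤ.* W₂.w (b ℤ.- b′)) ≡⟨ cong₂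
        (λ x y → + p₁ ℤ.* + p₂ ℤ.* (W₁.w x ℤ.* W₂.w y)) (l₂ a a′) (l₂ b b′) ⟩
      + p₁ ℤ.* + p₂ ℤ.* ww (+ 0) (+ 0) (a ℤ.+ (ℤ.- + 1) ℤ.* a′) (b ℤ.+ (ℤ.- + 1) ℤ.* b′) ∎

  mixed : R → ℕ → ℕ → ℤ → ℤ → ℤ
  mixed X i j k l = coef X k l ℤ.- coef X (k ℤ.+ W₁.step i) l
                    ℤ.- (coef X k (l ℤ.+ W₂.step j) ℤ.- coef X (k ℤ.+ W₁.step i) (l ℤ.+ W₂.step j))

  dd : ℕ → ℕ → ℤ → ℤ → ℤ → ℤ → ℤ
  dd i j k l a b = W₁.diff i (a ℤ.+ k) ℤ.* W₂.diff j (b ℤ.+ l)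

  mixed-ev : ∀ X i j k l → mixed X i j k l ≡ ev (dd i j k l) X
  mixed-ev X i j k l = trans (cong₂ ℤ._-_ (ev-sub _ _ X) (ev-sub _ _ X))
      (trans (ev-sub _ _ X) (ev-cong X (λ a b →
    trans (cong₂ (λ x y → ind n₁ (a ℤ.+ k) ℤ.* ind n₂ (b ℤ.+ l) ℤ.- ind n₁ x ℤ.* ind n₂ (b ℤ.+ l) ℤ.-
          (ind n₁ (a ℤ.+ k) ℤ.* ind n₂ y ℤ.- ind n₁ x ℤ.* ind n₂ y))
             (sym (ℤₚ.+-assoc a k (W₁.step i))) (sym (ℤₚ.+-assoc b l (W₂.step j))))
          (h (ind n₁ (a ℤ.+ k)) (ind n₂ (b ℤ.+ l)) _ _))))
    where h : ∀ x y x′ y′ → x ℤ.* y ℤ.- x′ ℤ.* y ℤ.- (x ℤ.* y′ ℤ.- x′ ℤ.* y′) ≡ (x ℤ.- x′) ℤ.* (y ℤ.- y′)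
          h = solve-∀

  hat-mixed : ∀ X k l → hat X k l ≡ Z.∑< p₁ (λ i → Z.∑< p₂ (λ j → mixed X i j k l))
  hat-mixed X k l = sym (begin
    Z.∑< p₁ (λ i → Z.∑< p₂ (λ j → mixed X i j k l))
      ≡⟨ Z.∑<-congᵃ p₁ (λ i → trans (Z.∑<-congᵃ p₂ (λ j → mixed-ev X i j k l)) (ev-∑< p₂ _ X)) ⟩
    Z.∑< p₁ (λ i → ev (λ a b → Z.∑< p₂ (λ j → dd i j k l a b)) X) ≡⟨ ev-∑< p₁ _ X ⟩
    ev (λ a b → Z.∑< p₁ (λ i → Z.∑< p₂ (λ j → dd i j k l a b))) X
      ≡⟨ ev-cong X (λ a b → trans (∑<-product p₁ p₂ (λ i → W₁.diff i (a ℤ.+ k)) (λ j → W₂.diff j (b ℤ.+ l)))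
          (cong₂ ℤ._*_ (W₁.∑-diff (a ℤ.+ k)) (W₂.∑-diff (b ℤ.+ l)))) ⟩
    hat X k l ∎)
    where open ≡-Reasoning

  -- Bilinear expansion again; for two single terms the sum factors into one `diff-conv` for each
  -- prime.
  energy : ∀ X → Z.∑< p₁ (λ i → Z.∑< n₁ (λ k → Z.∑< p₂ (λ j → Z.∑< n₂ (λ l →
                  mixed X i j (+ k) (+ l) ℤ.* mixed X i j (+ k) (+ l)))))
                  ≡ + 4 ℤ.* hat (X * ψ (ℤ.- + 1) X) (+ 0) (+ 0)
  energy X = begin
    Z.∑< p₁ (λ i → Z.∑< n₁ (λ k → Z.∑< p₂ (λ j → Z.∑< n₂
            (λ l → mixed X i j (+ k) (+ l) ℤ.* mixed X i j (+ k) (+ l)))))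
      ≡⟨ Z.∑<-congᵃ p₁ (λ i → trans (Z.∑<-congᵃ n₁
            (λ k → trans (Z.∑<-congᵃ p₂ (λ j → trans (Z.∑<-congᵃ n₂ (λ l →
           trans (cong₂ ℤ._*_ (mixed-ev X i j (+ k) (+ l)) (mixed-ev X i j (+ k) (+ l)))
             (ev-ev (dd i j (+ k) (+ l)) (dd i j (+ k) (+ l)) X X)))
           (ev-ev-∑< n₂ _ X X))) (ev-ev-∑< p₂ _ X X))) (ev-ev-∑< n₁ _ X X)) ⟩
    Z.∑< p₁ (λ i → ev (λ a b → ev (λ a′ b′ → Z.∑< n₁
            (λ k → Z.∑< p₂ (λ j → Z.∑< n₂ (λ l → dd i j (+ k) (+ l) a b ℤ.* dd i j (+ k) (+ l) a′ b′)))) X) X)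
      ≡⟨ ev-ev-∑< p₁ _ X X ⟩
    ev (λ a b → ev (λ a′ b′ → Z.∑< p₁ (λ i → Z.∑< n₁
            (λ k → Z.∑< p₂ (λ j → Z.∑< n₂ (λ l → dd i j (+ k) (+ l) a b ℤ.* dd i j (+ k) (+ l) a′ b′))))) X) X
      ≡⟨ ev-cong X (λ a b → ev-cong X (λ a′ b′ → inner a b a′ b′)) ⟩
    ev (λ a b → ev (λ a′ b′ → + 4 ℤ.* ww (+ 0) (+ 0) (a ℤ.+ (ℤ.- + 1) ℤ.* a′) (b ℤ.+ (ℤ.- + 1) ℤ.* b′)) X) X
      ≡⟨ ev-cong X (λ a b → trans (sym (ev-*ˡ _ X (+ 4)))
          (cong (+ 4 ℤ.*_) (sym (ev-ψ (shift a b (ww (+ 0) (+ 0))) (ℤ.- + 1) X)))) ⟩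
    ev (λ a b → + 4 ℤ.* ev (shift a b (ww (+ 0) (+ 0))) (ψ (ℤ.- + 1) X)) X
      ≡⟨ ev-*ˡ _ X (+ 4) ⟨
    + 4 ℤ.* ev (λ a b → ev (shift a b (ww (+ 0) (+ 0))) (ψ (ℤ.- + 1) X)) X
      ≡⟨ cong (+ 4 ℤ.*_) (ev-⊗ (ww (+ 0) (+ 0)) X (ψ (ℤ.- + 1) X)) ⟨
    + 4 ℤ.* hat (X * ψ (ℤ.- + 1) X) (+ 0) (+ 0) ∎
    where
    open ≡-Reasoning
    l₁ : ∀ a b c d → a ℤ.* b ℤ.* (c ℤ.* d) ≡ a ℤ.* c ℤ.* (b ℤ.* d)
    l₁ = solve-∀
    l₂ : ∀ a b → a ℤ.- b ≡ a ℤ.+ (ℤ.- + 1) ℤ.* b ℤ.+ + 0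
    l₂ = solve-∀
    l₃ : ∀ x y → + 2 ℤ.* x ℤ.* (+ 2 ℤ.* y) ≡ + 4 ℤ.* (x ℤ.* y)
    l₃ = solve-∀
    inner : ∀ a b a′ b′ → Z.∑< p₁ (λ i → Z.∑< n₁ (λ k → Z.∑< p₂
            (λ j → Z.∑< n₂ (λ l → dd i j (+ k) (+ l) a b ℤ.* dd i j (+ k) (+ l) a′ b′))))
                          ≡ + 4 ℤ.* ww (+ 0) (+ 0) (a ℤ.+ (ℤ.- + 1) ℤ.* a′) (b ℤ.+ (ℤ.- + 1) ℤ.* b′)
    inner a b a′ b′ = begin
      Z.∑< p₁ (λ i → Z.∑< n₁ (λ k → Z.∑< p₂ (λ j → Z.∑< n₂
              (λ l → dd i j (+ k) (+ l) a b ℤ.* dd i j (+ k) (+ l) a′ b′))))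
        ≡⟨ Z.∑<-congᵃ p₁ (λ i → Z.∑<-congᵃ n₁ (λ k → trans
              (Z.∑<-congᵃ p₂ (λ j → trans (Z.∑<-congᵃ n₂ (λ l → l₁ (W₁.diff i (a ℤ.+ + k)) _ _ _))
                (sym (Z.∑<-*ˡ (D₁ i k) n₂ (D₂ j))))) (sym (Z.∑<-*ˡ (D₁ i k) p₂ (λ j → Z.∑< n₂ (D₂ j)))))) ⟩
      Z.∑< p₁ (λ i → Z.∑< n₁ (λ k → D₁ i k ℤ.* E₂)) ≡⟨ Z.∑<-congᵃ p₁ (λ i → Z.∑<-*ʳ E₂ n₁ (D₁ i)) ⟨
      Z.∑< p₁ (λ i → Z.∑< n₁ (D₁ i) ℤ.* E₂) ≡⟨ Z.∑<-*ʳ E₂ p₁ (λ i → Z.∑< n₁ (D₁ i)) ⟨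
      Z.∑< p₁ (λ i → Z.∑< n₁ (D₁ i)) ℤ.* E₂ ≡⟨ cong₂ ℤ._*_ (W₁.diff-conv a a′) (W₂.diff-conv b b′) ⟩
      + 2 ℤ.* W₁.w (a ℤ.- a′) ℤ.* (+ 2 ℤ.* W₂.w (b ℤ.- b′)) ≡⟨ l₃ (W₁.w (a ℤ.- a′)) (W₂.w (b ℤ.- b′)) ⟩
      + 4 ℤ.* (W₁.w (a ℤ.- a′) ℤ.* W₂.w (b ℤ.- b′)) ≡⟨ cong₂ (λ x y → + 4 ℤ.* (W₁.w x ℤ.* W₂.w y)) (l₂ a a′)
        (l₂ b b′) ⟩
      + 4 ℤ.* ww (+ 0) (+ 0) (a ℤ.+ (ℤ.- + 1) ℤ.* a′) (b ℤ.+ (ℤ.- + 1) ℤ.* b′) ∎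
      where
      D₁ D₂ : ℕ → ℕ → ℤ
      D₁ i k = W₁.diff i (a ℤ.+ + k) ℤ.* W₁.diff i (a′ ℤ.+ + k)
      D₂ j l = W₂.diff j (b ℤ.+ + l) ℤ.* W₂.diff j (b′ ℤ.+ + l)
      E₂ : ℤ
      E₂ = Z.∑< p₂ (λ j → Z.∑< n₂ (D₂ j))

  cyclotomicRing : CyclotomicRing S
  cyclotomicRing = record
    { algebra = algebra ; hat = hat ; coef = coef ; ζ = ζ ; ψ = ψ
    ; hat-cong = λ h → at h ; hat-ext = eq
    ; hat-+ = λ X Y k l → Z.∑-++ X Y (term (ww k l))
    ; hat-ι = λ c X k l → ev-const-⊗ (ww k l) c X
    ; hat-ζ = hat-ζ ; hat-1 = hat-1 ; hat-per₁ = hat-per₁ ; hat-per₂ = hat-per₂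
    ; hat-coset₁ = hat-coset₁ ; hat-coset₂ = hat-coset₂
    ; ψ-+ = ψ-+ ; ψ-neg = ψ-neg ; ψ-one = λ s → ψ-ι s (+ 1) ; ψ-* = ψ-* ; ψ-ι = ψ-ι ; ψ-ζ = λ s a b →
        ≈-refl ; ψ-ψ = ψ-ψ
    ; ψ-mod = ψ-mod ; ψ-mod₁ = ψ-mod₁ ; ψ-mod₂ = ψ-mod₂ ; hat-ψ = hat-ψ ; frobenius = frobenius
    ; parseval = parseval ; coef-per₁ = coef-per₁ ; coef-per₂ = coef-per₂
    ; hat-mixed = hat-mixed ; energy = energy }

-- Divisibility, roots of unity and the Galois action in ℤ[ζ_N].

-- The multiples of a nonzero element of ℤ/p^(e+1) contain the subgroup of order p. Common factors p
-- of a and the modulus are stripped until a is a unit.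
prime-power-solve : ∀ {p} → Prime p → ∀ e a → ¬ + (p ℕ.^ suc e) Z.∣ a → Σ ℤ λ t → t ℤ.* a Z.≋ + (p ℕ.^ e) [ +
    (p ℕ.^ suc e) ]
prime-power-solve {p} pr e a ¬d = go e a ¬d (∣?ℤ p a)
  where
  go : ∀ e a → ¬ + (p ℕ.^ suc e) Z.∣ a → Dec (+ p Z.∣ a) → Σ ℤ λ t → t ℤ.* a Z.≋ + (p ℕ.^ e) [ +
      (p ℕ.^ suc e) ]
  go e a ¬d (no ¬p) = + (p ℕ.^ e) ℤ.* v , Z.congr (Z.divides (ℤ.- (+ (p ℕ.^ e) ℤ.* u))
        (trans (l (+ (p ℕ.^ e)) v a (+ (p ℕ.^ suc e) ℤ.* u))
          (trans (cong (λ z → + (p ℕ.^ e) ℤ.* (z ℤ.- + 1 ℤ.- + (p ℕ.^ suc e) ℤ.* u)) bz)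
            (l′ (+ (p ℕ.^ e)) (+ (p ℕ.^ suc e)) u))))
    where
    c : Comax (+ (p ℕ.^ suc e)) a
    c = subst (λ z → Comax z a) (sym (pos-^ p (suc e)))
        (comax-sym (comax-^ʳ (suc e) (comax-sym (prime-comax pr a ¬p))))
    open Comax c renaming (bézout to bz)
    l : ∀ q v a nu → q ℤ.* v ℤ.* a ℤ.- q ≡ q ℤ.* (nu ℤ.+ a ℤ.* v ℤ.- + 1 ℤ.- nu)
    l = solve-∀
    l′ : ∀ q n u → q ℤ.* (+ 1 ℤ.- + 1 ℤ.- n ℤ.* u) ≡ n ℤ.* (ℤ.- (q ℤ.* u))
    l′ = solve-∀
  go zero a ¬d (yes d) = ⊥-elim (¬d (Z.∣-respˡ (cong +_ (sym (ℕₚ.*-identityʳ p))) d))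
  go (suc e) a ¬d (yes (Z.divides a′ eq)) = t , Z.congr
      (Z.∣-resp (trans (l (+ p) t a′ (+ (p ℕ.^ e)))
          (cong₂ (λ y z → t ℤ.* y ℤ.- z) (sym eq) (sym (ℤₚ.pos-* p (p ℕ.^ e)))))
      (Z.∣-respˡ (sym (ℤₚ.pos-* p (p ℕ.^ suc e))) (Z.∣-*-mono (Z.∣-refl {+ p}) (Z.∣-diff h))))
    where
    r = go e a′ (λ d → ¬d (Z.∣-resp (sym eq) (Z.∣-respˡ (sym (ℤₚ.pos-* p (p ℕ.^ suc e)))
              (Z.∣-*-mono (Z.∣-refl {+ p}) d)))) (∣?ℤ p a′)
    t = proj₁ r
    h = proj₂ r
    l : ∀ p t a q → p ℤ.* (t ℤ.* a ℤ.- q) ≡ t ℤ.* (p ℤ.* a) ℤ.- p ℤ.* q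
    l = solve-∀

module Cyclotomic (S : Setting) (C : CyclotomicRing S) where
  open Setting S
  open CyclotomicRing C
  open RingTools algebra
  open RingPowers algebra
  open import Relation.Binary.Reasoning.Setoid setoid

  conj σ : Carrier → Carrier
  conj = ψ (ℤ.- + 1)
  σ = ψ (+ 2)

  comax-n₁ : ∀ {a} → Comax (+ p₁) a → Comax (+ n₁) a
  comax-n₁ {a} = W₁.comax-pow a (suc e₁)

  comax-n₂ : ∀ {a} → Comax (+ p₂) a → Comax (+ n₂) a
  comax-n₂ {a} = W₂.comax-pow a (suc e₂)

  comax-p₁p₂ : Comax (+ p₁) (+ p₂)
  comax-p₁p₂ = prime-comaxℕ pr₁ p₂ (λ d → [ (λ e → ℕₚ.<⇒≢ (prime>1 pr₁) (sym e)) , p₁≢p₂ ]′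
        (prime⇒irreducible pr₂ d))

  comax-odd : ∀ {p h} → p ≡ suc (2 ℕ.* h) → Comax (+ p) (+ 2)
  comax-odd {p} {h} refl = comax (+ 1) (ℤ.- + h) (trans
        (cong (λ z → (+ 1 ℤ.+ z) ℤ.* + 1 ℤ.+ + 2 ℤ.* (ℤ.- + h)) (ℤₚ.pos-* 2 h)) (l (+ h)))
    where l : ∀ h → (+ 1 ℤ.+ + 2 ℤ.* h) ℤ.* + 1 ℤ.+ + 2 ℤ.* (ℤ.- h) ≡ + 1
          l = solve-∀

  comax₁-2 : Comax (+ p₁) (+ 2)
  comax₁-2 = comax-odd {h = half₁} odd₁

  comax₂-2 : Comax (+ p₂) (+ 2)
  comax₂-2 = comax-odd {h = half₂} odd₂

  hat-0 : ∀ k l → hat 0# k l ≡ + 0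
  hat-0 k l = trans (hat-cong (≈-sym (≈-trans (*-cong ι-0 (≈-refl {0#})) (zeroˡ 0#))) k l)
      (hat-ι (+ 0) 0# k l)

  hat-neg : ∀ X k l → hat (- X) k l ≡ ℤ.- hat X k l
  hat-neg X k l = trans (hat-cong (h X) k l) (trans
        (hat-cong (*-cong (≈-sym (≈-trans (ι-neg (+ 1)) (-‿cong ι-1))) (≈-refl {X})) k l)
        (trans (hat-ι (ℤ.- + 1) X k l) (ℤₚ.-1*i≡-i _)))
    where h : ∀ X → - X ≈ - 1# * X
          h = solve 1 (λ X → :- X := :- con (+ 1) :* X) ≈-refl

  hat-sub : ∀ X Y k l → hat (X - Y) k l ≡ hat X k l ℤ.- hat Y k l
  hat-sub X Y k l = trans (hat-+ X (- Y) k l) (cong (ℤ._+_ (hat X k l)) (hat-neg Y k l))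

  hat-∑< : ∀ n f k l → hat (∑< n f) k l ≡ Z.∑< n (λ j → hat (f j) k l)
  hat-∑< zero f k l = hat-0 k l
  hat-∑< (suc n) f k l = trans (hat-+ (∑< n f) (f n) k l) (cong (ℤ._+ hat (f n) k l) (hat-∑< n f k l))

  hat-ι1 : ∀ c k l → hat (ι c) k l ≡ c ℤ.* (W₁.w k ℤ.* W₂.w l)
  hat-ι1 c k l = trans (hat-cong (≈-sym (*-identityʳ (ι c))) k l)
      (trans (hat-ι c 1# k l) (cong (c ℤ.*_) (hat-1 k l)))

  ι-cancel : ∀ c .{{_ : ℤ.NonZero c}} {X Y} → ι c * X ≈ ι c * Y → X ≈ Y
  ι-cancel c {X} {Y} h = hat-ext (λ k l → ℤₚ.*-cancelˡ-≡ c _ _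
        (trans (sym (hat-ι c X k l)) (trans (hat-cong h k l) (hat-ι c Y k l))))

  ι∣⇒∣hat : ∀ {d X} → ι d ∣ X → ∀ k l → d Z.∣ hat X k l
  ι∣⇒∣hat {d} {X} (divides Q e) k l = Z.divides (hat Q k l) (trans (hat-cong e k l) (hat-ι d Q k l))

  ι-comax-cancel : ∀ {d} a {X} → Comax d a → ι d ∣ ι a * X → ι d ∣ X
  ι-comax-cancel {d} a {X} (comax u v e) (divides Q f) = divides (ι u * X + ι v * Q) (begin
    X                                   ≈⟨ *-identityˡ X ⟨
    1# * X                              ≈⟨ *-cong (≈-trans (≈-sym ι-1)
        (≈-trans (≈-reflexive (cong ι (sym e))) (≈-trans (ι-+ _ _) (+-cong (ι-* d u) (ι-* a v)))))
      (≈-refl {X}) ⟩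
    (ι d * ι u + ι a * ι v) * X         ≈⟨ h (ι d) (ι u) (ι a) (ι v) X ⟩
    ι d * (ι u * X) + ι v * (ι a * X)   ≈⟨ +-cong ≈-refl (*-cong ≈-refl f) ⟩
    ι d * (ι u * X) + ι v * (ι d * Q)   ≈⟨ k (ι d) (ι u) (ι v) X Q ⟩
    ι d * (ι u * X + ι v * Q)           ∎)
    where
    h : ∀ d u a v x → (d * u + a * v) * x ≈ d * (u * x) + v * (a * x)
    h = solve 5 (λ d u a v x → (d :* u :+ a :* v) :* x := d :* (u :* x) :+ v :* (a :* x)) ≈-refl
    k : ∀ d u v x q → d * (u * x) + v * (d * q) ≈ d * (u * x + v * q)
    k = solve 5 (λ d u v x q → d :* (u :* x) :+ v :* (d :* q) := d :* (u :* x :+ v :* q)) ≈-refl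

  ι-comax-* : ∀ a b {X} → Comax a b → ι a ∣ X → ι b ∣ X → ι (a ℤ.* b) ∣ X
  ι-comax-* a b {X} c (divides Q e) h = ∣-resp (≈-sym e)
      (∣-respˡ (≈-sym (ι-* a b)) (∣-*-mono (∣-refl {ι a}) (ι-comax-cancel a (comax-sym c) (∣-resp e h))))

  ζ-at : ∀ a b k l → hat (ζ a b) k l ≡ W₁.w (k ℤ.+ a) ℤ.* W₂.w (l ℤ.+ b)
  ζ-at a b k l = trans (hat-cong (≈-sym (*-identityʳ (ζ a b))) k l)
      (trans (hat-ζ a b 1# k l) (hat-1 (k ℤ.+ a) (l ℤ.+ b)))

  ζ-+ : ∀ a b c d → ζ a b * ζ c d ≈ ζ (a ℤ.+ c) (b ℤ.+ d)
  ζ-+ a b c d = hat-ext (λ k l → trans (hat-ζ a b (ζ c d) k l)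
        (trans (ζ-at c d (k ℤ.+ a) (l ℤ.+ b)) (trans
            (cong₂ (λ x y → W₁.w x ℤ.* W₂.w y) (ℤₚ.+-assoc k a c) (ℤₚ.+-assoc l b d))
            (sym (ζ-at (a ℤ.+ c) (b ℤ.+ d) k l)))))

  ζ-0 : ζ (+ 0) (+ 0) ≈ 1#
  ζ-0 = hat-ext (λ k l → trans (ζ-at (+ 0) (+ 0) k l)
        (trans (cong₂ (λ x y → W₁.w x ℤ.* W₂.w y) (ℤₚ.+-identityʳ k) (ℤₚ.+-identityʳ l)) (sym (hat-1 k l))))

  ζ-per : ∀ {a a′ b b′} → a Z.≋ a′ [ + n₁ ] → b Z.≋ b′ [ + n₂ ] → ζ a b ≈ ζ a′ b′
  ζ-per {a} {a′} {b} {b′} h h′ = hat-ext (λ k l → trans (ζ-at a b k l)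
        (trans (cong₂ ℤ._*_ (W₁.w-per (≋-shift k h)) (W₂.w-per (≋-shift l h′))) (sym (ζ-at a′ b′ k l))))

  ζ-inv : ∀ a b → ζ (ℤ.- a) (ℤ.- b) * ζ a b ≈ 1#
  ζ-inv a b = ≈-trans (ζ-+ (ℤ.- a) (ℤ.- b) a b) (≈-trans
        (≈-reflexive (cong₂ ζ (ℤₚ.+-inverseˡ a) (ℤₚ.+-inverseˡ b))) ζ-0)

  ζ-^ : ∀ n a b → ζ a b ^ n ≈ ζ (+ n ℤ.* a) (+ n ℤ.* b)
  ζ-^ zero a b = ≈-sym ζ-0
  ζ-^ (suc n) a b = ≈-trans (*-cong (≈-refl {ζ a b}) (ζ-^ n a b))
      (≈-trans (ζ-+ a b (+ n ℤ.* a) (+ n ℤ.* b)) (≈-reflexive (cong₂ ζ (l (+ n) a) (l (+ n) b))))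
    where l : ∀ n a → a ℤ.+ n ℤ.* a ≡ (+ 1 ℤ.+ n) ℤ.* a
          l = solve-∀

  ζ-coset₁ : ∀ b → ∑< p₁ (λ j → ζ (W₁.step j) b) ≈ 0#
  ζ-coset₁ b = hat-ext (λ k l → trans (hat-∑< p₁ _ k l)
        (trans (trans (Z.∑<-congᵃ p₁ (λ j → ζ-at (W₁.step j) b k l))
            (trans (sym (Z.∑<-*ʳ (W₂.w (l ℤ.+ b)) p₁ _)) (cong (ℤ._* W₂.w (l ℤ.+ b)) (W₁.w-coset k))))
          (sym (hat-0 k l))))

  ζ-coset₂ : ∀ a → ∑< p₂ (λ j → ζ a (W₂.step j)) ≈ 0#
  ζ-coset₂ a = hat-ext (λ k l → trans (hat-∑< p₂ _ k l)
        (trans (trans (Z.∑<-congᵃ p₂ (λ j → ζ-at a (W₂.step j) k l))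
            (trans (sym (Z.∑<-*ˡ (W₁.w (k ℤ.+ a)) p₂ _))
            (trans (cong (W₁.w (k ℤ.+ a) ℤ.*_) (W₂.w-coset l)) (ℤₚ.*-zeroʳ (W₁.w (k ℤ.+ a))))))
          (sym (hat-0 k l))))

  -- If a nontrivial root of unity fixes Z modulo d then d divides p₁ Z or p₂ Z, because
  -- some power of it is a primitive p-th root of unity, and those sum to zero.

  fixed-pow : ∀ {d Z} a b → ζ a b * Z ≋ Z [ d ] → ∀ t → ζ (t ℤ.* a) (t ℤ.* b) * Z ≋ Z [ d ]
  fixed-pow {d} {Z} a b h (+ n) = ≋-trans (≈⇒≋ (*-cong (≈-sym (ζ-^ n a b)) (≈-refl {Z}))) (pow n)
    where
    pow : ∀ n → ζ a b ^ n * Z ≋ Z [ d ]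
    pow zero = ≈⇒≋ (*-identityˡ Z)
    pow (suc n) = ≋-trans (≈⇒≋ (*-assoc (ζ a b) (ζ a b ^ n) Z)) (≋-trans (≋-* (≋-refl {ζ a b}) (pow n)) h)
  fixed-pow {d} {Z} a b h t@(-[1+ n ]) = ≋-sym (≋-trans (≈⇒≋ eq)
        (≋-* (≋-refl {ζ (t ℤ.* a) (t ℤ.* b)}) (fixed-pow a b h (+ suc n))))
    where
    l : ∀ m a → (ℤ.- m) ℤ.* a ℤ.+ m ℤ.* a ≡ + 0
    l = solve-∀
    eq : Z ≈ ζ (t ℤ.* a) (t ℤ.* b) * (ζ (+ suc n ℤ.* a) (+ suc n ℤ.* b) * Z)
    eq = ≈-sym (≈-trans (≈-sym (*-assoc _ _ Z)) (≈-trans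
            (*-cong (≈-trans (ζ-+ (t ℤ.* a) (t ℤ.* b) (+ suc n ℤ.* a) (+ suc n ℤ.* b))
              (≈-trans (≈-reflexive (cong₂ ζ (l (+ suc n) a) (l (+ suc n) b))) ζ-0)) (≈-refl {Z}))
            (*-identityˡ Z)))

  fixed₁ : ∀ {d Z} a b → ζ a b * Z ≋ Z [ d ] → ¬ + n₁ Z.∣ a → d ∣ ι (+ p₁) * Z
  fixed₁ {d} {Z} a b h ¬d = ∣-resp (∑<-const p₁ Z) (≋-∣ total (∣-resp (≈-sym zero′) ∣0))
    where
    -- The power n₂ removes the ζ₂-part of `ζ a b`, and by coprimality the ζ₁-part stays nontrivial;
    -- the further power t turns it into a primitive p₁-th root of unity.
    ¬d′ : ¬ + n₁ Z.∣ + n₂ ℤ.* a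
    ¬d′ d = ¬d (comax-cancel (+ n₂) (comax-n₁ (subst (λ z → Comax (+ p₁) z) (sym (pos-^ p₂ (suc e₂)))
              (comax-^ʳ (suc e₂) comax-p₁p₂))) d)
    r = prime-power-solve pr₁ e₁ (+ n₂ ℤ.* a) ¬d′
    t = proj₁ r
    step₁ : ζ (+ W₁.n′) (+ 0) * Z ≋ Z [ d ]
    step₁ = ≋-trans (≈⇒≋ (*-cong (≈-sym (ζ-per (Z.≋-trans (Z.≈⇒≋ (ℤₚ.*-assoc t (+ n₂) a)) (proj₂ r))
              (Z.∣⇒≋0 (Z.∣-*ʳ b (Z.∣-*ˡ t Z.∣-refl))))) (≈-refl {Z}))) (fixed-pow a b h (t ℤ.* + n₂))
    total : ∑< p₁ (λ j → ζ (W₁.step j) (+ 0) * Z) ≋ ∑< p₁ (λ _ → Z) [ d ]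
    total = ∑<-≋ p₁ (λ j _ → ≋-trans (≈⇒≋ (*-cong (≈-reflexive
              (cong (ζ (W₁.step j)) (sym (ℤₚ.*-zeroʳ (+ j))))) (≈-refl {Z})))
          (fixed-pow (+ W₁.n′) (+ 0) step₁ (+ j)))
    zero′ : ∑< p₁ (λ j → ζ (W₁.step j) (+ 0) * Z) ≈ 0#
    zero′ = ≈-trans (≈-sym (∑<-*ʳ Z p₁ (λ j → ζ (W₁.step j) (+ 0))))
        (≈-trans (*-cong (ζ-coset₁ (+ 0)) (≈-refl {Z})) (zeroˡ Z))

  fixed₂ : ∀ {d Z} a b → ζ a b * Z ≋ Z [ d ] → ¬ + n₂ Z.∣ b → d ∣ ι (+ p₂) * Z
  fixed₂ {d} {Z} a b h ¬d = ∣-resp (∑<-const p₂ Z) (≋-∣ total (∣-resp (≈-sym zero′) ∣0))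
    where
    ¬d′ : ¬ + n₂ Z.∣ + n₁ ℤ.* b
    ¬d′ d = ¬d (comax-cancel (+ n₁) (comax-n₂ (subst (λ z → Comax (+ p₂) z) (sym (pos-^ p₁ (suc e₁)))
              (comax-^ʳ (suc e₁) (comax-sym comax-p₁p₂)))) d)
    r = prime-power-solve pr₂ e₂ (+ n₁ ℤ.* b) ¬d′
    t = proj₁ r
    step₁ : ζ (+ 0) (+ W₂.n′) * Z ≋ Z [ d ]
    step₁ = ≋-trans (≈⇒≋ (*-cong (≈-sym (ζ-per (Z.∣⇒≋0 (Z.∣-*ʳ a (Z.∣-*ˡ t Z.∣-refl)))
              (Z.≋-trans (Z.≈⇒≋ (ℤₚ.*-assoc t (+ n₁) b)) (proj₂ r)))) (≈-refl {Z})))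
        (fixed-pow a b h (t ℤ.* + n₁))
    total : ∑< p₂ (λ j → ζ (+ 0) (W₂.step j) * Z) ≋ ∑< p₂ (λ _ → Z) [ d ]
    total = ∑<-≋ p₂ (λ j _ → ≋-trans (≈⇒≋ (*-cong (≈-reflexive
              (cong (λ z → ζ z (W₂.step j)) (sym (ℤₚ.*-zeroʳ (+ j))))) (≈-refl {Z})))
          (fixed-pow (+ 0) (+ W₂.n′) step₁ (+ j)))
    zero′ : ∑< p₂ (λ j → ζ (+ 0) (W₂.step j) * Z) ≈ 0#
    zero′ = ≈-trans (≈-sym (∑<-*ʳ Z p₂ (λ j → ζ (+ 0) (W₂.step j))))
        (≈-trans (*-cong (ζ-coset₂ (+ 0)) (≈-refl {Z})) (zeroˡ Z))

  0∣⇒≈0 : ∀ {X} → 0# ∣ X → X ≈ 0#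
  0∣⇒≈0 (divides Q e) = ≈-trans e (zeroˡ Q)

  ι-zero : ∀ c .{{_ : ℤ.NonZero c}} {X} → ι c * X ≈ 0# → X ≈ 0#
  ι-zero c {X} h = ι-cancel c (≈-trans h (≈-sym (zeroʳ (ι c))))

  nontrivial? : ∀ a b → ((+ n₁ Z.∣ a) × (+ n₂ Z.∣ b)) ⊎ (¬ + n₁ Z.∣ a) ⊎ (¬ + n₂ Z.∣ b)
  nontrivial? a b with ∣?ℤ n₁ a | ∣?ℤ n₂ b
  ... | yes h | yes h′ = inj₁ (h , h′)
  ... | no h | _ = inj₂ (inj₁ h)
  ... | yes _ | no h = inj₂ (inj₂ h)

  ψ-1 : ∀ X → ψ (+ 1) X ≈ X
  ψ-1 X = hat-ext (λ k l → trans (cong₂ (hat (ψ (+ 1) X)) (sym (ℤₚ.*-identityˡ k)) (sym (ℤₚ.*-identityˡ l)))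
        (hat-ψ (+ 1) X k l comax-1ʳ comax-1ʳ))

  -- `hat-ψ` read backwards, with the inverses of s modulo n₁ and n₂: the traces of ψ s X are traces
  -- of X, so ψ s respects ≈ for such s.
  hat-ψ′ : ∀ s X k l → (c₁ : Comax (+ p₁) s) (c₂ : Comax (+ p₂) s) → hat (ψ s X) k l ≡ hat X
      (Comax.v (comax-n₁ c₁) ℤ.* k) (Comax.v (comax-n₂ c₂) ℤ.* l)
  hat-ψ′ s X k l c₁ c₂ = trans (trans (hat-per₁ (ψ s X) l (inv k (comax-n₁ c₁)))
        (hat-per₂ (ψ s X) _ (inv l (comax-n₂ c₂)))) (hat-ψ s X _ _ c₁ c₂)
    where
    inv : ∀ {n} k (c : Comax (+ n) s) → k Z.≋ s ℤ.* (Comax.v c ℤ.* k) [ + n ]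
    inv {n} k (comax u v e) = Z.congr (Z.divides (u ℤ.* k)
          (trans (cong (λ z → z ℤ.- s ℤ.* (v ℤ.* k)) (trans (sym (ℤₚ.*-identityˡ k)) (cong (ℤ._* k) (sym e))))
            (h (+ n) u s v k)))
      where h : ∀ n u s v k → (n ℤ.* u ℤ.+ s ℤ.* v) ℤ.* k ℤ.- s ℤ.* (v ℤ.* k) ≡ n ℤ.* (u ℤ.* k)
            h = solve-∀

  ψ-cong : ∀ s {X Y} → Comax (+ p₁) s → Comax (+ p₂) s → X ≈ Y → ψ s X ≈ ψ s Y
  ψ-cong s {X} {Y} c₁ c₂ h = hat-ext (λ k l → trans (hat-ψ′ s X k l c₁ c₂)
        (trans (hat-cong h _ _) (sym (hat-ψ′ s Y k l c₁ c₂))))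

  comax-neg1 : ∀ {a} → Comax a (ℤ.- + 1)
  comax-neg1 = comax-negʳ comax-1ʳ

  conj-cong : ∀ {X Y} → X ≈ Y → conj X ≈ conj Y
  conj-cong = ψ-cong (ℤ.- + 1) comax-neg1 comax-neg1

  σ-cong : ∀ {X Y} → X ≈ Y → σ X ≈ σ Y
  σ-cong = ψ-cong (+ 2) comax₁-2 comax₂-2

  hat-conj : ∀ X k l → hat (conj X) k l ≡ hat X (ℤ.- k) (ℤ.- l)
  hat-conj X k l = trans (cong₂ (hat (conj X)) (h k) (h l))
      (hat-ψ (ℤ.- + 1) X (ℤ.- k) (ℤ.- l) comax-neg1 comax-neg1)
    where h : ∀ k → k ≡ (ℤ.- + 1) ℤ.* (ℤ.- k)
          h = solve-∀

  conj-conj : ∀ X → conj (conj X) ≈ X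
  conj-conj X = ≈-trans (ψ-ψ (ℤ.- + 1) (ℤ.- + 1) X) (ψ-1 X)

  conj-+ : ∀ X Y → conj (X + Y) ≈ conj X + conj Y
  conj-+ = ψ-+ (ℤ.- + 1)

  conj-* : ∀ X Y → conj (X * Y) ≈ conj X * conj Y
  conj-* = ψ-* (ℤ.- + 1)

  conj-ι : ∀ c → conj (ι c) ≈ ι c
  conj-ι = ψ-ι (ℤ.- + 1)

  conj-1 : conj 1# ≈ 1#
  conj-1 = ≈-trans (conj-cong (≈-sym ι-1)) (≈-trans (conj-ι (+ 1)) ι-1)

  conj-ζ : ∀ a b → conj (ζ a b) ≈ ζ (ℤ.- a) (ℤ.- b)
  conj-ζ a b = ≈-trans (ψ-ζ (ℤ.- + 1) a b) (≈-reflexive (cong₂ ζ (ℤₚ.-1*i≡-i a) (ℤₚ.-1*i≡-i b)))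

  conj-neg : ∀ X → conj (- X) ≈ - conj X
  conj-neg X = hat-ext (λ k l → trans (hat-conj (- X) k l)
        (trans (hat-neg X _ _) (trans (cong ℤ.-_ (sym (hat-conj X k l))) (sym (hat-neg (conj X) k l)))))

  conj-sub : ∀ X Y → conj (X - Y) ≈ conj X - conj Y
  conj-sub X Y = ≈-trans (conj-+ X (- Y)) (+-cong ≈-refl (conj-neg Y))

  conj-^ : ∀ X n → conj (X ^ n) ≈ conj X ^ n
  conj-^ X zero = conj-1
  conj-^ X (suc n) = ≈-trans (conj-* X (X ^ n)) (*-cong ≈-refl (conj-^ X n))

  conj-∑ : {A : Set} (xs : List A) (f : A → Carrier) → conj (∑ xs f) ≈ ∑ xs (λ x → conj (f x))
  conj-∑ [] f = hat-ext (λ k l → trans (hat-conj 0# k l) (trans (hat-0 _ _) (sym (hat-0 k l))))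
  conj-∑ (x ∷ xs) f = ≈-trans (conj-+ (f x) (∑ xs f)) (+-cong ≈-refl (conj-∑ xs f))

  -- Fourier inversion, from `parseval` with a root of unity as second argument. It recovers p₁ p₂ X
  -- from integer traces, so that divisibility of all traces by a number prime to p₁ p₂ passes to X.
  reconstruct : ∀ X → ι (+ p₁ ℤ.* + p₂) * X ≈ ∑< n₁
      (λ k → ∑< n₂ (λ l → ι (hat X (+ k) (+ l)) * ζ (ℤ.- + k) (ℤ.- + l)))
  reconstruct X = hat-ext (λ a b → trans (hat-ι (+ p₁ ℤ.* + p₂) X a b)
        (sym (trans (hat-∑< n₁ _ a b) (trans (Z.∑<-congᵃ n₁
            (λ k → trans (hat-∑< n₂ _ a b) (Z.∑<-congᵃ n₂
            (λ l → trans (hat-ι (hat X (+ k) (+ l)) (ζ (ℤ.- + k) (ℤ.- + l)) a b)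
            (cong (hat X (+ k) (+ l) ℤ.*_) (flip a b (+ k) (+ l)))))))
            (trans (parseval X (ζ (ℤ.- a) (ℤ.- b))) (cong (+ p₁ ℤ.* + p₂ ℤ.*_) (final a b)))))))
    where
    neg-w₁ : ∀ a k → W₁.w (a ℤ.+ ℤ.- k) ≡ W₁.w (k ℤ.+ ℤ.- a)
    neg-w₁ a k = trans (sym (W₁.w-neg (a ℤ.- k))) (cong W₁.w (h a k))
      where h : ∀ a k → ℤ.- (a ℤ.- k) ≡ k ℤ.- a
            h = solve-∀
    neg-w₂ : ∀ a k → W₂.w (a ℤ.+ ℤ.- k) ≡ W₂.w (k ℤ.+ ℤ.- a)
    neg-w₂ a k = trans (sym (W₂.w-neg (a ℤ.- k))) (cong W₂.w (h a k))
      where h : ∀ a k → ℤ.- (a ℤ.- k) ≡ k ℤ.- a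
            h = solve-∀
    flip : ∀ a b k l → hat (ζ (ℤ.- k) (ℤ.- l)) a b ≡ hat (ζ (ℤ.- a) (ℤ.- b)) k l
    flip a b k l = trans (ζ-at (ℤ.- k) (ℤ.- l) a b)
        (trans (cong₂ ℤ._*_ (neg-w₁ a k) (neg-w₂ b l)) (sym (ζ-at (ℤ.- a) (ℤ.- b) k l)))
    final : ∀ a b → hat (X * conj (ζ (ℤ.- a) (ℤ.- b))) (+ 0) (+ 0) ≡ hat X a b
    final a b = trans (hat-cong (≈-trans (*-comm X _)
            (*-cong (≈-trans (conj-ζ (ℤ.- a) (ℤ.- b))
              (≈-reflexive (cong₂ ζ (ℤₚ.neg-involutive a) (ℤₚ.neg-involutive b)))) (≈-refl {X}))) (+ 0) (+ 0))
        (trans (hat-ζ a b X (+ 0) (+ 0)) (cong₂ (hat X) (ℤₚ.+-identityˡ a) (ℤₚ.+-identityˡ b)))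

  ∣hat⇒ι∣ : ∀ {d X} → Comax d (+ p₁ ℤ.* + p₂) → (∀ k l → d Z.∣ hat X (+ k) (+ l)) → ι d ∣ X
  ∣hat⇒ι∣ {d} {X} c h = ι-comax-cancel (+ p₁ ℤ.* + p₂) c
      (∣-resp (≈-sym (reconstruct X)) (∑<-∣ n₁ (λ k _ → ∑<-∣ n₂
            (λ l _ → ∣-*ʳ (ζ (ℤ.- + k) (ℤ.- + l)) (ι-∣ (h k l))))))

  comax-2-p₁p₂ : Comax (+ 2) (+ p₁ ℤ.* + p₂)
  comax-2-p₁p₂ = comax-*ʳ (comax-sym comax₁-2) (comax-sym comax₂-2)

-- Integer arrays with few nonzero mixed differences.

sumN : ℕ → (ℕ → ℕ) → ℕ
sumN zero    f = 0
sumN (suc n) f = sumN n f ℕ.+ f n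

sumN-cong : ∀ n {f g} → (∀ k → k ℕ.< n → f k ≡ g k) → sumN n f ≡ sumN n g
sumN-cong zero h = refl
sumN-cong (suc n) h = cong₂ ℕ._+_ (sumN-cong n (λ k l → h k (ℕₚ.m<n⇒m<1+n l))) (h n (ℕₚ.n<1+n n))

sumN-+ : ∀ n f g → sumN n (λ k → f k ℕ.+ g k) ≡ sumN n f ℕ.+ sumN n g
sumN-+ zero f g = refl
sumN-+ (suc n) f g = trans (cong (ℕ._+ (f n ℕ.+ g n)) (sumN-+ n f g)) (l (sumN n f) (sumN n g) (f n) (g n))
  where l : ∀ a b c e → a ℕ.+ b ℕ.+ (c ℕ.+ e) ≡ a ℕ.+ c ℕ.+ (b ℕ.+ e)
        l = ℕsolve-∀

sumN-pos : ∀ n f → Z.∑< n (λ k → + f k) ≡ + sumN n f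
sumN-pos zero f = refl
sumN-pos (suc n) f = cong (λ z → z ℤ.+ + f n) (sumN-pos n f)

sumN-0 : ∀ n {f} → (∀ k → k ℕ.< n → f k ≡ 0) → sumN n f ≡ 0
sumN-0 zero h = refl
sumN-0 (suc n) h = cong₂ ℕ._+_ (sumN-0 n (λ k l → h k (ℕₚ.m<n⇒m<1+n l))) (h n (ℕₚ.n<1+n n))

sumN≡0 : ∀ n {f} → sumN n f ≡ 0 → ∀ k → k ℕ.< n → f k ≡ 0
sumN≡0 (suc n) {f} e k k<n with k ℕ.≟ n
... | yes refl = ℕₚ.m+n≡0⇒n≡0 (sumN n f) e
... | no k≢n = sumN≡0 n (ℕₚ.m+n≡0⇒m≡0 (sumN n f) e) k (ℕₚ.≤∧≢⇒< (ℕₚ.≤-pred k<n) k≢n)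

sumN-≥ : ∀ n {f} m → (∀ k → k ℕ.< n → m ℕ.≤ f k) → n ℕ.* m ℕ.≤ sumN n f
sumN-≥ zero m h = z≤n
sumN-≥ (suc n) {f} m h = subst (ℕ._≤ sumN n f ℕ.+ f n) (ℕₚ.+-comm (n ℕ.* m) m)
    (ℕₚ.+-mono-≤ (sumN-≥ n m (λ k l → h k (ℕₚ.m<n⇒m<1+n l))) (h n (ℕₚ.n<1+n n)))

term≤sumN : ∀ n f k → k ℕ.< n → f k ℕ.≤ sumN n f
term≤sumN (suc n) f k k<n with k ℕ.≟ n
... | yes refl = ℕₚ.m≤n+m (f n) (sumN n f)
... | no k≢n = ℕₚ.≤-trans (term≤sumN n f k (ℕₚ.≤∧≢⇒< (ℕₚ.≤-pred k<n) k≢n)) (ℕₚ.m≤m+n (sumN n f) (f n))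

sumN-except : ∀ n f x k → x ℕ.< suc n → (∀ y → y ℕ.< suc n → y ≢ x → k ℕ.≤ f y) → f x ℕ.+ n ℕ.* k ℕ.≤ sumN
    (suc n) f
sumN-except n f x k x<n h with x ℕ.≟ n
... | yes refl = subst (ℕ._≤ sumN n f ℕ.+ f n) (ℕₚ.+-comm (n ℕ.* k) (f n))
    (ℕₚ.+-monoˡ-≤ (f n) (sumN-≥ n k (λ y l → h y (ℕₚ.m<n⇒m<1+n l) (ℕₚ.<⇒≢ l))))
sumN-except zero f zero k x<n h | no x≢n = ⊥-elim (x≢n refl)
sumN-except zero f (suc x) k (s≤s ()) h | no x≢n
sumN-except (suc n) f x k x<n h | no x≢n = subst (ℕ._≤ sumN (suc n) f ℕ.+ f (suc n)) eq
    (ℕₚ.+-mono-≤ (sumN-except n f x k (ℕₚ.≤∧≢⇒< (ℕₚ.≤-pred x<n) x≢n) (λ y l → h y (ℕₚ.m<n⇒m<1+n l)))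
        (h (suc n) (ℕₚ.n<1+n (suc n)) (λ e → x≢n (sym e))))
  where
  eq : f x ℕ.+ n ℕ.* k ℕ.+ k ≡ f x ℕ.+ suc n ℕ.* k
  eq = trans (ℕₚ.+-assoc (f x) (n ℕ.* k) k) (cong (f x ℕ.+_) (ℕₚ.+-comm (n ℕ.* k) k))

find-small : ∀ n (f : ℕ → ℕ) m → (∀ k → k ℕ.< n → m ℕ.≤ f k) ⊎ (Σ ℕ λ k → (k ℕ.< n) × (f k ℕ.< m))
find-small zero f m = inj₁ (λ _ ())
find-small (suc n) f m with find-small n f m | m ℕ.≤? f n
... | inj₂ (k , k<n , l) | _ = inj₂ (k , ℕₚ.m<n⇒m<1+n k<n , l)
... | inj₁ h | no ¬l = inj₂ (n , ℕₚ.n<1+n n , ℕₚ.≰⇒> ¬l)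
... | inj₁ h | yes l = inj₁ all
  where
  all : ∀ k → k ℕ.< suc n → m ℕ.≤ f k
  all k k<n with k ℕ.≟ n
  ... | yes refl = l
  ... | no k≢n = h k (ℕₚ.≤∧≢⇒< (ℕₚ.≤-pred k<n) k≢n)

-- d plays the role of a discrete metric: being at distance 0 is an equivalence relation, and
-- inequivalent points are at distance at least m.

module Gap (d : ℕ → ℕ → ℕ) (m : ℕ)
  (d-refl : ∀ x → d x x ≡ 0)
  (d-sym : ∀ x y → d x y ≡ d y x)
  (d-trans : ∀ x y z → d x y ≡ 0 → d y z ≡ 0 → d x z ≡ 0)
  (gap : ∀ x y → d x y ≡ 0 ⊎ m ℕ.≤ d x y)
  where

  total : ℕ → ℕ
  total n = sumN n (λ x → sumN n (d x))

  Zero : ℕ → Set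
  Zero n = ∀ x y → x ℕ.< n → y ℕ.< n → d x y ≡ 0

  row : ∀ n z → (∀ x → x ℕ.< n → d x z ≡ 0) ⊎ (m ℕ.≤ sumN n (λ x → d x z))
  row zero z = inj₁ (λ _ ())
  row (suc n) z with row n z | gap n z
  ... | inj₂ h | _ = inj₂ (ℕₚ.≤-trans h (ℕₚ.m≤m+n _ _))
  ... | inj₁ h | inj₂ g = inj₂ (ℕₚ.≤-trans g (ℕₚ.m≤n+m _ _))
  ... | inj₁ h | inj₁ g = inj₁ all
    where
    all : ∀ x → x ℕ.< suc n → d x z ≡ 0
    all x x<n with x ℕ.≟ n
    ... | yes refl = g
    ... | no x≢n = h x (ℕₚ.≤∧≢⇒< (ℕₚ.≤-pred x<n) x≢n)

  total-suc : ∀ n → total (suc n) ≡ total n ℕ.+ 2 ℕ.* sumN n (λ x → d x n)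
  total-suc n = trans (cong₂ ℕ._+_ (sumN-+ n (λ x → sumN n (d x)) (λ x → d x n))
        (trans (cong (sumN n (d n) ℕ.+_) (d-refl n))
          (trans (ℕₚ.+-identityʳ _) (sumN-cong n (λ k _ → d-sym n k)))))
    (l (total n) (sumN n (λ x → d x n)))
    where l : ∀ a b → a ℕ.+ b ℕ.+ b ≡ a ℕ.+ 2 ℕ.* b
          l = ℕsolve-∀

  -- If not all points are equivalent, then at least n - 1 unordered pairs are inequivalent.
  total-≥ : ∀ n → Zero n ⊎ (2 ℕ.* n ℕ.* m ℕ.≤ total n ℕ.+ 2 ℕ.* m)
  total-≥ zero = inj₁ (λ _ _ ())
  total-≥ (suc n) with row n n
  ... | inj₁ rz = inj₁ all
    where
    to-n : ∀ x → x ℕ.< suc n → d x n ≡ 0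
    to-n x x<n with x ℕ.≟ n
    ... | yes refl = d-refl n
    ... | no x≢n = rz x (ℕₚ.≤∧≢⇒< (ℕₚ.≤-pred x<n) x≢n)
    all : Zero (suc n)
    all x y x<n y<n = d-trans x n y (to-n x x<n) (trans (d-sym n y) (to-n y y<n))
  ... | inj₂ r with total-≥ n
  ... | inj₂ big = inj₂ (begin
    2 ℕ.* suc n ℕ.* m ≡⟨ l₁ n m ⟩
    2 ℕ.* n ℕ.* m ℕ.+ 2 ℕ.* m ≤⟨ ℕₚ.+-mono-≤ big (ℕₚ.*-monoʳ-≤ 2 r) ⟩
    total n ℕ.+ 2 ℕ.* m ℕ.+ 2 ℕ.* sumN n (λ x → d x n) ≡⟨ l₂ (total n) m (sumN n (λ x → d x n)) ⟩
    total n ℕ.+ 2 ℕ.* sumN n (λ x → d x n) ℕ.+ 2 ℕ.* m ≡⟨ cong (ℕ._+ 2 ℕ.* m) (total-suc n) ⟨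
    total (suc n) ℕ.+ 2 ℕ.* m ∎)
    where
    open ℕₚ.≤-Reasoning
    l₁ : ∀ n m → 2 ℕ.* (1 ℕ.+ n) ℕ.* m ≡ 2 ℕ.* n ℕ.* m ℕ.+ 2 ℕ.* m
    l₁ = ℕsolve-∀
    l₂ : ∀ t m s → t ℕ.+ 2 ℕ.* m ℕ.+ 2 ℕ.* s ≡ t ℕ.+ 2 ℕ.* s ℕ.+ 2 ℕ.* m
    l₂ = ℕsolve-∀
  ... | inj₁ zr = inj₂ (begin
    2 ℕ.* suc n ℕ.* m ≡⟨ l₁ n m ⟩
    2 ℕ.* (n ℕ.* m) ℕ.+ 2 ℕ.* m ≤⟨ ℕₚ.+-monoˡ-≤ (2 ℕ.* m) (ℕₚ.*-monoʳ-≤ 2 (sumN-≥ n m each)) ⟩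
    2 ℕ.* sumN n (λ x → d x n) ℕ.+ 2 ℕ.* m ≤⟨ ℕₚ.+-monoˡ-≤ (2 ℕ.* m) (ℕₚ.m≤n+m _ (total n)) ⟩
    total n ℕ.+ 2 ℕ.* sumN n (λ x → d x n) ℕ.+ 2 ℕ.* m ≡⟨ cong (ℕ._+ 2 ℕ.* m) (total-suc n) ⟨
    total (suc n) ℕ.+ 2 ℕ.* m ∎)
    where
    open ℕₚ.≤-Reasoning
    l₁ : ∀ n m → 2 ℕ.* (1 ℕ.+ n) ℕ.* m ≡ 2 ℕ.* (n ℕ.* m) ℕ.+ 2 ℕ.* m
    l₁ = ℕsolve-∀
    each : ∀ x → x ℕ.< n → m ℕ.≤ d x n
    each x x<n with gap x n
    ... | inj₂ g = g
    ... | inj₁ e = ℕₚ.≤-trans r (ℕₚ.≤-trans (ℕₚ.≤-reflexive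
            (sumN-0 n (λ y y<n → d-trans y x n (zr y x y<n x<n) e))) z≤n)

  -- Two nonzero entries would already contribute 2m.
  few : ∀ n (g : ℕ → ℕ) → (∀ x → g x ≡ 0 ⊎ m ℕ.≤ g x) → sumN n g ℕ.< 2 ℕ.* m →
        (∀ x → x ℕ.< n → g x ≡ 0) ⊎ (Σ ℕ λ x₁ → (x₁ ℕ.< n) × (g x₁ ≢ 0) × (∀ x → x ℕ.< n → x ≢ x₁ → g x ≡ 0))
  few zero g gg s = inj₁ (λ _ ())
  few (suc n) g gg s with gg n | few n g gg (ℕₚ.≤-<-trans (ℕₚ.m≤m+n (sumN n g) (g n)) s)
  ... | inj₁ e | inj₁ h = inj₁ (λ x x<n → extend x x<n)
    where
    extend : ∀ x → x ℕ.< suc n → g x ≡ 0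
    extend x x<n with x ℕ.≟ n
    ... | yes refl = e
    ... | no x≢n = h x (ℕₚ.≤∧≢⇒< (ℕₚ.≤-pred x<n) x≢n)
  ... | inj₁ e | inj₂ (x₁ , x₁<n , ne , h) = inj₂ (x₁ , ℕₚ.m<n⇒m<1+n x₁<n , ne , extend)
    where
    extend : ∀ x → x ℕ.< suc n → x ≢ x₁ → g x ≡ 0
    extend x x<n x≢ with x ℕ.≟ n
    ... | yes refl = e
    ... | no x≢n = h x (ℕₚ.≤∧≢⇒< (ℕₚ.≤-pred x<n) x≢n) x≢
  ... | inj₂ l | inj₁ h with g n ℕ.≟ 0
  ...   | yes e = inj₁ (λ x x<n → extend x x<n)
    where
    extend : ∀ x → x ℕ.< suc n → g x ≡ 0
    extend x x<n with x ℕ.≟ n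
    ... | yes refl = e
    ... | no x≢n = h x (ℕₚ.≤∧≢⇒< (ℕₚ.≤-pred x<n) x≢n)
  ...   | no ne = inj₂ (n , ℕₚ.n<1+n n , ne , λ x x<n x≢n → h x (ℕₚ.≤∧≢⇒< (ℕₚ.≤-pred x<n) x≢n))
  few (suc n) g gg s | inj₂ l | inj₂ (x₁ , x₁<n , ne , h) with gg x₁
  ...   | inj₁ e = ⊥-elim (ne e)
  ...   | inj₂ l′ = ⊥-elim (ℕₚ.<⇒≱ s (subst (ℕ._≤ sumN n g ℕ.+ g n) (cong (m ℕ.+_) (sym (ℕₚ.+-identityʳ m)))
          (ℕₚ.+-mono-≤ (ℕₚ.≤-trans l′ (term≤sumN n g x₁ x₁<n)) l)))

  -- On average the row sums lie below 2m, so some point b is inequivalent to at most one point; it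
  -- is so to exactly one, since otherwise all points would be equivalent and the total zero.
  outlier : ∀ n → 0 ℕ.< m → total n ≢ 0 → total n ℕ.< n ℕ.* (2 ℕ.* m) →
            Σ ℕ λ b → Σ ℕ λ x₁ → (b ℕ.< n) × (x₁ ℕ.< n) × (d b x₁ ≢ 0) × (∀ x → x ℕ.< n → x ≢ x₁ → d b x ≡ 0)
  outlier n 0<m ne small with find-small n (λ x → sumN n (d x)) (2 ℕ.* m)
  ... | inj₁ h = ⊥-elim (ℕₚ.<⇒≱ small (sumN-≥ n (2 ℕ.* m) h))
  ... | inj₂ (b , b<n , l) with few n (d b) (gap b) l
  ... | inj₁ z = ⊥-elim (ne (sumN-0 n (λ x x<n → sumN-0 n
            (λ y y<n → d-trans x b y (trans (d-sym x b) (z x x<n)) (z y y<n)))))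
  ... | inj₂ (x₁ , x₁<n , ne₁ , h) = b , x₁ , b<n , x₁<n , ne₁ , h

  -- The row and the column of the outlier contribute n k each.
  outlier-total : ∀ n x₁ k → x₁ ℕ.< suc n → (∀ x → x ℕ.< suc n → x ≢ x₁ → d x₁ x ≡ k) →
      2 ℕ.* n ℕ.* k ℕ.≤ total (suc n)
  outlier-total n x₁ k x₁<n h = ℕₚ.≤-trans (ℕₚ.≤-trans (ℕₚ.≤-reflexive (l n k))
        (ℕₚ.+-monoˡ-≤ (n ℕ.* k) row-x₁))
      (sumN-except n (λ x → sumN (suc n) (d x)) x₁ k x₁<n
          (λ y y<n y≢ → ℕₚ.≤-trans (ℕₚ.≤-reflexive (sym (trans (d-sym y x₁) (h y y<n y≢))))
            (term≤sumN (suc n) (d y) x₁ x₁<n)))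
    where
    l : ∀ n k → 2 ℕ.* n ℕ.* k ≡ n ℕ.* k ℕ.+ n ℕ.* k
    l = ℕsolve-∀
    row-x₁ : n ℕ.* k ℕ.≤ sumN (suc n) (d x₁)
    row-x₁ = ℕₚ.≤-trans (ℕₚ.m≤n+m (n ℕ.* k) (d x₁ x₁))
        (sumN-except n (d x₁) x₁ k x₁<n (λ y y<n y≢ → ℕₚ.≤-reflexive (sym (h y y<n y≢))))

sq : ℤ → ℕ
sq z = ℤ.∣ z ∣ ℕ.* ℤ.∣ z ∣

sq-pos : ∀ z → z ℤ.* z ≡ + sq z
sq-pos (+ n) = sym (ℤₚ.pos-* n n)
sq-pos -[1+ n ] = refl

sq≡0 : ∀ z → sq z ≡ 0 → z ≡ + 0
sq≡0 z e = ℤₚ.∣i∣≡0⇒i≡0 ([ id , id ]′ (ℕₚ.m*n≡0⇒m≡0∨n≡0 ℤ.∣ z ∣ e))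

sq-neg : ∀ z → sq (ℤ.- z) ≡ sq z
sq-neg z = cong₂ ℕ._*_ (ℤₚ.∣-i∣≡∣i∣ z) (ℤₚ.∣-i∣≡∣i∣ z)

sq≤1 : ∀ z → sq z ≢ 0 → sq z ℕ.≤ 1 → (z ≡ + 1) ⊎ (z ≡ ℤ.- + 1)
sq≤1 (+ 0) ne l = ⊥-elim (ne refl)
sq≤1 (+ 1) ne l = inj₁ refl
sq≤1 (+ suc (suc n)) ne (s≤s ())
sq≤1 -[1+ 0 ] ne l = inj₂ refl
sq≤1 -[1+ suc n ] ne (s≤s ())

sub≡0 : ∀ x y → x ℤ.- y ≡ + 0 → x ≡ y
sub≡0 x y e = Z.sub-0⇒≈ e

module Differences (v : ℕ → ℤ) where
  d : ℕ → ℕ → ℕ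
  d x y = sq (v x ℤ.- v y)

  neg-sub′ : ∀ a b → ℤ.- (a ℤ.- b) ≡ b ℤ.- a
  neg-sub′ = solve-∀

  d≡0 : ∀ x y → d x y ≡ 0 → v x ≡ v y
  d≡0 x y e = sub≡0 (v x) (v y) (sq≡0 _ e)

  v≡⇒d≡0 : ∀ {x y} → v x ≡ v y → d x y ≡ 0
  v≡⇒d≡0 {x} {y} e = cong sq (trans (cong (ℤ._- v y) e) (ℤₚ.+-inverseʳ (v y)))

  gap : ∀ x y → d x y ≡ 0 ⊎ 1 ℕ.≤ d x y
  gap x y with d x y
  ... | zero = inj₁ refl
  ... | suc _ = inj₂ (s≤s z≤n)

  open Gap d 1 (λ x → v≡⇒d≡0 {x} {x} refl)
    (λ x y → trans (sym (sq-neg (v x ℤ.- v y))) (cong sq (neg-sub′ (v x) (v y))))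
    (λ x y z e f → v≡⇒d≡0 {x} {z} (trans (d≡0 x y e) (d≡0 y z f))) gap public

  constant : ∀ n → total n ≡ 0 → ∀ x y → x ℕ.< n → y ℕ.< n → v x ≡ v y
  constant n e x y x<n y<n = d≡0 x y (sumN≡0 n (sumN≡0 n e x x<n) y y<n)

-- A p × q array of integers with few nonvanishing mixed second differences is, up to
-- functions of the row and functions of the column, plus or minus the indicator of one cell.
module Array (c : ℕ → ℕ → ℤ) (p′ q′ : ℕ) (0<p′ : 0 ℕ.< p′) (0<q′ : 0 ℕ.< q′) where
  p q : ℕ
  p = suc p′
  q = suc q′

  module Δ (v : ℕ → ℤ) = Differences v

  diff : ℕ → ℕ → ℕ → ℤ
  diff x x′ y = c x y ℤ.- c x′ y

  -- Distance 0 means that two rows differ by a constant.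
  d₂ : ℕ → ℕ → ℕ
  d₂ x x′ = Δ.total (diff x x′) q

  total-cong : ∀ (v v′ : ℕ → ℤ) → (∀ y y′ → y ℕ.< q → y′ ℕ.< q → Δ.d v y y′ ≡ Δ.d v′ y y′) → Δ.total v q
      ≡ Δ.total v′ q
  total-cong v v′ h = sumN-cong q (λ y y<q → sumN-cong q (λ y′ y′<q → h y y′ y<q y′<q))

  total-const : ∀ (v : ℕ → ℤ) → (∀ y y′ → y ℕ.< q → y′ ℕ.< q → v y ≡ v y′) → Δ.total v q ≡ 0
  total-const v h = sumN-0 q (λ y y<q → sumN-0 q (λ y′ y′<q → Δ.v≡⇒d≡0 v (h y y′ y<q y′<q)))

  d₂-refl : ∀ x → d₂ x x ≡ 0
  d₂-refl x = total-const (diff x x) (λ y y′ _ _ → trans (ℤₚ.+-inverseʳ (c x y))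
        (sym (ℤₚ.+-inverseʳ (c x y′))))

  d₂-sym : ∀ x x′ → d₂ x x′ ≡ d₂ x′ x
  d₂-sym x x′ = total-cong (diff x x′) (diff x′ x)
      (λ y y′ _ _ → trans (sym (sq-neg (diff x x′ y ℤ.- diff x x′ y′)))
        (cong sq (l (c x y) (c x′ y) (c x y′) (c x′ y′))))
    where l : ∀ a b e f → ℤ.- (a ℤ.- b ℤ.- (e ℤ.- f)) ≡ b ℤ.- a ℤ.- (f ℤ.- e)
          l = solve-∀

  d₂-trans : ∀ x y z → d₂ x y ≡ 0 → d₂ y z ≡ 0 → d₂ x z ≡ 0
  d₂-trans x y z e f = total-const (diff x z) (λ j j′ j<q j′<q → trans (l (c x j) (c y j) (c z j))
        (trans (cong₂ ℤ._+_ (Δ.constant (diff x y) q e j j′ j<q j′<q)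
            (Δ.constant (diff y z) q f j j′ j<q j′<q)) (sym (l (c x j′) (c y j′) (c z j′)))))
    where l : ∀ a b e → a ℤ.- e ≡ a ℤ.- b ℤ.+ (b ℤ.- e)
          l = solve-∀

  -- A nonconstant sequence of q integers has at least q - 1 unordered pairs of unequal entries, and
  -- each is counted twice.
  gap₂ : ∀ x y → d₂ x y ≡ 0 ⊎ 2 ℕ.* q′ ℕ.≤ d₂ x y
  gap₂ x y with Δ.total-≥ (diff x y) q
  ... | inj₁ z = inj₁ (sumN-0 q (λ j j<q → sumN-0 q (λ j′ j′<q → z j j′ j<q j′<q)))
  ... | inj₂ big = inj₂ (ℕₚ.+-cancelʳ-≤ 2 _ _ (subst (ℕ._≤ d₂ x y ℕ.+ 2) (l q′) big))
    where l : ∀ q → 2 ℕ.* (1 ℕ.+ q) ℕ.* 1 ≡ 2 ℕ.* q ℕ.+ 2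
          l = ℕsolve-∀

  module G₂ = Gap d₂ (2 ℕ.* q′) d₂-refl d₂-sym d₂-trans gap₂

  mixedᵃ : ℕ → ℕ → ℕ → ℕ → ℤ
  mixedᵃ x x′ y y′ = diff x x′ y ℤ.- diff x x′ y′

  Cell : Set
  Cell = Σ ℕ λ x₁ → Σ ℕ λ y₁ → Σ ℤ λ δ → (x₁ ℕ.< p) × (y₁ ℕ.< q) × ((δ ≡ + 1) ⊎ (δ ≡ ℤ.- + 1)) ×
         (∀ x y → x ℕ.< p → y ℕ.< q → x ≢ x₁ → y ≢ y₁ → mixedᵃ x₁ x y₁ y ≡ δ)

  lt : ∀ k n → 0 ℕ.< k → 2 ℕ.* n ℕ.* k ℕ.< suc n ℕ.* (2 ℕ.* k)
  lt (suc k) n _ = subst (2 ℕ.* n ℕ.* suc k ℕ.<_) (l n k)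
      (ℕₚ.m<n+m (2 ℕ.* n ℕ.* suc k) {2 ℕ.* suc k} (s≤s z≤n))
    where l : ∀ n k → 2 ℕ.* (1 ℕ.+ k) ℕ.+ 2 ℕ.* n ℕ.* (1 ℕ.+ k) ≡ (1 ℕ.+ n) ℕ.* (2 ℕ.* (1 ℕ.+ k))
          l = ℕsolve-∀

  2q′>0 : 0 ℕ.< 2 ℕ.* q′
  2q′>0 = ℕₚ.≤-trans 0<q′ (ℕₚ.m≤m+n q′ _)

  -- Used on the rows, `outlier` finds x₁. Row x₁ minus any other row is D₀ up to a constant, so the
  -- bound 4(p - 1)(q - 1) on the total leaves D₀ a total of at most 2(q - 1). Used on D₀, `outlier`
  -- finds y₁, and the same count shows that the nonzero δ has square at most 1.
  cell : G₂.total p ≢ 0 → G₂.total p ℕ.≤ 2 ℕ.* p′ ℕ.* (2 ℕ.* q′) → Cell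
  cell ne le = from-row (G₂.outlier p 2q′>0 ne (ℕₚ.≤-<-trans le (lt (2 ℕ.* q′) p′ 2q′>0)))
    where
    from-row : (Σ ℕ λ b → Σ ℕ λ x₁ → (b ℕ.< p) × (x₁ ℕ.< p) × (d₂ b x₁ ≢ 0) ×
          (∀ x → x ℕ.< p → x ≢ x₁ → d₂ b x ≡ 0)) → Cell
    from-row (b , x₁ , b<p , x₁<p , ne₁ , h) = from-col
        (Δ.outlier D₀ q (s≤s z≤n) QD≢0 (ℕₚ.≤-<-trans QD≤
            (subst (ℕ._< q ℕ.* 2) (ℕₚ.*-identityʳ (2 ℕ.* q′)) (lt 1 q′ (s≤s z≤n)))))
      where
      D₀ : ℕ → ℤ
      D₀ = diff x₁ b
      QD≢0 : Δ.total D₀ q ≢ 0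
      QD≢0 e = ne₁ (trans (d₂-sym b x₁) e)
      l : ∀ a b e a′ b′ e′ → (b ℤ.- e) ≡ (b′ ℤ.- e′) → a ℤ.- e ℤ.- (a′ ℤ.- e′) ≡ a ℤ.- b ℤ.- (a′ ℤ.- b′)
      l a b e a′ b′ e′ h = trans (l₁ a b e a′ b′ e′)
          (trans (cong (λ z → a ℤ.- b ℤ.- (a′ ℤ.- b′) ℤ.+ (z ℤ.- (b′ ℤ.- e′))) h)
            (l₂ (a ℤ.- b ℤ.- (a′ ℤ.- b′)) (b′ ℤ.- e′)))
        where l₁ : ∀ a b e a′ b′ e′ → a ℤ.- e ℤ.- (a′ ℤ.- e′) ≡ a ℤ.- b ℤ.- (a′ ℤ.- b′) ℤ.+
                  (b ℤ.- e ℤ.- (b′ ℤ.- e′))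
              l₁ = solve-∀
              l₂ : ∀ x y → x ℤ.+ (y ℤ.- y) ≡ x
              l₂ = solve-∀
      rows : ∀ x → x ℕ.< p → x ≢ x₁ → ∀ y y′ → y ℕ.< q → y′ ℕ.< q → mixedᵃ x₁ x y y′ ≡ D₀ y ℤ.- D₀ y′
      rows x x<p x≢ y y′ y<q y′<q = l (c x₁ y) (c b y) (c x y) (c x₁ y′) (c b y′) (c x y′)
          (Δ.constant (diff b x) q (h x x<p x≢) y y′ y<q y′<q)
      QD≤ : Δ.total D₀ q ℕ.≤ 2 ℕ.* q′
      QD≤ = ℕₚ.*-cancelˡ-≤ (2 ℕ.* p′) {{ℕ.>-nonZero (ℕₚ.≤-trans 0<p′ (ℕₚ.m≤m+n p′ _))}}
          (ℕₚ.≤-trans (G₂.outlier-total p′ x₁ (Δ.total D₀ q) x₁<p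
              (λ x x<p x≢ → total-cong (diff x₁ x) D₀
                (λ y y′ y<q y′<q → cong sq (rows x x<p x≢ y y′ y<q y′<q)))) le)
      from-col : (Σ ℕ λ b → Σ ℕ λ y₁ → (b ℕ.< q) × (y₁ ℕ.< q) × (Δ.d D₀ b y₁ ≢ 0) ×
            (∀ y → y ℕ.< q → y ≢ y₁ → Δ.d D₀ b y ≡ 0)) → Cell
      from-col (b′ , y₁ , b′<q , y₁<q , ne₂ , h₂) =
          x₁ , y₁ , δ , x₁<p , y₁<q , sq≤1 δ sqδ≢0 sqδ≤1 , λ x y x<p y<q x≢ y≢ → trans
          (rows x x<p x≢ y₁ y y₁<q y<q) (cong (λ z → D₀ y₁ ℤ.- z) (sym (Δ.d≡0 D₀ b′ y (h₂ y y<q y≢))))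
        where
        δ : ℤ
        δ = D₀ y₁ ℤ.- D₀ b′
        sqδ : Δ.d D₀ b′ y₁ ≡ sq δ
        sqδ = trans (sym (sq-neg (D₀ b′ ℤ.- D₀ y₁))) (cong sq (Δ.neg-sub′ D₀ (D₀ b′) (D₀ y₁)))
        sqδ≢0 : sq δ ≢ 0
        sqδ≢0 e = ne₂ (trans sqδ e)
        sqδ≤1 : sq δ ℕ.≤ 1
        sqδ≤1 = ℕₚ.*-cancelˡ-≤ (2 ℕ.* q′) {{ℕ.>-nonZero 2q′>0}}
            (ℕₚ.≤-trans (Δ.outlier-total D₀ q′ y₁ (sq δ) y₁<q
                (λ y y<q y≢ → cong (λ z → sq (D₀ y₁ ℤ.- z)) (sym (Δ.d≡0 D₀ b′ y (h₂ y y<q y≢)))))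
              (ℕₚ.≤-trans QD≤ (ℕₚ.≤-reflexive (sym (ℕₚ.*-identityʳ (2 ℕ.* q′))))))

∑<-except : ∀ n f x c → x ℕ.< n → f x ≡ + 0 → (∀ k → k ℕ.< n → k ≢ x → f k ≡ c) → Z.∑< n f ≡
    (+ n ℤ.- + 1) ℤ.* c
∑<-except n f x c x<n fx h = begin
  Z.∑< n f ≡⟨ Z.∑<-congᵃ n (λ k → l (f k) c) ⟩
  Z.∑< n (λ k → (f k ℤ.- c) ℤ.+ c) ≡⟨ Z.∑<-+ n (λ k → f k ℤ.- c) (λ _ → c) ⟩
  Z.∑< n (λ k → f k ℤ.- c) ℤ.+ Z.∑< n (λ _ → c)
    ≡⟨ cong₂ ℤ._+_ (Z.∑<-single n (λ k → f k ℤ.- c) x x<n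
        (λ k k<n k≢x → trans (cong (ℤ._- c) (h k k<n k≢x)) (ℤₚ.+-inverseʳ c))) (Z.∑<-const n c) ⟩
  (f x ℤ.- c) ℤ.+ + n ℤ.* c ≡⟨ cong (λ z → (z ℤ.- c) ℤ.+ + n ℤ.* c) fx ⟩
  (+ 0 ℤ.- c) ℤ.+ + n ℤ.* c ≡⟨ l′ (+ n) c ⟩
  (+ n ℤ.- + 1) ℤ.* c ∎
  where
  open ≡-Reasoning
  l : ∀ x c → x ≡ (x ℤ.- c) ℤ.+ c
  l = solve-∀
  l′ : ∀ n c → (+ 0 ℤ.- c) ℤ.+ n ℤ.* c ≡ (n ℤ.- + 1) ℤ.* c
  l′ = solve-∀

≋-scale : ∀ {n p n′ x y} → + n ≡ + p ℤ.* + n′ → x Z.≋ y [ + p ] → x ℤ.* + n′ Z.≋ y ℤ.* + n′ [ + n ]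
≋-scale {n} {p} {n′} {x} {y} e h = Z.congr (Z.∣-resp (l x y (+ n′))
      (Z.∣-respˡ (sym e) (Z.∣-*-mono (Z.∣-diff h) (Z.∣-refl {+ n′}))))
  where l : ∀ x y n → (x ℤ.- y) ℤ.* n ≡ x ℤ.* n ℤ.- y ℤ.* n
        l = solve-∀

arrayTotal : (ℕ → ℕ → ℤ) → ℕ → ℕ → ℕ
arrayTotal c p q = sumN p (λ x → sumN p (λ x′ → sumN q
        (λ y → sumN q (λ y′ → sq (c x y ℤ.- c x′ y ℤ.- (c x y′ ℤ.- c x′ y′))))))

ArrayCell : (ℕ → ℕ → ℤ) → ℕ → ℕ → Set
ArrayCell c p q = Σ ℕ λ x₁ → Σ ℕ λ y₁ → Σ ℤ λ δ → (x₁ ℕ.< p) × (y₁ ℕ.< q) × ((δ ≡ + 1) ⊎ (δ ≡ ℤ.- + 1)) ×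
  (∀ x y → x ℕ.< p → y ℕ.< q → x ≢ x₁ → y ≢ y₁ → c x₁ y₁ ℤ.- c x y₁ ℤ.- (c x₁ y ℤ.- c x y) ≡ δ)

array-cell : ∀ c {p q} p′ q′ → p ≡ suc p′ → q ≡ suc q′ → 1 ℕ.< p → 1 ℕ.< q → arrayTotal c p q ≢ 0 →
    arrayTotal c p q ℕ.≤ 2 ℕ.* p′ ℕ.* (2 ℕ.* q′) → ArrayCell c p q
array-cell c p′ q′ refl refl (s≤s 0<p′) (s≤s 0<q′) = Array.cell c p′ q′ 0<p′ 0<q′

find-nonzero₂ : ∀ m n (f : ℕ → ℕ → ℕ) → sumN m (λ r → sumN n (f r)) ≢ 0 → Σ ℕ λ r → Σ ℕ λ s → (r ℕ.< m) ×
    (s ℕ.< n) × (f r s ≢ 0)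
find-nonzero₂ m n f ne = let (r , r<m , h) = find m (λ r → sumN n (f r)) ne
                             (s , s<n , h′) = find n (f r) h in r , s , r<m , s<n , h′
  where
  find : ∀ n (g : ℕ → ℕ) → sumN n g ≢ 0 → Σ ℕ λ r → (r ℕ.< n) × (g r ≢ 0)
  find zero g ne = ⊥-elim (ne refl)
  find (suc n) g ne with g n ℕ.≟ 0
  ... | no h = n , ℕₚ.n<1+n n , h
  ... | yes e = let (r , r<n , h) = find n g (λ z → ne (cong₂ ℕ._+_ z e)) in r , ℕₚ.m<n⇒m<1+n r<n , h

-- Kronecker's theorem: elements with X conj X = 1.

module Kronecker (S : Setting) (C : CyclotomicRing S) where
  open Setting S
  open CyclotomicRing C
  open RingTools algebra
  open RingPowers algebra
  open Cyclotomic S C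

  open W₁ using () renaming (n′ to n₁′; step to step₁)
  open W₂ using () renaming (n′ to n₂′; step to step₂)

  instance
    n₁≢0 : ℕ.NonZero n₁
    n₁≢0 = W₁.n≢0
    n₂≢0 : ℕ.NonZero n₂
    n₂≢0 = W₂.n≢0

  -- The trace of 1 divided by N/(p₁ p₂), that is φ(p₁ p₂).
  φ : ℤ
  φ = (+ p₁ ℤ.- + 1) ℤ.* (+ p₂ ℤ.- + 1)

  hat-1-0 : hat 1# (+ 0) (+ 0) ≡ φ
  hat-1-0 = trans (hat-1 (+ 0) (+ 0)) (cong₂ ℤ._*_ W₁.w-0 W₂.w-0)

  sum-squares-0 : ∀ m n (f : ℕ → ℕ → ℤ) → Z.∑< m (λ k → Z.∑< n (λ l → f k l ℤ.* f k l)) ≡ + 0 → ∀ k l →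
      k ℕ.< m → l ℕ.< n → f k l ≡ + 0
  sum-squares-0 m n f e k l k<m l<n = sq≡0 (f k l) (sumN≡0 n (sumN≡0 m total k k<m) l l<n)
    where
    total : sumN m (λ k → sumN n (λ l → sq (f k l))) ≡ 0
    total = ℤₚ.+-injective (trans (sym (sumN-pos m _))
          (trans (Z.∑<-congᵃ m (λ k → trans (sym (sumN-pos n _)) (Z.∑<-congᵃ n (λ l → sym (sq-pos (f k l))))))
            e))

  hat-residue : ∀ X k l → hat X k l ≡ hat X (+ (k ℤ.%ℕ n₁)) (+ (l ℤ.%ℕ n₂))
  hat-residue X k l = trans (hat-per₁ X l (≋-%ℕ k n₁)) (hat-per₂ X _ (≋-%ℕ l n₂))

  hat-vanish : ∀ {X} → (∀ k l → k ℕ.< n₁ → l ℕ.< n₂ → hat X (+ k) (+ l) ≡ + 0) → X ≈ 0#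
  hat-vanish {X} h = hat-ext (λ k l → trans (hat-residue X k l)
        (trans (h _ _ (n%ℕd<d k n₁) (n%ℕd<d l n₂)) (sym (hat-0 k l))))

  -- By `parseval` the trace of X conj X is a positive multiple of a sum of squares of integers;
  -- this stands in for positivity under the complex embeddings.
  definite : ∀ X → hat (X * conj X) (+ 0) (+ 0) ≡ + 0 → X ≈ 0#
  definite X e = hat-vanish (sum-squares-0 n₁ n₂ (λ k l → hat X (+ k) (+ l))
        (trans (parseval X X) (trans (cong (+ p₁ ℤ.* + p₂ ℤ.*_) e) (ℤₚ.*-zeroʳ (+ p₁ ℤ.* + p₂)))))

  module _ (X : Carrier) where

    -- For fixed r and s, the coefficients on one coset of the subgroup of order p₁ p₂, laid out as
    -- a p₁ by p₂ array.
    cz : ℕ → ℕ → ℤ → ℤ → ℤ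
    cz r s x y = coef X (+ r ℤ.+ x ℤ.* + n₁′) (+ s ℤ.+ y ℤ.* + n₂′)

    cz-per₁ : ∀ r s y → Periodic p₁ (λ x → cz r s x y)
    cz-per₁ r s y {x} {x′} h = coef-per₁ X _ (≋-shift {+ n₁} {x ℤ.* + n₁′} {x′ ℤ.* + n₁′} (+ r)
          (≋-scale W₁.n≡ h))

    cz-per₂ : ∀ r s x → Periodic p₂ (cz r s x)
    cz-per₂ r s x {y} {y′} h = coef-per₂ X _ (≋-shift {+ n₂} {y ℤ.* + n₂′} {y′ ℤ.* + n₂′} (+ s)
          (≋-scale W₂.n≡ h))

    mx : ℕ → ℕ → ℤ → ℤ → ℤ → ℤ → ℤ
    mx r s x x′ y y′ = cz r s x y ℤ.- cz r s x′ y ℤ.- (cz r s x y′ ℤ.- cz r s x′ y′)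

    mx-per₁ : ∀ r s x y y′ → Periodic p₁ (λ x′ → mx r s x x′ y y′)
    mx-per₁ r s x y y′ h = cong₂ (λ a b → cz r s x y ℤ.- a ℤ.- (cz r s x y′ ℤ.- b)) (cz-per₁ r s y h)
        (cz-per₁ r s y′ h)

    mx-per₂ : ∀ r s x x′ y → Periodic p₂ (mx r s x x′ y)
    mx-per₂ r s x x′ y h = cong₂ (λ a b → cz r s x y ℤ.- cz r s x′ y ℤ.- (a ℤ.- b)) (cz-per₂ r s x h)
        (cz-per₂ r s x′ h)

    pos-lin : ∀ r x n → + (r ℕ.+ x ℕ.* n) ≡ + r ℤ.+ + x ℤ.* + n
    pos-lin r x n = cong (ℤ._+_ (+ r)) (ℤₚ.pos-* x n)

    mixed-mx : ∀ r s i j x y → mixed X i j (+ (r ℕ.+ x ℕ.* n₁′)) (+ (s ℕ.+ y ℕ.* n₂′)) ≡ mx r s (+ x)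
        (+ x ℤ.+ + i) (+ y) (+ y ℤ.+ + j)
    mixed-mx r s i j x y rewrite pos-lin r x n₁′ | pos-lin s y n₂′ =
      cong₂ (λ a b → coef X (+ r ℤ.+ + x ℤ.* + n₁′) (+ s ℤ.+ + y ℤ.* + n₂′) ℤ.- coef X a
          (+ s ℤ.+ + y ℤ.* + n₂′) ℤ.- (coef X (+ r ℤ.+ + x ℤ.* + n₁′) b ℤ.- coef X a b))
        (l (+ r) (+ x) (+ i) (+ n₁′)) (l (+ s) (+ y) (+ j) (+ n₂′))
      where l : ∀ r x i n → r ℤ.+ x ℤ.* n ℤ.+ i ℤ.* n ≡ r ℤ.+ (x ℤ.+ i) ℤ.* n
            l = solve-∀

    arr : ℕ → ℕ → ℕ → ℕ → ℤ
    arr r s x y = cz r s (+ x) (+ y)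

    ∑∑-cong : ∀ m n {f g : ℕ → ℕ → ℤ} → (∀ k l → f k l ≡ g k l) → Z.∑< m (λ k → Z.∑< n (f k)) ≡ Z.∑< m
        (λ k → Z.∑< n (g k))
    ∑∑-cong m n h = Z.∑<-congᵃ m (λ k → Z.∑<-congᵃ n (h k))

    -- Grouping the positions by cosets turns shifts by subgroup elements into pairs of rows and
    -- pairs of columns of the arrays.
    energy-arrays : Z.∑< n₁′ (λ r → Z.∑< n₂′ (λ s → + arrayTotal (arr r s) p₁ p₂)) ≡ + 4 ℤ.* hat (X * conj X)
        (+ 0) (+ 0)
    energy-arrays = sym (begin
      + 4 ℤ.* hat (X * conj X) (+ 0) (+ 0) ≡⟨ energy X ⟨
      Z.∑< p₁ (λ i → Z.∑< n₁ (λ k → Z.∑< p₂ (λ j → Z.∑< n₂ (λ l → M² i j (+ k) (+ l)))))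
        ≡⟨ ∑∑-cong p₁ n₁ (λ i k → cols i (+ k)) ⟩
      Z.∑< p₁ (λ i → Z.∑< n₁ (λ k → Z.∑< n₂′ (λ s → K i (+ k) s)))
        ≡⟨ Z.∑<-congᵃ p₁ (λ i → trans (Z.∑<-blocks n₁′ p₁ (λ k → Z.∑< n₂′ (λ s → K i (+ k) s)))
            (Z.∑<-congᵃ n₁′ (λ r → Z.∑<-swap p₁ n₂′ (λ x s → K i (+ (r ℕ.+ x ℕ.* n₁′)) s)))) ⟩
      Z.∑< p₁ (λ i → Z.∑< n₁′ (λ r → Z.∑< n₂′ (λ s → Z.∑< p₁ (λ x → K i (+ (r ℕ.+ x ℕ.* n₁′)) s))))
        ≡⟨ trans (Z.∑<-swap p₁ n₁′ _) (Z.∑<-congᵃ n₁′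
            (λ r → trans (Z.∑<-swap p₁ n₂′ _) (Z.∑<-congᵃ n₂′ (λ s → trans (Z.∑<-swap p₁ p₁ _) (rows r s)))))
          ⟩
      Z.∑< n₁′ (λ r → Z.∑< n₂′ (λ s → + arrayTotal (arr r s) p₁ p₂)) ∎)
      where
      open ≡-Reasoning
      M² : ℕ → ℕ → ℤ → ℤ → ℤ
      M² i j k l = mixed X i j k l ℤ.* mixed X i j k l
      K : ℕ → ℤ → ℕ → ℤ
      K i k s = Z.∑< p₂ (λ y → Z.∑< p₂ (λ j → M² i j k (+ (s ℕ.+ y ℕ.* n₂′))))
      cols : ∀ i k → Z.∑< p₂ (λ j → Z.∑< n₂ (λ l → M² i j k (+ l))) ≡ Z.∑< n₂′ (λ s → K i k s)
      cols i k = trans (Z.∑<-congᵃ p₂ (λ j → Z.∑<-blocks n₂′ p₂ (λ l → M² i j k (+ l))))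
          (trans (Z.∑<-swap p₂ n₂′ _) (Z.∑<-congᵃ n₂′ (λ s → Z.∑<-swap p₂ p₂ _)))
      Q : ℕ → ℕ → ℤ → ℤ → ℤ
      Q r s x x′ = Z.∑< p₂ (λ y → Z.∑< p₂ (λ y′ → mx r s x x′ (+ y) (+ y′) ℤ.* mx r s x x′ (+ y) (+ y′)))
      Q-per : ∀ r s x → Periodic p₁ (Q r s x)
      Q-per r s x h = ∑∑-cong p₂ p₂ (λ y y′ → cong₂ ℤ._*_ (mx-per₁ r s x (+ y) (+ y′) h)
            (mx-per₁ r s x (+ y) (+ y′) h))
      K-Q : ∀ r s i x → K i (+ (r ℕ.+ x ℕ.* n₁′)) s ≡ Q r s (+ x) (+ x ℤ.+ + i)
      K-Q r s i x = Z.∑<-congᵃ p₂ (λ y → trans (Z.∑<-congᵃ p₂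
              (λ j → cong₂ ℤ._*_ (mixed-mx r s i j x y) (mixed-mx r s i j x y)))
        (∑-shift p₂ (+ y) (λ y′ → mx r s (+ x) (+ x ℤ.+ + i) (+ y) y′ ℤ.* mx r s (+ x) (+ x ℤ.+ + i) (+ y) y′)
            (λ h → cong₂ ℤ._*_ (mx-per₂ r s (+ x) (+ x ℤ.+ + i) (+ y) h)
              (mx-per₂ r s (+ x) (+ x ℤ.+ + i) (+ y) h))))
      rows : ∀ r s → Z.∑< p₁ (λ x → Z.∑< p₁ (λ i → K i (+ (r ℕ.+ x ℕ.* n₁′)) s)) ≡ + arrayTotal
          (arr r s) p₁ p₂
      rows r s = trans (Z.∑<-congᵃ p₁ (λ x → trans (Z.∑<-congᵃ p₁ (λ i → K-Q r s i x))
              (trans (∑-shift p₁ (+ x) (Q r s (+ x)) (Q-per r s (+ x)))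
        (trans (Z.∑<-congᵃ p₁ (λ x′ → trans (Z.∑<-congᵃ p₂
                (λ y → trans (Z.∑<-congᵃ p₂ (λ y′ → sq-pos (mx r s (+ x) (+ x′) (+ y) (+ y′))))
                (sumN-pos p₂ _))) (sumN-pos p₂ _))) (sumN-pos p₁ _))))) (sumN-pos p₁ _)

    -- By `hat-mixed` the trace at the exceptional cell is the sum of the mixed differences based
    -- there; those along its own row or column vanish, and the (p₁ - 1)(p₂ - 1) others equal δ.
    hat-cell : ∀ r s x₁ y₁ δ → x₁ ℕ.< p₁ → y₁ ℕ.< p₂ →
               (∀ x y → x ℕ.< p₁ → y ℕ.< p₂ → x ≢ x₁ → y ≢ y₁ → mx r s (+ x₁) (+ x) (+ y₁) (+ y) ≡ δ) →
               hat X (+ (r ℕ.+ x₁ ℕ.* n₁′)) (+ (s ℕ.+ y₁ ℕ.* n₂′)) ≡ φ ℤ.* δ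
    hat-cell r s x₁ y₁ δ x₁<p y₁<q h = begin
      hat X (+ (r ℕ.+ x₁ ℕ.* n₁′)) (+ (s ℕ.+ y₁ ℕ.* n₂′)) ≡⟨ hat-mixed X _ _ ⟩
      Z.∑< p₁ (λ i → Z.∑< p₂ (λ j → mixed X i j (+ (r ℕ.+ x₁ ℕ.* n₁′)) (+ (s ℕ.+ y₁ ℕ.* n₂′))))
        ≡⟨ Z.∑<-congᵃ p₁ (λ i → trans (Z.∑<-congᵃ p₂ (λ j → mixed-mx r s i j x₁ y₁))
            (∑-shift p₂ (+ y₁) (mx r s (+ x₁) (+ x₁ ℤ.+ + i) (+ y₁))
              (mx-per₂ r s (+ x₁) (+ x₁ ℤ.+ + i) (+ y₁)))) ⟩
      Z.∑< p₁ (λ i → Z.∑< p₂ (λ y → mx r s (+ x₁) (+ x₁ ℤ.+ + i) (+ y₁) (+ y)))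
        ≡⟨ ∑-shift p₁ (+ x₁) (λ x → Z.∑< p₂ (λ y → mx r s (+ x₁) x (+ y₁) (+ y)))
          (λ e → Z.∑<-congᵃ p₂ (λ y → mx-per₁ r s (+ x₁) (+ y₁) (+ y) e)) ⟩
      Z.∑< p₁ (λ x → Z.∑< p₂ (λ y → mx r s (+ x₁) (+ x) (+ y₁) (+ y)))
        ≡⟨ ∑<-except p₁ _ x₁ ((+ p₂ ℤ.- + 1) ℤ.* δ) x₁<p
          (Z.∑<-0 p₂ (λ y _ → l₁ (arr r s x₁ y₁) (arr r s x₁ y)))
             (λ x x<p x≢ → ∑<-except p₂ _ y₁ δ y₁<q (l₂ (arr r s x₁ y₁) (arr r s x y₁))
                 (λ y y<q y≢ → h x y x<p y<q x≢ y≢)) ⟩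
      (+ p₁ ℤ.- + 1) ℤ.* ((+ p₂ ℤ.- + 1) ℤ.* δ) ≡⟨ ℤₚ.*-assoc (+ p₁ ℤ.- + 1) (+ p₂ ℤ.- + 1) δ ⟨
      φ ℤ.* δ ∎
      where
      open ≡-Reasoning
      l₁ : ∀ a b → a ℤ.- a ℤ.- (b ℤ.- b) ≡ + 0
      l₁ = solve-∀
      l₂ : ∀ a b → a ℤ.- b ℤ.- (a ℤ.- b) ≡ + 0
      l₂ = solve-∀

    -- the equality case of Cauchy–Schwarz for the trace form
    extremal : ∀ k l δ → (δ ≡ + 1) ⊎ (δ ≡ ℤ.- + 1) → hat (X * conj X) (+ 0) (+ 0) ≡ φ → hat X k l ≡ φ ℤ.* δ →
        X ≈ ι δ * ζ (ℤ.- k) (ℤ.- l)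
    extremal k l δ δ± norm e = sub-0⇒≈ (definite V (begin
      hat (V * conj V) (+ 0) (+ 0) ≡⟨ hat-cong expand (+ 0) (+ 0) ⟩
      hat ((X * conj X - ι δ * (X * conj Y)) - (ι δ * conj (X * conj Y) - ι (δ ℤ.* δ) * 1#)) (+ 0) (+ 0)
        ≡⟨ trans (hat-sub _ _ (+ 0) (+ 0)) (cong₂ ℤ._-_
            (trans (hat-sub _ _ (+ 0) (+ 0)) (cong₂ ℤ._-_ norm
                (trans (hat-ι δ _ (+ 0) (+ 0)) (cong (δ ℤ.*_) XY))))
             (trans (hat-sub _ _ (+ 0) (+ 0)) (cong₂ ℤ._-_
                   (trans (hat-ι δ _ (+ 0) (+ 0)) (cong (δ ℤ.*_) (trans (hat-conj _ (+ 0) (+ 0)) XY)))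
                   (trans (hat-ι (δ ℤ.* δ) _ (+ 0) (+ 0)) (cong (δ ℤ.* δ ℤ.*_) hat-1-0))))) ⟩
      φ ℤ.- δ ℤ.* (φ ℤ.* δ) ℤ.- (δ ℤ.* (φ ℤ.* δ) ℤ.- δ ℤ.* δ ℤ.* φ) ≡⟨ l₀ φ δ ⟩
      φ ℤ.* (+ 1 ℤ.- δ ℤ.* δ) ≡⟨ cong (λ z → φ ℤ.* (+ 1 ℤ.- z)) δ² ⟩
      φ ℤ.* (+ 1 ℤ.- + 1) ≡⟨ ℤₚ.*-zeroʳ φ ⟩
      + 0 ∎))
      where
      open ≡-Reasoning
      Y = ζ (ℤ.- k) (ℤ.- l)
      V = X - ι δ * Y
      δ² : δ ℤ.* δ ≡ + 1
      δ² = [ (λ { refl → refl }) , (λ { refl → refl }) ]′ δ±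
      l₀ : ∀ f d → f ℤ.- d ℤ.* (f ℤ.* d) ℤ.- (d ℤ.* (f ℤ.* d) ℤ.- d ℤ.* d ℤ.* f) ≡ f ℤ.* (+ 1 ℤ.- d ℤ.* d)
      l₀ = solve-∀
      XY : hat (X * conj Y) (+ 0) (+ 0) ≡ φ ℤ.* δ
      XY = trans (hat-cong (≈-trans (*-comm X _) (*-cong
                (≈-trans (conj-ζ (ℤ.- k) (ℤ.- l)) (≈-reflexive
                (cong₂ ζ (ℤₚ.neg-involutive k) (ℤₚ.neg-involutive l)))) (≈-refl {X}))) (+ 0) (+ 0))
          (trans (hat-ζ k l X (+ 0) (+ 0)) (trans (cong₂ (hat X) (ℤₚ.+-identityˡ k) (ℤₚ.+-identityˡ l)) e))
      l₁ : ∀ x x̄ d y ȳ → (x - d * y) * (x̄ - d * ȳ) ≈ (x * x̄ - d * (x * ȳ)) -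
          (d * (x̄ * y) - (d * d) * (ȳ * y))
      l₁ = solve 5 (λ x x̄ d y ȳ → (x :- d :* y) :* (x̄ :- d :* ȳ) := (x :* x̄ :- d :* (x :* ȳ)) :-
            (d :* (x̄ :* y) :- (d :* d) :* (ȳ :* y))) ≈-refl
      expand : V * conj V ≈ (X * conj X - ι δ * (X * conj Y)) - (ι δ * conj (X * conj Y) - ι (δ ℤ.* δ) * 1#)
      expand = ≈-trans (*-cong (≈-refl {V}) (≈-trans (conj-sub X (ι δ * Y))
              (-‿cong₂ ≈-refl (≈-trans (conj-* (ι δ) Y) (*-cong (conj-ι δ) ≈-refl)))))
        (≈-trans (l₁ X (conj X) (ι δ) Y (conj Y)) (-‿cong₂ ≈-refl
              (-‿cong₂ (*-cong ≈-refl (≈-sym (≈-trans (conj-* X (conj Y)) (*-cong ≈-refl (conj-conj Y)))))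
                (*-cong (≈-sym (ι-* δ δ)) (≈-trans (*-cong (conj-ζ (ℤ.- k) (ℤ.- l)) ≈-refl)
                (ζ-inv (ℤ.- k) (ℤ.- l)))))))

    -- The totals of all arrays add up to 4φ. Some array has a nonzero total, which is at most 4φ,
    -- so it has an exceptional cell and one trace of X is ± φ. This is the extreme value allowed by
    -- Cauchy-Schwarz, whence X is ± a root of unity.
    kronecker : X * conj X ≈ 1# → Σ ℤ λ δ → Σ ℤ λ a → Σ ℤ λ b → ((δ ≡ + 1) ⊎ (δ ≡ ℤ.- + 1)) ×
        (X ≈ ι δ * ζ a b)
    kronecker XX̄ = from-array (find-nonzero₂ n₁′ n₂′ T
          (λ e → 4q≢0 (ℤₚ.+-injective (trans (sym total) (cong +_ e)))))
      where
      q₁ = 2 ℕ.* half₁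
      q₂ = 2 ℕ.* half₂
      T : ℕ → ℕ → ℕ
      T r s = arrayTotal (arr r s) p₁ p₂
      norm : hat (X * conj X) (+ 0) (+ 0) ≡ φ
      norm = trans (hat-cong XX̄ (+ 0) (+ 0)) hat-1-0
      pred-pos : ∀ {p h} → p ≡ suc h → + p ℤ.- + 1 ≡ + h
      pred-pos {p} {h} refl = l (+ h)
        where l : ∀ x → (+ 1 ℤ.+ x) ℤ.- + 1 ≡ x
              l = solve-∀
      total : + sumN n₁′ (λ r → sumN n₂′ (T r)) ≡ + (2 ℕ.* q₁ ℕ.* (2 ℕ.* q₂))
      total = begin
        + sumN n₁′ (λ r → sumN n₂′ (T r)) ≡⟨ sumN-pos n₁′ _ ⟨
        Z.∑< n₁′ (λ r → + sumN n₂′ (T r)) ≡⟨ Z.∑<-congᵃ n₁′ (λ r → sumN-pos n₂′ (T r)) ⟨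
        Z.∑< n₁′ (λ r → Z.∑< n₂′ (λ s → + T r s)) ≡⟨ energy-arrays ⟩
        + 4 ℤ.* hat (X * conj X) (+ 0) (+ 0) ≡⟨ cong (+ 4 ℤ.*_)
          (trans norm (cong₂ ℤ._*_ (pred-pos odd₁) (pred-pos odd₂))) ⟩
        + 4 ℤ.* (+ q₁ ℤ.* + q₂) ≡⟨ cong (+ 4 ℤ.*_) (ℤₚ.pos-* q₁ q₂) ⟨
        + 4 ℤ.* + (q₁ ℕ.* q₂) ≡⟨ ℤₚ.pos-* 4 (q₁ ℕ.* q₂) ⟨
        + (4 ℕ.* (q₁ ℕ.* q₂)) ≡⟨ cong +_ (l q₁ q₂) ⟩
        + (2 ℕ.* q₁ ℕ.* (2 ℕ.* q₂)) ∎
        where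
        open ≡-Reasoning
        l : ∀ a b → 4 ℕ.* (a ℕ.* b) ≡ 2 ℕ.* a ℕ.* (2 ℕ.* b)
        l = ℕsolve-∀
      q>0 : ∀ {p q} → Prime p → p ≡ suc q → 0 ℕ.< q
      q>0 pr refl = ℕₚ.≤-pred (prime>1 pr)
      4q≢0 : 2 ℕ.* q₁ ℕ.* (2 ℕ.* q₂) ≢ 0
      4q≢0 e = ℕₚ.<⇒≢ (ℕₚ.*-mono-≤ {1} {2 ℕ.* q₁} {1} {2 ℕ.* q₂} (ℕₚ.≤-trans (q>0 pr₁ odd₁) (ℕₚ.m≤m+n q₁ _))
            (ℕₚ.≤-trans (q>0 pr₂ odd₂) (ℕₚ.m≤m+n q₂ _))) (sym e)
      from-array : (Σ ℕ λ r → Σ ℕ λ s → (r ℕ.< n₁′) × (s ℕ.< n₂′) × (T r s ≢ 0)) → Σ ℤ λ δ → Σ ℤ λ a →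
          Σ ℤ λ b → ((δ ≡ + 1) ⊎ (δ ≡ ℤ.- + 1)) × (X ≈ ι δ * ζ a b)
      from-array (r , s , r<n , s<n , ne) = from-cell
          (array-cell (arr r s) q₁ q₂ odd₁ odd₂ (prime>1 pr₁) (prime>1 pr₂) ne
          (ℕₚ.≤-trans (ℕₚ.≤-trans (term≤sumN n₂′ (T r) s s<n) (term≤sumN n₁′ (λ r → sumN n₂′ (T r)) r r<n))
              (ℕₚ.≤-reflexive (ℤₚ.+-injective total))))
        where
        from-cell : ArrayCell (arr r s) p₁ p₂ → Σ ℤ λ δ → Σ ℤ λ a → Σ ℤ λ b → ((δ ≡ + 1) ⊎ (δ ≡ ℤ.- + 1)) ×
            (X ≈ ι δ * ζ a b)
        from-cell (x₁ , y₁ , δ , x₁<p , y₁<q , δ± , h) = δ , _ , _ , δ± , extremal _ _ δ δ± norm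
            (hat-cell r s x₁ y₁ δ x₁<p y₁<q h)

-- Total ramification at p₁ and p₂, and self-conjugacy.

-- Evaluation of (1 - y)^p at y = 1: the p + 1 coefficients sum to 0, and each is 1 plus p + 1 times
-- a `cycloCoeff`.
sum-cycloCoeff : ∀ {p} (pr : Prime (suc p)) → 0 ℕ.< p → Z.∑< (suc p) (cycloCoeff pr) ≡ ℤ.- + 1
sum-cycloCoeff {p@(suc p-1)} pr _ = ℤₚ.*-cancelˡ-≡ (+ suc p) _ _
    (sub≡0 _ _ (trans (trans (l (+ suc p) (Z.∑< (suc p) (cycloCoeff pr))) (sym eq)) refl))
  where
  open ≡-Reasoning
  l : ∀ n s → n ℤ.* s ℤ.- n ℤ.* (ℤ.- + 1) ≡ n ℤ.* + 1 ℤ.+ n ℤ.* s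
  l = solve-∀
  eq : + 0 ≡ + suc p ℤ.* + 1 ℤ.+ + suc p ℤ.* Z.∑< (suc p) (cycloCoeff pr)
  eq = begin
    + 0 ≡⟨⟩
    (+ 1 ℤ.- + 1) Z.^ p ≡⟨ ZP.1-y^ p (+ 1) ⟩
    Z.∑< (suc p) (λ j → sbinom p j ℤ.* (+ 1) Z.^ j) ≡⟨ Z.∑<-cong (suc p)
      (λ j j<p → trans (cong (sbinom p j ℤ.*_) (Z.1^ j))
        (trans (ℤₚ.*-identityʳ _) (cycloCoeff-spec pr j (ℕₚ.≤-pred j<p)))) ⟩
    Z.∑< (suc p) (λ j → + 1 ℤ.+ + suc p ℤ.* cycloCoeff pr j) ≡⟨ Z.∑<-+ (suc p) _ _ ⟩
    Z.∑< (suc p) (λ _ → + 1) ℤ.+ Z.∑< (suc p) (λ j → + suc p ℤ.* cycloCoeff pr j) ≡⟨ cong₂ ℤ._+_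
      (Z.∑<-const (suc p) (+ 1)) (sym (Z.∑<-*ˡ (+ suc p) (suc p) (cycloCoeff pr))) ⟩
    + suc p ℤ.* + 1 ℤ.+ + suc p ℤ.* Z.∑< (suc p) (cycloCoeff pr) ∎

module SelfConjugate (S : Setting) (C : CyclotomicRing S) where
  open Setting S
  open CyclotomicRing C
  open RingTools algebra
  open RingPowers algebra
  open Cyclotomic S C
  open import Relation.Binary.Reasoning.Setoid setoid

  frobenius-iterate : ∀ {p} → Prime p → ∀ s X → X ^ (p ℕ.^ s) ≋ ψ (+ (p ℕ.^ s)) X [ ι (+ p) ]
  frobenius-iterate pr zero X = ≈⇒≋ (≈-trans (*-identityʳ X) (≈-sym (ψ-1 X)))
  frobenius-iterate {p} pr (suc s) X =
    ≋-trans (≈⇒≋ (≈-sym (^-assocʳ X p (p ℕ.^ s))))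
    (≋-trans (≋-^ (p ℕ.^ s) (frobenius pr X))
    (≋-trans (frobenius-iterate pr s (ψ (+ p) X))
    (≈⇒≋ (≈-trans (ψ-ψ (+ (p ℕ.^ s)) (+ p) X) (≈-reflexive
            (cong (λ z → ψ z X) (trans (ℤₚ.*-comm (+ (p ℕ.^ s)) (+ p)) (sym (ℤₚ.pos-* p (p ℕ.^ s))))))))))

  ι-pow : ∀ c n → ι (c Z.^ n) ≈ ι c ^ n
  ι-pow c zero = ι-1
  ι-pow c (suc n) = ≈-trans (ι-* c (c Z.^ n)) (*-cong ≈-refl (ι-pow c n))

  -- p is totally ramified in the subring generated by g, with prime element π = 1 - g
  module Ramified (p h e N′ : ℕ) (pr : Prime p) (p≡ : p ≡ suc (2 ℕ.* h)) (g : Carrier)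
    (ψ-g : ∀ n → ψ (+ n) (1# - g) ≈ 1# - g ^ n)
    (coset : ∑< p (λ j → (g ^ (p ℕ.^ e)) ^ j) ≈ 0#)
    (cancel : ∀ Z → (1# - g) * Z ≈ 0# → Z ≈ 0#)
    (ψ-modπ : ∀ {s t} X → s Z.≋ t [ + N′ ] → ψ s X ≋ ψ t X [ 1# - g ])
    (selfconj : Σ ℕ λ s → (+ p) Z.^ s Z.≋ ℤ.- + 1 [ + N′ ])
    (N′∤2 : ¬ + N′ Z.∣ + 2)
    (conj-g : conj g * g ≈ 1#)
    where

    π ρ y : Carrier
    π = 1# - g
    y = g ^ (p ℕ.^ e)
    ρ = 1# - y

    y^≋1 : ∀ j → y ^ j ≋ 1# [ ρ ]
    y^≋1 j = ≋-sym (congr (1-y∣1-y^ y j))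

    -- The coefficients of (1 - y)^(p-1) are 1 plus multiples of p, and the powers of y sum to 0, so
    -- p divides out. As y ≡ 1 modulo ρ, the cofactor is congruent to the sum of the `cycloCoeff`,
    -- that is to -1.
    ρ-power : Σ Carrier λ r → ρ ^ (2 ℕ.* h) ≈ ι (+ p) * (ρ * r - 1#)
    ρ-power = go p≡
      where
      go : p ≡ suc (2 ℕ.* h) → Σ Carrier λ r → ρ ^ (2 ℕ.* h) ≈ ι (+ p) * (ρ * r - 1#)
      go refl = _∣_.quotient (∣-diff z≋-1) , (begin
        ρ ^ q ≈⟨ 1-y^ q y ⟩
        ∑< p (λ j → ι (sbinom q j) * y ^ j) ≈⟨ ∑<-cong p
          (λ j j<p → ≈-trans (*-cong (≈-trans (≈-reflexive (cong ι (cycloCoeff-spec pr j (ℕₚ.≤-pred j<p))))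
                (≈-trans (ι-+ (+ 1) _) (+-cong ι-1 (ι-* (+ p) (cycloCoeff pr j))))) ≈-refl)
            (l₁ (ι (+ p)) (ι (cycloCoeff pr j)) (y ^ j))) ⟩
        ∑< p (λ j → y ^ j + ι (+ p) * (ι (cycloCoeff pr j) * y ^ j)) ≈⟨ ∑<-+ p _ _ ⟩
        ∑< p (λ j → y ^ j) + ∑< p (λ j → ι (+ p) * (ι (cycloCoeff pr j) * y ^ j)) ≈⟨ +-cong coset
          (≈-sym (∑<-*ˡ (ι (+ p)) p _)) ⟩
        0# + ι (+ p) * z ≈⟨ +-identityˡ _ ⟩
        ι (+ p) * z ≈⟨ *-cong ≈-refl (≈-trans (≈-sym (cancel- z (- 1#)))
            (+-cong (_∣_.equality (∣-diff z≋-1)) ≈-refl)) ⟩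
        ι (+ p) * (ρ * _∣_.quotient (∣-diff z≋-1) - 1#) ∎)
        where
        q = 2 ℕ.* h
        z = ∑< p (λ j → ι (cycloCoeff pr j) * y ^ j)
        l₁ : ∀ n d x → (1# + n * d) * x ≈ x + n * (d * x)
        l₁ = solve 3 (λ n d x → (con (+ 1) :+ n :* d) :* x := x :+ n :* (d :* x)) ≈-refl
        ι-∑ : ∀ n f → ι (Z.∑< n f) ≈ ∑< n (λ j → ι (f j))
        ι-∑ zero f = ι-0
        ι-∑ (suc n) f = ≈-trans (ι-+ _ _) (+-cong (ι-∑ n f) ≈-refl)
        z≋-1 : z ≋ - 1# [ ρ ]
        z≋-1 = ≋-trans (∑<-≋ p (λ j _ → ≋-* (≋-refl {ι (cycloCoeff pr j)}) (y^≋1 j)))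
          (≈⇒≋ (≈-trans (∑<-congᵃ p (λ j → *-identityʳ _))
                (≈-trans (≈-sym (ι-∑ p (cycloCoeff pr)))
                  (≈-trans (≈-reflexive (cong ι (sum-cycloCoeff pr (ℕₚ.≤-pred (prime>1 pr)))))
                  (≈-trans (ι-neg (+ 1)) (-‿cong ι-1))))))

    ιp∣ρ-power : ι (+ p) ∣ ρ ^ (2 ℕ.* h)
    ιp∣ρ-power = divides _ (proj₂ ρ-power)

    -- A bootstrap from p = p ρ r - ρ^(p-1): if ρ^i divides p and i < p - 1, then ρ^(i+1) divides
    -- the right side. In this way ρ r - 1 acts as a unit without being inverted.
    ρ^i∣ιp : ∀ i → i ℕ.≤ 2 ℕ.* h → ρ ^ i ∣ ι (+ p)
    ρ^i∣ιp zero _ = divides (ι (+ p)) (≈-sym (*-identityˡ _))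
    ρ^i∣ιp (suc i) i<q = ∣-resp eq (∣-sub (∣-*ʳ (proj₁ ρ-power)
            (∣-*-mono (∣-refl {ρ}) (ρ^i∣ιp i (ℕₚ.<⇒≤ i<q)))) (∣-^ ρ i<q))
      where
      l : ∀ c d r → d * c * r - c * (d * r - 1#) ≈ c
      l = solve 3 (λ c d r → d :* c :* r :- c :* (d :* r :- con (+ 1)) := c) ≈-refl
      eq : ρ * ι (+ p) * proj₁ ρ-power - ρ ^ (2 ℕ.* h) ≈ ι (+ p)
      eq = ≈-trans (-‿cong₂ ≈-refl (proj₂ ρ-power)) (l (ι (+ p)) ρ (proj₁ ρ-power))

    h>0 : 0 ℕ.< h
    h>0 = go h p≡
      where
      go : ∀ h → p ≡ suc (2 ℕ.* h) → 0 ℕ.< h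
      go zero e = ⊥-elim (ℕₚ.<⇒≢ (prime>1 pr) (sym e))
      go (suc h) e = s≤s z≤n

    ρ²∣ιp : ρ ^ 2 ∣ ι (+ p)
    ρ²∣ιp = ρ^i∣ιp 2 (ℕₚ.*-monoʳ-≤ 2 h>0)

    π^P≋ρ : π ^ (p ℕ.^ e) ≋ ρ [ ι (+ p) ]
    π^P≋ρ = ≋-trans (frobenius-iterate pr e π) (≈⇒≋ (ψ-g (p ℕ.^ e)))

    π∣ρ : π ∣ ρ
    π∣ρ = 1-y∣1-y^ g (p ℕ.^ e)

    ρ∣π^P : ρ ∣ π ^ (p ℕ.^ e)
    ρ∣π^P = ≋-∣ (≋-sym (≋-weaken (∣-trans (∣-respˡ (*-identityʳ ρ) (∣-^ ρ {1} {2} (s≤s z≤n))) ρ²∣ιp) π^P≋ρ))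
        ∣-refl

    -- The same bootstrap: π^(p^e) - ρ is divisible by p, hence by ρ², and ρ² is divisible by
    -- π^(i+1) once π^i divides ρ.
    π^i∣ρ : ∀ i → i ℕ.≤ p ℕ.^ e → π ^ i ∣ ρ
    π^i∣ρ zero _ = divides ρ (≈-sym (*-identityˡ ρ))
    π^i∣ρ (suc i) i<P = ∣-resp (l (π ^ (p ℕ.^ e)) ρ)
        (∣-sub (∣-^ π i<P) (∣-trans (∣-*-mono π∣ρ (π^i∣ρ i (ℕₚ.<⇒≤ i<P)))
            (∣-trans (∣-respˡ (l₂ ρ) ρ²∣ιp) (∣-diff π^P≋ρ))))
      where
      l : ∀ a b → a - (a - b) ≈ b
      l = solve 2 (λ a b → a :- (a :- b) := b) ≈-refl
      l₂ : ∀ r → r * (r * 1#) ≈ r * r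
      l₂ = solve 1 (λ r → r :* (r :* con (+ 1)) := r :* r) ≈-refl

    -- The ramification index φ(p^(e+1)): p and π^v divide each other.
    v : ℕ
    v = (p ℕ.^ e) ℕ.* (2 ℕ.* h)

    π^v∣ιp : π ^ v ∣ ι (+ p)
    π^v∣ιp = ∣-respˡ (^-assocʳ π (p ℕ.^ e) (2 ℕ.* h))
        (∣-trans (∣-^-mono (2 ℕ.* h) (π^i∣ρ (p ℕ.^ e) ℕₚ.≤-refl)) (ρ^i∣ιp (2 ℕ.* h) ℕₚ.≤-refl))

    ιp∣π^v : ι (+ p) ∣ π ^ v
    ιp∣π^v = ∣-resp (^-assocʳ π (p ℕ.^ e) (2 ℕ.* h)) (∣-trans ιp∣ρ-power (∣-^-mono (2 ℕ.* h) ρ∣π^P))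

    π∣ιp : π ∣ ι (+ p)
    π∣ιp = ∣-trans π∣ρ (∣-trans (∣-respˡ (*-identityʳ ρ) (∣-^ ρ {1} {2} (s≤s z≤n))) ρ²∣ιp)

    -- modulo π, conjugation is a power of Frobenius
    radical : ∀ X → π ∣ X * conj X → π ∣ X
    radical X d = go (proj₁ selfconj) (proj₂ selfconj)
      where
      go : ∀ s → (+ p) Z.^ s Z.≋ ℤ.- + 1 [ + N′ ] → π ∣ X
      go zero e = ⊥-elim (N′∤2 (Z.∣-diff e))
      -- With q = p^(s+1), Y^q ≡ conj Y modulo π for all Y. So X^(q+1) ≡ X conj X ≡ 0, while X^(q²)
      -- ≡ X, and q + 1 ≤ q².
      go (suc s) e = ≋-∣ X≋ (∣-resp (≈-sym (^-homo-* X (suc q) (q ℕ.* q ℕ.∸ suc q)))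
            (∣-*ʳ (X ^ (q ℕ.* q ℕ.∸ suc q)) X^q+1))
        where
        q = p ℕ.^ suc s
        instance _ = prime⇒nonZero pr
        2≤q : 2 ℕ.≤ q
        2≤q = ℕₚ.≤-trans (prime>1 pr) (ℕₚ.m≤m*n p (p ℕ.^ s) {{ℕₚ.m^n≢0 p s}})
        sq<q² : suc q ℕ.≤ q ℕ.* q
        sq<q² = ℕₚ.≤-trans (ℕₚ.+-monoˡ-≤ q (ℕₚ.≤-trans (s≤s z≤n) 2≤q))
            (ℕₚ.≤-trans (ℕₚ.≤-reflexive (cong (q ℕ.+_) (sym (ℕₚ.+-identityʳ q)))) (ℕₚ.*-monoˡ-≤ q 2≤q))
        q≋-1 : + q Z.≋ ℤ.- + 1 [ + N′ ]
        q≋-1 = Z.≋-trans (Z.≈⇒≋ (pos-^ p (suc s))) e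
        X^q≋ : ∀ Y → Y ^ q ≋ conj Y [ π ]
        X^q≋ Y = ≋-trans (≋-weaken π∣ιp (frobenius-iterate pr (suc s) Y)) (ψ-modπ Y q≋-1)
        X^q+1 : π ∣ X ^ suc q
        X^q+1 = ≋-∣ (≋-sym (≋-* (≋-refl {X}) (X^q≋ X))) d
        X≋ : X ^ (suc q ℕ.+ (q ℕ.* q ℕ.∸ suc q)) ≋ X [ π ]
        X≋ = ≋-trans (≈⇒≋ (≈-trans (≈-reflexive (cong (X ^_) (ℕₚ.m+[n∸m]≡n sq<q²))) (≈-sym (^-assocʳ X q q))))
            (≋-trans (≋-^ q (X^q≋ X)) (≋-trans (X^q≋ (conj X)) (≈⇒≋ (conj-conj X))))

    conj-π : conj π ≈ - conj g * π
    conj-π = ≈-trans (conj-sub 1# g) (≈-trans (-‿cong₂ (≈-trans conj-1 (≈-sym conj-g)) ≈-refl) (l (conj g) g))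
      where l : ∀ ḡ g → ḡ * g - ḡ ≈ - ḡ * (1# - g)
            l = solve 2 (λ ḡ g → ḡ :* g :- ḡ := :- ḡ :* (con (+ 1) :- g)) ≈-refl

    cancel-∣ : ∀ {a b} → π * a ∣ π * b → a ∣ b
    cancel-∣ {a} {b} (divides Q f) = divides Q (sub-0⇒≈ (cancel _ (≈-trans (l π a b Q) (≈⇒sub-0 f))))
      where l : ∀ π a b Q → π * (b - a * Q) ≈ π * b - π * a * Q
            l = solve 4 (λ π a b Q → π :* (b :- a :* Q) := π :* b :- π :* a :* Q) ≈-refl

    -- π divides X by `radical`, and conj π is π times the unit -conj g, so removing π from X
    -- removes π² from X conj X.
    halve : ∀ j X → π ^ (j ℕ.+ j) ∣ X * conj X → π ^ j ∣ X
    halve zero X d = divides X (≈-sym (*-identityˡ X))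
    halve (suc j) X d with radical X (∣-trans (∣-*ʳ (π ^ (j ℕ.+ suc j)) ∣-refl) d)
    ... | divides X′ f = ∣-resp (≈-sym f) (∣-*-mono (∣-refl {π}) (halve j X′ (cancel-∣ (cancel-∣ d′))))
      where
      l₁ : ∀ π x ḡ x̄ → π * x * (- ḡ * π * x̄) ≈ - ḡ * (π * (π * (x * x̄)))
      l₁ = solve 4 (λ π x ḡ x̄ → π :* x :* (:- ḡ :* π :* x̄) := :- ḡ :* (π :* (π :* (x :* x̄)))) ≈-refl
      eq : X * conj X ≈ - conj g * (π * (π * (X′ * conj X′)))
      eq = ≈-trans (*-cong f (≈-trans (conj-cong f) (≈-trans (conj-* π X′) (*-cong conj-π ≈-refl))))
          (l₁ π X′ (conj g) (conj X′))
      l₂ : ∀ g ḡ x → - g * (- ḡ * x) ≈ ḡ * g * x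
      l₂ = solve 3 (λ g ḡ x → :- g :* (:- ḡ :* x) := ḡ :* g :* x) ≈-refl
      d′ : π * (π * π ^ (j ℕ.+ j)) ∣ π * (π * (X′ * conj X′))
      d′ = ∣-respˡ (≈-reflexive (cong (λ z → π * π ^ z) (ℕₚ.+-suc j j)))
          (∣-resp (≈-trans (l₂ g (conj g) _) (≈-trans (*-cong conj-g ≈-refl) (*-identityˡ _)))
            (∣-*ˡ (- g) (∣-resp eq d)))

    self-conjugate : ∀ k Z → ι (+ p) ^ (k ℕ.+ k) ∣ Z * conj Z → ι (+ p) ^ k ∣ Z
    self-conjugate k Z d = ∣-trans (∣-resp (^-assocʳ π v k) (∣-^-mono k ιp∣π^v))
        (halve (v ℕ.* k) Z (∣-trans (∣-respˡ (≈-trans (^-assocʳ π v (k ℕ.+ k))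
              (≈-reflexive (cong (π ^_) (ℕₚ.*-distribˡ-+ v k k)))) (∣-^-mono (k ℕ.+ k) π^v∣ιp)) d))

  ∤2 : ∀ {p n} → Prime p → Comax (+ p) (+ 2) → + p Z.∣ + n → ¬ + n Z.∣ + 2
  ∤2 pr c d d′ = comax⇒∤ pr c (Z.∣-trans d d′)

  n∤1 : ∀ {p n} → Prime p → + p Z.∣ + n → ¬ + n Z.∣ + 1
  n∤1 pr d d′ = comax⇒∤ pr comax-1ʳ (Z.∣-trans d d′)

  fixed-0 : ∀ {g Z} → (1# - g) * Z ≈ 0# → g * Z ≋ Z [ 0# ]
  fixed-0 {g} {Z} h = ≋-sym (congr (∣-resp (≈-trans (≈-sym h) (l g Z)) ∣0))
    where l : ∀ g z → (1# - g) * z ≈ z - g * z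
          l = solve 2 (λ g z → (con (+ 1) :- g) :* z := z :- g :* z) ≈-refl

  ψ-sub-ζ : ∀ n a b → ψ (+ n) (1# - ζ a b) ≈ 1# - ζ a b ^ n
  ψ-sub-ζ n a b = ≈-trans (ψ-+ (+ n) 1# (- ζ a b))
      (+-cong (ψ-one (+ n)) (≈-trans (ψ-neg (+ n) (ζ a b))
          (-‿cong (≈-trans (ψ-ζ (+ n) a b) (≈-sym (ζ-^ n a b))))))

  conj-ζ-* : ∀ a b → conj (ζ a b) * ζ a b ≈ 1#
  conj-ζ-* a b = ≈-trans (*-cong (conj-ζ a b) ≈-refl) (ζ-inv a b)

  ζ-^^ : ∀ P j a b → (ζ a b ^ P) ^ j ≈ ζ (+ j ℤ.* + P ℤ.* a) (+ j ℤ.* + P ℤ.* b)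
  ζ-^^ P j a b = ≈-trans (^-congˡ j (ζ-^ P a b)) (≈-trans (ζ-^ j (+ P ℤ.* a) (+ P ℤ.* b))
        (≈-reflexive (cong₂ ζ (sym (ℤₚ.*-assoc (+ j) (+ P) a)) (sym (ℤₚ.*-assoc (+ j) (+ P) b)))))

  module R₁ = Ramified p₁ half₁ e₁ n₂ pr₁ odd₁ (ζ (+ 1) (+ 0)) (λ n → ψ-sub-ζ n (+ 1) (+ 0))
    (≈-trans (∑<-congᵃ p₁ (λ j → ≈-trans (ζ-^^ (p₁ ℕ.^ e₁) j (+ 1) (+ 0))
            (≈-reflexive (cong₂ ζ (ℤₚ.*-identityʳ _) (ℤₚ.*-zeroʳ (+ j ℤ.* + W₁.n′)))))) (ζ-coset₁ (+ 0)))
    (λ Z h → ι-zero (+ p₁) (0∣⇒≈0 (fixed₁ (+ 1) (+ 0) (fixed-0 h) (n∤1 pr₁ W₁.p∣n))))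
    ψ-mod₁ selfconj₁ (∤2 pr₂ comax₂-2 W₂.p∣n) (conj-ζ-* (+ 1) (+ 0))

  module R₂ = Ramified p₂ half₂ e₂ n₁ pr₂ odd₂ (ζ (+ 0) (+ 1)) (λ n → ψ-sub-ζ n (+ 0) (+ 1))
    (≈-trans (∑<-congᵃ p₂ (λ j → ≈-trans (ζ-^^ (p₂ ℕ.^ e₂) j (+ 0) (+ 1))
            (≈-reflexive (cong₂ ζ (ℤₚ.*-zeroʳ (+ j ℤ.* + W₂.n′)) (ℤₚ.*-identityʳ _))))) (ζ-coset₂ (+ 0)))
    (λ Z h → ι-zero (+ p₂) (0∣⇒≈0 (fixed₂ (+ 0) (+ 1) (fixed-0 h) (n∤1 pr₂ W₂.p∣n))))
    ψ-mod₂ selfconj₂ (∤2 pr₁ comax₁-2 W₁.p∣n) (conj-ζ-* (+ 0) (+ 1))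

  -- The primes over p₁ and p₂ are fixed by conj, so they divide Z and conj Z equally often; the two
  -- prime powers are then joined by coprimality.
  N-self-conjugate : ∀ k Z → ι ((+ n₁ ℤ.* + n₂) Z.^ (k ℕ.+ k)) ∣ Z * conj Z → ι ((+ n₁ ℤ.* + n₂) Z.^ k) ∣ Z
  N-self-conjugate k Z d = ∣-respˡ (≈-reflexive (cong ι (sym (Z.^-distrib-* (+ n₁) (+ n₂) k))))
      (ι-comax-* ((+ n₁) Z.^ k) ((+ n₂) Z.^ k) cm
      (∣-respˡ (≈-sym (pow p₁ (suc e₁) k)) (R₁.self-conjugate (suc e₁ ℕ.* k) Z
            (∣-respˡ (≈-trans (pow p₁ (suc e₁) (k ℕ.+ k))
              (≈-reflexive (cong (ι (+ p₁) ^_) (ℕₚ.*-distribˡ-+ (suc e₁) k k))))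
              (∣-trans (ι-∣ (Z.∣-resp (sym (Z.^-distrib-* (+ n₁) (+ n₂) (k ℕ.+ k)))
              (Z.∣-*ʳ ((+ n₂) Z.^ (k ℕ.+ k)) Z.∣-refl))) d))))
      (∣-respˡ (≈-sym (pow p₂ (suc e₂) k)) (R₂.self-conjugate (suc e₂ ℕ.* k) Z
            (∣-respˡ (≈-trans (pow p₂ (suc e₂) (k ℕ.+ k))
              (≈-reflexive (cong (ι (+ p₂) ^_) (ℕₚ.*-distribˡ-+ (suc e₂) k k))))
              (∣-trans (ι-∣ (Z.∣-resp (sym (Z.^-distrib-* (+ n₁) (+ n₂) (k ℕ.+ k)))
              (Z.∣-*ˡ ((+ n₁) Z.^ (k ℕ.+ k)) Z.∣-refl))) d)))))
    where
    pow : ∀ p e k → ι ((+ (p ℕ.^ e)) Z.^ k) ≈ ι (+ p) ^ (e ℕ.* k)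
    pow p e k = ≈-trans (≈-reflexive (cong ι (trans (cong (Z._^ k) (pos-^ p e)) (Z.^-assocʳ (+ p) e k))))
        (ι-pow (+ p) (e ℕ.* k))
    cm : Comax ((+ n₁) Z.^ k) ((+ n₂) Z.^ k)
    cm = comax-^ k k (subst (λ z → Comax z (+ n₂)) (sym (pos-^ p₁ (suc e₁)))
          (subst (λ z → Comax ((+ p₁) Z.^ suc e₁) z) (sym (pos-^ p₂ (suc e₂)))
            (comax-^ (suc e₁) (suc e₂) comax-p₁p₂)))

-- Eigenfunctions of the unit group.

Sign : ℤ → Set
Sign c = (c ≡ + 1) ⊎ (c ≡ ℤ.- + 1)

sign-^-even : ∀ {c} t → Sign c → eps t ≡ + 1 → c Z.^ t ≡ + 1
sign-^-even t (inj₁ refl) e = Z.1^ t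
sign-^-even t (inj₂ refl) e = e

sign-^ : ∀ {c} t → Sign c → Sign (c Z.^ t)
sign-^ t (inj₁ refl) = inj₁ (Z.1^ t)
sign-^ t (inj₂ refl) = eps-± t

sign-square : ∀ {c} x → Sign c → c ℤ.* x ℤ.* (c ℤ.* x) ≡ x ℤ.* x
sign-square x (inj₁ refl) = cong₂ ℤ._*_ (ℤₚ.*-identityˡ x) (ℤₚ.*-identityˡ x)
sign-square x (inj₂ refl) = l x
  where l : ∀ x → (ℤ.- + 1) ℤ.* x ℤ.* ((ℤ.- + 1) ℤ.* x) ≡ x ℤ.* x
        l = solve-∀

self-neg⇒0 : ∀ {x} → x ≡ (ℤ.- + 1) ℤ.* x → x ≡ + 0
self-neg⇒0 {x} e = ℤₚ.*-cancelˡ-≡ (+ 2) x (+ 0) (trans (l x) (trans (cong (ℤ._+ x) e) (l′ x)))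
  where
  l : ∀ x → + 2 ℤ.* x ≡ x ℤ.+ x
  l = solve-∀
  l′ : ∀ x → (ℤ.- + 1) ℤ.* x ℤ.+ x ≡ + 2 ℤ.* + 0
  l′ = solve-∀

≋0⇒≡ : ∀ {x y} → x Z.≋ y [ + 0 ] → x ≡ y
≋0⇒≡ {x} {y} (Z.congr (Z.divides q e)) = sub≡0 x y (trans e (ℤₚ.*-zeroˡ q))

-- functions on ℤ/n₁ × ℤ/n₂ with vanishing sums over the cosets of the subgroups of order p₁ and p₂
module Eigen (S : Setting) where
  open Setting S
  module W₁ = Weight p₁ e₁ pr₁
  module W₂ = Weight p₂ e₂ pr₂
  open W₁ using () renaming (n′ to n₁′; step to step₁)
  open W₂ using () renaming (n′ to n₂′; step to step₂)

  -- The modulus d = 0 gives equality, d = 2 the reduction modulo 2. The unit ± 2^i acts through the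
  -- signs c for -1 and δ for 2.
  record EigenFunction (v : ℤ → ℤ → ℤ) (d δ c : ℤ) : Set where
    field
      per₁ : ∀ l → Periodic n₁ (λ k → v k l)
      per₂ : ∀ k → Periodic n₂ (v k)
      coset₁ : ∀ k l → Z.∑< p₁ (λ j → v (k ℤ.+ step₁ j) l) ≡ + 0
      coset₂ : ∀ k l → Z.∑< p₂ (λ j → v k (l ℤ.+ step₂ j)) ≡ + 0
      sign-δ : Sign δ
      sign-c : Sign c
      double : ∀ k l → v (+ 2 ℤ.* k) (+ 2 ℤ.* l) Z.≋ δ ℤ.* v k l [ d ]
      negate : ∀ k l → v ((ℤ.- + 1) ℤ.* k) ((ℤ.- + 1) ℤ.* l) Z.≋ c ℤ.* v k l [ d ]

  module _ {v : ℤ → ℤ → ℤ} {d δ c : ℤ} (E : EigenFunction v d δ c) where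
    open EigenFunction E

    per : ∀ {k k′ l l′} → k Z.≋ k′ [ + n₁ ] → l Z.≋ l′ [ + n₂ ] → v k l ≡ v k′ l′
    per {k} {k′} {l} h h′ = trans (per₁ l h) (per₂ k′ h′)

    act-2^ : ∀ i k l → v ((+ 2) Z.^ i ℤ.* k) ((+ 2) Z.^ i ℤ.* l) Z.≋ δ Z.^ i ℤ.* v k l [ d ]
    act-2^ zero k l = Z.≈⇒≋ (trans (cong₂ v (ℤₚ.*-identityˡ k) (ℤₚ.*-identityˡ l))
          (sym (ℤₚ.*-identityˡ (v k l))))
    act-2^ (suc i) k l = Z.≋-trans (Z.≈⇒≋ (cong₂ v (ℤₚ.*-assoc (+ 2) ((+ 2) Z.^ i) k)
            (ℤₚ.*-assoc (+ 2) ((+ 2) Z.^ i) l)))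
      (Z.≋-trans (double _ _) (Z.≋-trans (Z.≋-* (Z.≋-refl {δ}) (act-2^ i k l))
            (Z.≈⇒≋ (sym (ℤₚ.*-assoc δ (δ Z.^ i) (v k l))))))

    act-eps : ∀ t k l → v (eps t ℤ.* k) (eps t ℤ.* l) Z.≋ c Z.^ t ℤ.* v k l [ d ]
    act-eps zero k l = Z.≈⇒≋ (trans (cong₂ v (ℤₚ.*-identityˡ k) (ℤₚ.*-identityˡ l))
          (sym (ℤₚ.*-identityˡ (v k l))))
    act-eps (suc t) k l = Z.≋-trans (Z.≈⇒≋ (cong₂ v (ℤₚ.*-assoc (ℤ.- + 1) (eps t) k)
            (ℤₚ.*-assoc (ℤ.- + 1) (eps t) l)))
      (Z.≋-trans (negate _ _) (Z.≋-trans (Z.≋-* (Z.≋-refl {c}) (act-eps t k l))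
            (Z.≈⇒≋ (sym (ℤₚ.*-assoc c (c Z.^ t) (v k l))))))

    act : ∀ t i k l → v (pm2 t i ℤ.* k) (pm2 t i ℤ.* l) Z.≋ c Z.^ t ℤ.* δ Z.^ i ℤ.* v k l [ d ]
    act t i k l = Z.≋-trans (Z.≈⇒≋ (cong₂ v (ℤₚ.*-assoc (eps t) ((+ 2) Z.^ i) k)
            (ℤₚ.*-assoc (eps t) ((+ 2) Z.^ i) l)))
      (Z.≋-trans (act-eps t _ _) (Z.≋-trans (Z.≋-* (Z.≋-refl {c Z.^ t}) (act-2^ i k l))
            (Z.≈⇒≋ (sym (ℤₚ.*-assoc (c Z.^ t) (δ Z.^ i) (v k l))))))

    act-≋ : ∀ t i {x y} k l → pm2 t i Z.≋ x [ + n₁ ] → pm2 t i Z.≋ y [ + n₂ ] → v (x ℤ.* k)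
        (y ℤ.* l) Z.≋ c Z.^ t ℤ.* δ Z.^ i ℤ.* v k l [ d ]
    act-≋ t i k l h h′ = Z.≋-trans (Z.≈⇒≋ (sym (per (≋-mulʳ k h) (≋-mulʳ l h′)))) (act t i k l)

    -- A unit that is 1 modulo p₁ and p₂ is some (-1)^t 2^i with t and i even, by the parity fields:
    -- the action factors through the two quadratic characters.
    act-trivial : ∀ x y k l → x Z.≋ + 1 [ + p₁ ] → y Z.≋ + 1 [ + p₂ ] → v (x ℤ.* k) (y ℤ.* l) Z.≋ v k l [ d ]
    act-trivial x y k l hx hy = Z.≋-trans (act-≋ t i k l ux uy)
        (Z.≈⇒≋ (trans (cong (ℤ._* v k l) (cong₂ ℤ._*_ (sign-^-even t sign-c et) (sign-^-even i sign-δ ei)))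
            (ℤₚ.*-identityˡ (v k l))))
      where
      unit : ∀ {p x} → Prime p → x Z.≋ + 1 [ + p ] → ¬ + p Z.∣ x
      unit pr h d = comax⇒∤ pr comax-1ʳ (Z.≋-∣ h d)
      u = units x y (unit pr₁ hx) (unit pr₂ hy)
      t = proj₁ u
      i = proj₁ (proj₂ u)
      ux : pm2 t i Z.≋ x [ + n₁ ]
      ux = proj₁ (proj₂ (proj₂ u))
      uy : pm2 t i Z.≋ y [ + n₂ ]
      uy = proj₂ (proj₂ (proj₂ u))
      ei : eps i ≡ + 1
      ei = parity₂ t i (Z.≋-trans (Z.≋-weaken W₂.p∣n uy) hy)
      et : eps t ≡ + 1
      et = trans (sym (ℤₚ.*-identityʳ (eps t))) (trans (cong (eps t ℤ.*_) (sym ei))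
            (trans (sym (eps-+ t i)) (parity₁ t i (Z.≋-trans (Z.≋-weaken W₁.p∣n ux) hx))))

    -- If p^e does not divide k, some t has p t k ≡ p^e modulo p^(e+1). So a = 1 + j p t moves k
    -- along its coset under the subgroup of order p, and a ≡ 1 modulo p.
    support : ∀ {p} (pr : Prime p) e k → ¬ + (p ℕ.^ e) Z.∣ k → ∀ j → Σ ℤ λ a → (a Z.≋ + 1 [ + p ]) ×
        (a ℤ.* k Z.≋ k ℤ.+ + j ℤ.* + (p ℕ.^ e) [ + (p ℕ.^ suc e) ])
    support {p} pr zero k ¬d j = ⊥-elim (¬d (Z.divides k (sym (ℤₚ.*-identityˡ k))))
    support {p} pr (suc e) k ¬d j = a , Z.congr (Z.∣-resp (l₁ (+ p) t (+ j)) (Z.∣-*ʳ (t ℤ.* + j) Z.∣-refl)) ,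
        Z.congr (Z.∣-resp (trans (l₂ (+ j) (+ p) t k (+ (p ℕ.^ e)))
              (cong (λ z → a ℤ.* k ℤ.- (k ℤ.+ + j ℤ.* z)) (sym (ℤₚ.pos-* p (p ℕ.^ e)))))
            (Z.∣-*ˡ (+ j) (Z.∣-respˡ (sym (ℤₚ.pos-* p (p ℕ.^ suc e)))
                (Z.∣-*-mono (Z.∣-refl {+ p}) (Z.∣-diff (proj₂ r))))))
      where
      r = prime-power-solve pr e k ¬d
      t = proj₁ r
      a = + 1 ℤ.+ + j ℤ.* (+ p ℤ.* t)
      l₁ : ∀ p t j → p ℤ.* (t ℤ.* j) ≡ + 1 ℤ.+ j ℤ.* (p ℤ.* t) ℤ.- + 1
      l₁ = solve-∀
      l₂ : ∀ j p t k q → j ℤ.* (p ℤ.* (t ℤ.* k ℤ.- q)) ≡ (+ 1 ℤ.+ j ℤ.* (p ℤ.* t)) ℤ.* k ℤ.-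
          (k ℤ.+ j ℤ.* (p ℤ.* q))
      l₂ = solve-∀

    -- By `support` and `act-trivial`, v is constant on a coset of size p₁ over which its sum is 0.
    support₁ : ∀ k l → ¬ + n₁′ Z.∣ k → + p₁ ℤ.* v k l Z.≋ + 0 [ d ]
    support₁ k l ¬d = Z.≋-trans (Z.≈⇒≋ (sym (Z.∑<-const p₁ (v k l))))
        (Z.≋-trans (Z.≋-sym (Z.∑<-≋ p₁ (λ j _ → same j))) (Z.≈⇒≋ (coset₁ k l)))
      where
      same : ∀ j → v (k ℤ.+ step₁ j) l Z.≋ v k l [ d ]
      same j = let (a , a≋1 , ak) = support pr₁ e₁ k ¬d j in
        Z.≋-trans (Z.≈⇒≋ (trans (per₁ l (Z.≋-sym ak)) (cong (v (a ℤ.* k)) (sym (ℤₚ.*-identityˡ l)))))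
          (act-trivial a (+ 1) k l a≋1 Z.≋-refl)

    support₂ : ∀ k l → ¬ + n₂′ Z.∣ l → + p₂ ℤ.* v k l Z.≋ + 0 [ d ]
    support₂ k l ¬d = Z.≋-trans (Z.≈⇒≋ (sym (Z.∑<-const p₂ (v k l))))
        (Z.≋-trans (Z.≋-sym (Z.∑<-≋ p₂ (λ j _ → same j))) (Z.≈⇒≋ (coset₂ k l)))
      where
      same : ∀ j → v k (l ℤ.+ step₂ j) Z.≋ v k l [ d ]
      same j = let (a , a≋1 , al) = support pr₂ e₂ l ¬d j in
        Z.≋-trans (Z.≈⇒≋ (trans (per₂ k (Z.≋-sym al)) (cong (λ z → v z (a ℤ.* l)) (sym (ℤₚ.*-identityˡ k)))))
          (act-trivial (+ 1) a k l Z.≋-refl a≋1)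

    p∤1 : ∀ {p} → Prime p → ¬ + p Z.∣ + 1
    p∤1 pr = comax⇒∤ pr comax-1ʳ

    -- A unit that moves only the first coordinate is 1 modulo p₂, so i is even and the sign is c^t.
    act₁ : ∀ x k l → ¬ + p₁ Z.∣ x → Σ ℤ λ s → Sign s × (c ≡ + 1 → s ≡ + 1) ×
        (v (x ℤ.* k) l Z.≋ s ℤ.* v k l [ d ])
    act₁ x k l ¬x = s , sign-^ t sign-c , (λ { refl → Z.1^ t }) , Z.≋-trans
        (Z.≈⇒≋ (cong (v (x ℤ.* k)) (sym (ℤₚ.*-identityˡ l))))
        (Z.≋-trans (act-≋ t i k l ux uy) (Z.≈⇒≋ (cong (ℤ._* v k l)
              (trans (cong (c Z.^ t ℤ.*_) (sign-^-even i sign-δ (parity₂ t i (Z.≋-weaken W₂.p∣n uy))))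
              (ℤₚ.*-identityʳ s)))))
      where
      u = units x (+ 1) ¬x (p∤1 pr₂)
      t = proj₁ u
      i = proj₁ (proj₂ u)
      s : ℤ
      s = c Z.^ t
      ux : pm2 t i Z.≋ x [ + n₁ ]
      ux = proj₁ (proj₂ (proj₂ u))
      uy : pm2 t i Z.≋ + 1 [ + n₂ ]
      uy = proj₂ (proj₂ (proj₂ u))

    -- A unit that moves only the second coordinate is 1 modulo p₁, so t + i is even, and the sign
    -- c^t δ^i is trivial when c = δ.
    act₂ : ∀ y k l → ¬ + p₂ Z.∣ y → Σ ℤ λ s → Sign s × (c ≡ δ → s ≡ + 1) ×
        (v k (y ℤ.* l) Z.≋ s ℤ.* v k l [ d ])
    act₂ y k l ¬y = s , sign-s , triv , Z.≋-trans (Z.≈⇒≋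
          (cong (λ z → v z (y ℤ.* l)) (sym (ℤₚ.*-identityˡ k)))) (act-≋ t i k l ux uy)
      where
      u = units (+ 1) y (p∤1 pr₁) ¬y
      t = proj₁ u
      i = proj₁ (proj₂ u)
      s : ℤ
      s = c Z.^ t ℤ.* δ Z.^ i
      ux : pm2 t i Z.≋ + 1 [ + n₁ ]
      ux = proj₁ (proj₂ (proj₂ u))
      uy : pm2 t i Z.≋ y [ + n₂ ]
      uy = proj₂ (proj₂ (proj₂ u))
      sign-* : ∀ {a b} → Sign a → Sign b → Sign (a ℤ.* b)
      sign-* (inj₁ refl) (inj₁ refl) = inj₁ refl
      sign-* (inj₁ refl) (inj₂ refl) = inj₂ refl
      sign-* (inj₂ refl) (inj₁ refl) = inj₂ refl
      sign-* (inj₂ refl) (inj₂ refl) = inj₁ refl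
      sign-s : Sign s
      sign-s = sign-* (sign-^ t sign-c) (sign-^ i sign-δ)
      triv : c ≡ δ → s ≡ + 1
      triv refl = trans (sym (Z.^-homo-* c t i)) (sign-^-even (t ℕ.+ i) sign-c
            (parity₁ t i (Z.≋-weaken W₁.p∣n ux)))

  -- Modulo 2 the whole unit group acts trivially, so such a function is determined by one value.
  even-function : ∀ {v} → EigenFunction v (+ 2) (+ 1) (+ 1) → Comax (+ 2) (+ p₁) → Comax (+ 2) (+ p₂) →
                  + 2 Z.∣ v (+ n₁′) (+ n₂′) → ∀ k l → + 2 Z.∣ v k l
  even-function {v} E c₁ c₂ base k l = any k l (∣?ℤ n₁′ k) (∣?ℤ n₂′ l)
    where
    open EigenFunction E
    -- Cells with unit coordinates are carried to the base cell by the unit group. Cells with a zero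
    -- coordinate follow from the vanishing coset sums, and points off these cells from the support
    -- lemmas, as p₁ and p₂ are odd.
    unit-unit : ∀ x y → ¬ + p₁ Z.∣ x → ¬ + p₂ Z.∣ y → + 2 Z.∣ v (x ℤ.* + n₁′) (y ℤ.* + n₂′)
    unit-unit x y ¬x ¬y = Z.≋-∣ (Z.≋-sym h₁) (Z.∣-*ˡ s₁ (Z.≋-∣ (Z.≋-sym h₂) (Z.∣-*ˡ s₂ base)))
      where
      a₁ = act₁ E x (+ n₁′) (y ℤ.* + n₂′) ¬x
      s₁ = proj₁ a₁
      h₁ = proj₂ (proj₂ (proj₂ a₁))
      a₂ = act₂ E y (+ n₁′) (+ n₂′) ¬y
      s₂ = proj₁ a₂
      h₂ = proj₂ (proj₂ (proj₂ a₂))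
    small : ∀ {p j} → suc j ℕ.< p → ¬ + p Z.∣ + suc j
    small l d = ℕ∣.>⇒∤ l (∣⇒abs∣ d)
    drop : ∀ n (f : ℕ → ℤ) → Z.∑< n f ≡ + 0 → 0 ℕ.< n → (∀ j → suc j ℕ.< n → + 2 Z.∣ f (suc j)) → + 2 Z.∣ f 0
    drop (suc n) f e _ h = Z.∣-resp (neg-of (f 0) (Z.∑< n (f ∘ suc)) (trans (sym (Z.∑<-head n f)) e))
        (Z.∣-neg (Z.∑<-∣ n (λ j j<n → h j (s≤s j<n))))
      where
      neg-of : ∀ a b → a ℤ.+ b ≡ + 0 → ℤ.- b ≡ a
      neg-of a b e = sym (sub≡0 a (ℤ.- b) (trans (cong (ℤ._+_ a) (ℤₚ.neg-involutive b)) e))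
    multiple-0 : ∀ {p n n′ x} → + n ≡ + p ℤ.* + n′ → + p Z.∣ x → x ℤ.* + n′ Z.≋ + 0 ℤ.+ + 0 ℤ.* + n′ [ + n ]
    multiple-0 {x = x} e d = Z.≋-trans (≋-scale e (Z.∣⇒≋0 d)) (Z.≈⇒≋ refl)
    col : ∀ x y → ¬ + p₂ Z.∣ y → Dec (+ p₁ Z.∣ x) → + 2 Z.∣ v (x ℤ.* + n₁′) (y ℤ.* + n₂′)
    col x y ¬y (no ¬x) = unit-unit x y ¬x ¬y
    col x y ¬y (yes d) = Z.∣-resp (sym (per₁ (y ℤ.* + n₂′) (multiple-0 W₁.n≡ d)))
        (drop p₁ (λ j → v (+ 0 ℤ.+ step₁ j) (y ℤ.* + n₂′)) (coset₁ (+ 0) (y ℤ.* + n₂′)) (ℕₚ.<⇒≤ (prime>1 pr₁))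
      (λ j j<p → Z.∣-resp (cong (λ z → v z (y ℤ.* + n₂′)) (sym (ℤₚ.+-identityˡ (step₁ (suc j)))))
          (unit-unit (+ suc j) y (small j<p) ¬y)))
    cell : ∀ x y → Dec (+ p₂ Z.∣ y) → + 2 Z.∣ v (x ℤ.* + n₁′) (y ℤ.* + n₂′)
    cell x y (no ¬y) = col x y ¬y (∣?ℤ p₁ x)
    cell x y (yes d) = Z.∣-resp (sym (per₂ (x ℤ.* + n₁′) (multiple-0 W₂.n≡ d)))
        (drop p₂ (λ j → v (x ℤ.* + n₁′) (+ 0 ℤ.+ step₂ j)) (coset₂ (x ℤ.* + n₁′) (+ 0)) (ℕₚ.<⇒≤ (prime>1 pr₂))
      (λ j j<p → Z.∣-resp (cong (v (x ℤ.* + n₁′)) (sym (ℤₚ.+-identityˡ (step₂ (suc j)))))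
          (col x (+ suc j) (small j<p) (∣?ℤ p₁ x))))
    any : ∀ k l → Dec (+ n₁′ Z.∣ k) → Dec (+ n₂′ Z.∣ l) → + 2 Z.∣ v k l
    any k l (no ¬d) _ = comax-cancel (+ p₁) c₁ (Z.≋0⇒∣ (support₁ E k l ¬d))
    any k l (yes _) (no ¬d) = comax-cancel (+ p₂) c₂ (Z.≋0⇒∣ (support₂ E k l ¬d))
    any k l (yes (Z.divides x e)) (yes (Z.divides y e′)) = Z.∣-resp
        (cong₂ v (trans (ℤₚ.*-comm x (+ n₁′)) (sym e)) (trans (ℤₚ.*-comm y (+ n₂′)) (sym e′)))
        (cell x y (∣?ℤ p₂ y))

  -- The factor by which the square sum over a line exceeds p - 1 times one square: p if the units
  -- of that coordinate act trivially, 1 if they act by the quadratic character.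
  κ : ∀ {c} → Sign c → ℕ → ℤ
  κ (inj₁ _) p = + p
  κ (inj₂ _) p = + 1

  small : ∀ {p j} → suc j ℕ.< p → ¬ + p Z.∣ + suc j
  small l d = ℕ∣.>⇒∤ l (∣⇒abs∣ d)

  -- For trivial action all entries off 0 equal g 1 and g 0 = -(p - 1) g 1, which gives (p - 1)² +
  -- (p - 1) = (p - 1) p times the square of g 1; otherwise g 0 = 0 and p - 1 squares remain.
  line : ∀ p (g : ℕ → ℤ) {c} (sc : Sign c) → 1 ℕ.< p → Z.∑< p g ≡ + 0 →
         (∀ j → suc j ℕ.< p → g (suc j) ℤ.* g (suc j) ≡ g 1 ℤ.* g 1) →
         (c ≡ + 1 → ∀ j → suc j ℕ.< p → g (suc j) ≡ g 1) → (c ≡ ℤ.- + 1 → g 0 ≡ + 0) →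
         Z.∑< p (λ j → g j ℤ.* g j) ≡ (+ p ℤ.- + 1) ℤ.* κ sc p ℤ.* (g 1 ℤ.* g 1)
  line (suc p) g sc 1<p sum0 squares trivial odd = trans (Z.∑<-head p (λ j → g j ℤ.* g j))
      (trans (cong (ℤ._+_ (g 0 ℤ.* g 0)) (trans (Z.∑<-cong p (λ j j<p → squares j (s≤s j<p)))
            (Z.∑<-const p (g 1 ℤ.* g 1)))) (finish sc trivial odd))
    where
    finish : ∀ {c} (sc : Sign c) → (c ≡ + 1 → ∀ j → suc j ℕ.< suc p → g (suc j) ≡ g 1) →
        (c ≡ ℤ.- + 1 → g 0 ≡ + 0) → g 0 ℤ.* g 0 ℤ.+ + p ℤ.* (g 1 ℤ.* g 1) ≡ (+ suc p ℤ.- + 1) ℤ.* κ sc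
        (suc p) ℤ.* (g 1 ℤ.* g 1)
    finish (inj₁ e) trivial odd = trans (cong (λ z → z ℤ.* z ℤ.+ + p ℤ.* (g 1 ℤ.* g 1)) g0) (l (+ p) (g 1))
      where
      g0 : g 0 ≡ ℤ.- (+ p ℤ.* g 1)
      g0 = sub≡0 (g 0) (ℤ.- (+ p ℤ.* g 1)) (trans (cong (ℤ._+_ (g 0))
              (trans (ℤₚ.neg-involutive (+ p ℤ.* g 1))
                (sym (trans (Z.∑<-cong p (λ j j<p → trivial e j (s≤s j<p))) (Z.∑<-const p (g 1))))))
            (trans (sym (Z.∑<-head p g)) sum0))
      l : ∀ p g → (ℤ.- (p ℤ.* g)) ℤ.* (ℤ.- (p ℤ.* g)) ℤ.+ p ℤ.* (g ℤ.* g) ≡ (+ 1 ℤ.+ p ℤ.- + 1) ℤ.*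
          (+ 1 ℤ.+ p) ℤ.* (g ℤ.* g)
      l = solve-∀
    finish (inj₂ e) trivial odd = trans (cong (λ z → z ℤ.* z ℤ.+ + p ℤ.* (g 1 ℤ.* g 1)) (odd e))
        (l (+ p) (g 1))
      where
      l : ∀ p g → + 0 ℤ.* + 0 ℤ.+ p ℤ.* (g ℤ.* g) ≡ (+ 1 ℤ.+ p ℤ.- + 1) ℤ.* + 1 ℤ.* (g ℤ.* g)
      l = solve-∀

  -- A nonresidue modulo p₂ that is 1 modulo p₁ acts by c δ, so this product governs the second
  -- coordinate as c governs the first.
  sign-swap : ∀ {δ c} → Sign δ → Sign c → Sign (c ℤ.* δ)
  sign-swap (inj₁ refl) (inj₁ refl) = inj₁ refl
  sign-swap (inj₁ refl) (inj₂ refl) = inj₂ refl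
  sign-swap (inj₂ refl) (inj₁ refl) = inj₂ refl
  sign-swap (inj₂ refl) (inj₂ refl) = inj₁ refl

  module _ {v : ℤ → ℤ → ℤ} {δ c : ℤ} (E : EigenFunction v (+ 0) δ c) where
    open EigenFunction E

    instance
      p₁≢0 : ℕ.NonZero p₁
      p₁≢0 = prime⇒nonZero pr₁
      p₂≢0 : ℕ.NonZero p₂
      p₂≢0 = prime⇒nonZero pr₂

    vanish₁ : ∀ k l → ¬ + n₁′ Z.∣ k → v k l ≡ + 0
    vanish₁ k l ¬d = ℤₚ.*-cancelˡ-≡ (+ p₁) _ _ (trans (≋0⇒≡ (support₁ E k l ¬d)) (sym (ℤₚ.*-zeroʳ (+ p₁))))

    vanish₂ : ∀ k l → ¬ + n₂′ Z.∣ l → v k l ≡ + 0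
    vanish₂ k l ¬d = ℤₚ.*-cancelˡ-≡ (+ p₂) _ _ (trans (≋0⇒≡ (support₂ E k l ¬d)) (sym (ℤₚ.*-zeroʳ (+ p₂))))

    F : ℤ → ℤ → ℤ
    F x y = v (x ℤ.* + n₁′) (y ℤ.* + n₂′)

    -- The unit of `flip₁` fixes the point but multiplies the value by c = -1.
    vanish-0₁ : c ≡ ℤ.- + 1 → ∀ y → F (+ 0) y ≡ + 0
    vanish-0₁ e y = let (t , i , et , ei , u) = flip₁ in self-neg⇒0 (begin
      F (+ 0) y ≡⟨ per E (Z.≈⇒≋ (sym (ℤₚ.*-zeroʳ (pm2 t i))))
        (Z.≋-sym (Z.≋-trans (Z.≈⇒≋ (sym (ℤₚ.*-assoc (pm2 t i) y (+ n₂′))))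
            (≋-scale W₂.n≡ (Z.≋-trans (≋-mulʳ y u) (Z.≈⇒≋ (ℤₚ.*-identityˡ y)))))) ⟩
      v (pm2 t i ℤ.* (+ 0 ℤ.* + n₁′)) (pm2 t i ℤ.* (y ℤ.* + n₂′)) ≡⟨ ≋0⇒≡
        (act E t i (+ 0 ℤ.* + n₁′) (y ℤ.* + n₂′)) ⟩
      c Z.^ t ℤ.* δ Z.^ i ℤ.* F (+ 0) y ≡⟨ cong (ℤ._* F (+ 0) y)
        (cong₂ ℤ._*_ (trans (cong (Z._^ t) e) et) (sign-^-even i sign-δ ei)) ⟩
      (ℤ.- + 1) ℤ.* F (+ 0) y ∎)
      where open ≡-Reasoning

    vanish-0₂ : c ℤ.* δ ≡ ℤ.- + 1 → ∀ x → F x (+ 0) ≡ + 0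
    vanish-0₂ e x = let (t , i , et , ei , u) = flip₂ in self-neg⇒0 (begin
      F x (+ 0) ≡⟨ per E (Z.≋-sym (Z.≋-trans (Z.≈⇒≋ (sym (ℤₚ.*-assoc (pm2 t i) x (+ n₁′))))
            (≋-scale W₁.n≡ (Z.≋-trans (≋-mulʳ x u) (Z.≈⇒≋ (ℤₚ.*-identityˡ x))))))
        (Z.≈⇒≋ (sym (ℤₚ.*-zeroʳ (pm2 t i)))) ⟩
      v (pm2 t i ℤ.* (x ℤ.* + n₁′)) (pm2 t i ℤ.* (+ 0 ℤ.* + n₂′)) ≡⟨ ≋0⇒≡
        (act E t i (x ℤ.* + n₁′) (+ 0 ℤ.* + n₂′)) ⟩
      c Z.^ t ℤ.* δ Z.^ i ℤ.* F x (+ 0) ≡⟨ cong (ℤ._* F x (+ 0)) (sgn t i et ei sign-c sign-δ e) ⟩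
      (ℤ.- + 1) ℤ.* F x (+ 0) ∎)
      where
      open ≡-Reasoning
      sgn : ∀ t i → eps t ≡ ℤ.- + 1 → eps i ≡ ℤ.- + 1 → ∀ {c δ} → Sign c → Sign δ → c ℤ.* δ ≡ ℤ.- + 1 →
          c Z.^ t ℤ.* δ Z.^ i ≡ ℤ.- + 1
      sgn t i et ei (inj₁ refl) (inj₁ refl) ()
      sgn t i et ei (inj₂ refl) (inj₂ refl) ()
      sgn t i et ei (inj₁ refl) (inj₂ refl) _ = cong₂ ℤ._*_ (Z.1^ t) ei
      sgn t i et ei (inj₂ refl) (inj₁ refl) _ = cong₂ ℤ._*_ et (Z.1^ i)

    row-squares : ∀ y → Z.∑< p₁ (λ x → F (+ x) y ℤ.* F (+ x) y) ≡ (+ p₁ ℤ.- + 1) ℤ.* κ sign-c p₁ ℤ.*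
        (F (+ 1) y ℤ.* F (+ 1) y)
    row-squares y = line p₁ (λ x → F (+ x) y) sign-c (prime>1 pr₁)
      (trans (Z.∑<-congᵃ p₁ (λ j → cong (λ z → v z (y ℤ.* + n₂′)) (sym (ℤₚ.+-identityˡ (step₁ j)))))
          (coset₁ (+ 0) (y ℤ.* + n₂′)))
      (λ j j<p → let (s , ss , _ , h) = act₁ E (+ suc j) (+ 1 ℤ.* + n₁′) (y ℤ.* + n₂′) (small j<p)
          in trans (cong₂ ℤ._*_ (shape j s h) (shape j s h)) (sign-square (F (+ 1) y) ss))
      (λ e j j<p → let (s , ss , triv , h) = act₁ E (+ suc j) (+ 1 ℤ.* + n₁′) (y ℤ.* + n₂′) (small j<p)
          in trans (shape j s h) (trans (cong (ℤ._* F (+ 1) y) (triv e)) (ℤₚ.*-identityˡ (F (+ 1) y))))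
      (λ e → vanish-0₁ e y)
      where
      shape : ∀ j s → v (+ suc j ℤ.* (+ 1 ℤ.* + n₁′)) (y ℤ.* + n₂′) Z.≋ s ℤ.* F (+ 1) y [ + 0 ] → F
          (+ suc j) y ≡ s ℤ.* F (+ 1) y
      shape j s h = trans (cong (λ z → v (+ suc j ℤ.* z) (y ℤ.* + n₂′)) (sym (ℤₚ.*-identityˡ (+ n₁′))))
          (≋0⇒≡ h)

    col-squares : ∀ x → Z.∑< p₂ (λ y → F x (+ y) ℤ.* F x (+ y)) ≡ (+ p₂ ℤ.- + 1) ℤ.* κ
        (sign-swap sign-δ sign-c) p₂ ℤ.* (F x (+ 1) ℤ.* F x (+ 1))
    col-squares x = line p₂ (λ y → F x (+ y)) (sign-swap sign-δ sign-c) (prime>1 pr₂)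
      (trans (Z.∑<-congᵃ p₂ (λ j → cong (v (x ℤ.* + n₁′)) (sym (ℤₚ.+-identityˡ (step₂ j)))))
          (coset₂ (x ℤ.* + n₁′) (+ 0)))
      (λ j j<p → let (s , ss , _ , h) = act₂ E (+ suc j) (x ℤ.* + n₁′) (+ 1 ℤ.* + n₂′) (small j<p)
          in trans (cong₂ ℤ._*_ (shape j s h) (shape j s h)) (sign-square (F x (+ 1)) ss))
      (λ e j j<p → let (s , ss , triv , h) = act₂ E (+ suc j) (x ℤ.* + n₁′) (+ 1 ℤ.* + n₂′) (small j<p)
          in trans (shape j s h) (trans (cong (ℤ._* F x (+ 1)) (triv (same sign-c sign-δ e)))
              (ℤₚ.*-identityˡ (F x (+ 1)))))
      (λ e → vanish-0₂ e x)
      where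
      shape : ∀ j s → v (x ℤ.* + n₁′) (+ suc j ℤ.* (+ 1 ℤ.* + n₂′)) Z.≋ s ℤ.* F x (+ 1) [ + 0 ] → F x
          (+ suc j) ≡ s ℤ.* F x (+ 1)
      shape j s h = trans (cong (λ z → v (x ℤ.* + n₁′) (+ suc j ℤ.* z)) (sym (ℤₚ.*-identityˡ (+ n₂′))))
          (≋0⇒≡ h)
      same : ∀ {c δ} → Sign c → Sign δ → c ℤ.* δ ≡ + 1 → c ≡ δ
      same (inj₁ refl) (inj₁ refl) _ = refl
      same (inj₂ refl) (inj₂ refl) _ = refl
      same (inj₁ refl) (inj₂ refl) ()
      same (inj₂ refl) (inj₁ refl) ()

    sparse : ∀ n′ p (g : ℕ → ℤ) .{{_ : ℕ.NonZero n′}} → (∀ k → ¬ + n′ Z.∣ + k → g k ≡ + 0) → Z.∑< (p ℕ.* n′) g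
        ≡ Z.∑< p (λ x → g (x ℕ.* n′))
    sparse (suc m) p g h = trans (Z.∑<-blocks (suc m) p g)
        (trans (Z.∑<-head m (λ r → Z.∑< p (λ x → g (r ℕ.+ x ℕ.* suc m))))
          (trans (cong (ℤ._+_ (Z.∑< p (λ x → g (x ℕ.* suc m))))
              (Z.∑<-0 m (λ r r<m → Z.∑<-0 p (λ x _ → h (suc r ℕ.+ x ℕ.* suc m) (off r r<m x)))))
            (ℤₚ.+-identityʳ _)))
      where
      off : ∀ r → r ℕ.< m → ∀ x → ¬ + suc m Z.∣ + (suc r ℕ.+ x ℕ.* suc m)
      off r r<m x d = ℕ∣.>⇒∤ (s≤s r<m) (ℕ∣.∣m+n∣m⇒∣n
            (subst (suc m ℕ∣.∣_) (ℕₚ.+-comm (suc r) (x ℕ.* suc m)) (∣⇒abs∣ d)) (ℕ∣.n∣m*n x))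

    -- The function vanishes off the multiples of n₁′ and n₂′; on these, rows and then columns are
    -- summed by `line`.
    square-sum : Z.∑< n₁ (λ k → Z.∑< n₂ (λ l → v (+ k) (+ l) ℤ.* v (+ k) (+ l)))
                 ≡ (+ p₁ ℤ.- + 1) ℤ.* (+ p₂ ℤ.- + 1) ℤ.*
                   (κ sign-c p₁ ℤ.* κ (sign-swap sign-δ sign-c) p₂ ℤ.* (F (+ 1) (+ 1) ℤ.* F (+ 1) (+ 1)))
    square-sum = begin
      Z.∑< n₁ (λ k → Z.∑< n₂ (λ l → v (+ k) (+ l) ℤ.* v (+ k) (+ l)))
        ≡⟨ sparse n₁′ p₁ _ (λ k ¬d → Z.∑<-0 n₂ (λ l _ → cong (λ z → z ℤ.* z) (vanish₁ (+ k) (+ l) ¬d))) ⟩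
      Z.∑< p₁ (λ x → Z.∑< n₂ (λ l → v (+ (x ℕ.* n₁′)) (+ l) ℤ.* v (+ (x ℕ.* n₁′)) (+ l)))
        ≡⟨ Z.∑<-congᵃ p₁ (λ x → trans (sparse n₂′ p₂ _
              (λ l ¬d → cong (λ z → z ℤ.* z) (vanish₂ (+ (x ℕ.* n₁′)) (+ l) ¬d)))
            (Z.∑<-congᵃ p₂ (λ y → cong₂ (λ a b → v a b ℤ.* v a b) (ℤₚ.pos-* x n₁′) (ℤₚ.pos-* y n₂′)))) ⟩
      Z.∑< p₁ (λ x → Z.∑< p₂ (λ y → F (+ x) (+ y) ℤ.* F (+ x) (+ y)))
        ≡⟨ Z.∑<-swap p₁ p₂ _ ⟩
      Z.∑< p₂ (λ y → Z.∑< p₁ (λ x → F (+ x) (+ y) ℤ.* F (+ x) (+ y)))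
        ≡⟨ trans (Z.∑<-congᵃ p₂ (λ y → row-squares (+ y)))
          (sym (Z.∑<-*ˡ ((+ p₁ ℤ.- + 1) ℤ.* κ sign-c p₁) p₂ _)) ⟩
      (+ p₁ ℤ.- + 1) ℤ.* κ sign-c p₁ ℤ.* Z.∑< p₂ (λ y → F (+ 1) (+ y) ℤ.* F (+ 1) (+ y))
        ≡⟨ cong ((+ p₁ ℤ.- + 1) ℤ.* κ sign-c p₁ ℤ.*_) (col-squares (+ 1)) ⟩
      (+ p₁ ℤ.- + 1) ℤ.* κ sign-c p₁ ℤ.* ((+ p₂ ℤ.- + 1) ℤ.* κ (sign-swap sign-δ sign-c) p₂ ℤ.*
          (F (+ 1) (+ 1) ℤ.* F (+ 1) (+ 1)))
        ≡⟨ l (+ p₁ ℤ.- + 1) (κ sign-c p₁) (+ p₂ ℤ.- + 1) (κ (sign-swap sign-δ sign-c) p₂)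
          (F (+ 1) (+ 1) ℤ.* F (+ 1) (+ 1)) ⟩
      (+ p₁ ℤ.- + 1) ℤ.* (+ p₂ ℤ.- + 1) ℤ.* (κ sign-c p₁ ℤ.* κ (sign-swap sign-δ sign-c) p₂ ℤ.*
          (F (+ 1) (+ 1) ℤ.* F (+ 1) (+ 1))) ∎
      where
      open ≡-Reasoning
      instance
        _ = W₁.n′≢0
        _ = W₂.n′≢0
      l : ∀ a b c d e → a ℤ.* b ℤ.* (c ℤ.* d ℤ.* e) ≡ a ℤ.* c ℤ.* (b ℤ.* d ℤ.* e)
      l = solve-∀

-- Divisibility at the prime 2.

parityℤ : ∀ b → (+ 2 Z.∣ b) ⊎ (b Z.≋ + 1 [ + 2 ])
parityℤ b with b ℤ.%ℕ 2 | ≋-%ℕ b 2 | n%ℕd<d b 2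
... | 0 | h | _ = inj₁ (Z.≋0⇒∣ h)
... | 1 | h | _ = inj₂ h
... | suc (suc _) | _ | s≤s (s≤s ())

module TwoPart (S : Setting) (C : CyclotomicRing S) where
  open Setting S
  open CyclotomicRing C
  open RingTools algebra
  open RingPowers algebra
  open Cyclotomic S C
  open SelfConjugate S C using (frobenius-iterate; N-self-conjugate; ι-pow)
  open Kronecker S C using (kronecker)
  open Eigen S using (EigenFunction; even-function)
  open import Relation.Binary.Reasoning.Setoid setoid

  two : Carrier
  two = ι (+ 2)

  two≈2# : two ≈ 2#
  two≈2# = ≈-trans (ι-+ (+ 1) (+ 1)) (+-cong ι-1 ι-1)

  ≋-modulus : ∀ {d d′ X Y} → d ≈ d′ → X ≋ Y [ d ] → X ≋ Y [ d′ ]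
  ≋-modulus h (congr k) = congr (∣-respˡ h k)

  σ-sub : ∀ X Y → σ (X - Y) ≈ σ X - σ Y
  σ-sub X Y = ≈-trans (ψ-+ (+ 2) X (- Y)) (+-cong ≈-refl (ψ-neg (+ 2) Y))

  fixed-even : ∀ V → σ V ≋ V [ two ] → conj V ≋ V [ two ] → + 2 Z.∣ hat V (+ W₁.n′) (+ W₂.n′) → two ∣ V
  fixed-even V hσ hc base = ∣hat⇒ι∣ comax-2-p₁p₂ (λ k l → even-function E (comax-sym comax₁-2)
        (comax-sym comax₂-2) base (+ k) (+ l))
    where
    close : ∀ {X Y} → X ≋ Y [ two ] → ∀ k l → hat X k l Z.≋ hat Y k l [ + 2 ]
    close {X} {Y} (congr h) k l = Z.congr (Z.∣-resp (hat-sub X Y k l) (ι∣⇒∣hat h k l))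
    E : EigenFunction (hat V) (+ 2) (+ 1) (+ 1)
    E = record
      { per₁ = hat-per₁ V ; per₂ = hat-per₂ V ; coset₁ = hat-coset₁ V ; coset₂ = hat-coset₂ V
      ; sign-δ = inj₁ refl ; sign-c = inj₁ refl
      ; double = λ k l → Z.≋-trans (Z.≋-sym (close hσ _ _))
          (Z.≈⇒≋ (trans (hat-ψ (+ 2) V k l comax₁-2 comax₂-2) (sym (ℤₚ.*-identityˡ (hat V k l)))))
      ; negate = λ k l → Z.≋-trans (Z.≋-sym (close hc _ _))
          (Z.≈⇒≋ (trans (hat-ψ (ℤ.- + 1) V k l comax-neg1 comax-neg1) (sym (ℤₚ.*-identityˡ (hat V k l))))) }

  -- Galois invariants modulo 2 form the field of two elements. The trace at (n₁′, n₂′) tells 0 from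
  -- 1: it is 1 for the element 1, and its parity determines a fixed element modulo 2.
  fixed-rational : ∀ s → σ s ≋ s [ two ] → conj s ≋ s [ two ] → (two ∣ s) ⊎ (s ≋ 1# [ two ])
  fixed-rational s hσ hc with parityℤ b
    where b = hat s (+ W₁.n′) (+ W₂.n′)
  ... | inj₁ even = inj₁ (fixed-even s hσ hc even)
  ... | inj₂ odd = inj₂ (congr (fixed-even (s - 1#)
          (≋-trans (≈⇒≋ (σ-sub s 1#)) (≋-sub hσ (≈⇒≋ (ψ-one (+ 2)))))
          (≋-trans (≈⇒≋ (conj-sub s 1#)) (≋-sub hc (≈⇒≋ conj-1)))
          (Z.∣-resp (trans (cong (λ z → hat s (+ W₁.n′) (+ W₂.n′) ℤ.- z) (sym value))
                (sym (hat-sub s 1# (+ W₁.n′) (+ W₂.n′)))) (Z.∣-diff odd))))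
    where
    value : hat 1# (+ W₁.n′) (+ W₂.n′) ≡ + 1
    value = trans (hat-1 (+ W₁.n′) (+ W₂.n′)) (trans
          (cong₂ (λ x y → W₁.w x ℤ.* W₂.w y) (sym (ℤₚ.*-identityˡ (+ W₁.n′)))
            (sym (ℤₚ.*-identityˡ (+ W₂.n′)))) (cong₂ ℤ._*_ (W₁.w-step (comax⇒∤ pr₁ comax-1ʳ))
            (W₂.w-step (comax⇒∤ pr₂ comax-1ʳ))))

  -- Writes 2^f - 1 as a successor n = n′ + 1, so that X^n visibly contains a factor X.
  order : Σ ℕ λ n → 2 ℕ.^ f ≡ suc (suc n)
  order = go f f>0
    where
    go : ∀ f → 0 ℕ.< f → Σ ℕ λ n → 2 ℕ.^ f ≡ suc (suc n)
    go (suc f) _ with 2 ℕ.^ f | ℕₚ.m^n>0 2 f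
    ... | suc m | _ = m ℕ.+ m , trans (cong (suc m ℕ.+_) (ℕₚ.+-identityʳ (suc m))) (cong suc (ℕₚ.+-suc m m))

  n′ n : ℕ
  n′ = proj₁ order
  n = suc n′

  frobenius-order : ∀ X → X * X ^ n ≋ X [ two ]
  frobenius-order X = ≋-trans (≈⇒≋ (≈-reflexive (cong (X ^_) (sym (proj₂ order)))))
      (≋-trans (frobenius-iterate prime[2] f X) (≈⇒≋
          (≈-trans (ψ-mod X (Z.≋-trans (Z.≈⇒≋ (pos-^ 2 f)) 2^f₁) (Z.≋-trans (Z.≈⇒≋ (pos-^ 2 f)) 2^f₂))
            (ψ-1 X))))

  -- X^(2^f) ≡ X modulo 2, so X^n X^n = X^n′ X^(n+1) ≡ X^n′ X = X^n.
  idempotent : ∀ X → X ^ n * X ^ n ≋ X ^ n [ two ]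
  idempotent X = ≋-trans (≈⇒≋ (l X (X ^ n′) (X ^ n)))
      (≋-trans (≋-* (≋-refl {X ^ n′}) (frobenius-order X)) (≈⇒≋ (*-comm (X ^ n′) X)))
    where l : ∀ x y z → x * y * z ≈ y * (x * z)
          l = solve 3 (λ x y z → x :* y :* z := y :* (x :* z)) ≈-refl

  -- The residue ring at 2 is a product of two fields exchanged by conj: the idempotent X^n
  -- attached to an element X that is neither 0 nor a unit satisfies X^n + conj X^n = 1.
  complementary : ∀ X → ¬ two ∣ X → two ∣ X * conj X → X ^ n + conj X ^ n ≋ 1# [ two ]
  complementary X ¬d d = [ ⊥-elim ∘ ¬d ∘ s-even , id ]′ (fixed-rational s σs conj-s)
    where
    e = X ^ n
    ē = conj X ^ n
    s = e + ē
    eē : e * ē ≋ 0# [ two ]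
    eē = ∣⇒≋0 (∣-resp (^-distrib-* X (conj X) n) (∣-*ʳ ((X * conj X) ^ n′) d))
    l₁ : ∀ a b → (a + b) * (a + b) ≈ a * a + b * b + (a * b + a * b)
    l₁ = solve 2 (λ a b → (a :+ b) :* (a :+ b) := a :* a :+ b :* b :+ (a :* b :+ a :* b)) ≈-refl
    l₂ : ∀ a b → a + b + (0# + 0#) ≈ a + b
    l₂ = solve 2 (λ a b → a :+ b :+ (con (+ 0) :+ con (+ 0)) := a :+ b) ≈-refl
    s²≋s : s * s ≋ s [ two ]
    s²≋s = ≋-trans (≈⇒≋ (l₁ e ē)) (≋-trans (≋-+ (≋-+ (idempotent X) (idempotent (conj X))) (≋-+ eē eē))
          (≈⇒≋ (l₂ e ē)))
    σs : σ s ≋ s [ two ]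
    σs = ≋-trans (≋-sym (frobenius prime[2] s)) (≋-trans (≈⇒≋ (*-cong ≈-refl (*-identityʳ s))) s²≋s)
    conj-s : conj s ≋ s [ two ]
    conj-s = ≈⇒≋ (≈-trans (conj-+ e ē) (≈-trans (+-cong (conj-^ X n)
              (≈-trans (conj-^ (conj X) n) (^-congˡ n (conj-conj X)))) (+-comm ē e)))
    l₃ : ∀ a b → (a + b) * a - a * b ≈ a * a
    l₃ = solve 2 (λ a b → (a :+ b) :* a :- a :* b := a :* a) ≈-refl
    s-even : two ∣ s → two ∣ X
    s-even h = ≋-∣ (frobenius-order X) (∣-*ˡ X (≋-∣ (idempotent X)
            (∣-resp (l₃ e ē) (∣-sub (∣-*ʳ e h) (≋0⇒∣ eē)))))

  -- Let e and ē be the n-th powers of X and conj X, and K = 2^k. Modulo 2^(k+1), (e + ē)^K ≡ 1 by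
  -- `complementary`, and X ē ≡ 0 leaves X ≡ X e^K. As e^K ≡ (Y^n)^K, also conj Y e^K ≡ 0, so
  -- 2^(k+1) divides X conj Y.
  module _ (X Y : Carrier) (k : ℕ) (¬d : ¬ two ∣ X)
    (X-norm : 2# ^ suc k ∣ X * conj X) (Y-norm : 2# ^ suc k ∣ Y * conj Y)
    (same : Y ^ n ≋ X ^ n [ two ]) where

    e ē : Carrier
    e = X ^ n
    ē = conj X ^ n

    Kp : ℕ
    Kp = 2 ℕ.^ k

    D : Carrier
    D = 2# ^ suc k

    two∣D : two ∣ D
    two∣D = ∣-respˡ (≈-sym two≈2#) (∣-*ʳ (2# ^ k) ∣-refl)

    sum-power : (e + ē) ^ Kp ≋ 1# [ D ]
    sum-power = ≋-trans (power-lift k (≋-modulus two≈2# (complementary X ¬d (∣-trans two∣D X-norm))))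
        (≈⇒≋ (1^ Kp))

    Xē≋0 : X * ē ≋ 0# [ D ]
    Xē≋0 = ∣⇒≋0 (∣-resp (*-assoc X (conj X) (conj X ^ n′)) (∣-*ʳ (conj X ^ n′) X-norm))

    absorb : ∀ j → X * (e + ē) ^ j ≋ X * e ^ j [ D ]
    absorb zero = ≋-refl
    absorb (suc j) = ≋-trans (≈⇒≋ (l₁ X e ē ((e + ē) ^ j)))
        (≋-trans (≋-+ (≋-* (≋-refl {e}) (absorb j)) (≋-* Xē≋0 (≋-refl {(e + ē) ^ j})))
          (≈⇒≋ (l₂ X e (e ^ j) ((e + ē) ^ j))))
      where
      l₁ : ∀ x e f z → x * ((e + f) * z) ≈ e * (x * z) + x * f * z
      l₁ = solve 4 (λ x e f z → x :* ((e :+ f) :* z) := e :* (x :* z) :+ x :* f :* z) ≈-refl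
      l₂ : ∀ x e y z → e * (x * y) + 0# * z ≈ x * (e * y)
      l₂ = solve 4 (λ x e y z → e :* (x :* y) :+ con (+ 0) :* z := x :* (e :* y)) ≈-refl

    Kp≡ : Σ ℕ λ j → Kp ≡ suc j
    Kp≡ with 2 ℕ.^ k | ℕₚ.m^n>0 2 k
    ... | suc j | _ = j , refl

    kill : conj Y * e ^ Kp ≋ 0# [ D ]
    kill = ≋-trans (≋-* (≋-refl {conj Y}) (≋-sym (power-lift k (≋-modulus two≈2# same))))
        (∣⇒≋0 (∣-resp (≈-reflexive (cong (λ z → conj Y * (Y ^ n) ^ z) (sym (proj₂ Kp≡))))
            (∣-resp (l (conj Y) Y (Y ^ n′) ((Y ^ n) ^ proj₁ Kp≡))
              (∣-*ʳ (Y ^ n′ * (Y ^ n) ^ proj₁ Kp≡) Y-norm))))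
      where l : ∀ ȳ y z w → y * ȳ * (z * w) ≈ ȳ * (y * z * w)
            l = solve 4 (λ ȳ y z w → y :* ȳ :* (z :* w) := ȳ :* (y :* z :* w)) ≈-refl

    two-part : D ∣ X * conj Y
    two-part = ≋0⇒∣ (≋-trans (≈⇒≋ (l₁ X (conj Y)))
          (≋-trans (≋-* (≋-* (≋-refl {X}) (≋-sym sum-power)) (≋-refl {conj Y}))
            (≋-trans (≋-* (absorb Kp) (≋-refl {conj Y}))
              (≋-trans (≈⇒≋ (l₂ X (e ^ Kp) (conj Y))) (≋-trans (≋-* (≋-refl {X}) kill) (≈⇒≋ (zeroʳ X)))))))
      where
      l₁ : ∀ x y → x * y ≈ x * 1# * y
      l₁ = solve 2 (λ x y → x :* y := x :* con (+ 1) :* y) ≈-refl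
      l₂ : ∀ x z y → x * z * y ≈ x * (y * z)
      l₂ = solve 3 (λ x z y → x :* z :* y := x :* (y :* z)) ≈-refl

  Nℤ : ℤ
  Nℤ = + n₁ ℤ.* + n₂

  norm-value : ℕ → ℕ → ℤ
  norm-value k m = (+ 2) Z.^ k ℤ.* Nℤ Z.^ m

  comax-2-N : ∀ k m → Comax ((+ 2) Z.^ k) (Nℤ Z.^ m)
  comax-2-N k m = comax-^ k m (comax-*ʳ (comax-sym (comax-n₁ comax₁-2)) (comax-sym (comax-n₂ comax₂-2)))

  nonzero-value : ∀ k m → ℤ.NonZero (norm-value k m)
  nonzero-value k m = ℤₚ.i*j≢0 ((+ 2) Z.^ k) (Nℤ Z.^ m) {{pow 2 k}}
      {{subst (λ z → ℤ.NonZero (z Z.^ m)) (ℤₚ.pos-* n₁ n₂)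
          (pow (n₁ ℕ.* n₂) m {{ℕₚ.m*n≢0 n₁ n₂ {{W₁.n≢0}} {{W₂.n≢0}}}})}}
    where
    pow : ∀ a j .{{_ : ℕ.NonZero a}} → ℤ.NonZero ((+ a) Z.^ j)
    pow a j = subst ℤ.NonZero (pos-^ a j) (ℕₚ.m^n≢0 a j)

  2#^≈ : ∀ k → 2# ^ k ≈ ι ((+ 2) Z.^ k)
  2#^≈ k = ≈-sym (≈-trans (ι-pow (+ 2) k) (^-congˡ k two≈2#))

  -- W = X conj Y is divisible by the whole norm M: its power of 2 by `two-part`, its power of N by
  -- self-conjugacy, as W conj W = M². The quotient u has u conj u = 1, so it is ± a root of unity,
  -- and X = u Y because Y conj Y X = W Y.
  associated : ∀ X Y k m → ¬ two ∣ X → X * conj X ≈ ι (norm-value (suc k) m) → Y * conj Y ≈ ι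
      (norm-value (suc k) m) →
               Y ^ n ≋ X ^ n [ two ] → Σ ℤ λ δ → Σ ℤ λ a → Σ ℤ λ b → Sign δ × (X ≈ ι δ * ζ a b * Y)
  associated X Y k m ¬d X-norm Y-norm same = finish (kronecker u uū≈1)
    where
    M = norm-value (suc k) m
    instance _ = nonzero-value (suc k) m
    W = X * conj Y
    two∣norm : ∀ Z → Z * conj Z ≈ ι M → 2# ^ suc k ∣ Z * conj Z
    two∣norm Z h = ∣-resp (≈-sym (≈-trans h (ι-* ((+ 2) Z.^ suc k) (Nℤ Z.^ m))))
        (∣-respˡ (≈-sym (2#^≈ (suc k))) (∣-*ʳ (ι (Nℤ Z.^ m)) ∣-refl))
    part₂ : ι ((+ 2) Z.^ suc k) ∣ W
    part₂ = ∣-respˡ (2#^≈ (suc k)) (two-part X Y k ¬d (two∣norm X X-norm) (two∣norm Y Y-norm) same)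
    l₁ : ∀ x ȳ x̄ y → x * ȳ * (x̄ * y) ≈ (x * x̄) * (y * ȳ)
    l₁ = solve 4 (λ x ȳ x̄ y → x :* ȳ :* (x̄ :* y) := (x :* x̄) :* (y :* ȳ)) ≈-refl
    WW̄ : W * conj W ≈ ι M * ι M
    WW̄ = ≈-trans (*-cong ≈-refl (≈-trans (conj-* X (conj Y)) (*-cong ≈-refl (conj-conj Y))))
        (≈-trans (l₁ X (conj Y) (conj X) Y) (*-cong X-norm Y-norm))
    N∣M² : Nℤ Z.^ (m ℕ.+ m) Z.∣ M ℤ.* M
    N∣M² = Z.∣-respˡ (sym (Z.^-homo-* Nℤ m m)) (Z.∣-*-mono N∣M N∣M)
      where
      N∣M : Nℤ Z.^ m Z.∣ M
      N∣M = Z.∣-*ˡ ((+ 2) Z.^ suc k) Z.∣-refl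
    part-N : ι (Nℤ Z.^ m) ∣ W
    part-N = N-self-conjugate m W (∣-resp (≈-sym (≈-trans WW̄ (≈-sym (ι-* M M)))) (ι-∣ N∣M²))
    M∣W : ι M ∣ W
    M∣W = ι-comax-* ((+ 2) Z.^ suc k) (Nℤ Z.^ m) (comax-2-N (suc k) m) part₂ part-N
    u = _∣_.quotient M∣W
    W≈ : W ≈ ι M * u
    W≈ = _∣_.equality M∣W
    l₂ : ∀ c u ū → c * (c * (u * ū)) ≈ c * u * (c * ū)
    l₂ = solve 3 (λ c u ū → c :* (c :* (u :* ū)) := c :* u :* (c :* ū)) ≈-refl
    uū≈1 : u * conj u ≈ 1#
    uū≈1 = ι-cancel M (ι-cancel M (≈-trans (l₂ (ι M) u (conj u))
            (≈-trans (*-cong (≈-sym W≈) (≈-sym (≈-trans (conj-cong W≈)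
              (≈-trans (conj-* (ι M) u) (*-cong (conj-ι M) ≈-refl)))))
              (≈-trans WW̄ (*-cong ≈-refl (≈-sym (*-identityʳ (ι M))))))))
    l₃ : ∀ x y ȳ → y * ȳ * x ≈ x * ȳ * y
    l₃ = solve 3 (λ x y ȳ → y :* ȳ :* x := x :* ȳ :* y) ≈-refl
    X≈uY : X ≈ u * Y
    X≈uY = ι-cancel M (≈-trans (*-cong (≈-sym Y-norm) ≈-refl)
          (≈-trans (l₃ X Y (conj Y)) (≈-trans (*-cong W≈ ≈-refl) (*-assoc (ι M) u Y))))
    finish : (Σ ℤ λ δ → Σ ℤ λ a → Σ ℤ λ b → ((δ ≡ + 1) ⊎ (δ ≡ ℤ.- + 1)) × (u ≈ ι δ * ζ a b)) → Σ ℤ λ δ →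
        Σ ℤ λ a → Σ ℤ λ b → Sign δ × (X ≈ ι δ * ζ a b * Y)
    finish (δ , a , b , s , h) = δ , a , b , s , ≈-trans X≈uY (*-cong h ≈-refl)

-- From norms to binary quadratic forms.

module Descent (S : Setting) (C : CyclotomicRing S) where
  open Setting S
  open CyclotomicRing C
  open RingTools algebra
  open RingPowers algebra
  open Cyclotomic S C
  open TwoPart S C
  open Kronecker S C using (φ; hat-1-0)
  open Eigen S using (EigenFunction; square-sum; κ; sign-swap)

  -- Norm forms of ℚ(√(-p₁ p₂)): the principal one, and the one of the class of the prime over p₁.
  -- The factor 4 allows for half-integral coordinates. Dividing the value by p₁ or by p₂ exchanges
  -- them.
  Form₁ Form₂ : ℤ → Set
  Form₁ M = Σ ℤ λ A → Σ ℤ λ B → A ℤ.* A ℤ.+ + p₁ ℤ.* + p₂ ℤ.* (B ℤ.* B) ≡ + 4 ℤ.* M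
  Form₂ M = Σ ℤ λ A → Σ ℤ λ B → + p₁ ℤ.* (A ℤ.* A) ℤ.+ + p₂ ℤ.* (B ℤ.* B) ≡ + 4 ℤ.* M

  prime-square : ∀ {p} → Prime p → ∀ x → + p Z.∣ x ℤ.* x → + p Z.∣ x
  prime-square pr x h = [ id , id ]′ (euclidℤ pr x x h)

  isolate : ∀ p x y z → x ℤ.+ p ℤ.* y ≡ p ℤ.* z → p Z.∣ x
  isolate p x y z e = Z.divides (z ℤ.- y) (trans (l x (p ℤ.* y)) (trans (cong (ℤ._- p ℤ.* y) e) (l′ p y z)))
    where
    l : ∀ x y → x ≡ x ℤ.+ y ℤ.- y
    l = solve-∀
    l′ : ∀ p y z → p ℤ.* z ℤ.- p ℤ.* y ≡ p ℤ.* (z ℤ.- y)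
    l′ = solve-∀

  reduce₁₂-p₁ : ∀ M → Form₁ (+ p₁ ℤ.* M) → Form₂ M
  reduce₁₂-p₁ M (A , B , e) = from (prime-square pr₁ A
        (isolate (+ p₁) (A ℤ.* A) (+ p₂ ℤ.* (B ℤ.* B)) (+ 4 ℤ.* M)
          (trans (cong (ℤ._+_ (A ℤ.* A)) (sym (ℤₚ.*-assoc (+ p₁) (+ p₂) (B ℤ.* B))))
            (trans e (l₀ (+ p₁) M)))))
    where
    l₀ : ∀ p m → + 4 ℤ.* (p ℤ.* m) ≡ p ℤ.* (+ 4 ℤ.* m)
    l₀ = solve-∀
    from : + p₁ Z.∣ A → Form₂ M
    from (Z.divides A′ f) = A′ , B , ℤₚ.*-cancelˡ-≡ (+ p₁) _ _
        (trans (l (+ p₁) (+ p₂) A′ B) (trans (cong (λ z → z ℤ.* z ℤ.+ + p₁ ℤ.* + p₂ ℤ.* (B ℤ.* B)) (sym f))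
            (trans e (l₀ (+ p₁) M))))
      where l : ∀ p q a b → p ℤ.* (p ℤ.* (a ℤ.* a) ℤ.+ q ℤ.* (b ℤ.* b)) ≡ p ℤ.* a ℤ.*
                (p ℤ.* a) ℤ.+ p ℤ.* q ℤ.* (b ℤ.* b)
            l = solve-∀

  reduce₁₂-p₂ : ∀ M → Form₁ (+ p₂ ℤ.* M) → Form₂ M
  reduce₁₂-p₂ M (A , B , e) = from (prime-square pr₂ A
        (isolate (+ p₂) (A ℤ.* A) (+ p₁ ℤ.* (B ℤ.* B)) (+ 4 ℤ.* M)
          (trans (cong (ℤ._+_ (A ℤ.* A)) (l₁ (+ p₁) (+ p₂) (B ℤ.* B))) (trans e (l₀ (+ p₂) M)))))
    where
    l₀ : ∀ p m → + 4 ℤ.* (p ℤ.* m) ≡ p ℤ.* (+ 4 ℤ.* m)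
    l₀ = solve-∀
    l₁ : ∀ p q b → q ℤ.* (p ℤ.* b) ≡ p ℤ.* q ℤ.* b
    l₁ = solve-∀
    from : + p₂ Z.∣ A → Form₂ M
    from (Z.divides A′ f) = B , A′ , ℤₚ.*-cancelˡ-≡ (+ p₂) _ _
        (trans (l (+ p₁) (+ p₂) A′ B) (trans (cong (λ z → z ℤ.* z ℤ.+ + p₁ ℤ.* + p₂ ℤ.* (B ℤ.* B)) (sym f))
            (trans e (l₀ (+ p₂) M))))
      where l : ∀ p q a b → q ℤ.* (p ℤ.* (b ℤ.* b) ℤ.+ q ℤ.* (a ℤ.* a)) ≡ q ℤ.* a ℤ.*
                (q ℤ.* a) ℤ.+ p ℤ.* q ℤ.* (b ℤ.* b)
            l = solve-∀

  reduce₂₁-p₁ : ∀ M → Form₂ (+ p₁ ℤ.* M) → Form₁ M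
  reduce₂₁-p₁ M (A , B , e) = from (prime-square pr₁ B
        (comax-cancel (+ p₂) comax-p₁p₂ (isolate (+ p₁) (+ p₂ ℤ.* (B ℤ.* B)) (A ℤ.* A) (+ 4 ℤ.* M)
            (trans (ℤₚ.+-comm (+ p₂ ℤ.* (B ℤ.* B)) (+ p₁ ℤ.* (A ℤ.* A))) (trans e (l₀ (+ p₁) M))))))
    where
    l₀ : ∀ p m → + 4 ℤ.* (p ℤ.* m) ≡ p ℤ.* (+ 4 ℤ.* m)
    l₀ = solve-∀
    from : + p₁ Z.∣ B → Form₁ M
    from (Z.divides B′ f) = A , B′ , ℤₚ.*-cancelˡ-≡ (+ p₁) _ _
        (trans (l (+ p₁) (+ p₂) A B′) (trans (cong (λ z → + p₁ ℤ.* (A ℤ.* A) ℤ.+ + p₂ ℤ.* (z ℤ.* z)) (sym f))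
            (trans e (l₀ (+ p₁) M))))
      where l : ∀ p q a b → p ℤ.* (a ℤ.* a ℤ.+ p ℤ.* q ℤ.* (b ℤ.* b)) ≡ p ℤ.* (a ℤ.* a) ℤ.+ q ℤ.*
                (p ℤ.* b ℤ.* (p ℤ.* b))
            l = solve-∀

  reduce₂₁-p₂ : ∀ M → Form₂ (+ p₂ ℤ.* M) → Form₁ M
  reduce₂₁-p₂ M (A , B , e) = from (prime-square pr₂ A
        (comax-cancel (+ p₁) (comax-sym comax-p₁p₂)
          (isolate (+ p₂) (+ p₁ ℤ.* (A ℤ.* A)) (B ℤ.* B) (+ 4 ℤ.* M) (trans e (l₀ (+ p₂) M)))))
    where
    l₀ : ∀ p m → + 4 ℤ.* (p ℤ.* m) ≡ p ℤ.* (+ 4 ℤ.* m)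
    l₀ = solve-∀
    from : + p₂ Z.∣ A → Form₁ M
    from (Z.divides A′ f) = B , A′ , ℤₚ.*-cancelˡ-≡ (+ p₂) _ _
        (trans (l (+ p₁) (+ p₂) A′ B) (trans (cong (λ z → + p₁ ℤ.* (z ℤ.* z) ℤ.+ + p₂ ℤ.* (B ℤ.* B)) (sym f))
            (trans e (l₀ (+ p₂) M))))
      where l : ∀ p q a b → q ℤ.* (b ℤ.* b ℤ.+ p ℤ.* q ℤ.* (a ℤ.* a)) ≡ p ℤ.*
                (q ℤ.* a ℤ.* (q ℤ.* a)) ℤ.+ q ℤ.* (b ℤ.* b)
            l = solve-∀

  Form : ℤ → Set
  Form M = Form₁ M ⊎ Form₂ M

  reduce-p₁ : ∀ a M → Form ((+ p₁) Z.^ a ℤ.* M) → Form M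
  reduce-p₁ zero M = subst Form (ℤₚ.*-identityˡ M)
  reduce-p₁ (suc a) M h = reduce-p₁ a M ([ inj₂ ∘ reduce₁₂-p₁ ((+ p₁) Z.^ a ℤ.* M) , inj₁ ∘ reduce₂₁-p₁
        ((+ p₁) Z.^ a ℤ.* M) ]′ (subst Form (ℤₚ.*-assoc (+ p₁) ((+ p₁) Z.^ a) M) h))

  reduce-p₂ : ∀ a M → Form ((+ p₂) Z.^ a ℤ.* M) → Form M
  reduce-p₂ zero M = subst Form (ℤₚ.*-identityˡ M)
  reduce-p₂ (suc a) M h = reduce-p₂ a M ([ inj₂ ∘ reduce₁₂-p₂ ((+ p₂) Z.^ a ℤ.* M) , inj₁ ∘ reduce₂₁-p₂
        ((+ p₂) Z.^ a ℤ.* M) ]′ (subst Form (ℤₚ.*-assoc (+ p₂) ((+ p₂) Z.^ a) M) h))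

  four-pow : ∀ k → + 4 ℤ.* (+ 2) Z.^ k ≡ + (2 ℕ.^ (k ℕ.+ 2))
  four-pow k = trans (ℤₚ.*-comm (+ 4) ((+ 2) Z.^ k))
      (trans (sym (Z.^-homo-* (+ 2) k 2)) (sym (pos-^ 2 (k ℕ.+ 2))))

  -- Stripping all factors p₁ and p₂ leaves 4·2^k represented by one of the two forms, and
  -- `no-principal` excludes the first.
  solvable : ∀ k m → eps k ≡ ℤ.- + 1 → Form (norm-value k m) → Solvable p₁ p₂ k
  solvable k m odd h = finish (reduce-p₂ (suc e₂ ℕ.* m) ((+ 2) Z.^ k)
        (reduce-p₁ (suc e₁ ℕ.* m) ((+ p₂) Z.^ (suc e₂ ℕ.* m) ℤ.* (+ 2) Z.^ k) (subst Form eq h)))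
    where
    l : ∀ t a b → t ℤ.* (a ℤ.* b) ≡ a ℤ.* (b ℤ.* t)
    l = solve-∀
    pow : ∀ p e → (+ (p ℕ.^ e)) Z.^ m ≡ (+ p) Z.^ (e ℕ.* m)
    pow p e = trans (cong (Z._^ m) (pos-^ p e)) (Z.^-assocʳ (+ p) e m)
    eq : norm-value k m ≡ (+ p₁) Z.^ (suc e₁ ℕ.* m) ℤ.* ((+ p₂) Z.^ (suc e₂ ℕ.* m) ℤ.* (+ 2) Z.^ k)
    eq = trans (cong ((+ 2) Z.^ k ℤ.*_) (trans (Z.^-distrib-* (+ n₁) (+ n₂) m)
            (cong₂ ℤ._*_ (pow p₁ (suc e₁)) (pow p₂ (suc e₂)))))
        (l ((+ 2) Z.^ k) ((+ p₁) Z.^ (suc e₁ ℕ.* m)) ((+ p₂) Z.^ (suc e₂ ℕ.* m)))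
    finish : Form ((+ 2) Z.^ k) → Solvable p₁ p₂ k
    finish (inj₁ (A , B , e)) = ⊥-elim (no-principal k A B odd (trans e (four-pow k)))
    finish (inj₂ (A , B , e)) = A , B , trans e (four-pow k)

  -- an element X with σ X = ± X lies in ℚ(√-p₁,√p₂); its norm is read off from the transform

  conj-σ : ∀ X → conj (σ X) ≈ σ (conj X)
  conj-σ X = ≈-trans (ψ-ψ (ℤ.- + 1) (+ 2) X) (≈-sym (ψ-ψ (+ 2) (ℤ.- + 1) X))

  eigenfunction : ∀ V δ c → Sign δ → Sign c → σ V ≈ ι δ * V → conj V ≈ ι c * V → EigenFunction (hat V)
      (+ 0) δ c
  eigenfunction V δ c sδ sc hσ hc = record
    { per₁ = hat-per₁ V ; per₂ = hat-per₂ V ; coset₁ = hat-coset₁ V ; coset₂ = hat-coset₂ V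
    ; sign-δ = sδ ; sign-c = sc
    ; double = λ k l → Z.≈⇒≋ (flip _ _ sδ (trans (sym (hat-ψ (+ 2) V k l comax₁-2 comax₂-2))
            (trans (hat-cong hσ _ _) (hat-ι δ V _ _))))
    ; negate = λ k l → Z.≈⇒≋ (flip _ _ sc (trans (sym (hat-ψ (ℤ.- + 1) V k l comax-neg1 comax-neg1))
            (trans (hat-cong hc _ _) (hat-ι c V _ _)))) }
    where
    flip : ∀ {δ} x y → Sign δ → x ≡ δ ℤ.* y → y ≡ δ ℤ.* x
    flip x y (inj₁ refl) e = trans (sym (ℤₚ.*-identityˡ y)) (trans (sym e) (sym (ℤₚ.*-identityˡ x)))
    flip x y (inj₂ refl) e = trans (l y) (cong (ℤ._*_ (ℤ.- + 1)) (sym e))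
      where l : ∀ y → y ≡ (ℤ.- + 1) ℤ.* ((ℤ.- + 1) ℤ.* y)
            l = solve-∀

  φ≢0 : ℤ.NonZero φ
  φ≢0 = ℤₚ.i*j≢0 (+ p₁ ℤ.- + 1) (+ p₂ ℤ.- + 1) {{pred≢0 pr₁}} {{pred≢0 pr₂}}
    where
    pred≢0 : ∀ {p} → Prime p → ℤ.NonZero (+ p ℤ.- + 1)
    pred≢0 {zero} pr = ⊥-elim (ℕₚ.n≮0 (prime>1 pr))
    pred≢0 {1} pr = ⊥-elim (ℕₚ.<-irrefl refl (prime>1 pr))
    pred≢0 {suc (suc p)} pr = _

  -- X + conj X and X - conj X are eigenvectors of both σ and conj, and their norms V conj V add up
  -- to 4 X conj X. Through `square-sum` each contributes one square, with the κ factors determined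
  -- by its signs.
  norm-equation : ∀ X δ M → (s : Sign δ) → σ X ≈ ι δ * X → X * conj X ≈ ι M →
    Σ ℤ λ A → Σ ℤ λ B → κ {+ 1} (inj₁ refl) p₁ ℤ.* κ (sign-swap s (inj₁ refl)) p₂ ℤ.* (A ℤ.* A)
                  ℤ.+ κ {ℤ.- + 1} (inj₂ refl) p₁ ℤ.* κ (sign-swap s (inj₂ refl)) p₂ ℤ.* (B ℤ.* B) ≡ + 4 ℤ.*
                    (+ p₁ ℤ.* + p₂ ℤ.* M)
  norm-equation X δ M s hσ norm = A , B , ℤₚ.*-cancelˡ-≡ φ _ _ {{φ≢0}} (begin
    φ ℤ.* (K₊ ℤ.* (A ℤ.* A) ℤ.+ K₋ ℤ.* (B ℤ.* B)) ≡⟨ ℤₚ.*-distribˡ-+ φ _ _ ⟩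
    φ ℤ.* (K₊ ℤ.* (A ℤ.* A)) ℤ.+ φ ℤ.* (K₋ ℤ.* (B ℤ.* B)) ≡⟨ cong₂ ℤ._+_ (square-sum E₊) (square-sum E₋) ⟨
    Z.∑< n₁ (λ k → Z.∑< n₂ (λ l → hat V₊ (+ k) (+ l) ℤ.* hat V₊ (+ k) (+ l))) ℤ.+ Z.∑< n₁
      (λ k → Z.∑< n₂ (λ l → hat V₋ (+ k) (+ l) ℤ.* hat V₋ (+ k) (+ l)))
      ≡⟨ cong₂ ℤ._+_ (parseval V₊ V₊) (parseval V₋ V₋) ⟩
    P ℤ.* hat (V₊ * conj V₊) (+ 0) (+ 0) ℤ.+ P ℤ.* hat (V₋ * conj V₋) (+ 0) (+ 0) ≡⟨ ℤₚ.*-distribˡ-+ P _ _ ⟨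
    P ℤ.* (hat (V₊ * conj V₊) (+ 0) (+ 0) ℤ.+ hat (V₋ * conj V₋) (+ 0) (+ 0)) ≡⟨ cong (P ℤ.*_)
      (trans (sym (hat-+ _ _ (+ 0) (+ 0))) (trans (hat-cong total (+ 0) (+ 0))
          (trans (hat-ι (+ 4 ℤ.* M) 1# (+ 0) (+ 0)) (cong (+ 4 ℤ.* M ℤ.*_) hat-1-0)))) ⟩
    P ℤ.* (+ 4 ℤ.* M ℤ.* φ) ≡⟨ l₀ P M φ ⟩
    φ ℤ.* (+ 4 ℤ.* (P ℤ.* M)) ∎)
    where
    open ≡-Reasoning
    X̄ = conj X
    V₊ = X + X̄
    V₋ = X - X̄
    P = + p₁ ℤ.* + p₂
    l₀ : ∀ p m f → p ℤ.* (+ 4 ℤ.* m ℤ.* f) ≡ f ℤ.* (+ 4 ℤ.* (p ℤ.* m))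
    l₀ = solve-∀
    hσ̄ : σ X̄ ≈ ι δ * X̄
    hσ̄ = ≈-trans (≈-sym (conj-σ X)) (≈-trans (conj-cong hσ)
          (≈-trans (conj-* (ι δ) X) (*-cong (conj-ι δ) ≈-refl)))
    l₁ : ∀ d x y → d * x - d * y ≈ d * (x - y)
    l₁ = solve 3 (λ d x y → d :* x :- d :* y := d :* (x :- y)) ≈-refl
    l₂ : ∀ x y → x - y ≈ - 1# * (y - x)
    l₂ = solve 2 (λ x y → x :- y := :- con (+ 1) :* (y :- x)) ≈-refl
    conj₊ : conj V₊ ≈ V₊
    conj₊ = ≈-trans (conj-+ X X̄) (≈-trans (+-cong ≈-refl (conj-conj X)) (+-comm X̄ X))
    conj₋ : conj V₋ ≈ X̄ - X
    conj₋ = ≈-trans (conj-sub X X̄) (-‿cong₂ ≈-refl (conj-conj X))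
    E₊ : EigenFunction (hat V₊) (+ 0) δ (+ 1)
    E₊ = eigenfunction V₊ δ (+ 1) s (inj₁ refl) (≈-trans (ψ-+ (+ 2) X X̄)
          (≈-trans (+-cong hσ hσ̄) (≈-sym (distribˡ (ι δ) X X̄))))
        (≈-trans conj₊ (≈-sym (≈-trans (*-cong ι-1 ≈-refl) (*-identityˡ V₊))))
    E₋ : EigenFunction (hat V₋) (+ 0) δ (ℤ.- + 1)
    E₋ = eigenfunction V₋ δ (ℤ.- + 1) s (inj₂ refl)
        (≈-trans (σ-sub X X̄) (≈-trans (-‿cong₂ hσ hσ̄) (l₁ (ι δ) X X̄)))
        (≈-trans conj₋ (≈-trans (l₂ X̄ X) (*-cong (≈-sym (≈-trans (ι-neg (+ 1)) (-‿cong ι-1))) ≈-refl)))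
    A = hat V₊ (+ 1 ℤ.* + W₁.n′) (+ 1 ℤ.* + W₂.n′)
    B = hat V₋ (+ 1 ℤ.* + W₁.n′) (+ 1 ℤ.* + W₂.n′)
    K₊ = κ {+ 1} (inj₁ refl) p₁ ℤ.* κ (sign-swap s (inj₁ refl)) p₂
    K₋ = κ {ℤ.- + 1} (inj₂ refl) p₁ ℤ.* κ (sign-swap s (inj₂ refl)) p₂
    l₃ : ∀ x y → (x + y) * (x + y) + (x - y) * (y - x) ≈ (1# + 1# + (1# + 1#)) * (x * y)
    l₃ = solve 2 (λ x y → (x :+ y) :* (x :+ y) :+ (x :- y) :* (y :- x) :=
          (con (+ 1) :+ con (+ 1) :+ (con (+ 1) :+ con (+ 1))) :* (x :* y)) ≈-refl
    four : 1# + 1# + (1# + 1#) ≈ ι (+ 4)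
    four = ≈-sym (≈-trans (ι-+ (+ 2) (+ 2)) (+-cong two≈2# two≈2#))
    total : V₊ * conj V₊ + V₋ * conj V₋ ≈ ι (+ 4 ℤ.* M) * 1#
    total = ≈-trans (+-cong (*-cong ≈-refl conj₊) (*-cong ≈-refl conj₋))
        (≈-trans (l₃ X X̄) (≈-trans (*-cong four norm)
            (≈-trans (≈-sym (ι-* (+ 4) M)) (≈-sym (*-identityʳ _)))))

  -- The left side of `norm-equation` is p₁ p₂ A² + B² for δ = 1 and p₁ A² + p₂ B² for δ = -1, with
  -- value 4 p₁ p₂ M; removing p₁ and p₂ exchanges the forms twice.
  form-of-eigenvector : ∀ X δ M → Sign δ → σ X ≈ ι δ * X → X * conj X ≈ ι M → Form M
  form-of-eigenvector X δ M (inj₁ refl) hσ norm = from (norm-equation X (+ 1) M (inj₁ refl) hσ norm)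
    where
    from : (Σ ℤ λ A → Σ ℤ λ B → + p₁ ℤ.* + p₂ ℤ.* (A ℤ.* A) ℤ.+ + 1 ℤ.* + 1 ℤ.* (B ℤ.* B) ≡ + 4 ℤ.*
          (+ p₁ ℤ.* + p₂ ℤ.* M)) → Form M
    from (A , B , e) = inj₁ (reduce₂₁-p₁ M (reduce₁₂-p₂ (+ p₁ ℤ.* M)
            (B , A , trans (l (+ p₁ ℤ.* + p₂) A B) (trans e (l′ (+ p₁) (+ p₂) M)))))
      where
      l : ∀ p a b → b ℤ.* b ℤ.+ p ℤ.* (a ℤ.* a) ≡ p ℤ.* (a ℤ.* a) ℤ.+ + 1 ℤ.* + 1 ℤ.* (b ℤ.* b)
      l = solve-∀
      l′ : ∀ p q m → + 4 ℤ.* (p ℤ.* q ℤ.* m) ≡ + 4 ℤ.* (q ℤ.* (p ℤ.* m))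
      l′ = solve-∀
  form-of-eigenvector X δ M (inj₂ refl) hσ norm = from (norm-equation X (ℤ.- + 1) M (inj₂ refl) hσ norm)
    where
    from : (Σ ℤ λ A → Σ ℤ λ B → + p₁ ℤ.* + 1 ℤ.* (A ℤ.* A) ℤ.+ + 1 ℤ.* + p₂ ℤ.* (B ℤ.* B) ≡ + 4 ℤ.*
          (+ p₁ ℤ.* + p₂ ℤ.* M)) → Form M
    from (A , B , e) = inj₂ (reduce₁₂-p₁ M (reduce₂₁-p₂ (+ p₁ ℤ.* M)
            (A , B , trans (l (+ p₁) (+ p₂) A B) (trans e (l′ (+ p₁) (+ p₂) M)))))
      where
      l : ∀ p q a b → p ℤ.* (a ℤ.* a) ℤ.+ q ℤ.* (b ℤ.* b) ≡ p ℤ.* + 1 ℤ.* (a ℤ.* a) ℤ.+ + 1 ℤ.* q ℤ.*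
          (b ℤ.* b)
      l = solve-∀
      l′ : ∀ p q m → + 4 ℤ.* (p ℤ.* q ℤ.* m) ≡ + 4 ℤ.* (q ℤ.* (p ℤ.* m))
      l′ = solve-∀

  -- Since σ - 1 is invertible on roots of unity of odd order, X can be multiplied by a root of
  -- unity to become an eigenvector of σ.
  odd-element : ∀ k m X → eps (suc k) ≡ ℤ.- + 1 → ¬ two ∣ X → X * conj X ≈ ι (norm-value (suc k) m) →
      Solvable p₁ p₂ (suc k)
  odd-element k m X odd ¬d norm = from (associated X (σ X) k m ¬d norm σ-norm same)
    where
    M = norm-value (suc k) m
    σ-norm : σ X * conj (σ X) ≈ ι M
    σ-norm = ≈-trans (*-cong ≈-refl (conj-σ X)) (≈-trans (≈-sym (ψ-* (+ 2) X (conj X)))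
          (≈-trans (σ-cong norm) (ψ-ι (+ 2) M)))
    -- σ X ≡ X² modulo 2, so (σ X)^n ≡ (X^n)² ≡ X^n: the idempotents of X and σ X agree.
    same : σ X ^ n ≋ X ^ n [ two ]
    same = ≋-trans (≋-^ n (≋-sym (frobenius prime[2] X)))
        (≋-trans (≈⇒≋ (≈-trans (^-assocʳ X 2 n) (≈-trans
              (≈-reflexive (cong (X ^_) (cong (n ℕ.+_) (ℕₚ.+-identityʳ n)))) (^-homo-* X n n))))
          (idempotent X))
    from : (Σ ℤ λ δ → Σ ℤ λ a → Σ ℤ λ b → Sign δ × (X ≈ ι δ * ζ a b * σ X)) → Solvable p₁ p₂ (suc k)
    from (δ , a , b , s , h) = solvable (suc k) m odd (form-of-eigenvector X′ δ M s hσ norm′)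
      where
      -- From X = δ ζ σ X follows σ (ζ X) = ζ² σ X = δ ζ X. As σ doubles exponents, σ - 1 is the
      -- identity on them, so ζ itself is the multiplier.
      X′ = ζ a b * X
      l₁ : ∀ z w x y → z * x * (w * y) ≈ (w * z) * (x * y)
      l₁ = solve 4 (λ z w x y → z :* x :* (w :* y) := (w :* z) :* (x :* y)) ≈-refl
      norm′ : X′ * conj X′ ≈ ι M
      norm′ = ≈-trans (*-cong ≈-refl (conj-* (ζ a b) X))
          (≈-trans (l₁ (ζ a b) (conj (ζ a b)) X (conj X))
            (≈-trans (*-cong (≈-trans (*-cong (conj-ζ a b) ≈-refl) (ζ-inv a b)) norm) (*-identityˡ (ι M))))
      δ² : ι δ * ι δ ≈ 1#
      δ² = ≈-trans (≈-sym (ι-* δ δ)) (≈-trans (≈-reflexive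
              (cong ι ([ (λ { refl → refl }) , (λ { refl → refl }) ]′ s))) ι-1)
      l₂ : ∀ d z y → (d * d) * (z * z) * y ≈ d * (z * (d * z * y))
      l₂ = solve 3 (λ d z y → (d :* d) :* (z :* z) :* y := d :* (z :* (d :* z :* y))) ≈-refl
      l₃ : ∀ z → + 2 ℤ.* z ≡ z ℤ.+ z
      l₃ = solve-∀
      hσ : σ X′ ≈ ι δ * X′
      hσ = ≈-trans (ψ-* (+ 2) (ζ a b) X) (≈-trans (*-cong
              (≈-trans (ψ-ζ (+ 2) a b) (≈-trans (≈-reflexive (cong₂ ζ (l₃ a) (l₃ b)))
                (≈-trans (≈-sym (ζ-+ a b a b)) (≈-sym (≈-trans (*-cong δ² ≈-refl) (*-identityˡ _)))))) ≈-refl)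
        (≈-trans (l₂ (ι δ) (ζ a b) (σ X)) (*-cong ≈-refl (*-cong ≈-refl (≈-sym h)))))

  -- Since 2 is prime to p₁ p₂, the parities of finitely many traces decide.
  two-divides? : ∀ X → Dec (two ∣ X)
  two-divides? X with all-even
    where
    open Kronecker S C using (hat-residue; n₁≢0; n₂≢0)
    bounded : ∀ n {P : ℕ → Set} → (∀ k → Dec (P k)) → Dec (∀ k → k ℕ.< n → P k)
    bounded zero P? = yes (λ _ ())
    bounded (suc n) {P} P? with bounded n P? | P? n
    ... | no ¬h | _ = no (λ h → ¬h (λ k k<n → h k (ℕₚ.m<n⇒m<1+n k<n)))
    ... | yes _ | no ¬p = no (λ h → ¬p (h n (ℕₚ.n<1+n n)))
    ... | yes h | yes p = yes all
      where
      all : ∀ k → k ℕ.< suc n → P k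
      all k k<n with k ℕ.≟ n
      ... | yes refl = p
      ... | no k≢n = h k (ℕₚ.≤∧≢⇒< (ℕₚ.≤-pred k<n) k≢n)
    all-even : Dec (∀ k → k ℕ.< n₁ → ∀ l → l ℕ.< n₂ → + 2 Z.∣ hat X (+ k) (+ l))
    all-even = bounded n₁ (λ k → bounded n₂ (λ l → ∣?ℤ 2 (hat X (+ k) (+ l))))
  ... | no ¬h = no (λ d → ¬h (λ k _ l _ → ι∣⇒∣hat d (+ k) (+ l)))
  ... | yes h = yes (∣hat⇒ι∣ comax-2-p₁p₂ (λ k l → Z.∣-resp (sym (hat-residue X (+ k) (+ l)))
          (h _ (n%ℕd<d (+ k) n₁) _ (n%ℕd<d (+ l) n₂))))
    where open Kronecker S C using (hat-residue; n₁≢0; n₂≢0)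

  ι-even : ∀ c → two ∣ ι c → + 2 Z.∣ c
  ι-even c d = Z.∣-resp (trans (hat-ι1 c (+ 1 ℤ.* + W₁.n′) (+ 1 ℤ.* + W₂.n′))
        (trans (cong (c ℤ.*_) (cong₂ ℤ._*_ (W₁.w-step (comax⇒∤ pr₁ comax-1ʳ))
            (W₂.w-step (comax⇒∤ pr₂ comax-1ʳ)))) (ℤₚ.*-identityʳ c)))
      (ι∣⇒∣hat d (+ 1 ℤ.* + W₁.n′) (+ 1 ℤ.* + W₂.n′))

  norm-halve : ∀ k m X Q → X ≈ two * Q → X * conj X ≈ ι (norm-value (suc (suc k)) m) → Q * conj Q ≈ ι
      (norm-value k m)
  norm-halve k m X Q e norm = ι-cancel (+ 4) (≈-trans (≈-sym eq)
        (≈-trans norm (≈-trans (≈-reflexive (cong ι (l₂ ((+ 2) Z.^ k) (Nℤ Z.^ m))))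
            (ι-* (+ 4) (norm-value k m)))))
    where
    l₁ : ∀ t q q̄ → t * q * (t * q̄) ≈ t * t * (q * q̄)
    l₁ = solve 3 (λ t q q̄ → t :* q :* (t :* q̄) := t :* t :* (q :* q̄)) ≈-refl
    l₂ : ∀ t n → + 2 ℤ.* (+ 2 ℤ.* t) ℤ.* n ≡ + 4 ℤ.* (t ℤ.* n)
    l₂ = solve-∀
    eq : X * conj X ≈ ι (+ 4) * (Q * conj Q)
    eq = ≈-trans (*-cong e (≈-trans (conj-cong e) (≈-trans (conj-* two Q) (*-cong (conj-ι (+ 2)) ≈-refl))))
        (≈-trans (l₁ two Q (conj Q)) (*-cong (≈-sym (ι-* (+ 2) (+ 2))) ≈-refl))

  -- X = 2Q would give 2 Q conj Q = N^m, which is odd.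
  norm-1-odd : ∀ m X Q → X ≈ two * Q → ¬ X * conj X ≈ ι (norm-value 1 m)
  norm-1-odd m X Q e norm = comax⇒∤ prime[2] (comax-^ʳ m
        (comax-*ʳ (comax-sym (comax-n₁ comax₁-2)) (comax-sym (comax-n₂ comax₂-2))))
      (ι-even (Nℤ Z.^ m) (divides (Q * conj Q) (ι-cancel (+ 2)
            (≈-trans (≈-trans (≈-sym (ι-* (+ 2) (Nℤ Z.^ m))) (≈-sym norm)) eq))))
    where
    l₁ : ∀ t q q̄ → t * q * (t * q̄) ≈ t * (t * (q * q̄))
    l₁ = solve 3 (λ t q q̄ → t :* q :* (t :* q̄) := t :* (t :* (q :* q̄))) ≈-refl
    eq : X * conj X ≈ two * (two * (Q * conj Q))
    eq = ≈-trans (*-cong e (≈-trans (conj-cong e) (≈-trans (conj-* two Q) (*-cong (conj-ι (+ 2)) ≈-refl))))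
        (l₁ two Q (conj Q))

  -- Halving X lowers k by 2 and keeps it odd, until 2 no longer divides X and `odd-element`
  -- applies.
  norm⇒solvable : ∀ k m X → eps k ≡ ℤ.- + 1 → X * conj X ≈ ι (norm-value k m) → Σ ℕ λ j → (0 ℕ.< j) ×
      (j ℕ.≤ k) × Solvable p₁ p₂ j
  norm⇒solvable zero m X () norm
  norm⇒solvable 1 m X odd norm with two-divides? X
  ... | yes (divides Q e) = ⊥-elim (norm-1-odd m X Q e norm)
  ... | no ¬d = 1 , s≤s z≤n , s≤s z≤n , odd-element 0 m X odd ¬d norm
  norm⇒solvable (suc (suc k)) m X odd norm with two-divides? X
  ... | no ¬d = suc (suc k) , s≤s z≤n , ℕₚ.≤-refl , odd-element (suc k) m X odd ¬d norm
  ... | yes (divides Q e) =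
      let (j , 0<j , j≤k , sol) = norm⇒solvable k m Q (trans (sym (l (eps k))) odd) (norm-halve k m X Q e norm)
      in j , 0<j , ℕₚ.≤-trans j≤k (ℕₚ.m≤n+m k 2) , sol
    where l : ∀ x → (ℤ.- + 1) ℤ.* ((ℤ.- + 1) ℤ.* x) ≡ x
          l = solve-∀

  -- Half of X would have norm 2^(m-2) N^m′ and lead to a solution with an exponent below m; for m =
  -- 1 the norm itself is not divisible by 4.
  not-even : ∀ m m′ X → eps m ≡ ℤ.- + 1 → (∀ k → 0 ℕ.< k → k ℕ.< m → ¬ Solvable p₁ p₂ k) → X * conj X ≈ ι
      (norm-value m m′) → ¬ two ∣ X
  not-even zero m′ X () _ _ _
  not-even 1 m′ X odd _ norm (divides Q e) = norm-1-odd m′ X Q e norm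
  not-even (suc (suc k)) m′ X odd minimal norm (divides Q e) =
      let (j , 0<j , j≤k , sol) = norm⇒solvable k m′ Q (trans (sym (l (eps k))) odd) (norm-halve k m′ X Q e norm)
      in minimal j 0<j (ℕₚ.≤-trans (s≤s j≤k) (ℕₚ.n≤1+n (suc k))) sol
    where l : ∀ x → (ℤ.- + 1) ℤ.* ((ℤ.- + 1) ℤ.* x) ≡ x
          l = solve-∀

-- The group ring of ℤ/q and its evaluation at a root of unity.

eps-even⇒2∣ : ∀ n → eps n ≡ + 1 → 2 ℕ∣.∣ n
eps-even⇒2∣ zero e = ℕ∣.divides 0 refl
eps-even⇒2∣ 1 ()
eps-even⇒2∣ (suc (suc n)) e = ℕ∣.∣m∣n⇒∣m+n (ℕ∣.divides 1 refl) (eps-even⇒2∣ n (trans (sym (l (eps n))) e))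
  where l : ∀ x → (ℤ.- + 1) ℤ.* ((ℤ.- + 1) ℤ.* x) ≡ x
        l = solve-∀

eps-* : ∀ a b → eps a ≡ ℤ.- + 1 → eps (a ℕ.* b) ≡ eps b
eps-* a b e = trans (sym (Z.^-assocʳ (ℤ.- + 1) a b)) (cong (Z._^ b) e)

eps-pow : ∀ a k → eps a ≡ ℤ.- + 1 → eps (a ℕ.^ k) ≡ ℤ.- + 1
eps-pow a zero e = refl
eps-pow a (suc k) e = trans (eps-* a (a ℕ.^ k) e) (eps-pow a k e)

module Residues (q : ℕ) .{{_ : ℕ.NonZero q}} where

  mod≋ : ∀ a → + toℕ (a mod q) Z.≋ + a [ + q ]
  mod≋ a = Z.≋-trans (Z.≈⇒≋ (cong +_ (Finₚ.toℕ-fromℕ< (m%n<n a q)))) (Z.≋-sym (≋-%ℕ (+ a) q))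

  Fin-unique : ∀ {i j : Fin q} → + toℕ i Z.≋ + toℕ j [ + q ] → i ≡ j
  Fin-unique {i} {j} h = Finₚ.toℕ-injective (residue-unique (Finₚ.toℕ<n i) (Finₚ.toℕ<n j) h)

  +q≋ : ∀ i j → + toℕ (D._+q_ q i j) Z.≋ + toℕ i ℤ.+ + toℕ j [ + q ]
  +q≋ i j = mod≋ (toℕ i ℕ.+ toℕ j)

  -q≋ : ∀ i → + toℕ (D.-q_ q i) Z.≋ ℤ.- + toℕ i [ + q ]
  -q≋ i = Z.≋-trans (mod≋ (q ℕ.∸ toℕ i)) (Z.congr (Z.∣-resp (sym eq) Z.∣-refl))
    where
    l : ∀ q i → q ℤ.- i ℤ.- (ℤ.- i) ≡ q
    l = solve-∀
    eq : + (q ℕ.∸ toℕ i) ℤ.- (ℤ.- + toℕ i) ≡ + q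
    eq = trans (cong (ℤ._- (ℤ.- + toℕ i)) (sym (trans (ℤₚ.m-n≡m⊖n q (toℕ i))
              (ℤₚ.⊖-≥ (ℕₚ.<⇒≤ (Finₚ.toℕ<n i)))))) (l (+ q) (+ toℕ i))

  minus≋ : ∀ i j → + toℕ (D._-q_ q i j) Z.≋ + toℕ i ℤ.- + toℕ j [ + q ]
  minus≋ i j = Z.≋-trans (+q≋ i (D.-q_ q j)) (Z.≋-+ (Z.≋-refl {+ toℕ i}) (-q≋ j))

  sub-add : ∀ i k → D._+q_ q (D._-q_ q k i) i ≡ k
  sub-add i k = Fin-unique (Z.≋-trans (+q≋ (D._-q_ q k i) i)
        (Z.≋-trans (Z.≋-+ (minus≋ k i) (Z.≋-refl {+ toℕ i})) (Z.≈⇒≋ (l (+ toℕ k) (+ toℕ i)))))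
    where l : ∀ k i → k ℤ.- i ℤ.+ i ≡ k
          l = solve-∀

  add-sub : ∀ i k → D._-q_ q (D._+q_ q k i) i ≡ k
  add-sub i k = Fin-unique (Z.≋-trans (minus≋ (D._+q_ q k i) i)
        (Z.≋-trans (Z.≋-sub (+q≋ k i) (Z.≋-refl {+ toℕ i})) (Z.≈⇒≋ (l (+ toℕ k) (+ toℕ i)))))
    where l : ∀ k i → k ℤ.+ i ℤ.- i ≡ k
          l = solve-∀

  neg-neg : ∀ k → D.-q_ q (D.-q_ q k) ≡ k
  neg-neg k = Fin-unique (Z.≋-trans (-q≋ (D.-q_ q k))
        (Z.≋-trans (Z.≋-neg (-q≋ k)) (Z.≈⇒≋ (ℤₚ.neg-involutive (+ toℕ k)))))

module FinSums (𝓑 : ℤAlgebra) where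
  open RingTools 𝓑
  open import Algebra.Properties.CommutativeMonoid.Sum
      (CommutativeRing.+-commutativeMonoid cring) using (sum; sum-permute)

  ∑-tabulate : ∀ {n} {A : Set} (g : Fin n → A) f → ∑ (tabulate g) f ≈ sum (f ∘ g)
  ∑-tabulate {zero} g f = ≈-refl
  ∑-tabulate {suc n} g f = +-cong ≈-refl (∑-tabulate (g ∘ Fin.suc) f)

  reindex : ∀ {n} (f : Fin n → Carrier) (to from : Fin n → Fin n) → (∀ k → to (from k) ≡ k) →
      (∀ k → from (to k) ≡ k) →
            ∑ (allFin n) (f ∘ to) ≈ ∑ (allFin n) f
  reindex f to from h h′ = ≈-trans (∑-tabulate id (f ∘ to))
      (≈-trans (≈-sym (sum-permute f (Perm.permutation to from h h′))) (≈-sym (∑-tabulate id f)))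

  sum-0 : ∀ n (f : Fin n → Carrier) → (∀ j → f j ≈ 0#) → sum f ≈ 0#
  sum-0 zero f h = ≈-refl
  sum-0 (suc n) f h = ≈-trans (+-cong (h Fin.zero) (sum-0 n (f ∘ Fin.suc) (h ∘ Fin.suc))) (+-identityˡ 0#)

  sum-single : ∀ n (f : Fin n → Carrier) k → (∀ j → j ≢ k → f j ≈ 0#) → sum f ≈ f k
  sum-single (suc n) f Fin.zero h = ≈-trans (+-cong ≈-refl
        (sum-0 n (f ∘ Fin.suc) (λ j → h (Fin.suc j) (λ ())))) (+-identityʳ _)
  sum-single (suc n) f (Fin.suc k) h = ≈-trans (+-cong (h Fin.zero (λ ()))
        (sum-single n (f ∘ Fin.suc) k (λ j j≢k → h (Fin.suc j) (j≢k ∘ Finₚ.suc-injective)))) (+-identityˡ _)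

  ∑-single : ∀ {n} (f : Fin n → Carrier) k → (∀ j → j ≢ k → f j ≈ 0#) → ∑ (allFin n) f ≈ f k
  ∑-single {n} f k h = ≈-trans (∑-tabulate id f) (sum-single n f k h)

  ∑-toℕ : ∀ n (f : ℕ → Carrier) → ∑ (allFin n) (f ∘ toℕ) ≈ ∑< n f
  ∑-toℕ n f = ≈-trans (∑-tabulate {n} id (f ∘ toℕ)) (go n f)
    where
    go : ∀ n (f : ℕ → Carrier) → sum {n} (f ∘ toℕ) ≈ ∑< n f
    go zero f = ≈-refl
    go (suc n) f = ≈-trans (+-cong ≈-refl (go n (f ∘ suc))) (≈-sym (∑<-head n f))

module Characters (S : Setting) (C : CyclotomicRing S)
   (q : ℕ) (q≡ : q ≡ 2 ℕ.* (Setting.n₁ S ℕ.* Setting.n₂ S)) .{{_ : ℕ.NonZero q}} where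
  open Setting S
  open CyclotomicRing C
  open RingTools algebra
  open RingPowers algebra
  open Cyclotomic S C
  open Residues q
  open FinSums algebra

  N : ℕ
  N = n₁ ℕ.* n₂

  eps-N : eps N ≡ ℤ.- + 1
  eps-N = trans (eps-* n₁ n₂ (eps-pow p₁ (suc e₁) (odd half₁ odd₁))) (eps-pow p₂ (suc e₂) (odd half₂ odd₂))
    where
    odd : ∀ {p} h → p ≡ suc (2 ℕ.* h) → eps p ≡ ℤ.- + 1
    odd h refl = eps-odd h

  n₁∣N : + n₁ Z.∣ + N
  n₁∣N = pos∣ (ℕ∣.m∣m*n n₂)

  n₂∣N : + n₂ Z.∣ + N
  n₂∣N = pos∣ (ℕ∣.n∣m*n n₁)

  comax-n₁n₂ : Comax (+ n₁) (+ n₂)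
  comax-n₁n₂ = subst (λ z → Comax z (+ n₂)) (sym (pos-^ p₁ (suc e₁)))
      (subst (λ z → Comax ((+ p₁) Z.^ suc e₁) z) (sym (pos-^ p₂ (suc e₂)))
        (comax-^ (suc e₁) (suc e₂) comax-p₁p₂))

  -- -ζ₁ζ₂ is a primitive q-th root of unity, as N is odd
  E : ℕ → Carrier
  E k = ι (eps k) * ζ (+ k) (+ k)

  E-+ : ∀ a b → E (a ℕ.+ b) ≈ E a * E b
  E-+ a b = ≈-trans (*-cong (≈-trans (≈-reflexive (cong ι (eps-+ a b))) (ι-* (eps a) (eps b)))
        (≈-sym (ζ-+ (+ a) (+ a) (+ b) (+ b)))) (l (ι (eps a)) (ι (eps b)) (ζ (+ a) (+ a)) (ζ (+ b) (+ b)))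
    where l : ∀ a b x y → a * b * (x * y) ≈ a * x * (b * y)
          l = solve 4 (λ a b x y → a :* b :* (x :* y) := a :* x :* (b :* y)) ≈-refl

  E-0 : E 0 ≈ 1#
  E-0 = ≈-trans (*-cong ι-1 ζ-0) (*-identityˡ 1#)

  ζ-N : ∀ j → ζ (+ (N ℕ.* j)) (+ (N ℕ.* j)) ≈ 1#
  ζ-N j = ≈-trans (ζ-per (Z.∣⇒≋0 (Z.∣-trans n₁∣N (pos∣ (ℕ∣.m∣m*n j))))
        (Z.∣⇒≋0 (Z.∣-trans n₂∣N (pos∣ (ℕ∣.m∣m*n j))))) ζ-0

  E-N : ∀ j → E (N ℕ.* j) ≈ ι (eps j)
  E-N j = ≈-trans (*-cong (≈-reflexive (cong ι (eps-* N j eps-N))) (ζ-N j)) (*-identityʳ _)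

  E-q : ∀ j → E (j ℕ.* q) ≈ 1#
  E-q j = ≈-trans (≈-reflexive (cong E (trans (cong (j ℕ.*_) q≡) (l j N))))
      (≈-trans (E-N (2 ℕ.* j)) (≈-trans (≈-reflexive (cong ι (eps-even j))) ι-1))
    where l : ∀ j n → j ℕ.* (2 ℕ.* n) ≡ n ℕ.* (2 ℕ.* j)
          l = ℕsolve-∀

  E-% : ∀ a → E (a ℕ.% q) ≈ E a
  E-% a = ≈-sym (≈-trans (≈-reflexive (cong E (m≡m%n+[m/n]*n a q)))
        (≈-trans (E-+ (a ℕ.% q) (a ℕ./ q ℕ.* q)) (≈-trans (*-cong ≈-refl (E-q (a ℕ./ q))) (*-identityʳ _))))

  E-≋ : ∀ {a b} → + a Z.≋ + b [ + q ] → E a ≈ E b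
  E-≋ {a} {b} h = ≈-trans (≈-sym (E-% a)) (≈-trans
        (≈-reflexive (cong E (residue-unique (m%n<n a q) (m%n<n b q)
            (Z.≋-trans (Z.≋-sym (≋-%ℕ (+ a) q)) (Z.≋-trans h (≋-%ℕ (+ b) q)))))) (E-% b))

  ι-sign² : ∀ k → ι (eps k) * ι (eps k) ≈ 1#
  ι-sign² k = ≈-trans (≈-sym (ι-* (eps k) (eps k))) (≈-trans (≈-reflexive (cong ι (eps² k))) ι-1)

  conj-E : ∀ k → conj (E k) ≈ ι (eps k) * ζ (ℤ.- + k) (ℤ.- + k)
  conj-E k = ≈-trans (conj-* (ι (eps k)) (ζ (+ k) (+ k))) (*-cong (conj-ι (eps k)) (conj-ζ (+ k) (+ k)))

  E-conj : ∀ k → conj (E k) * E k ≈ 1#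
  E-conj k = ≈-trans (*-cong (conj-E k) ≈-refl) (≈-trans
        (l (ι (eps k)) (ζ (ℤ.- + k) (ℤ.- + k)) (ζ (+ k) (+ k)))
        (≈-trans (*-cong (ι-sign² k) (ζ-inv (+ k) (+ k))) (*-identityˡ 1#)))
    where l : ∀ a x y → a * x * (a * y) ≈ a * a * (x * y)
          l = solve 3 (λ a x y → a :* x :* (a :* y) := a :* a :* (x :* y)) ≈-refl

  inverse-unique : ∀ {x y} k → x * E k ≈ 1# → y * E k ≈ 1# → x ≈ y
  inverse-unique {x} {y} k h h′ = ≈-trans (≈-sym (*-identityʳ x))
      (≈-trans (*-cong ≈-refl (≈-sym h′)) (≈-trans (l x y (E k)) (≈-trans (*-cong h ≈-refl) (*-identityˡ y))))
    where l : ∀ x y e → x * (y * e) ≈ x * e * y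
          l = solve 3 (λ x y e → x :* (y :* e) := x :* e :* y) ≈-refl

  E-neg : ∀ i → E (toℕ (D.-q_ q i)) ≈ conj (E (toℕ i))
  E-neg i = inverse-unique (toℕ i) (≈-trans (≈-sym (E-+ _ (toℕ i)))
        (≈-trans (E-≋ {b = 0} (Z.≋-trans (Z.≋-+ (-q≋ i) (Z.≋-refl {+ toℕ i}))
            (Z.≈⇒≋ (ℤₚ.+-inverseˡ (+ toℕ i))))) E-0)) (E-conj (toℕ i))

  E-add : ∀ i j → E (toℕ (D._+q_ q i j)) ≈ E (toℕ i) * E (toℕ j)
  E-add i j = ≈-trans (E-≋ (+q≋ i j)) (E-+ (toℕ i) (toℕ j))

  E-sub : ∀ i j → E (toℕ (D._-q_ q i j)) ≈ E (toℕ i) * conj (E (toℕ j))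
  E-sub i j = ≈-trans (E-add i (D.-q_ q j)) (*-cong ≈-refl (E-neg j))

  E-mod : ∀ a → E (toℕ (a mod q)) ≈ E a
  E-mod a = E-≋ (mod≋ a)

  E-^ : ∀ a k → E a ^ k ≈ E (k ℕ.* a)
  E-^ a zero = ≈-sym E-0
  E-^ a (suc k) = ≈-trans (*-cong ≈-refl (E-^ a k)) (≈-sym (E-+ a (k ℕ.* a)))

  -- The square of E d is ζ^(2d). If this is nontrivial, the fixed-point lemmas give p₁ Z = 0 or p₂
  -- Z = 0. Otherwise d = N j, where j is odd because 0 < d < 2N, and E d = -1 gives 2 Z = 0.
  cancel-E : ∀ d Z → 0 ℕ.< d → d ℕ.< q → E d * Z ≈ Z → Z ≈ 0#
  cancel-E d Z 0<d d<q h = case (nontrivial? (+ (2 ℕ.* d)) (+ (2 ℕ.* d)))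
    where
    h₂ : ζ (+ (2 ℕ.* d)) (+ (2 ℕ.* d)) * Z ≈ Z
    h₂ = ≈-trans (*-cong (≈-sym (≈-trans (*-cong (≈-trans (≈-reflexive (cong ι (eps-even d))) ι-1) ≈-refl)
              (*-identityˡ _))) ≈-refl)
      (≈-trans (*-cong (≈-sym (E-^ d 2)) ≈-refl) (≈-trans (l (E d) Z) (≈-trans (*-cong ≈-refl h) h)))
      where l : ∀ e z → e * (e * 1#) * z ≈ e * (e * z)
            l = solve 2 (λ e z → e :* (e :* con (+ 1)) :* z := e :* (e :* z)) ≈-refl
    half : ∀ n → Comax (+ n) (+ 2) → + n Z.∣ + (2 ℕ.* d) → + n Z.∣ + d
    half n c d₂ = comax-cancel (+ 2) c (Z.∣-resp (ℤₚ.pos-* 2 d) d₂)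
    odd-case : ∀ j → d ≡ N ℕ.* j → Sign (eps j) → Z ≈ 0#
    odd-case j refl (inj₁ e) = ⊥-elim (ℕ∣.>⇒∤ {{ℕ.>-nonZero 0<d}} d<q
          (subst (ℕ∣._∣ (N ℕ.* j)) (trans (ℕₚ.*-comm N 2) (sym q≡)) (ℕ∣.*-monoʳ-∣ N (eps-even⇒2∣ j e))))
    odd-case j refl (inj₂ e) = ι-zero (+ 2) (≈-trans
          (*-cong (≈-trans (ι-+ (+ 1) (+ 1)) (+-cong ι-1 ι-1)) ≈-refl)
          (≈-trans (l Z) (≈-trans (+-cong ≈-refl (≈-sym h))
              (≈-trans (+-cong ≈-refl (*-cong (≈-trans (E-N j)
              (≈-trans (≈-reflexive (cong ι e)) (≈-trans (ι-neg (+ 1)) (-‿cong ι-1)))) ≈-refl)) (l′ Z)))))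
      where
      l : ∀ z → (1# + 1#) * z ≈ z + z
      l = solve 1 (λ z → (con (+ 1) :+ con (+ 1)) :* z := z :+ z) ≈-refl
      l′ : ∀ z → z + - 1# * z ≈ 0#
      l′ = solve 1 (λ z → z :+ :- con (+ 1) :* z := con (+ 0)) ≈-refl
    case : ((+ n₁ Z.∣ + (2 ℕ.* d)) × (+ n₂ Z.∣ + (2 ℕ.* d))) ⊎ (¬ + n₁ Z.∣ + (2 ℕ.* d)) ⊎
        (¬ + n₂ Z.∣ + (2 ℕ.* d)) → Z ≈ 0#
    case (inj₂ (inj₁ ¬d)) = ι-zero (+ p₁) (0∣⇒≈0 (fixed₁ _ _ (≈⇒≋ h₂) ¬d))
    case (inj₂ (inj₂ ¬d)) = ι-zero (+ p₂) (0∣⇒≈0 (fixed₂ _ _ (≈⇒≋ h₂) ¬d))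
    case (inj₁ (d₁ , d₂)) = from (∣⇒abs∣ (Z.∣-respˡ (sym (ℤₚ.pos-* n₁ n₂))
            (comax-∣-* comax-n₁n₂ (half n₁ (comax-n₁ comax₁-2) d₁) (half n₂ (comax-n₂ comax₂-2) d₂))))
      where
      from : N ℕ∣.∣ d → Z ≈ 0#
      from (ℕ∣.divides j e) = odd-case j (trans e (ℕₚ.*-comm j N)) (eps-± j)

  -- Evaluation of a group-ring element at the q-th root of unity -ζ₁ζ₂.
  Φ : (Fin q → ℤ) → Carrier
  Φ c = ∑ (allFin q) (λ k → ι (c k) * E (toℕ k))

  Φ-⊖ : ∀ a b → Φ (D._⊖_ q a b) ≈ Φ a - Φ b
  Φ-⊖ a b = ≈-trans (∑-cong (allFin q) (λ k → ≈-trans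
          (*-cong (≈-trans (ι-+ (a k) _) (+-cong ≈-refl (ι-neg (b k)))) ≈-refl)
          (l (ι (a k)) (ι (b k)) (E (toℕ k))))) (∑-sub (allFin q) _ _)
    where l : ∀ a b e → (a - b) * e ≈ a * e - b * e
          l = solve 3 (λ a b e → (a :- b) :* e := a :* e :- b :* e) ≈-refl

  Φ-scale : ∀ c a → Φ (D.scale q c a) ≈ ι c * Φ a
  Φ-scale c a = ≈-trans (∑-cong (allFin q) (λ k → ≈-trans (*-cong (ι-* c (a k)) ≈-refl) (*-assoc _ _ _)))
      (≈-sym (∑-*ˡ (ι c) (allFin q) _))

  δ-same : ∀ k → D.δ q k k ≡ + 1
  δ-same k with k Fin.≟ k
  ... | yes _ = refl
  ... | no ¬e = ⊥-elim (¬e refl)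

  δ-other : ∀ k j → j ≢ k → D.δ q k j ≡ + 0
  δ-other k j ne with k Fin.≟ j
  ... | yes e = ⊥-elim (ne (sym e))
  ... | no _ = refl

  Φ-δ : ∀ k → Φ (D.δ q k) ≈ E (toℕ k)
  Φ-δ k = ≈-trans (∑-single _ k (λ j ne → ≈-trans (*-cong
            (≈-trans (≈-reflexive (cong ι (δ-other k j ne))) ι-0) ≈-refl) (zeroˡ _)))
      (≈-trans (*-cong (≈-trans (≈-reflexive (cong ι (δ-same k))) ι-1) ≈-refl) (*-identityˡ _))

  ι-sumℤ : {A : Set} (xs : List A) (f : A → ℤ) → ι (D.sumℤ q (map f xs)) ≈ ∑ xs (λ x → ι (f x))
  ι-sumℤ [] f = ι-0
  ι-sumℤ (x ∷ xs) f = ≈-trans (ι-+ (f x) _) (+-cong ≈-refl (ι-sumℤ xs f))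

  Φ-⋆ : ∀ a b → Φ (D._⋆_ q a b) ≈ Φ a * Φ b
  Φ-⋆ a b = ≈-trans (∑-cong (allFin q) (λ k → ≈-trans
          (*-cong (ι-sumℤ (allFin q) (λ i → a i ℤ.* b (D._-q_ q k i))) ≈-refl)
          (≈-trans (∑-*ʳ (E (toℕ k)) (allFin q) _) (∑-cong (allFin q) (λ i → term k i)))))
    (≈-trans (∑-swap (allFin q) (allFin q) _) (≈-trans
          (∑-cong (allFin q) (λ i → ≈-trans (≈-sym (∑-*ˡ (ι (a i) * E (toℕ i)) (allFin q) _))
            (*-cong ≈-refl (reindex (λ k → ι (b k) * E (toℕ k)) (λ k → D._-q_ q k i) (λ k → D._+q_ q k i)
            (add-sub i) (sub-add i))))) (≈-sym (∑-*ʳ (Φ b) (allFin q) _))))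
    where
    l : ∀ a b e f → a * b * (e * f) ≈ a * f * (b * e)
    l = solve 4 (λ a b e f → a :* b :* (e :* f) := a :* f :* (b :* e)) ≈-refl
    term : ∀ k i → ι (a i ℤ.* b (D._-q_ q k i)) * E (toℕ k) ≈ ι (a i) * E (toℕ i) *
        (ι (b (D._-q_ q k i)) * E (toℕ (D._-q_ q k i)))
    term k i = ≈-trans (*-cong (ι-* (a i) _) (≈-trans (≈-reflexive (cong (E ∘ toℕ) (sym (sub-add i k))))
            (E-add (D._-q_ q k i) i))) (l (ι (a i)) (ι (b (D._-q_ q k i))) (E (toℕ (D._-q_ q k i)))
          (E (toℕ i)))

  Φ-conj : ∀ a → Φ (D.conj q a) ≈ conj (Φ a)
  Φ-conj a = ≈-trans (∑-cong (allFin q) (λ k → *-cong ≈-refl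
          (≈-trans (≈-reflexive (cong (E ∘ toℕ) (sym (neg-neg k)))) (E-neg (D.-q_ q k)))))
    (≈-trans (reindex (λ k → ι (a k) * conj (E (toℕ k))) (D.-q_ q) (D.-q_ q) neg-neg neg-neg)
    (≈-sym (≈-trans (conj-∑ (allFin q) _) (∑-cong (allFin q)
            (λ k → ≈-trans (conj-* (ι (a k)) (E (toℕ k))) (*-cong (conj-ι (a k)) ≈-refl))))))

  Φ-cong0 : ∀ a → (∀ k → a k ≡ + 0) → Φ a ≈ 0#
  Φ-cong0 a h = ∑-0 (allFin q) (λ k → ≈-trans (*-cong (≈-trans (≈-reflexive (cong ι (h k))) ι-0) ≈-refl)
        (zeroˡ _))

  divisors : List ℕ
  divisors = List.filter (λ d → (0 ℕ.<? d) ×-dec (d ℕ∣.∣? q)) (upTo q)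

  -- Under Φ each factor of `Mq` becomes E d - 1 with 0 < d < q, which `cancel-E` removes; so a
  -- group-ring element annihilated by `Mq` has value 0.
  cancel-Mq : ∀ ds → (∀ d → d ∈ ds → (0 ℕ.< d) × (d ℕ.< q)) → ∀ Z →
              Z * Φ (List.foldr (λ d acc → D._⋆_ q acc (D._⊖_ q (D.δ q (d mod q)) (D.δ q (D.zeroq q))))
                  (D.δ q (D.zeroq q)) ds) ≈ 0# → Z ≈ 0#
  cancel-Mq [] h Z e = ≈-trans (≈-sym (≈-trans (*-cong ≈-refl
            (≈-trans (Φ-δ (D.zeroq q)) (≈-trans (E-mod 0) E-0))) (*-identityʳ Z))) e
  cancel-Mq (d ∷ ds) h Z e = cancel-Mq ds (λ d′ i → h d′ (Any.there i)) Z
      (cancel-E d (Z * Φ acc) (proj₁ (h d (Any.here refl))) (proj₂ (h d (Any.here refl)))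
        (sub-0⇒≈ (≈-trans (≈-sym eq) e)))
    where
    acc = List.foldr (λ d acc → D._⋆_ q acc (D._⊖_ q (D.δ q (d mod q)) (D.δ q (D.zeroq q))))
        (D.δ q (D.zeroq q)) ds
    l : ∀ z a e → z * (a * (e - 1#)) ≈ e * (z * a) - z * a
    l = solve 3 (λ z a e → z :* (a :* (e :- con (+ 1))) := e :* (z :* a) :- z :* a) ≈-refl
    eq : Z * Φ (D._⋆_ q acc (D._⊖_ q (D.δ q (d mod q)) (D.δ q (D.zeroq q)))) ≈ E d * (Z * Φ acc) - Z * Φ acc
    eq = ≈-trans (*-cong ≈-refl (≈-trans (Φ-⋆ acc _)
            (*-cong ≈-refl (≈-trans (Φ-⊖ _ _) (-‿cong₂ (≈-trans (Φ-δ (d mod q)) (E-mod d))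
              (≈-trans (Φ-δ (D.zeroq q)) (≈-trans (E-mod 0) E-0))))))) (l Z (Φ acc) (E d))

  vanishes⇒Φ≈0 : ∀ c → D.VanishesAtζ q c → Φ c ≈ 0#
  vanishes⇒Φ≈0 c v = cancel-Mq divisors (λ d i →
      let (i′ , (0<d , _)) = ∈-filter⁻ (λ d → (0 ℕ.<? d) ×-dec (d ℕ∣.∣? q)) {xs = upTo q} i
      in 0<d , ∈-upTo⁻ i′) (Φ c) (≈-trans (≈-sym (Φ-⋆ c (D.Mq q))) (Φ-cong0 _ v))

  -- The coefficients count the fibres of g; summing over the fibres restores the exponential sum.
  Φ-walsh-list : {A : Set} (g : A → Fin q) (xs : List A) → Φ
      (λ k → + List.length (List.filter (λ x → g x Fin.≟ k) xs)) ≈ ∑ xs (λ x → E (toℕ (g x)))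
  Φ-walsh-list g [] = Φ-cong0 _ (λ _ → refl)
  Φ-walsh-list g (x ∷ xs) = ≈-trans (∑-cong (allFin q)
        (λ k → ≈-trans (*-cong (≈-trans (≈-reflexive (cong ι (count k))) (ι-+ (D.δ q (g x) k) _)) ≈-refl)
          (distribʳ _ _ _))) (≈-trans (∑-+ (allFin q) _ _) (+-cong (Φ-δ (g x)) (Φ-walsh-list g xs)))
    where
    count : ∀ k → + List.length (List.filter (λ x → g x Fin.≟ k) (x ∷ xs)) ≡ D.δ q (g x) k ℤ.+ + List.length
        (List.filter (λ x → g x Fin.≟ k) xs)
    count k with g x Fin.≟ k
    ... | yes _ = refl
    ... | no _ = refl

  gbf-norm : ∀ m (f : Vec (Fin q) m → Fin q) → D.IsGBF q m f → ∀ λv →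
             ∑ (D.allVecs q m) (λ x → E (toℕ (D._-q_ q (f x) (D.dot q λv x)))) * conj
               (∑ (D.allVecs q m) (λ x → E (toℕ (D._-q_ q (f x) (D.dot q λv x))))) ≈ ι (+ (q ℕ.^ m))
  gbf-norm m f gbf λv = ≈-trans (*-cong (≈-sym W≈) (conj-cong (≈-sym W≈)))
      (≈-trans (*-cong ≈-refl (≈-sym (Φ-conj W))) (≈-trans (≈-sym (Φ-⋆ W (D.conj q W)))
      (≈-trans (sub-0⇒≈ (≈-trans (≈-sym (Φ-⊖ _ _)) (vanishes⇒Φ≈0 _ (gbf λv))))
          (≈-trans (Φ-scale (+ (q ℕ.^ m)) (D.δ q (D.zeroq q)))
            (≈-trans (*-cong ≈-refl (≈-trans (Φ-δ (D.zeroq q)) (≈-trans (E-mod 0) E-0))) (*-identityʳ _))))))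
    where
    W = D.walsh q m f λv
    W≈ : Φ W ≈ ∑ (D.allVecs q m) (λ x → E (toℕ (D._-q_ q (f x) (D.dot q λv x))))
    W≈ = Φ-walsh-list (λ x → D._-q_ q (f x) (D.dot q λv x)) (D.allVecs q m)

-- The Fourier transform on (ℤ/q)^m and the parity contradiction.

even : ℕ → ℤ
even k with eps-± k
... | inj₁ _ = + 1
... | inj₂ _ = + 0

1+eps : ∀ k → + 1 ℤ.+ eps k ≡ + 2 ℤ.* even k
1+eps k with eps-± k
... | inj₁ e = cong (ℤ._+_ (+ 1)) e
... | inj₂ e = cong (ℤ._+_ (+ 1)) e

even-eps : ∀ k → even k ℤ.* eps k ≡ even k
even-eps k with eps-± k
... | inj₁ e = trans (ℤₚ.*-identityˡ (eps k)) e
... | inj₂ e = refl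

even-idem : ∀ k → even k ℤ.* even k ≡ even k
even-idem k with eps-± k
... | inj₁ e = refl
... | inj₂ e = refl

even-2n : ∀ n → eps n ≡ + 1 → even n ≡ + 1
even-2n n e with eps-± n
... | inj₁ _ = refl
... | inj₂ e′ with trans (sym e) e′
... | ()

even-2n+1 : ∀ n → eps n ≡ ℤ.- + 1 → even n ≡ + 0
even-2n+1 n e with eps-± n
... | inj₂ _ = refl
... | inj₁ e′ with trans (sym e) e′
... | ()

∑-even : ∀ n → Z.∑< (n ℕ.+ n) even ≡ + n
∑-even zero = refl
∑-even (suc n) = trans (cong (λ z → Z.∑< (suc z) even) (ℕₚ.+-suc n n))
    (trans (cong₂ (λ a b → a ℤ.+ b) (cong₂ ℤ._+_ (∑-even n) (even-2n (n ℕ.+ n) ee))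
        (even-2n+1 (suc (n ℕ.+ n)) (cong (ℤ._*_ (ℤ.- + 1)) ee))) (l (+ n)))
  where
  ee : eps (n ℕ.+ n) ≡ + 1
  ee = trans (eps-+ n n) (eps² n)
  l : ∀ n → n ℤ.+ + 1 ℤ.+ + 0 ≡ + 1 ℤ.+ n
  l = solve-∀

cube : ∀ m → List (Vec ℕ m)
cube zero    = [] ∷ []
cube (suc m) = map (0 ∷_) (cube m) ++ map (1 ∷_) (cube m)

module Fourier (S : Setting) (C : CyclotomicRing S)
   (q : ℕ) (q≡ : q ≡ 2 ℕ.* (Setting.n₁ S ℕ.* Setting.n₂ S)) .{{_ : ℕ.NonZero q}} where
  open Setting S
  open CyclotomicRing C
  open RingTools algebra
  open RingPowers algebra
  open Cyclotomic S C
  open Kronecker S C using (φ; hat-1-0)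
  open TwoPart S C
  open Descent S C using (not-even; φ≢0)
  open Residues q
  open FinSums algebra
  open Characters S C q q≡

  -- Frequencies are vectors of natural numbers, read modulo q, so that translation by N μ is
  -- literal addition.
  dotN : ∀ {m} → Vec ℕ m → Vec (Fin q) m → ℕ
  dotN []      []      = 0
  dotN (a ∷ l) (y ∷ x) = a ℕ.* toℕ y ℕ.+ dotN l x

  E-dot : ∀ {m} (l : Vec ℕ m) x → E (toℕ (D.dot q (Vec.map (_mod q) l) x)) ≈ E (dotN l x)
  E-dot [] [] = E-mod 0
  E-dot (a ∷ l) (y ∷ x) = ≈-trans (E-add _ _) (≈-trans
        (*-cong (≈-trans (E-mod (toℕ (a mod q) ℕ.* toℕ y)) (E-≋ prod)) (E-dot l x))
        (≈-sym (E-+ (a ℕ.* toℕ y) (dotN l x))))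
    where
    prod : + (toℕ (a mod q) ℕ.* toℕ y) Z.≋ + (a ℕ.* toℕ y) [ + q ]
    prod = Z.≋-trans (Z.≈⇒≋ (ℤₚ.pos-* (toℕ (a mod q)) (toℕ y)))
        (Z.≋-trans (≋-mulʳ (+ toℕ y) (mod≋ a)) (Z.≈⇒≋ (sym (ℤₚ.pos-* a (toℕ y)))))

  transform : ∀ {m} → (Vec (Fin q) m → Carrier) → Vec ℕ m → Carrier
  transform {m} g l = ∑ (D.allVecs q m) (λ x → g x * conj (E (dotN l x)))

  E-E̅ : ∀ k → E k * conj (E k) ≈ 1#
  E-E̅ k = ≈-trans (*-comm _ _) (E-conj k)

  kernel : Fin q → Fin q → Carrier
  kernel y z = ∑< q (λ a → conj (E (a ℕ.* toℕ y)) * E (a ℕ.* toℕ z))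

  kernel-same : ∀ y → kernel y y ≈ ι (+ q)
  kernel-same y = ≈-trans (∑<-congᵃ q (λ a → E-conj (a ℕ.* toℕ y))) (≈-trans (∑<-const q 1#) (*-identityʳ _))

  -- The kernel is a geometric sum in E d, and multiplication by E d fixes it, as E d has q-th power
  -- 1.
  kernel-other : ∀ y z → z ≢ y → kernel y z ≈ 0#
  kernel-other y z ne = cancel-E d K 0<d (Finₚ.toℕ<n (D._-q_ q z y))
      (≈-sym (sub-0⇒≈ (≈-trans (l (E d) K) (≈-trans (*-cong ≈-refl K≈)
            (≈-trans (geometric q (E d)) (≈-trans (-‿cong₂ ≈-refl
            (≈-trans (E-^ d q) (≈-trans (≈-reflexive (cong E (ℕₚ.*-comm q d))) (E-q d)))) (x-x 1#)))))))
    where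
    d = toℕ (D._-q_ q z y)
    K = kernel y z
    l : ∀ e k → k - e * k ≈ (1# - e) * k
    l = solve 2 (λ e k → k :- e :* k := (con (+ 1) :- e) :* k) ≈-refl
    u≈ : conj (E (toℕ y)) * E (toℕ z) ≈ E d
    u≈ = ≈-trans (*-comm _ _) (≈-sym (E-sub z y))
    K≈ : K ≈ ∑< q (E d ^_)
    K≈ = ∑<-congᵃ q (λ a → ≈-trans (*-cong (≈-trans (conj-cong (≈-sym (E-^ (toℕ y) a)))
              (conj-^ (E (toℕ y)) a)) (≈-sym (E-^ (toℕ z) a)))
          (≈-trans (≈-sym (^-distrib-* (conj (E (toℕ y))) (E (toℕ z)) a)) (^-congˡ a u≈)))
    pos : ∀ e → e ≡ toℕ (D._-q_ q z y) → 0 ℕ.< e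
    pos (suc e) _ = s≤s z≤n
    pos zero e = ⊥-elim (ne (Fin-unique (Z.congr (Z.≋0⇒∣
              (Z.≋-sym (Z.≋-trans (Z.≈⇒≋ (cong +_ e)) (minus≋ z y)))))))
    0<d : 0 ℕ.< d
    0<d = pos d refl

  parseval₁ : ∀ (G : Fin q → Carrier) → ∑< q (λ a → ∑ (allFin q) (λ y → G y * conj (E (a ℕ.* toℕ y))) * conj
        (∑ (allFin q) (λ y → G y * conj (E (a ℕ.* toℕ y)))))
              ≈ ι (+ q) * ∑ (allFin q) (λ y → G y * conj (G y))
  parseval₁ G = ≈-trans (∑<-congᵃ q expand) (≈-trans (≈-sym (∑-∑<-swap (allFin q) q _))
        (≈-trans (∑-cong (allFin q) row) (≈-sym (∑-*ˡ (ι (+ q)) (allFin q) _))))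
    where
    expand : ∀ a → ∑ (allFin q) (λ y → G y * conj (E (a ℕ.* toℕ y))) * conj
        (∑ (allFin q) (λ y → G y * conj (E (a ℕ.* toℕ y))))
             ≈ ∑ (allFin q) (λ y → ∑ (allFin q) (λ z → (G y * conj (G z)) *
                   (conj (E (a ℕ.* toℕ y)) * E (a ℕ.* toℕ z))))
    expand a = ≈-trans (∑-*ʳ _ (allFin q) _) (∑-cong (allFin q)
          (λ y → ≈-trans (*-cong ≈-refl (conj-∑ (allFin q) _))
            (≈-trans (∑-*ˡ _ (allFin q) _) (∑-cong (allFin q)
              (λ z → ≈-trans (*-cong ≈-refl (≈-trans (conj-* (G z) _) (*-cong ≈-refl (conj-conj _))))
              (l (G y) (conj (E (a ℕ.* toℕ y))) (conj (G z)) (E (a ℕ.* toℕ z))))))))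
      where l : ∀ a b c d → a * b * (c * d) ≈ a * c * (b * d)
            l = solve 4 (λ a b c d → a :* b :* (c :* d) := a :* c :* (b :* d)) ≈-refl
    row : ∀ y → ∑< q (λ a → ∑ (allFin q) (λ z → (G y * conj (G z)) *
            (conj (E (a ℕ.* toℕ y)) * E (a ℕ.* toℕ z)))) ≈ ι (+ q) * (G y * conj (G y))
    row y = ≈-trans (≈-sym (∑-∑<-swap (allFin q) q _))
        (≈-trans (∑-cong (allFin q) (λ z → ≈-sym (∑<-*ˡ (G y * conj (G z)) q _)))
          (≈-trans (∑-single _ y (λ z ne → ≈-trans (*-cong ≈-refl (kernel-other y z ne)) (zeroʳ _)))
            (≈-trans (*-cong ≈-refl (kernel-same y)) (*-comm _ _))))

  box : ∀ m → List (Vec ℕ m)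
  box zero    = [] ∷ []
  box (suc m) = concatMap (λ a → map (a ∷_) (box m)) (upTo q)

  ∑-box : ∀ m (f : Vec ℕ (suc m) → Carrier) → ∑ (box (suc m)) f ≈ ∑< q (λ a → ∑ (box m) (λ l → f (a ∷ l)))
  ∑-box m f = ≈-trans (∑-concatMap (λ a → map (a ∷_) (box m)) (upTo q) f)
      (≈-trans (∑-cong (upTo q) (λ a → ∑-map (a ∷_) (box m) f)) (∑<-upTo q _))

  ∑-allVecs : ∀ m (f : Vec (Fin q) (suc m) → Carrier) → ∑ (D.allVecs q (suc m)) f ≈ ∑ (allFin q)
      (λ y → ∑ (D.allVecs q m) (λ x → f (y ∷ x)))
  ∑-allVecs m f = ≈-trans (∑-concatMap (λ y → map (y ∷_) (D.allVecs q m)) (allFin q) f)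
      (∑-cong (allFin q) (λ y → ∑-map (y ∷_) (D.allVecs q m) f))

  transform-∷ : ∀ {m} (g : Vec (Fin q) (suc m) → Carrier) a l → transform g (a ∷ l) ≈ ∑ (allFin q)
      (λ y → transform (λ x → g (y ∷ x)) l * conj (E (a ℕ.* toℕ y)))
  transform-∷ {m} g a l = ≈-trans (∑-allVecs m _) (∑-cong (allFin q)
        (λ y → ≈-trans (∑-cong (D.allVecs q m) (λ x → ≈-trans
            (*-cong ≈-refl (≈-trans (conj-cong (E-+ (a ℕ.* toℕ y) (dotN l x))) (conj-* _ _)))
            (l₁ (g (y ∷ x)) (conj (E (a ℕ.* toℕ y))) (conj (E (dotN l x))))))
          (≈-sym (∑-*ʳ (conj (E (a ℕ.* toℕ y))) (D.allVecs q m) _))))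
    where l₁ : ∀ g a b → g * (a * b) ≈ g * b * a
          l₁ = solve 3 (λ g a b → g :* (a :* b) := g :* b :* a) ≈-refl

  parsevalᵐ : ∀ m (g : Vec (Fin q) m → Carrier) → ∑ (box m) (λ l → transform g l * conj (transform g l)) ≈ ι
      ((+ q) Z.^ m) * ∑ (D.allVecs q m) (λ x → g x * conj (g x))
  parsevalᵐ zero g = ≈-trans (+-identityʳ _) (≈-trans (*-cong eq (conj-cong eq))
        (≈-sym (≈-trans (*-cong ι-1 (+-identityʳ _)) (*-identityˡ _))))
    where
    eq : transform g [] ≈ g []
    eq = ≈-trans (+-identityʳ _) (≈-trans (*-cong ≈-refl (≈-trans (conj-cong E-0) conj-1)) (*-identityʳ _))
  parsevalᵐ (suc m) g = begin
    ∑ (box (suc m)) (λ l → transform g l * conj (transform g l)) ≈⟨ ∑-box m _ ⟩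
    ∑< q (λ a → ∑ (box m) (λ l → transform g (a ∷ l) * conj (transform g (a ∷ l)))) ≈⟨ ∑<-congᵃ q
      (λ a → ∑-cong (box m) (λ l → *-cong (transform-∷ g a l) (conj-cong (transform-∷ g a l)))) ⟩
    ∑< q (λ a → ∑ (box m) (λ l → ∑ (allFin q) (λ y → G l y * conj (E (a ℕ.* toℕ y))) * conj
          (∑ (allFin q) (λ y → G l y * conj (E (a ℕ.* toℕ y)))))) ≈⟨ ∑-∑<-swap (box m) q _ ⟨
    ∑ (box m) (λ l → ∑< q (λ a → ∑ (allFin q) (λ y → G l y * conj (E (a ℕ.* toℕ y))) * conj
          (∑ (allFin q) (λ y → G l y * conj (E (a ℕ.* toℕ y)))))) ≈⟨ ∑-cong (box m) (λ l → parseval₁ (G l)) ⟩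
    ∑ (box m) (λ l → ι (+ q) * ∑ (allFin q) (λ y → G l y * conj (G l y))) ≈⟨ ∑-*ˡ (ι (+ q)) (box m) _ ⟨
    ι (+ q) * ∑ (box m) (λ l → ∑ (allFin q) (λ y → G l y * conj (G l y))) ≈⟨ *-cong ≈-refl
      (≈-trans (∑-swap (box m) (allFin q) _) (∑-cong (allFin q) (λ y → parsevalᵐ m (λ x → g (y ∷ x))))) ⟩
    ι (+ q) * ∑ (allFin q) (λ y → ι ((+ q) Z.^ m) * ∑ (D.allVecs q m) (λ x → g (y ∷ x) * conj (g (y ∷ x))))
      ≈⟨ *-cong ≈-refl (≈-sym (∑-*ˡ (ι ((+ q) Z.^ m)) (allFin q) _)) ⟩
    ι (+ q) * (ι ((+ q) Z.^ m) * ∑ (allFin q) (λ y → ∑ (D.allVecs q m) (λ x → g (y ∷ x) * conj (g (y ∷ x)))))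
      ≈⟨ *-assoc _ _ _ ⟨
    ι (+ q) * ι ((+ q) Z.^ m) * ∑ (allFin q) (λ y → ∑ (D.allVecs q m) (λ x → g (y ∷ x) * conj (g (y ∷ x))))
      ≈⟨ *-cong (≈-sym (ι-* (+ q) ((+ q) Z.^ m))) (≈-sym (∑-allVecs m _)) ⟩
    ι ((+ q) Z.^ suc m) * ∑ (D.allVecs q (suc m)) (λ x → g x * conj (g x)) ∎
    where
    open import Relation.Binary.Reasoning.Setoid setoid
    G : Vec ℕ m → Fin q → Carrier
    G l y = transform (λ x → g (y ∷ x)) l

  translate : ∀ {m} → Vec ℕ m → Vec ℕ m → Vec ℕ m
  translate []      []      = []
  translate (a ∷ l) (u ∷ μ) = (a ℕ.+ N ℕ.* u) ∷ translate l μ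

  dotN-translate : ∀ {m} (l μ : Vec ℕ m) x → dotN (translate l μ) x ≡ dotN l x ℕ.+ N ℕ.* dotN μ x
  dotN-translate [] [] [] = sym (ℕₚ.*-zeroʳ N)
  dotN-translate (a ∷ l) (u ∷ μ) (y ∷ x) = trans (cong ((a ℕ.+ N ℕ.* u) ℕ.* toℕ y ℕ.+_)
        (dotN-translate l μ x)) (l₁ a N u (toℕ y) (dotN l x) (dotN μ x))
    where l₁ : ∀ a n u y d e → (a ℕ.+ n ℕ.* u) ℕ.* y ℕ.+ (d ℕ.+ n ℕ.* e) ≡ a ℕ.* y ℕ.+ d ℕ.+ n ℕ.*
              (u ℕ.* y ℕ.+ e)
          l₁ = ℕsolve-∀

  conj-E-N : ∀ a t → conj (E (a ℕ.+ N ℕ.* t)) ≈ ι (eps t) * conj (E a)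
  conj-E-N a t = ≈-trans (conj-cong (≈-trans (E-+ a (N ℕ.* t))
          (≈-trans (*-cong ≈-refl (E-N t)) (*-comm _ _))))
      (≈-trans (conj-* (ι (eps t)) (E a)) (*-cong (conj-ι (eps t)) ≈-refl))

  transform-translate : ∀ {m} (g : Vec (Fin q) m → Carrier) l μ → transform g (translate l μ) ≈ ∑
      (D.allVecs q m) (λ x → ι (eps (dotN μ x)) * (g x * conj (E (dotN l x))))
  transform-translate {m} g l μ = ∑-cong (D.allVecs q m)
      (λ x → ≈-trans (*-cong ≈-refl (≈-trans (≈-reflexive (cong (conj ∘ E) (dotN-translate l μ x)))
            (conj-E-N (dotN l x) (dotN μ x)))) (l₁ (g x) (ι (eps (dotN μ x))) (conj (E (dotN l x)))))
    where l₁ : ∀ g s e → g * (s * e) ≈ s * (g * e)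
          l₁ = solve 3 (λ g s e → g :* (s :* e) := s :* (g :* e)) ≈-refl

  sign≋1 : ∀ t → ι (eps t) ≋ 1# [ two ]
  sign≋1 t = ≋-trans (ι-≋ ([ (λ e → Z.≈⇒≋ e) , (λ e → Z.≋-trans (Z.≈⇒≋ e)
            (Z.congr (Z.divides (ℤ.- + 1) refl))) ]′ (eps-± t))) (≈⇒≋ ι-1)

  -- As E N = -1, translation by N μ inserts the signs (-1)^(μ·x), and signs are 1 modulo 2.
  translate≋ : ∀ {m} (g : Vec (Fin q) m → Carrier) l μ → transform g (translate l μ) ≋ transform g l [ two ]
  translate≋ {m} g l μ = ≋-trans (≈⇒≋ (transform-translate g l μ))
      (∑-≋ (D.allVecs q m) (λ x → ≋-trans (≋-* (sign≋1 (dotN μ x)) ≋-refl) (≈⇒≋ (*-identityˡ _))))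

  allEven : ∀ {m} → Vec (Fin q) m → ℤ
  allEven []      = + 1
  allEven (y ∷ x) = even (toℕ y) ℤ.* allEven x

  -- The sum over {0,1}^m factors: an odd entry of x contributes 1 - 1 and an even one contributes
  -- 2.
  ∑-cube : ∀ {m} (x : Vec (Fin q) m) → Z.∑ (cube m) (λ μ → eps (dotN μ x)) ≡ (+ 2) Z.^ m ℤ.* allEven x
  ∑-cube [] = refl
  ∑-cube {suc m} (y ∷ x) = begin
    Z.∑ (map (0 ∷_) (cube m) ++ map (1 ∷_) (cube m)) (λ μ → eps (dotN μ (y ∷ x))) ≡⟨ Z.∑-++
      (map (0 ∷_) (cube m)) _ _ ⟩
    Z.∑ (map (0 ∷_) (cube m)) (λ μ → eps (dotN μ (y ∷ x))) ℤ.+ Z.∑ (map (1 ∷_) (cube m))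
      (λ μ → eps (dotN μ (y ∷ x)))
      ≡⟨ cong₂ ℤ._+_ (Z.∑-map (0 ∷_) (cube m) _) (trans (Z.∑-map (1 ∷_) (cube m) _)
          (trans (Z.∑-cong (cube m) (λ μ → trans (cong (λ z → eps (z ℕ.+ dotN μ x)) (ℕₚ.+-identityʳ (toℕ y)))
              (eps-+ (toℕ y) (dotN μ x)))) (sym (Z.∑-*ˡ (eps (toℕ y)) (cube m) _)))) ⟩
    T ℤ.+ eps (toℕ y) ℤ.* T ≡⟨ l₁ T (eps (toℕ y)) ⟩
    (+ 1 ℤ.+ eps (toℕ y)) ℤ.* T ≡⟨ cong₂ ℤ._*_ (1+eps (toℕ y)) (∑-cube x) ⟩
    + 2 ℤ.* even (toℕ y) ℤ.* ((+ 2) Z.^ m ℤ.* allEven x) ≡⟨ l₂ (+ 2) (even (toℕ y)) ((+ 2) Z.^ m) (allEven x)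
      ⟩
    + 2 ℤ.* (+ 2) Z.^ m ℤ.* (even (toℕ y) ℤ.* allEven x) ∎
    where
    open ≡-Reasoning
    T = Z.∑ (cube m) (λ μ → eps (dotN μ x))
    l₁ : ∀ t e → t ℤ.+ e ℤ.* t ≡ (+ 1 ℤ.+ e) ℤ.* t
    l₁ = solve-∀
    l₂ : ∀ a b c d → a ℤ.* b ℤ.* (c ℤ.* d) ≡ a ℤ.* c ℤ.* (b ℤ.* d)
    l₂ = solve-∀

  ι-∑ : {A : Set} (xs : List A) (f : A → ℤ) → ι (Z.∑ xs f) ≈ ∑ xs (λ x → ι (f x))
  ι-∑ [] f = ι-0
  ι-∑ (x ∷ xs) f = ≈-trans (ι-+ _ _) (+-cong ≈-refl (ι-∑ xs f))

  evenPart : ∀ {m} → (Vec (Fin q) m → Carrier) → Vec (Fin q) m → Carrier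
  evenPart g x = ι (allEven x) * g x

  ∑-translates : ∀ {m} (g : Vec (Fin q) m → Carrier) l → ∑ (cube m) (λ μ → transform g (translate l μ)) ≈ ι
      ((+ 2) Z.^ m) * transform (evenPart g) l
  ∑-translates {m} g l = ≈-trans (∑-cong (cube m) (transform-translate g l))
      (≈-trans (∑-swap (cube m) (D.allVecs q m) _)
        (≈-trans (∑-cong (D.allVecs q m) (λ x → ≈-trans (≈-sym (∑-*ʳ (g x * conj (E (dotN l x))) (cube m) _))
            (≈-trans (*-cong (≈-trans (≈-sym (ι-∑ (cube m) _))
            (≈-trans (≈-reflexive (cong ι (∑-cube x))) (ι-* _ _))) ≈-refl)
            (l₁ (ι ((+ 2) Z.^ m)) (ι (allEven x)) (g x) (conj (E (dotN l x)))))))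
          (≈-sym (∑-*ˡ (ι ((+ 2) Z.^ m)) (D.allVecs q m) _))))
    where l₁ : ∀ a b g e → a * b * (g * e) ≈ a * (b * g * e)
          l₁ = solve 4 (λ a b g e → a :* b :* (g :* e) := a :* (b :* g :* e)) ≈-refl

  two-cancel : ∀ c X → ¬ two ∣ X → two ∣ ι c * X → + 2 Z.∣ c
  two-cancel c X ¬d d with parityℤ c
  ... | inj₁ h = h
  ... | inj₂ h = ⊥-elim (¬d (≋-∣ (≋-trans (≋-* (≋-trans (ι-≋ h) (≈⇒≋ ι-1)) ≋-refl) (≈⇒≋ (*-identityˡ X))) d))

  -- Modulo 2 an odd c acts on X as 1, so as long as a factor 2 remains on the right, c must be
  -- even. This makes β an integer multiple of α.
  two-power-cancel : ∀ j c X Y → ¬ two ∣ X → ι c * X ≈ ι ((+ 2) Z.^ j) * Y → Σ ℤ λ c′ → ι c′ * X ≈ Y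
  two-power-cancel zero c X Y ¬d e = c , ≈-trans e (≈-trans (*-cong ι-1 ≈-refl) (*-identityˡ Y))
  two-power-cancel (suc j) c X Y ¬d e = from (two-cancel c X ¬d
        (∣-resp (≈-sym e) (∣-*ʳ Y (∣-resp (≈-sym (ι-* (+ 2) ((+ 2) Z.^ j))) (∣-*ʳ _ ∣-refl)))))
    where
    from : + 2 Z.∣ c → Σ ℤ λ c′ → ι c′ * X ≈ Y
    from (Z.divides c₁ h) = two-power-cancel j c₁ X Y ¬d
        (ι-cancel (+ 2) (≈-trans (≈-sym (*-assoc _ _ _))
            (≈-trans (*-cong (≈-sym (≈-trans (≈-reflexive (cong ι h)) (ι-* (+ 2) c₁))) ≈-refl)
              (≈-trans e (≈-trans (*-cong (ι-* (+ 2) ((+ 2) Z.^ j)) ≈-refl) (*-assoc _ _ _))))))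

  hat-∑ : {A : Set} (xs : List A) (f : A → Carrier) → hat (∑ xs f) (+ 0) (+ 0) ≡ Z.∑ xs
      (λ x → hat (f x) (+ 0) (+ 0))
  hat-∑ [] f = hat-0 (+ 0) (+ 0)
  hat-∑ (x ∷ xs) f = trans (hat-+ (f x) (∑ xs f) (+ 0) (+ 0))
      (cong (ℤ._+_ (hat (f x) (+ 0) (+ 0))) (hat-∑ xs f))

  q-power : ∀ m → (+ q) Z.^ m ≡ norm-value m m
  q-power m = trans (cong (Z._^ m) (trans (cong +_ q≡)
          (trans (ℤₚ.pos-* 2 N) (cong (+ 2 ℤ.*_) (ℤₚ.pos-* n₁ n₂))))) (Z.^-distrib-* (+ 2) Nℤ m)

  allEven-idem : ∀ {m} (x : Vec (Fin q) m) → allEven x ℤ.* allEven x ≡ allEven x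
  allEven-idem [] = refl
  allEven-idem (y ∷ x) = trans (l₁ (even (toℕ y)) (allEven x))
      (cong₂ ℤ._*_ (even-idem (toℕ y)) (allEven-idem x))
    where l₁ : ∀ a b → a ℤ.* b ℤ.* (a ℤ.* b) ≡ a ℤ.* a ℤ.* (b ℤ.* b)
          l₁ = solve-∀

  q≡N+N : q ≡ N ℕ.+ N
  q≡N+N = trans q≡ (cong (N ℕ.+_) (ℕₚ.+-identityʳ N))

  module ZF = FinSums ℤ-algebra

  ∑-allEven : ∀ m → Z.∑ (D.allVecs q m) allEven ≡ (+ N) Z.^ m
  ∑-allEven zero = refl
  ∑-allEven (suc m) = begin
    Z.∑ (D.allVecs q (suc m)) allEven ≡⟨ Z.∑-concatMap (λ y → map (y ∷_) (D.allVecs q m)) (allFin q) allEven ⟩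
    Z.∑ (allFin q) (λ y → Z.∑ (map (y ∷_) (D.allVecs q m)) allEven) ≡⟨ Z.∑-cong (allFin q)
      (λ y → trans (Z.∑-map (y ∷_) (D.allVecs q m) allEven)
        (sym (Z.∑-*ˡ (even (toℕ y)) (D.allVecs q m) allEven))) ⟩
    Z.∑ (allFin q) (λ y → even (toℕ y) ℤ.* Z.∑ (D.allVecs q m) allEven) ≡⟨ Z.∑-*ʳ
      (Z.∑ (D.allVecs q m) allEven) (allFin q) (even ∘ toℕ) ⟨
    Z.∑ (allFin q) (even ∘ toℕ) ℤ.* Z.∑ (D.allVecs q m) allEven ≡⟨ cong₂ ℤ._*_
      (trans (ZF.∑-toℕ q even) (trans (cong (λ z → Z.∑< z even) q≡N+N) (∑-even N))) (∑-allEven m) ⟩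
    + N ℤ.* (+ N) Z.^ m ∎
    where open ≡-Reasoning

  no-gbf : ∀ m → eps m ≡ ℤ.- + 1 → (∀ k → 0 ℕ.< k → k ℕ.< m → ¬ D.Solvable p₁ p₂ k) →
      (f : Vec (Fin q) m → Fin q) → ¬ D.IsGBF q m f
  no-gbf zero () _ _ _
  no-gbf m@(suc m-1) odd minimal f gbf = 2∤N^m (from-total (∑-τ-even))
    where
    g : Vec (Fin q) m → Carrier
    g x = E (toℕ (f x))

    α β : Vec ℕ m → Carrier
    α = transform g
    β = transform (evenPart g)

    α-norm : ∀ l → α l * conj (α l) ≈ ι (norm-value m m)
    α-norm l = ≈-trans (*-cong α≈ (conj-cong α≈)) (≈-trans (gbf-norm m f gbf (Vec.map (_mod q) l))
          (≈-reflexive (cong ι (trans (pos-^ q m) (q-power m)))))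
      where
      α≈ : α l ≈ ∑ (D.allVecs q m) (λ x → E (toℕ (D._-q_ q (f x) (D.dot q (Vec.map (_mod q) l) x))))
      α≈ = ∑-cong (D.allVecs q m) (λ x → ≈-sym (≈-trans (E-sub (f x) _)
              (*-cong ≈-refl (conj-cong (E-dot l x)))))

    α-odd : ∀ l → ¬ two ∣ α l
    α-odd l = not-even m m (α l) odd minimal (α-norm l)

    -- translates of α differ by a sign, since roots of unity of odd order are distinct modulo 2
    α-translate : ∀ l μ → Σ ℤ λ δ → α (translate l μ) ≈ ι δ * α l
    α-translate l μ = from (associated (α (translate l μ)) (α l) m-1 m (α-odd (translate l μ))
          (α-norm (translate l μ)) (α-norm l) (≋-sym (≋-^ n (translate≋ g l μ))))
      where
      from : (Σ ℤ λ δ → Σ ℤ λ a → Σ ℤ λ b → Sign δ × (α (translate l μ) ≈ ι δ * ζ a b * α l)) → Σ ℤ λ δ → α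
          (translate l μ) ≈ ι δ * α l
      from (δ , a , b , s , h) = case (nontrivial? a b)
        where
        δ≋1 : ι δ ≋ 1# [ two ]
        δ≋1 = ≋-trans (ι-≋ ([ (λ e → Z.≈⇒≋ e) , (λ e → Z.≋-trans (Z.≈⇒≋ e)
                  (Z.congr (Z.divides (ℤ.- + 1) refl))) ]′ s)) (≈⇒≋ ι-1)
        fixed : ζ a b * α l ≋ α l [ two ]
        fixed = ≋-trans (≈⇒≋ (≈-sym (*-cong (*-identityˡ (ζ a b)) ≈-refl)))
            (≋-trans (≋-* (≋-* (≋-sym δ≋1) (≋-refl {ζ a b})) (≋-refl {α l}))
              (≋-trans (≈⇒≋ (≈-sym h)) (translate≋ g l μ)))
        case : ((+ n₁ Z.∣ a) × (+ n₂ Z.∣ b)) ⊎ (¬ + n₁ Z.∣ a) ⊎ (¬ + n₂ Z.∣ b) → Σ ℤ λ δ → α (translate l μ)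
            ≈ ι δ * α l
        case (inj₁ (da , db)) = δ , ≈-trans h (*-cong
              (≈-trans (*-cong ≈-refl (≈-trans (ζ-per (Z.∣⇒≋0 da) (Z.∣⇒≋0 db)) ζ-0)) (*-identityʳ (ι δ)))
              ≈-refl)
        case (inj₂ (inj₁ ¬d)) = ⊥-elim (α-odd l (ι-comax-cancel (+ p₁) (comax-sym comax₁-2)
                (fixed₁ a b fixed ¬d)))
        case (inj₂ (inj₂ ¬d)) = ⊥-elim (α-odd l (ι-comax-cancel (+ p₂) (comax-sym comax₂-2)
                (fixed₂ a b fixed ¬d)))

    ∑-multiple : ∀ l (μs : List (Vec ℕ m)) → Σ ℤ λ c → ∑ μs (λ μ → α (translate l μ)) ≈ ι c * α l
    ∑-multiple l [] = + 0 , ≈-sym (≈-trans (*-cong ι-0 ≈-refl) (zeroˡ (α l)))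
    ∑-multiple l (μ ∷ μs) = let (δ , h) = α-translate l μ
                                (c , h′) = ∑-multiple l μs in
      δ ℤ.+ c , ≈-trans (+-cong h h′) (≈-trans (≈-sym (distribʳ (α l) (ι δ) (ι c)))
          (*-cong (≈-sym (ι-+ δ c)) ≈-refl))

    β-multiple : ∀ l → Σ ℤ λ c → ι c * α l ≈ β l
    β-multiple l = let (c , h) = ∑-multiple l (cube m)
        in two-power-cancel m c (α l) (β l) (α-odd l) (≈-trans (≈-sym h) (∑-translates g l))

    -- The normalised trace of α conj α. With β = c α for an integer c, the trace τ of β conj β is
    -- c² Dv, so the count of nonzero β is carried out as divisibility by Dv.
    Dv : ℤ
    Dv = norm-value m m ℤ.* φ

    instance
      _ = nonzero-value m m
      _ = φ≢0

    Dv≢0 : ℤ.NonZero Dv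
    Dv≢0 = ℤₚ.i*j≢0 (norm-value m m) φ

    τ : Vec ℕ m → ℤ
    τ l = hat (β l * conj (β l)) (+ 0) (+ 0)

    Dv∣τ : ∀ l → Dv Z.∣ τ l
    Dv∣τ l = let (c , h) = β-multiple l
        in Z.divides (c ℤ.* c) (trans (hat-cong (≈-trans
                (*-cong (≈-sym h) (≈-trans (conj-cong (≈-sym h))
                (≈-trans (conj-* (ι c) (α l)) (*-cong (conj-ι c) ≈-refl))))
                (≈-trans (l₁ (ι c) (α l) (conj (α l)))
                (≈-trans (*-cong (≈-sym (ι-* c c)) (α-norm l))
                (≈-trans (≈-sym (ι-* (c ℤ.* c) (norm-value m m))) (≈-sym (*-identityʳ _)))))) (+ 0) (+ 0))
            (trans (hat-ι (c ℤ.* c ℤ.* norm-value m m) 1# (+ 0) (+ 0))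
              (trans (cong (c ℤ.* c ℤ.* norm-value m m ℤ.*_) hat-1-0) (l₂ (c ℤ.* c) (norm-value m m) φ))))
      where
      l₁ : ∀ c a ā → c * a * (c * ā) ≈ c * c * (a * ā)
      l₁ = solve 3 (λ c a ā → c :* a :* (c :* ā) := c :* c :* (a :* ā)) ≈-refl
      l₂ : ∀ c n p → c ℤ.* n ℤ.* p ≡ n ℤ.* p ℤ.* c
      l₂ = solve-∀

    -- Translation by N multiplies the term of a vector with first entry y by (-1)^y, and y is even
    -- wherever `evenPart` is nonzero.
    β-shift : ∀ a l → β ((N ℕ.+ a) ∷ l) ≈ β (a ∷ l)
    β-shift a l = ∑-cong (D.allVecs q m) term
      where
      l₁ : ∀ n a y d → (n ℕ.+ a) ℕ.* y ℕ.+ d ≡ a ℕ.* y ℕ.+ d ℕ.+ n ℕ.* y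
      l₁ = ℕsolve-∀
      l₂ : ∀ e g s c → e * g * (s * c) ≈ e * s * g * c
      l₂ = solve 4 (λ e g s c → e :* g :* (s :* c) := e :* s :* g :* c) ≈-refl
      l₃ : ∀ e a s → e ℤ.* a ℤ.* s ≡ e ℤ.* s ℤ.* a
      l₃ = solve-∀
      term : ∀ x → evenPart g x * conj (E (dotN ((N ℕ.+ a) ∷ l) x)) ≈ evenPart g x * conj (E (dotN (a ∷ l) x))
      term (y ∷ x) = ≈-trans (*-cong ≈-refl (≈-trans
              (≈-reflexive (cong (conj ∘ E) (l₁ N a (toℕ y) (dotN l x))))
              (conj-E-N (a ℕ.* toℕ y ℕ.+ dotN l x) (toℕ y))))
        (≈-trans (l₂ (ι (allEven (y ∷ x))) (g (y ∷ x)) (ι (eps (toℕ y))) _)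
            (*-cong (*-cong (≈-trans (≈-sym (ι-* _ _))
                (≈-reflexive (cong ι (trans (l₃ (even (toℕ y)) (allEven x) (eps (toℕ y)))
                (cong (ℤ._* allEven x) (even-eps (toℕ y))))))) ≈-refl) ≈-refl))

    τ-shift : ∀ a l → τ ((N ℕ.+ a) ∷ l) ≡ τ (a ∷ l)
    τ-shift a l = hat-cong (*-cong (β-shift a l) (conj-cong (β-shift a l))) (+ 0) (+ 0)

    -- Frequencies with first entry below N; those from N to q - 1 repeat the same values, as q =
    -- 2N.
    half : ℤ
    half = Z.∑< N (λ a → Z.∑ (box m-1) (λ l → τ (a ∷ l)))

    Dv∣half : Dv Z.∣ half
    Dv∣half = Z.∑<-∣ N (λ a _ → Z.∑-∣ (box m-1) (λ l → Dv∣τ (a ∷ l)))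

    ∑-τ : Z.∑ (box m) τ ≡ + 2 ℤ.* half
    ∑-τ = begin
      Z.∑ (box m) τ ≡⟨ Z.∑-concatMap (λ a → map (a ∷_) (box m-1)) (upTo q) τ ⟩
      Z.∑ (upTo q) (λ a → Z.∑ (map (a ∷_) (box m-1)) τ) ≡⟨ Z.∑-cong (upTo q)
        (λ a → Z.∑-map (a ∷_) (box m-1) τ) ⟩
      Z.∑ (upTo q) (λ a → Z.∑ (box m-1) (λ l → τ (a ∷ l))) ≡⟨ Z.∑<-upTo q _ ⟩
      Z.∑< q (λ a → Z.∑ (box m-1) (λ l → τ (a ∷ l))) ≡⟨ cong
        (λ z → Z.∑< z (λ a → Z.∑ (box m-1) (λ l → τ (a ∷ l)))) q≡N+N ⟩
      Z.∑< (N ℕ.+ N) (λ a → Z.∑ (box m-1) (λ l → τ (a ∷ l))) ≡⟨ Z.∑<-split N N _ ⟩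
      half ℤ.+ Z.∑< N (λ a → Z.∑ (box m-1) (λ l → τ ((N ℕ.+ a) ∷ l))) ≡⟨ cong (ℤ._+_ half)
        (Z.∑<-congᵃ N (λ a → Z.∑-cong (box m-1) (λ l → τ-shift a l))) ⟩
      half ℤ.+ half ≡⟨ l₁ half ⟩
      + 2 ℤ.* half ∎
      where
      open ≡-Reasoning
      l₁ : ∀ h → h ℤ.+ h ≡ + 2 ℤ.* h
      l₁ = solve-∀

    ∑-τ-even : Σ ℤ λ r → Z.∑ (box m) τ ≡ Dv ℤ.* (+ 2 ℤ.* r)
    ∑-τ-even = let (Z.divides r e) = Dv∣half in r , trans ∑-τ (trans (cong (+ 2 ℤ.*_) e) (l₁ (+ 2) Dv r))
      where l₁ : ∀ a b c → a ℤ.* (b ℤ.* c) ≡ b ℤ.* (a ℤ.* c)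
            l₁ = solve-∀

    -- Parseval gives q^m times the number N^m of vectors with even entries, and q^m = 2^m N^m is
    -- the norm of α; the multiple of Dv is therefore the odd number N^m.
    ∑-τ-value : Z.∑ (box m) τ ≡ Dv ℤ.* (+ N) Z.^ m
    ∑-τ-value = trans (sym (hat-∑ (box m) (λ l → β l * conj (β l))))
        (trans (hat-cong (≈-trans (parsevalᵐ m (evenPart g))
              (≈-trans (*-cong ≈-refl (≈-trans (∑-cong (D.allVecs q m) norm-g)
              (≈-trans (≈-sym (ι-∑ (D.allVecs q m) allEven)) (≈-reflexive (cong ι (∑-allEven m))))))
              (≈-trans (≈-sym (ι-* _ _)) (≈-sym (*-identityʳ _))))) (+ 0) (+ 0))
          (trans (hat-ι ((+ q) Z.^ m ℤ.* (+ N) Z.^ m) 1# (+ 0) (+ 0))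
            (trans (cong₂ (λ a b → a ℤ.* (+ N) Z.^ m ℤ.* b) (q-power m) hat-1-0)
              (l₁ (norm-value m m) ((+ N) Z.^ m) φ))))
      where
      l₁ : ∀ a b c → a ℤ.* b ℤ.* c ≡ a ℤ.* c ℤ.* b
      l₁ = solve-∀
      l₂ : ∀ e g ḡ → e * g * (e * ḡ) ≈ e * e * (g * ḡ)
      l₂ = solve 3 (λ e g ḡ → e :* g :* (e :* ḡ) := e :* e :* (g :* ḡ)) ≈-refl
      norm-g : ∀ x → evenPart g x * conj (evenPart g x) ≈ ι (allEven x)
      norm-g x = ≈-trans (*-cong ≈-refl (≈-trans (conj-* _ _) (*-cong (conj-ι (allEven x)) ≈-refl)))
          (≈-trans (l₂ (ι (allEven x)) (g x) (conj (g x)))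
            (≈-trans (*-cong (≈-trans (≈-sym (ι-* _ _)) (≈-reflexive (cong ι (allEven-idem x))))
                (E-E̅ (toℕ (f x)))) (*-identityʳ _)))

    from-total : (Σ ℤ λ r → Z.∑ (box m) τ ≡ Dv ℤ.* (+ 2 ℤ.* r)) → + 2 Z.∣ (+ N) Z.^ m
    from-total (r , e) = Z.divides r (ℤₚ.*-cancelˡ-≡ Dv _ _ {{Dv≢0}} (trans (sym ∑-τ-value) e))

    2∤N^m : ¬ + 2 Z.∣ (+ N) Z.^ m
    2∤N^m = comax⇒∤ prime[2] (comax-^ʳ m (subst (Comax (+ 2)) (sym (ℤₚ.pos-* n₁ n₂))
            (comax-*ʳ (comax-sym (comax-n₁ comax₁-2)) (comax-sym (comax-n₂ comax₂-2)))))

-- Reading off the hypotheses of the theorem.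

open import Data.Nat using (_+_; _*_; _^_; _<_; _%_; _/_)

theorem1 : (p₁ p₂ e₁ e₂ m : ℕ) →
    Prime p₁ → Prime p₂ → p₁ % 8 ≡ 3 → p₂ % 8 ≡ 5 →
    0 < e₁ → 0 < e₂ →
    LegendreMinusOne p₁ p₂ →
    IsMultOrder 2 (p₁ ^ e₁ * p₂ ^ e₂) (totient (p₁ ^ e₁ * p₂ ^ e₂) / 2) →
    0 < m → Solvable p₁ p₂ m → (∀ k → 0 < k → k < m → ¬ Solvable p₁ p₂ k) →
    ¬ ExistsGBF m (2 * (p₁ ^ e₁ * p₂ ^ e₂))
theorem1 p₁ p₂ (suc e₁) (suc e₂) m pr₁ pr₂ p₁%8≡3 p₂%8≡5 _ _ leg ord _ (A , B , sol) minimal =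
    nonexistence _ refl
  where
  k₁ k₂ : ℕ
  k₁ = p₁ / 8
  k₂ = p₂ / 8

  p₁≡ : p₁ ≡ suc (2 * suc (4 * k₁))
  p₁≡ = trans (m≡m%n+[m/n]*n p₁ 8) (trans (cong (_+ k₁ * 8) p₁%8≡3) (rearrange k₁))
    where
    rearrange : ∀ k → 3 + k * 8 ≡ suc (2 * suc (4 * k))
    rearrange = ℕsolve-∀

  p₂≡ : p₂ ≡ suc (2 * (2 * suc (2 * k₂)))
  p₂≡ = trans (m≡m%n+[m/n]*n p₂ 8) (trans (cong (_+ k₂ * 8) p₂%8≡5) (rearrange k₂))
    where
    rearrange : ∀ k → 5 + k * 8 ≡ suc (2 * (2 * suc (2 * k)))
    rearrange = ℕsolve-∀

  H : Hypotheses
  H = record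
    { p₁ = p₁ ; p₂ = p₂ ; e₁ = e₁ ; e₂ = e₂ ; k₁ = k₁ ; k₂ = k₂ ; pr₁ = pr₁ ; pr₂ = pr₂
    ; p₁≡ = p₁≡ ; p₂≡ = p₂≡ ; A = A ; B = B ; m = m ; sol = sol ; leg = leg ; ord = ord }

  S : Setting
  S = Arith.setting H

  -- q is generalised, with an equation, because `ExistsGBF` unfolds to a GBF only on a successor.
  nonexistence : ∀ q → q ≡ 2 * (p₁ ^ suc e₁ * p₂ ^ suc e₂) → ¬ ExistsGBF m q
  nonexistence (suc q) q≡ (f , gbf) =
    Fourier.no-gbf S (FormalSumsRing.cyclotomicRing S) (suc q) q≡ m (Arith.m-odd H) minimal f gbf
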